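{- For every nonnegative integer $n$, \begin{align*} \overline{b}_5(4n+1) &= c_5(n)-2\overline{b}_5(2n-1),\\ \overline{b}_5(10n) &= \tfrac{1}{2}c_5(10n+2),\\ \overline{b}_5(10n+1) &= c_5(5n+1),\\ \overline{b}_5(10n+2) &= \tfrac{1}{4}\overline{a}_5(2n+1) +\tfrac{1}{2}c_5(2n),\\ \overline{b}_5(10n+3) &= c_5(5n+2),\\ \overline{b}_5(10n+4) &= \tfrac{1}{2}c_5(10n+6),\\ \overline{b}_5(10n+6) &= 0,\\ \overline{b}_5(10n+8) &= 0,\\ \overline{b}_5(20n+5) &= -c_5(5n+1),\\ \overline{b}_5(20n+7) &= \tfrac{1}{2}\overline{a}_5(2n+1) +c_5(2n),\\ \overline{b}_5(20n+9) &= -c_5(5n+2),\\ \overline{b}_5(20n+15) &= 0,\\ \overline{b}_5(20n+19) &= 0. \end{align*}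
   Context: For a partition $\lambda=(\lambda_1,\ldots,\lambda_m)$ of $n$ with conjugate parts $\lambda'_j$, the hook number of the node $(i,j)$ of its Ferrers--Young diagram is $\lambda_i+\lambda'_j-i-j+1$; $\lambda$ is a $5$-core if none of its hook numbers is divisible by $5$. $c_5(n)$ denotes the number of partitions of $n$ that are $5$-cores. With $f_j:=\prod_{k\ge 1}(1-q^{jk})$ (for $|q|<1$, or as a formal power series), its generating function is $\sum_{n\ge 0} c_5(n)q^n = f_5^5/f_1$ (a known identity). Let $\varphi(-q):=\sum_{n=-\infty}^{\infty}(-1)^n q^{n^2}=f_1^2/f_2$ and $\psi(-q):=\sum_{n=0}^{\infty}(-q)^{n(n+1)/2}=f_1f_4/f_2$, so that $\varphi(-q^5)=f_5^2/f_{10}$ and $\psi(-q^5)=f_5f_{20}/f_{10}$. The integers $\overline{a}_5(n)$ and $\overline{b}_5(n)$ are defined by $$\sum_{n=0}^\infty \overline{a}_5(n)q^n=\frac{\varphi^5(-q^5)}{\varphi(-q)}=1+2q+4q^2+8q^3+14q^4+14q^5+20q^6+24q^7+\cdots,$$ $$\sum_{n=0}^\infty \overline{b}_5(n)q^n=\frac{\psi^5(-q^5)}{\psi(-q)}=1+q+q^2+2q^3+3q^4-q^5+2q^7-2q^9+6q^{10}+\cdots .$$ By convention $c_5(n)=\overline{a}_5(n)=\overline{b}_5(n)=0$ for $n<0$. -}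

module Defs where

open import Data.Bool.Base using (if_then_else_)
open import Data.Fin.Base using (Fin; toℕ)
open import Data.Fin.Properties using (all?)
open import Data.Integer.Base as ℤ using (ℤ; +_; -[1+_]; 0ℤ; 1ℤ; -1ℤ)
import Data.Integer.Properties as ℤ
open import Data.List.Base
  using (List; []; _∷_; length; lookup; filter; map; concat; upTo)
open import Data.List.Membership.Propositional using (_∈_)
open import Data.List.Membership.Propositional.Properties
  using (∈-map⁺; ∈-map⁻; ∈-concat⁺′; ∈-concat⁻′; ∈-upTo⁺; ∈-upTo⁻)
open import Data.List.Properties using (∷-injective; ∷-injectiveʳ)
open import Data.List.Relation.Binary.Disjoint.Propositional using (Disjoint)
open import Data.List.Relation.Unary.All using (All; []; _∷_)
import Data.List.Relation.Unary.All.Properties as All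
open import Data.List.Relation.Unary.AllPairs using ([]; _∷_)
import Data.List.Relation.Unary.AllPairs as AllPairs
import Data.List.Relation.Unary.AllPairs.Properties as AllPairs
open import Data.List.Relation.Unary.Any using (here)
open import Data.List.Relation.Unary.Linked using (Linked; []; [-]; _∷_)
import Data.List.Relation.Unary.Linked as Linked
open import Data.List.Relation.Unary.Unique.Propositional using (Unique)
import Data.List.Relation.Unary.Unique.Propositional.Properties as Unique
open import Data.Nat.Base using (ℕ; zero; suc; _+_; _*_; _∸_; _⊓_; _≤_; _<_; _≥_;
  z≤n; s≤s; s≤s⁻¹; _/_; NonZero)
open import Data.Nat.Divisibility using (_∣_; _∣?_; quotient)
open import Data.Nat.ListAction using (sum)
open import Data.Nat.Properties
open import Data.Product.Base using (_×_; _,_; proj₁; proj₂)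
open import Data.Rational.Base as ℚ using (ℚ)
open import Function.Base using (_∘_; case_of_)
open import Function.Bundles using (_⇔_; mk⇔)
open import Relation.Binary.PropositionalEquality
  using (_≡_; _≢_; _≗_; refl; sym; trans; cong; module ≡-Reasoning)
open import Relation.Nullary.Decidable using (yes; no; ⌊_⌋; ¬?)
open import Relation.Nullary.Negation using (¬_)
open import Relation.Unary using (Decidable)
open import Algebra.Properties.CommutativeMonoid.Sum ℤ.+-0-commutativeMonoid
  using (sum-syntax)

------------------------------------------------------------------------
-- Partitions

IsPartition : ℕ → List ℕ → Set
IsPartition n λs = Linked _≥_ λs × All (0 <_) λs × sum λs ≡ n

-- Partitions of n with all parts at most b; the first argument is fuel,
-- sufficient when it is at least n.
partitions≤ : ℕ → ℕ → ℕ → List (List ℕ)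
partitions≤ _          b zero    = [] ∷ []
partitions≤ zero       b (suc n) = []
partitions≤ (suc fuel) b (suc n) =
  concat (map (λ p → map (suc p ∷_) (partitions≤ fuel (suc p) (n ∸ p)))
              (upTo (b ⊓ suc n)))

partitions : ℕ → List (List ℕ)
partitions n = partitions≤ n n n

private
  IsPartition≤ : ℕ → ℕ → List ℕ → Set
  IsPartition≤ b n λs = Linked _≥_ (b ∷ λs) × All (0 <_) λs × sum λs ≡ n

  sound : ∀ f b n {λs} → λs ∈ partitions≤ f b n → IsPartition≤ b n λs
  sound zero    b zero (here refl) = [-] , [] , refl
  sound (suc f) b zero (here refl) = [-] , [] , refl
  sound (suc f) b (suc n) λs∈
    with ∈-concat⁻′ (map (λ p → map (suc p ∷_) (partitions≤ f (suc p) (n ∸ p)))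
                         (upTo (b ⊓ suc n))) λs∈
  ... | _ , λs∈m , m∈
    with ∈-map⁻ (λ p → map (suc p ∷_) (partitions≤ f (suc p) (n ∸ p)))
                {xs = upTo (b ⊓ suc n)} m∈
  ... | p , p∈ , refl
    with ∈-map⁻ (suc p ∷_) λs∈m
  ... | μs , μs∈ , refl
    with sound f (suc p) (n ∸ p) μs∈ | ∈-upTo⁻ p∈
  ... | linked , pos , Σμs | p<
    = ≤-trans p< (m⊓n≤m b (suc n)) ∷ linked
    , s≤s z≤n ∷ pos
    , cong suc (trans (cong (λ s → p + s) Σμs)
        (m+[n∸m]≡n (s≤s⁻¹ (≤-trans p< (m⊓n≤n b (suc n))))))

  complete : ∀ f b n {λs} → n ≤ f → IsPartition≤ b n λs → λs ∈ partitions≤ f b n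
  complete zero    b zero {[]} _ _ = here refl
  complete (suc f) b zero {[]} _ _ = here refl
  complete f b zero {suc p ∷ μs} _ (_ , _ , ())
  complete f b n {zero ∷ μs} _ (_ , () ∷ _ , _)
  complete f b (suc n) {[]} _ (_ , _ , ())
  complete (suc f) b (suc n) {suc p ∷ μs} (s≤s n≤f) (p≤b ∷ linked , _ ∷ pos , refl) =
    ∈-concat⁺′
      (∈-map⁺ (suc p ∷_)
        (complete f (suc p) (n ∸ p) (≤-trans (m∸n≤m n p) n≤f)
          (linked , pos , sym (m+n∸m≡n p (sum μs)))))
      (∈-map⁺ _ (∈-upTo⁺ (⊓-glb p≤b (s≤s (m≤m+n p (sum μs))))))

  unique : ∀ f b n → Unique (partitions≤ f b n)
  unique zero    b zero    = [] ∷ []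
  unique (suc f) b zero    = [] ∷ []
  unique zero    b (suc n) = []
  unique (suc f) b (suc n) = Unique.concat⁺
    (All.map⁺ (All.applyUpTo⁺₂ _ (b ⊓ suc n)
      (λ p → Unique.map⁺ ∷-injectiveʳ (unique f (suc p) (n ∸ p)))))
    (AllPairs.map⁺ (AllPairs.map disjoint (Unique.upTo⁺ (b ⊓ suc n))))
    where
    disjoint : ∀ {p q} → p ≢ q →
      Disjoint (map (suc p ∷_) (partitions≤ f (suc p) (n ∸ p)))
               (map (suc q ∷_) (partitions≤ f (suc q) (n ∸ q)))
    disjoint {p} {q} p≢q (v∈p , v∈q) with ∈-map⁻ (suc p ∷_) v∈p | ∈-map⁻ (suc q ∷_) v∈q
    ... | _ , _ , refl | _ , _ , eq = p≢q (suc-injective (proj₁ (∷-injective eq)))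

∈-partitions : ∀ n {λs} → λs ∈ partitions n ⇔ IsPartition n λs
∈-partitions n = mk⇔ to from
  where
  to : ∀ {λs} → λs ∈ partitions n → IsPartition n λs
  to λs∈ with sound n n n λs∈
  ... | linked , rest = Linked.tail linked , rest

  from : ∀ {λs} → IsPartition n λs → λs ∈ partitions n
  from {[]}     (_ , rest)            = complete n n n ≤-refl ([-] , rest)
  from {p ∷ μs} (linked , pos , refl) =
    complete n n n ≤-refl (m≤m+n p (sum μs) ∷ linked , pos , refl)

partitions-unique : ∀ n → Unique (partitions n)
partitions-unique n = unique n n n

------------------------------------------------------------------------
-- Hook numbers and cores

conjugatePart : List ℕ → ℕ → ℕ
conjugatePart λs j = length (filter (j ≤?_) λs)

-- The Fin indices count from zero, so (i , j) is the node in row 1 + i and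
-- column 1 + j.  The subtraction does not truncate: at a node of a partition
-- the row is at most the conjugate part and the column at most the part.
hook : (λs : List ℕ) (i : Fin (length λs)) → Fin (lookup λs i) → ℕ
hook λs i j =
  (lookup λs i + conjugatePart λs column + 1) ∸ (row + column)
  where
  row    = suc (toℕ i)
  column = suc (toℕ j)

IsCore : ℕ → List ℕ → Set
IsCore t λs = ∀ (i : Fin (length λs)) (j : Fin (lookup λs i)) → ¬ (t ∣ hook λs i j)

isCore? : ∀ t → Decidable (IsCore t)
isCore? t λs = all? λ i → all? λ j → ¬? (t ∣? hook λs i j)

coreCount : ℕ → ℕ → ℕ
coreCount t n = length (filter (isCore? t) (partitions n))

------------------------------------------------------------------------
-- Formal power series over ℤ, as coefficient sequences

PowerSeries : Set
PowerSeries = ℕ → ℤ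

infix  8 _q^_
infixl 7 _⊛_ _⊘_
infixr 9 _↑_

_q^_ : ℤ → ℕ → PowerSeries
(a q^ e) n = if ⌊ e ≟ n ⌋ then a else 0ℤ

_⊛_ : PowerSeries → PowerSeries → PowerSeries
(f ⊛ g) n = ∑[ i < suc n ] (f (toℕ i) ℤ.* g (n ∸ toℕ i))

_↑_ : PowerSeries → ℕ → PowerSeries
f ↑ zero  = 1ℤ q^ 0
f ↑ suc k = f ⊛ (f ↑ k)

-- Long division; it is the quotient only for constant term g 0 ≡ 1ℤ.
_⊘_ : PowerSeries → PowerSeries → PowerSeries
(f ⊘ g) zero    = f 0
(f ⊘ g) (suc n) = ((λ k → f (suc k) ℤ.- f 0 ℤ.* g (suc k)) ⊘ g) n

⊘-⊛-cancel : ∀ f g → g 0 ≡ 1ℤ → (f ⊘ g) ⊛ g ≗ f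
⊘-⊛-cancel f g g₀≡1 zero = begin
  f 0 ℤ.* g 0 ℤ.+ 0ℤ  ≡⟨ ℤ.+-identityʳ _ ⟩
  f 0 ℤ.* g 0         ≡⟨ cong (f 0 ℤ.*_) g₀≡1 ⟩
  f 0 ℤ.* 1ℤ          ≡⟨ ℤ.*-identityʳ _ ⟩
  f 0                 ∎
  where open ≡-Reasoning
⊘-⊛-cancel f g g₀≡1 (suc n) = begin
  c ℤ.+ ((f′ ⊘ g) ⊛ g) n        ≡⟨ cong (λ x → c ℤ.+ x) (⊘-⊛-cancel f′ g g₀≡1 n) ⟩
  c ℤ.+ (f (suc n) ℤ.- c)       ≡⟨ ℤ.+-comm c _ ⟩
  (f (suc n) ℤ.- c) ℤ.+ c       ≡⟨ ℤ.+-assoc (f (suc n)) (ℤ.- c) c ⟩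
  f (suc n) ℤ.+ (ℤ.- c ℤ.+ c)   ≡⟨ cong (λ x → f (suc n) ℤ.+ x) (ℤ.+-inverseˡ c) ⟩
  f (suc n) ℤ.+ 0ℤ              ≡⟨ ℤ.+-identityʳ _ ⟩
  f (suc n)                     ∎
  where
  open ≡-Reasoning
  c = f 0 ℤ.* g (suc n)
  f′ : PowerSeries
  f′ k = f (suc k) ℤ.- f 0 ℤ.* g (suc k)

-- The substitution q ↦ q^m.
dilate : (m : ℕ) .{{_ : NonZero m}} → PowerSeries → PowerSeries
dilate m f n = case m ∣? n of λ where
  (yes m∣n) → f (quotient m∣n)
  (no  _)   → 0ℤ

-- φ(-q) = ∑_{k ∈ ℤ} (-1)^k q^(k²).  Only |k| ≤ n can contribute to the
-- coefficient of q^n; the two sums run over k = 0, …, n and k = -1, …, -n.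
φ[-q] : PowerSeries
φ[-q] n = (∑[ k < suc n ] term (+ toℕ k) n) ℤ.+ (∑[ k < n ] term -[1+ toℕ k ] n)
  where
  term : ℤ → PowerSeries
  term k = (-1ℤ ℤ.^ ℤ.∣ k ∣) q^ ℤ.∣ k ℤ.* k ∣

-- ψ(-q) = ∑_{k ≥ 0} (-q)^(k(k+1)/2).  Only k ≤ n can contribute to the
-- coefficient of q^n.
ψ[-q] : PowerSeries
ψ[-q] n = ∑[ k < suc n ] term (toℕ k) n
  where
  term : ℕ → PowerSeries
  term k = (-1ℤ ℤ.^ (k * (k + 1) / 2)) q^ (k * (k + 1) / 2)

------------------------------------------------------------------------
-- The coefficient sequences, zero at negative indices

extend : (ℕ → ℤ) → ℤ → ℤ
extend f (+ n)    = f n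
extend f -[1+ _ ] = 0ℤ

c₅ : ℤ → ℤ
c₅ = extend λ n → + coreCount 5 n

ā₅ : ℤ → ℤ
ā₅ = extend (dilate 5 φ[-q] ↑ 5 ⊘ φ[-q])

b̄₅ : ℤ → ℤ
b̄₅ = extend (dilate 5 ψ[-q] ↑ 5 ⊘ ψ[-q])

fromℤ : ℤ → ℚ
fromℤ z = z ℚ./ 1

{-# OPTIONS --safe #-}
module Submission where

-- Sliding beads on the 5-abacus identifies the 5-cores with the tuples of runner heights, and the
-- functional equation of ∏ (1 + z q^m) then gives C(q) = ∑ c₅(n) qⁿ = f₅⁵ / f₁. The triple product
-- and the sublattice (2 + i) ℤ[i] of index 5 turn C(q) + q C(q²) and C(q) − 4 q C(q²) into products.
-- Comparing two expressions of F(q²), where F = f₁⁵ / f₅, yields the Hecke relation at 2,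
-- C(q) − C(−q) = 2 q C(q²) + 4 q³ C(q⁴). As ∑ a̅₅(n) qⁿ = C(q)² / C(q²) and
-- ∑ b̅₅(n) qⁿ = C(q) C(q⁴) / C(q²), it makes the odd coefficients of ∑ a̅₅(n) qⁿ and F linear
-- combinations of those of q C and q³ ∑ b̅₅(n) qⁿ. Finally the 5-dissection
-- f₁ = u(q⁵) + q x(q⁵) + q² v(q⁵) with u v = −x² relates q C and F on every residue class modulo 5
-- up to one unknown series R, and the Hecke relations at 2 force R = 1.

open import Defs
open import Algebra.Bundles using (CommutativeMonoid; CommutativeRing; RawRing)
import Algebra.Properties.CommutativeMonoid.Sum as CMSum
import Algebra.Properties.CommutativeSemigroup as CSProperties
import Algebra.Properties.Ring as RingProperties
import Algebra.Properties.Semiring.Exp as Exp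
import Algebra.Solver.Ring as RingSolver
open import Algebra.Solver.Ring.AlmostCommutativeRing
  using (fromCommutativeRing; AlmostCommutativeRing; _-Raw-AlmostCommutative⟶_)
open import Algebra.Structures using (IsCommutativeRing)
open import Data.Fin.Base using (Fin; toℕ; opposite; fromℕ<) renaming (zero to fzero; suc to fsuc)
open import Data.Fin.Patterns using (0F; 1F; 2F; 3F; 4F)
import Data.Fin.Properties as Fin
open import Data.Integer.Base as ℤ using (ℤ; +_; -[1+_]; 0ℤ; 1ℤ; -1ℤ)
import Data.Integer.Properties as ℤ
import Data.Integer.Tactic.RingSolver as ℤTactic
open import Data.List.Base
  using (List; []; _∷_; _++_; map; upTo; applyUpTo; cartesianProduct; deduplicate; length;
         filter; lookup; replicate; downFrom; concat)
open import Data.List.Membership.Propositional using (_∈_; _∉_)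
import Data.List.Membership.Propositional.Properties as ∈
import Data.List.Properties as List
open import Data.List.Relation.Unary.All as All using (All; []; _∷_)
import Data.List.Relation.Unary.All.Properties as All
open import Data.List.Relation.Unary.AllPairs as AllPairs using ([]; _∷_; AllPairs)
import Data.List.Relation.Unary.AllPairs.Properties as AllPairs
open import Data.List.Relation.Unary.Any using (here; there)
open import Data.List.Relation.Unary.Linked using (Linked)
import Data.List.Relation.Unary.Linked.Properties as Linked
import Data.List.Relation.Unary.Unique.DecPropositional.Properties as DecUnique
open import Data.List.Relation.Unary.Unique.Propositional using (Unique)
import Data.List.Relation.Unary.Unique.Propositional.Properties as Unique
open import Data.Maybe.Base using (Maybe; just; nothing)
open import Data.Nat.Base
  using (ℕ; zero; suc; _+_; _*_; _∸_; _≤_; _<_; _≥_; z≤n; s≤s; s≤s⁻¹; NonZero; ≢-nonZero;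
         ≢-nonZero⁻¹; _/_)
import Data.Nat.DivMod as DivMod
open import Data.Nat.Divisibility as Div using (_∣_; _∣?_; divides)
open import Data.Nat.Induction using (<-rec)
open import Data.Nat.ListAction.Properties using (sum-++)
open import Data.Nat.Properties as ℕ using (_≤?_; _<?_)
import Data.Nat.Tactic.RingSolver as ℕTactic
open import Data.Product.Base using (_×_; _,_; proj₁; proj₂; ∃)
open import Data.Rational.Base as ℚ using (½)
import Data.Rational.Properties as ℚ
open import Data.Rational.Unnormalised.Base as ℚᵘ using (mkℚᵘ; *≡*)
import Data.Rational.Unnormalised.Properties as ℚᵘ
open import Data.Sum.Base using (_⊎_; inj₁; inj₂; [_,_])
open import Data.Unit.Base using (⊤; tt)
open import Data.Vec.Base as Vec using (Vec; []; _∷_; tabulate)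
import Data.Vec.Properties as Vec
open import Function.Base using (_∘_; id)
open import Function.Bundles using (Equivalence)
open import Level using (0ℓ)
open import Relation.Binary.Definitions using (DecidableEquality; tri<; tri≈; tri>)
open import Relation.Binary.PropositionalEquality
  using (_≡_; _≢_; refl; sym; trans; cong; cong₂; subst; module ≡-Reasoning)
import Relation.Binary.Reasoning.Setoid as SetoidReasoning
open import Relation.Nullary.Decidable using (yes; no; Dec)
open import Relation.Nullary.Negation using (¬_; contradiction)

-- Let χ be the Legendre symbol modulo 5. Classically q C has the coefficients G(n) = ∑ χ(n/d) d and
-- F the coefficients -5 ∑ χ(d) d, n > 0, summed over the divisors d of n: these are the Eisenstein
-- series of weight 2 with character χ. All arithmetic below is a shadow of this, obtained from
-- identities of integral formal series: G(2m) = G(m) + 2 G(m/2), G(5m) = 5 G(m), F(5m) = F(m), and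
-- F(m) = -5 χ(m) G(m) for m prime to 5. The equation R = 1 is the norm identity ∏ f₁(ζ q) = f₅⁶ /
-- f₂₅ over the fifth roots of unity ζ. There are no such ζ among integral series, so R is kept as
-- an unknown. Up to its first nontrivial coefficient the relations at 5 hold, doubling carries them
-- to an index at which that coefficient would be visible, and so it vanishes. What decides the
-- theorem is a collision of two formulas. With B̂ = q³ ∑ b̅₅(n) qⁿ, for odd m also F(m) = -5 G(m) +
-- 20 B̂(m). Hence B̂(m) is 0 when χ(m) = 1 and G(m)/2 when χ(m) = -1; the remaining indices follow
-- by doubling, and from m to 5 m.

-- Formal power series over a commutative ring, and substitution into them.

module Series (R : CommutativeRing 0ℓ 0ℓ) where
  private module R = CommutativeRing R
  open CMSum R.+-commutativeMonoid using (sum)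

  S : Set
  S = ℕ → R.Carrier

  infix  4 _≋_ _≋[_]_
  infixl 6 _⊞_
  infixl 7 _⋆_

  -- A record and not bare pointwise equality, so that `f` and `g` can be inferred from a proof.
  record _≋_ (f g : S) : Set where
    constructor mk≋
    field at : ∀ n → f n R.≈ g n
  open _≋_ public

  -- Congruence modulo q^N. Infinite sums and products are compared at every finite precision, and
  -- `≋[]⇒≋` passes to equality.
  record _≋[_]_ (f : S) (N : ℕ) (g : S) : Set where
    constructor mk≋[]
    field below : ∀ n → n < N → f n R.≈ g n
  open _≋[_]_ public

  0s : S
  0s _ = R.0#

  const : R.Carrier → S
  const c zero    = c
  const c (suc _) = R.0#

  1s : S
  1s = const R.1#

  opaque
    -- Opaque, so that long identities are treated as expressions in `_⊞_` and `_⋆_` and do not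
    -- unfold to sums of coefficients.
    _⊞_ _⋆_ : S → S → S
    (f ⊞ g) n = f n R.+ g n
    (f ⋆ g) n = sum {suc n} (λ i → f (toℕ i) R.* g (n ∸ toℕ i))

    ⊟_ tl : S → S
    (⊟ f) n = R.- f n
    tl f n = f (suc n)

    ⊞-at : ∀ f g n → (f ⊞ g) n ≡ f n R.+ g n
    ⊞-at f g n = refl

    ⊟-at : ∀ f n → (⊟ f) n ≡ R.- f n
    ⊟-at f n = refl

    tl-at : ∀ f n → tl f n ≡ f (suc n)
    tl-at f n = refl

    ⋆-suc : ∀ f g n → (f ⋆ g) (suc n) ≡ f 0 R.* g (suc n) R.+ (tl f ⋆ g) n
    ⋆-suc f g n = refl

    ⋆-zero : ∀ f g → (f ⋆ g) 0 R.≈ f 0 R.* g 0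
    ⋆-zero f g = R.+-identityʳ _

  private
    open SetoidReasoning R.setoid
    module +S = CSProperties (CommutativeMonoid.commutativeSemigroup R.+-commutativeMonoid)

  opaque
    unfolding _⊞_

    ⋆-local : ∀ n {f f′ g g′} → (∀ m → m ≤ n → f m R.≈ f′ m) → (∀ m → m ≤ n → g m R.≈ g′ m) →
              (f ⋆ g) n R.≈ (f′ ⋆ g′) n
    ⋆-local zero    p q = R.+-congʳ (R.*-cong (p 0 z≤n) (q 0 z≤n))
    ⋆-local (suc n) p q = R.+-cong (R.*-cong (p 0 z≤n) (q (suc n) ℕ.≤-refl))
      (⋆-local n (λ m m≤n → p (suc m) (s≤s m≤n)) (λ m m≤n → q m (ℕ.m≤n⇒m≤1+n m≤n)))

    zeroˡ : ∀ f n → (0s ⋆ f) n R.≈ R.0#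
    zeroˡ f zero    = R.trans (R.+-identityʳ _) (R.zeroˡ _)
    zeroˡ f (suc n) = R.trans (R.+-cong (R.zeroˡ _) (zeroˡ f n)) (R.+-identityˡ _)

    const-⋆ : ∀ c f n → (const c ⋆ f) n R.≈ c R.* f n
    const-⋆ c f zero    = R.+-identityʳ _
    const-⋆ c f (suc n) = R.trans (R.+-congˡ (zeroˡ f n)) (R.+-identityʳ _)

    scale-⋆ : ∀ c f g n → ((λ k → c R.* f k) ⋆ g) n R.≈ c R.* (f ⋆ g) n
    scale-⋆ c f g zero = begin
      c R.* f 0 R.* g 0 R.+ R.0#   ≈⟨ R.+-identityʳ _ ⟩
      c R.* f 0 R.* g 0            ≈⟨ R.*-assoc _ _ _ ⟩
      c R.* (f 0 R.* g 0)          ≈⟨ R.*-congˡ (R.+-identityʳ _) ⟨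
      c R.* (f 0 R.* g 0 R.+ R.0#) ∎
    scale-⋆ c f g (suc n) = R.trans (R.+-cong (R.*-assoc _ _ _) (scale-⋆ c (tl f) g n))
      (R.sym (R.distribˡ _ _ _))

    distribʳ : ∀ h f g n → ((f ⊞ g) ⋆ h) n R.≈ (f ⋆ h) n R.+ (g ⋆ h) n
    distribʳ h f g zero = begin
      (f 0 R.+ g 0) R.* h 0 R.+ R.0#                    ≈⟨ R.+-identityʳ _ ⟩
      (f 0 R.+ g 0) R.* h 0                             ≈⟨ R.distribʳ _ _ _ ⟩
      f 0 R.* h 0 R.+ g 0 R.* h 0
          ≈⟨ R.+-cong (R.+-identityʳ _) (R.+-identityʳ _) ⟨
      (f 0 R.* h 0 R.+ R.0#) R.+ (g 0 R.* h 0 R.+ R.0#) ∎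
    distribʳ h f g (suc n) = R.trans
      (R.+-cong (R.distribʳ _ _ _) (distribʳ h (tl f) (tl g) n)) (+S.interchange _ _ _ _)

    -- The convolution peels off its first term by definition; peeling off the last one as well
    -- makes commutativity a plain induction.
    last : ∀ f g n → (f ⋆ g) (suc n) R.≈ (f ⋆ tl g) n R.+ f (suc n) R.* g 0
    last f g zero    = begin
      f 0 R.* g 1 R.+ (f 1 R.* g 0 R.+ R.0#)
          ≈⟨ R.+-cong (R.+-identityʳ _) (R.sym (R.+-identityʳ _)) ⟨
      (f 0 R.* g 1 R.+ R.0#) R.+ f 1 R.* g 0   ∎
    last f g (suc n) = R.trans (R.+-congˡ (last (tl f) g n)) (R.sym (R.+-assoc _ _ _))

    ⋆-commₙ : ∀ f g n → (f ⋆ g) n R.≈ (g ⋆ f) n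
    ⋆-commₙ f g zero    = R.+-congʳ (R.*-comm _ _)
    ⋆-commₙ f g (suc n) = begin
      f 0 R.* g (suc n) R.+ (tl f ⋆ g) n  ≈⟨ R.+-cong (R.*-comm _ _) (⋆-commₙ (tl f) g n) ⟩
      g (suc n) R.* f 0 R.+ (g ⋆ tl f) n  ≈⟨ R.+-comm _ _ ⟩
      (g ⋆ tl f) n R.+ g (suc n) R.* f 0  ≈⟨ last g f n ⟨
      (g ⋆ f) (suc n)                     ∎

    ⋆-assocₙ : ∀ f g h n → ((f ⋆ g) ⋆ h) n R.≈ (f ⋆ (g ⋆ h)) n
    ⋆-assocₙ f g h zero = R.+-congʳ (begin
      (f 0 R.* g 0 R.+ R.0#) R.* h 0     ≈⟨ R.*-congʳ (R.+-identityʳ _) ⟩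
      f 0 R.* g 0 R.* h 0                ≈⟨ R.*-assoc _ _ _ ⟩
      f 0 R.* (g 0 R.* h 0)              ≈⟨ R.*-congˡ (R.+-identityʳ _) ⟨
      f 0 R.* (g 0 R.* h 0 R.+ R.0#)     ∎)
    ⋆-assocₙ f g h (suc n) = begin
      (f ⋆ g) 0 R.* h (suc n) R.+ (((λ k → f 0 R.* tl g k) ⊞ (tl f ⋆ g)) ⋆ h) n
        ≈⟨ R.+-cong (R.trans (R.*-congʳ (R.+-identityʳ _)) (R.*-assoc _ _ _))
             (R.trans (distribʳ h (λ k → f 0 R.* tl g k) (tl f ⋆ g) n)
                 (R.+-cong (scale-⋆ (f 0) (tl g) h n) (⋆-assocₙ (tl f) g h n))) ⟩
      f 0 R.* (g 0 R.* h (suc n)) R.+ (f 0 R.* (tl g ⋆ h) n R.+ (tl f ⋆ (g ⋆ h)) n)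
        ≈⟨ R.+-assoc _ _ _ ⟨
      f 0 R.* (g 0 R.* h (suc n)) R.+ f 0 R.* (tl g ⋆ h) n R.+ (tl f ⋆ (g ⋆ h)) n
        ≈⟨ R.+-congʳ (R.distribˡ _ _ _) ⟨
      (f ⋆ (g ⋆ h)) (suc n) ∎

    identityˡ : ∀ f n → (1s ⋆ f) n R.≈ f n
    identityˡ f n = R.trans (const-⋆ R.1# f n) (R.*-identityˡ _)

    ⋆-cong : ∀ {f f′ g g′} → f ≋ f′ → g ≋ g′ → f ⋆ g ≋ f′ ⋆ g′
    ⋆-cong p q .at n = ⋆-local n (λ m _ → p .at m) (λ m _ → q .at m)

    isCommutativeRing : IsCommutativeRing _≋_ _⊞_ _⋆_ ⊟_ 0s 1s
    isCommutativeRing = record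
      { isRing = record
        { +-isAbelianGroup = record
          { isGroup = record
            { isMonoid = record
              { isSemigroup = record
                { isMagma = record
                  { isEquivalence = record
                    { refl  = mk≋ λ _ → R.refl
                    ; sym   = λ p → mk≋ λ n → R.sym (p .at n)
                    ; trans = λ p q → mk≋ λ n → R.trans (p .at n) (q .at n)
                    }
                  ; ∙-cong = λ p q → mk≋ λ n → R.+-cong (p .at n) (q .at n)
                  }
                ; assoc = λ f g h → mk≋ λ n → R.+-assoc _ _ _
                }
              ; identity = (λ f → mk≋ λ n → R.+-identityˡ _) , (λ f → mk≋ λ n → R.+-identityʳ _)
              }
            ; inverse = (λ f → mk≋ λ n → R.-‿inverseˡ _) , (λ f → mk≋ λ n → R.-‿inverseʳ _)
            ; ⁻¹-cong = λ p → mk≋ λ n → R.-‿cong (p .at n)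
            }
          ; comm = λ f g → mk≋ λ n → R.+-comm _ _
          }
        ; *-cong = ⋆-cong
        ; *-assoc = λ f g h → mk≋ (⋆-assocₙ f g h)
        ; *-identity = (λ f → mk≋ (identityˡ f))
                     , (λ f → mk≋ λ n → R.trans (⋆-commₙ f 1s n) (identityˡ f n))
        ; distrib = (λ h f g → mk≋ λ n → R.trans (⋆-commₙ h (f ⊞ g) n) (R.trans (distribʳ h f g n)
                                  (R.+-cong (⋆-commₙ f h n) (⋆-commₙ g h n))))
                  , (λ h f g → mk≋ (distribʳ h f g))
        }
      ; *-comm = λ f g → mk≋ (⋆-commₙ f g)
      }

  ring : CommutativeRing 0ℓ 0ℓ
  ring = record { isCommutativeRing = isCommutativeRing }

  opaque
    unfolding _⊞_

    const-⋆-at : ∀ c f n → (const c ⋆ f) n R.≈ c R.* f n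
    const-⋆-at = const-⋆

    tl-⊞ : ∀ f g → tl (f ⊞ g) ≋ tl f ⊞ tl g
    tl-⊞ f g .at n = R.refl

    tl-⋆ : ∀ f g → tl (f ⋆ g) ≋ const (f 0) ⋆ tl g ⊞ tl f ⋆ g
    tl-⋆ f g .at n = R.+-congʳ (R.sym (const-⋆ (f 0) (tl g) n))

    tl-cong : ∀ {f g} → f ≋ g → tl f ≋ tl g
    tl-cong p .at n = p .at (suc n)

    tl-local : ∀ {f g N} → f ≋[ suc N ] g → tl f ≋[ N ] tl g
    tl-local p .below n n<N = p .below (suc n) (s≤s n<N)

    const-+ : ∀ a b → const (a R.+ b) ≋ const a ⊞ const b
    const-+ a b .at zero    = R.refl
    const-+ a b .at (suc n) = R.sym (R.+-identityˡ _)

    const-* : ∀ a b → const (a R.* b) ≋ const a ⋆ const b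
    const-* a b .at n = R.sym (R.trans (const-⋆ a (const b) n) (go n))
      where
      go : ∀ n → a R.* const b n R.≈ const (a R.* b) n
      go zero    = R.refl
      go (suc n) = R.zeroʳ a

    const-neg : ∀ a → const (R.- a) ≋ ⊟ const a
    const-neg a .at zero    = R.refl
    const-neg a .at (suc n) = R.trans (R.sym (R.-‿inverseʳ R.0#)) (R.+-identityˡ _)

    ⊞-cong[] : ∀ {f f′ g g′ N} → f ≋[ N ] f′ → g ≋[ N ] g′ → f ⊞ g ≋[ N ] f′ ⊞ g′
    ⊞-cong[] p q .below n n<N = R.+-cong (p .below n n<N) (q .below n n<N)

    ⋆-cong[] : ∀ {f f′ g g′ N} → f ≋[ N ] f′ → g ≋[ N ] g′ → f ⋆ g ≋[ N ] f′ ⋆ g′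
    ⋆-cong[] p q .below n n<N = ⋆-local n
      (λ m m≤n → p .below m (ℕ.≤-<-trans m≤n n<N)) (λ m m≤n → q .below m (ℕ.≤-<-trans m≤n n<N))

    -- A factor without constant term gains one order of precision. This is what makes a recursion f
    -- = c + s · g determine f.
    ⋆-raise : ∀ {s f g N} → s 0 R.≈ R.0# → f ≋[ N ] g → s ⋆ f ≋[ suc N ] s ⋆ g
    ⋆-raise {s} {f} {g} s₀ p .below zero _ = R.+-congʳ
      (R.trans (R.*-congʳ s₀) (R.trans (R.zeroˡ _) (R.sym (R.trans (R.*-congʳ s₀) (R.zeroˡ _)))))
    ⋆-raise {s} {f} {g} s₀ p .below (suc n) (s≤s n<N) = R.+-cong
      (R.trans (R.*-congʳ s₀) (R.trans (R.zeroˡ _) (R.sym (R.trans (R.*-congʳ s₀) (R.zeroˡ _)))))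
      (⋆-local n {tl s} {tl s} (λ m m≤n → R.refl) (λ m m≤n → p .below m (ℕ.≤-<-trans m≤n n<N)))

  const-cong : ∀ {a b} → a R.≈ b → const a ≋ const b
  const-cong p .at zero    = p
  const-cong p .at (suc n) = R.refl

  ≋⇒≋[] : ∀ {f g N} → f ≋ g → f ≋[ N ] g
  ≋⇒≋[] p .below n _ = p .at n

  ≋[]⇒≋ : ∀ {f g} → (∀ N → f ≋[ N ] g) → f ≋ g
  ≋[]⇒≋ p .at n = p (suc n) .below n ℕ.≤-refl

  ≋[]-refl : ∀ {f N} → f ≋[ N ] f
  ≋[]-refl .below n _ = R.refl

  ≋[]-sym : ∀ {f g N} → f ≋[ N ] g → g ≋[ N ] f
  ≋[]-sym p .below n n<N = R.sym (p .below n n<N)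

  ≋[]-trans : ∀ {f g h N} → f ≋[ N ] g → g ≋[ N ] h → f ≋[ N ] h
  ≋[]-trans p q .below n n<N = R.trans (p .below n n<N) (q .below n n<N)

  ≋[]-weaken : ∀ {f g M N} → M ≤ N → f ≋[ N ] g → f ≋[ M ] g
  ≋[]-weaken M≤N p .below n n<M = p .below n (ℕ.<-≤-trans n<M M≤N)

  -- The substitution of a series s without constant term for the variable is
  -- determined by h f = f₀ + s · h (f − f₀)/q.
  record Substitution (h : S → S) (s : S) : Set where
    field
      s₀   : s 0 R.≈ R.0#
      step : ∀ f → h f ≋ const (f 0) ⊞ s ⋆ h (tl f)

    private
      module P = CommutativeRing ring
      module +P = CSProperties (CommutativeMonoid.commutativeSemigroup P.+-commutativeMonoid)
      module *P = CSProperties (CommutativeMonoid.commutativeSemigroup P.*-commutativeMonoid)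

      infixl 1 _⨟_
      _⨟_ : ∀ {f g h N} → f ≋[ N ] g → g ≋ h → f ≋[ N ] h
      p ⨟ q = ≋[]-trans p (≋⇒≋[] q)

      unfold : ∀ {f N g} → h (tl f) ≋[ N ] g → h f ≋[ suc N ] const (f 0) ⊞ s ⋆ g
      unfold {f} p = ≋[]-trans (≋⇒≋[] (step f)) (⊞-cong[] ≋[]-refl (⋆-raise s₀ p))

    cong-h : ∀ {f g} → f ≋ g → h f ≋ h g
    cong-h p = ≋[]⇒≋ λ N → go N p
      where
      go : ∀ N {f g} → f ≋ g → h f ≋[ N ] h g
      go zero    p .below n ()
      go (suc N) {f} {g} p = unfold (go N (tl-cong p))
        ⨟ P.trans (P.+-congʳ (const-cong (p .at 0))) (P.sym (step g))

    +-homo : ∀ f g → h (f ⊞ g) ≋ h f ⊞ h g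
    +-homo f g = ≋[]⇒≋ λ N → go N f g
      where
      go : ∀ N f g → h (f ⊞ g) ≋[ N ] h f ⊞ h g
      go zero    f g .below n ()
      go (suc N) f g = unfold (≋[]-trans (≋⇒≋[] (cong-h (tl-⊞ f g))) (go N (tl f) (tl g)))
        ⨟ P.+-cong (P.trans (const-cong (R.reflexive (⊞-at f g 0))) (const-+ (f 0) (g 0)))
            (P.distribˡ s _ _)
        ⨟ +P.interchange _ _ _ _
        ⨟ P.sym (P.+-cong (step f) (step g))

    const-⋆-homo : ∀ c f → h (const c ⋆ f) ≋ const c ⋆ h f
    const-⋆-homo c f = ≋[]⇒≋ λ N → go N f
      where
      tl-const : ∀ f → tl (const c ⋆ f) ≋ const c ⋆ tl f
      tl-const f .at n = R.trans (R.reflexive (tl-at _ n)) (R.trans (const-⋆-at c f (suc n))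
        (R.trans (R.*-congˡ (R.reflexive (sym (tl-at f n)))) (R.sym (const-⋆-at c (tl f) n))))

      go : ∀ N f → h (const c ⋆ f) ≋[ N ] const c ⋆ h f
      go zero    f .below n ()
      go (suc N) f = unfold (≋[]-trans (≋⇒≋[] (cong-h (tl-const f))) (go N (tl f)))
        ⨟ P.+-cong (P.trans (const-cong (const-⋆-at c f 0)) (const-* c (f 0))) (*P.x∙yz≈y∙xz s _ _)
        ⨟ P.sym (P.distribˡ _ _ _)
        ⨟ P.*-congˡ (P.sym (step f))

    -- Induction on the precision. The tail of f g is f₀ (tail of g) + (tail of f) g, so additivity
    -- and homogeneity come first; the remaining product stands behind the factor `s` and is needed
    -- at one order less.
    *-homo : ∀ f g → h (f ⋆ g) ≋ h f ⋆ h g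
    *-homo f g = ≋[]⇒≋ λ N → go N f g
      where
      go : ∀ N f g → h (f ⋆ g) ≋[ N ] h f ⋆ h g
      go zero    f g .below n ()
      go (suc N) f g = unfold (≋[]-trans
          (≋⇒≋[] (P.trans (cong-h (tl-⋆ f g)) (+-homo (const (f 0) ⋆ tl g) (tl f ⋆ g))))
                                (⊞-cong[] (≋⇒≋[] (const-⋆-homo (f 0) (tl g))) (go N (tl f) g)))
        ⨟ P.+-cong (P.trans (const-cong (⋆-zero f g)) (const-* (f 0) (g 0))) (P.distribˡ s _ _)
        ⨟ P.sym (P.+-assoc _ _ _)
        ⨟ P.+-cong (P.trans (P.+-congˡ (*P.x∙yz≈y∙xz s _ _)) (P.sym (P.distribˡ _ _ _)))
                   (P.sym (P.*-assoc s _ _))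
        ⨟ P.+-congʳ (P.*-congˡ (P.sym (step g)))
        ⨟ P.sym (P.distribʳ _ _ _)
        ⨟ P.*-congʳ (P.sym (step f))

    const-homo : ∀ c → h (const c) ≋ const c
    const-homo c = P.trans (step (const c))
      (P.trans (P.+-congˡ (P.trans (P.*-congˡ h0) (P.zeroʳ s))) (P.+-identityʳ _))
      where
      z : tl (const c) ≋ const R.0# ⋆ tl (const c)
      z .at n = R.trans (R.reflexive (tl-at (const c) n))
          (R.sym (R.trans (const-⋆-at R.0# _ n) (R.zeroˡ _)))
      h0 : h (tl (const c)) ≋ 0s
      h0 = P.trans (cong-h z) (P.trans (const-⋆-homo R.0# (tl (const c)))
             (mk≋ λ n → R.trans (const-⋆-at R.0# _ n) (R.zeroˡ _)))

    local : ∀ {f g} N → f ≋[ N ] g → h f ≋[ N ] h g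
    local zero    p .below n ()
    local {f} {g} (suc N) p =
      ≋[]-trans (unfold (local N (tl-local p)))
        (≋[]-trans (⊞-cong[] (≋⇒≋[] (const-cong (p .below 0 (s≤s z≤n)))) ≋[]-refl)
                   (≋⇒≋[] (P.sym (step g))))

-- Series in q over ℤ: division, the substitutions q ↦ q^m and q ↦ -q, sections modulo 5.

module PowerSeriesRing where
  open Series ℤ.+-*-commutativeRing public
    using (_≋_; mk≋; at; _≋[_]_; mk≋[]; below; _⊞_; _⋆_; ⊟_; tl; 0s; 1s; const; const-+;
           const-*; const-neg; ⊞-at; ⊟-at; tl-at; ⋆-suc; ⋆-zero; tl-cong; const-cong;
           const-⋆-at; ≋⇒≋[]; ≋[]⇒≋; ≋[]-refl; ≋[]-sym; ≋[]-trans; ≋[]-weaken; ⊞-cong[];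
           ⋆-cong[]; ⋆-raise; Substitution)
    renaming (ring to ℤ[[q]])

  module P = CommutativeRing ℤ[[q]]
  open Exp P.semiring public using (_^_; ^-homo-*; ^-congˡ; ^-assocʳ)

  -- The coefficients of the solver are integers, embedded by `const`, so that numerical factors are
  -- computed and not carried as atoms.
  module Solver where
    ring′ : AlmostCommutativeRing 0ℓ 0ℓ
    ring′ = fromCommutativeRing ℤ[[q]]

    ℤ-ring : RawRing 0ℓ 0ℓ
    ℤ-ring = CommutativeRing.rawRing ℤ.+-*-commutativeRing

    morphism : ℤ-ring -Raw-AlmostCommutative⟶ ring′
    morphism = record
      { ⟦_⟧ = const ; +-homo = const-+ ; *-homo = const-* ; -‿homo = const-neg
      ; 0-homo = mk≋ λ { zero → refl ; (suc n) → refl } ; 1-homo = P.refl }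

    dec : ∀ a b → Maybe (const a ≋ const b)
    dec a b with a ℤ.≟ b
    ... | yes a≡b = just (const-cong a≡b)
    ... | no _    = nothing

    open RingSolver ℤ-ring ring′ morphism dec public

  open Solver public using (solve; _:=_; _:+_; _:*_; _:-_; :-_; _:^_; con)

  module +P = CSProperties (CommutativeMonoid.commutativeSemigroup P.+-commutativeMonoid)
  module *P = CSProperties (CommutativeMonoid.commutativeSemigroup P.*-commutativeMonoid)

  infixl 1 _⨟_
  _⨟_ : ∀ {f g h} → f ≋ g → g ≋ h → f ≋ h
  _⨟_ = P.trans

  infixl 7 _⟪⋆⟫_
  infixl 6 _⟪⊞⟫_
  _⟪⋆⟫_ : ∀ {f f′ g g′} → f ≋ f′ → g ≋ g′ → f ⋆ g ≋ f′ ⋆ g′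
  _⟪⋆⟫_ = P.*-cong

  _⟪⊞⟫_ : ∀ {f f′ g g′} → f ≋ f′ → g ≋ g′ → f ⊞ g ≋ f′ ⊞ g′
  _⟪⊞⟫_ = P.+-cong

  ≋⨟ : ∀ {f g h N} → f ≋ g → g ≋[ N ] h → f ≋[ N ] h
  ≋⨟ p q = ≋[]-trans (≋⇒≋[] p) q

  ⨟≋ : ∀ {f g h N} → f ≋[ N ] g → g ≋ h → f ≋[ N ] h
  ⨟≋ p q = ≋[]-trans p (≋⇒≋[] q)

  X : PowerSeries
  X zero    = 0ℤ
  X (suc n) = 1s n

  ≡⇒≋ : ∀ {f g} → f ≡ g → f ≋ g
  ≡⇒≋ refl = P.refl

  tl-X : tl X ≋ 1s
  tl-X .at n = tl-at X n

  X⋆-zero : ∀ f → (X ⋆ f) 0 ≡ 0ℤ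
  X⋆-zero f = ⋆-zero X f

  X⋆-suc : ∀ f n → (X ⋆ f) (suc n) ≡ f n
  X⋆-suc f n = trans (⋆-suc X f n) (trans (ℤ.+-identityˡ _)
    (trans (P.*-congʳ {f} tl-X .at n) (P.*-identityˡ f .at n)))

  X^⋆-< : ∀ e f {n} → n < e → (X ^ e ⋆ f) n ≡ 0ℤ
  X^⋆-< (suc e) f {zero}  _         = trans (P.*-assoc X (X ^ e) f .at 0) (X⋆-zero _)
  X^⋆-< (suc e) f {suc n} (s≤s n<e) =
    trans (P.*-assoc X (X ^ e) f .at (suc n)) (trans (X⋆-suc _ n) (X^⋆-< e f n<e))

  X^⋆-+ : ∀ e f n → (X ^ e ⋆ f) (e + n) ≡ f n
  X^⋆-+ zero    f n = P.*-identityˡ f .at n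
  X^⋆-+ (suc e) f n =
    trans (P.*-assoc X (X ^ e) f .at (suc (e + n))) (trans (X⋆-suc _ (e + n)) (X^⋆-+ e f n))

  X^⋆≋[]0 : ∀ e f → X ^ e ⋆ f ≋[ e ] 0s
  X^⋆≋[]0 e f .below n n<e = X^⋆-< e f n<e

  X^≋[]0 : ∀ e → X ^ e ≋[ e ] 0s
  X^≋[]0 e = ≋[]-trans (≋⇒≋[] (P.sym (P.*-identityʳ _))) (X^⋆≋[]0 e 1s)

  X^-at : ∀ e → (X ^ e) e ≡ 1ℤ
  X^-at e = trans (sym (P.*-identityʳ (X ^ e) .at e))
    (trans (cong (X ^ e ⋆ 1s) (sym (ℕ.+-identityʳ e))) (X^⋆-+ e 1s 0))

  X^-≢ : ∀ e {n} → e ≢ n → (X ^ e) n ≡ 0ℤ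
  X^-≢ e {n} e≢n with ℕ.<-≤-connex n e
  ... | inj₁ n<e = X^≋[]0 e .below n n<e
  ... | inj₂ e≤n with n ∸ e in eq
  ...   | zero  = contradiction (ℕ.≤-antisym e≤n (ℕ.m∸n≡0⇒m≤n eq)) e≢n
  ...   | suc k = trans (sym (P.*-identityʳ (X ^ e) .at n))
    (trans (cong (X ^ e ⋆ 1s) (sym (trans (cong (λ i → e + i) (sym eq)) (ℕ.m+[n∸m]≡n e≤n))))
        (X^⋆-+ e 1s (suc k)))

  q^-≋ : ∀ a e → a q^ e ≋ const a ⋆ X ^ e
  q^-≋ a e .at n = trans (go n) (sym (const-⋆-at a (X ^ e) n))
    where
    go : ∀ n → (a q^ e) n ≡ a ℤ.* (X ^ e) n
    go n with e ℕ.≟ n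
    ... | yes refl = sym (trans (cong (λ x → a ℤ.* x) (X^-at e)) (ℤ.*-identityʳ a))
    ... | no e≢n   = sym (trans (cong (λ x → a ℤ.* x) (X^-≢ e e≢n)) (ℤ.*-zeroʳ a))

  opaque
    unfolding _⋆_

    ⊛-≋ : ∀ f g → f ⊛ g ≋ f ⋆ g
    ⊛-≋ f g .at n = refl

  ↑-≋ : ∀ f k → f ↑ k ≋ f ^ k
  ↑-≋ f zero    = mk≋ λ { zero → refl ; (suc n) → refl }
  ↑-≋ f (suc k) = P.trans (⊛-≋ f (f ↑ k)) (P.*-congˡ {f} (↑-≋ f k))

  X^-cancel : ∀ e {f g N} → X ^ e ⋆ f ≋[ e + N ] X ^ e ⋆ g → f ≋[ N ] g
  X^-cancel e {f} {g} p .below n n<N =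
    trans (sym (X^⋆-+ e f n)) (trans (p .below (e + n) (ℕ.+-monoʳ-< e n<N)) (X^⋆-+ e g n))

  X^-cancel≋ : ∀ e {f g} → X ^ e ⋆ f ≋ X ^ e ⋆ g → f ≋ g
  X^-cancel≋ e p .at n = X^-cancel e {N = suc n} (≋⇒≋[] p) .below n ℕ.≤-refl

  inv : PowerSeries → PowerSeries
  inv g = 1s ⊘ g

  Unit : PowerSeries → Set
  Unit g = g 0 ≡ 1ℤ

  inv-⋆ : ∀ {g} → Unit g → inv g ⋆ g ≋ 1s
  inv-⋆ {g} u = P.trans (P.sym (⊛-≋ (inv g) g)) (mk≋ (⊘-⊛-cancel 1s g u))

  ⊘-⋆ : ∀ f {g} → Unit g → (f ⊘ g) ⋆ g ≋ f
  ⊘-⋆ f {g} u = P.trans (P.sym (⊛-≋ (f ⊘ g) g)) (mk≋ (⊘-⊛-cancel f g u))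

  ⋆-cancel[] : ∀ {g f h N} → Unit g → g ⋆ f ≋[ N ] g ⋆ h → f ≋[ N ] h
  ⋆-cancel[] {g} {f} {h} u p =
    ≋[]-trans (≋⇒≋[] (P.sym (lem f))) (≋[]-trans (⋆-cong[] (≋[]-refl {inv g}) p) (≋⇒≋[] (lem h)))
    where
    lem : ∀ f → inv g ⋆ (g ⋆ f) ≋ f
    lem f = P.trans (P.sym (P.*-assoc _ _ _)) (P.trans (P.*-congʳ (inv-⋆ u)) (P.*-identityˡ f))

  ⋆-cancel : ∀ {g f h} → Unit g → g ⋆ f ≋ g ⋆ h → f ≋ h
  ⋆-cancel u p = ≋[]⇒≋ λ N → ⋆-cancel[] u (≋⇒≋[] p)

  Unit-⋆ : ∀ {f g} → Unit f → Unit g → Unit (f ⋆ g)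
  Unit-⋆ {f} {g} u v = trans (⋆-zero f g) (cong₂ ℤ._*_ u v)

  Unit-^ : ∀ {f} k → Unit f → Unit (f ^ k)
  Unit-^ zero    u = refl
  Unit-^ {f} (suc k) u = Unit-⋆ {f} {f ^ k} u (Unit-^ k u)

  const-cancel : ∀ c .{{_ : ℤ.NonZero c}} {f g} → const c ⋆ f ≋ const c ⋆ g → f ≋ g
  const-cancel c {f} {g} p .at n = ℤ.*-cancelˡ-≡ c (f n) (g n)
    (trans (sym (const-⋆-at c f n)) (trans (p .at n) (const-⋆-at c g n)))

  dilate-* : ∀ m .{{_ : NonZero m}} f k → dilate m f (k * m) ≡ f k
  dilate-* m f k with m ∣? k * m
  ... | yes m∣ = cong f (ℕ.*-cancelʳ-≡ _ _ m (sym (_∣_.equality m∣)))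
  ... | no ¬m∣ = contradiction (divides k refl) ¬m∣

  dilate-∤ : ∀ m .{{_ : NonZero m}} f {n} → ¬ (m ∣ n) → dilate m f n ≡ 0ℤ
  dilate-∤ m f {n} ¬m∣ with m ∣? n
  ... | yes m∣ = contradiction m∣ ¬m∣
  ... | no _   = refl

  dilation : ∀ m .{{_ : NonZero m}} → Substitution (dilate m) (X ^ m)
  dilation m = record { s₀ = X^≋[]0 m .below 0 (ℕ.n≢0⇒n>0 (≢-nonZero⁻¹ m)) ; step = λ f →
      mk≋ (go f) }
    where
    small : ∀ f n → n < m → dilate m f n ≡ const (f 0) n
    small f zero    _   = dilate-* m f 0
    small f (suc n) n<m = dilate-∤ m f λ m∣ → ℕ.<⇒≱ n<m (Div.∣⇒≤ m∣)

    const-large : ∀ c k → const c (m + k) ≡ 0ℤ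
    const-large c k with m + k in eq
    ... | zero  = contradiction (ℕ.m+n≡0⇒m≡0 m eq) (≢-nonZero⁻¹ m)
    ... | suc _ = refl

    large : ∀ f k → dilate m f (m + k) ≡ dilate m (tl f) k
    large f k with m ∣? k
    ... | yes (divides j refl) = trans (dilate-* m f (suc j)) (sym (tl-at f j))
    ... | no ¬m∣ = dilate-∤ m f λ m∣ → ¬m∣ (Div.∣m+n∣m⇒∣n m∣ Div.∣-refl)

    go : ∀ f n → dilate m f n ≡ (const (f 0) ⊞ X ^ m ⋆ dilate m (tl f)) n
    go f n with ℕ.<-≤-connex n m
    ... | inj₁ n<m = trans (small f n n<m)
        (sym (trans (⊞-at _ _ n) (trans (cong (λ x → const (f 0) n ℤ.+ x) (X^⋆-< m _ n<m))
        (ℤ.+-identityʳ _))))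
    ... | inj₂ m≤n = subst (λ n → dilate m f n ≡ (const (f 0) ⊞ X ^ m ⋆ dilate m (tl f)) n)
        (ℕ.m+[n∸m]≡n m≤n)
      (trans (large f (n ∸ m)) (sym (trans (⊞-at _ _ (m + (n ∸ m)))
          (trans (cong₂ ℤ._+_ (const-large (f 0) (n ∸ m)) (X^⋆-+ m _ (n ∸ m))) (ℤ.+-identityˡ _)))))

  module D (m : ℕ) .{{_ : NonZero m}} = Substitution (dilation m)

  infix 9 -1^_
  -1^_ : ℕ → ℤ
  -1^ zero  = 1ℤ
  -1^ suc n = ℤ.- (-1^ n)

  opaque
    -- The substitution q ↦ -q; f + σ f and f - σ f isolate the even and the odd coefficients.
    σ : PowerSeries → PowerSeries
    σ f n = -1^ n ℤ.* f n

    σ-at : ∀ f n → σ f n ≡ -1^ n ℤ.* f n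
    σ-at f n = refl

  σ-substitution : Substitution σ (⊟ X)
  σ-substitution = record { s₀ = ⊟-at X 0 ; step = λ f → mk≋ (go f) }
    where
    open ≡-Reasoning
    go : ∀ f n → σ f n ≡ (const (f 0) ⊞ (⊟ X) ⋆ σ (tl f)) n
    go f zero    = begin
      σ f 0                          ≡⟨ σ-at f 0 ⟩
      1ℤ ℤ.* f 0                     ≡⟨ ℤ.*-identityˡ _ ⟩
      f 0                            ≡⟨ ℤ.+-identityʳ _ ⟨
      f 0 ℤ.+ 0ℤ                     ≡⟨ cong (λ x → f 0 ℤ.+ x)
          (trans (⋆-zero (⊟ X) (σ (tl f))) (cong (ℤ._* σ (tl f) 0) (⊟-at X 0))) ⟨
      f 0 ℤ.+ ((⊟ X) ⋆ σ (tl f)) 0   ≡⟨ ⊞-at _ _ 0 ⟨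
      (const (f 0) ⊞ (⊟ X) ⋆ σ (tl f)) 0 ∎
    go f (suc n) = begin
      σ f (suc n)                          ≡⟨ σ-at f (suc n) ⟩
      ℤ.- (-1^ n) ℤ.* f (suc n)            ≡⟨ ℤ.neg-distribˡ-* (-1^ n) (f (suc n)) ⟨
      ℤ.- (-1^ n ℤ.* f (suc n))            ≡⟨ cong (λ x → ℤ.- (-1^ n ℤ.* x)) (tl-at f n) ⟨
      ℤ.- (-1^ n ℤ.* tl f n)               ≡⟨ cong ℤ.-_ (σ-at (tl f) n) ⟨
      ℤ.- σ (tl f) n                       ≡⟨ cong ℤ.-_ (X⋆-suc (σ (tl f)) n) ⟨
      ℤ.- (X ⋆ σ (tl f)) (suc n)           ≡⟨ ⊟-at _ (suc n) ⟨
      (⊟ (X ⋆ σ (tl f))) (suc n)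
          ≡⟨ RingProperties.-‿distribˡ-* P.ring X (σ (tl f)) .at (suc n) ⟩
      ((⊟ X) ⋆ σ (tl f)) (suc n)           ≡⟨ ℤ.+-identityˡ _ ⟨
      0ℤ ℤ.+ ((⊟ X) ⋆ σ (tl f)) (suc n)    ≡⟨ ⊞-at _ _ (suc n) ⟨
      (const (f 0) ⊞ (⊟ X) ⋆ σ (tl f)) (suc n) ∎

  module σH = Substitution σ-substitution

  homo-^ : ∀ {h s} (H : Substitution h s) f k → h (f ^ k) ≋ h f ^ k
  homo-^ H f zero    = Substitution.const-homo H 1ℤ
  homo-^ H f (suc k) = P.trans (Substitution.*-homo H f (f ^ k)) (P.*-congˡ (homo-^ H f k))

  homo-X : ∀ {h s} → Substitution h s → h X ≋ s
  homo-X {h} {s} H = P.trans (H.step X) (P.trans (P.+-cong (mk≋ λ { zero → refl ; (suc n) → refl })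
    (P.*-congˡ (P.trans (H.cong-h tl-X) (H.const-homo 1ℤ))))
        (P.trans (P.+-identityˡ _) (P.*-identityʳ s)))
    where module H = Substitution H

  ⊟-≋ : ∀ f → ⊟ f ≋ const -1ℤ ⋆ f
  ⊟-≋ f .at n = trans (⊟-at f n) (trans (sym (ℤ.-1*i≡-i (f n))) (sym (const-⋆-at -1ℤ f n)))

  homo-neg : ∀ {h s} (H : Substitution h s) f → h (⊟ f) ≋ ⊟ h f
  homo-neg {h} H f = P.trans (H.cong-h (⊟-≋ f)) (P.trans (H.const-⋆-homo -1ℤ f) (P.sym (⊟-≋ (h f))))
    where module H = Substitution H

  homo-Unit : ∀ {h s} → Substitution h s → ∀ {f} → Unit f → Unit (h f)
  homo-Unit {h} {s} H {f} u = trans (H.step f .at 0) (trans (⊞-at _ _ 0) (cong₂ ℤ._+_ u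
    (trans (⋆-zero s (h (tl f))) (cong (ℤ._* h (tl f) 0) H.s₀))))
    where module H = Substitution H

  opaque
    sec : ℕ → PowerSeries → PowerSeries
    sec c f n = f (5 * n + c)

    sec-at : ∀ c f n → sec c f n ≡ f (5 * n + c)
    sec-at c f n = refl

  sec-cong : ∀ c {f g} → f ≋ g → sec c f ≋ sec c g
  sec-cong c {f} {g} p .at n = trans (sec-at c f n) (trans (p .at _) (sym (sec-at c g n)))

  sec-⊞ : ∀ c f g → sec c (f ⊞ g) ≋ sec c f ⊞ sec c g
  sec-⊞ c f g .at n = trans (sec-at c (f ⊞ g) n) (trans (⊞-at f g _)
    (trans (cong₂ ℤ._+_ (sym (sec-at c f n)) (sym (sec-at c g n))) (sym (⊞-at _ _ n))))

  -- Sections are linear over series in q⁵. In particular multiplication by f₅ becomes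
  -- multiplication by f₁ on each section.
  sec-dilate : ∀ c → c < 5 → ∀ g f → sec c (dilate 5 g ⋆ f) ≋ g ⋆ sec c f
  sec-dilate c c<5 g f .at n = trans (sec-at c _ n) (go n g)
    where
    unfold : ∀ g n → (dilate 5 g ⋆ f) n ≡ g 0 ℤ.* f n ℤ.+ (X ^ 5 ⋆ (dilate 5 (tl g) ⋆ f)) n
    unfold g n = trans (P.trans (P.*-congʳ {f} (D.step 5 g)) (P.trans (P.distribʳ f _ _)
      (P.+-congˡ (P.*-assoc _ _ _))) .at n)
          (trans (⊞-at _ _ n) (cong₂ ℤ._+_ (const-⋆-at (g 0) f n) refl))

    go : ∀ n g → (dilate 5 g ⋆ f) (5 * n + c) ≡ (g ⋆ sec c f) n
    go zero    g = trans (unfold g c) (trans (cong (λ x → g 0 ℤ.* f c ℤ.+ x) (X^⋆-< 5 _ c<5))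
      (trans (ℤ.+-identityʳ _) (trans (cong (g 0 ℤ.*_) (sym (sec-at c f 0)))
          (sym (⋆-zero g (sec c f))))))
    go (suc n) g = trans (unfold g (5 * suc n + c)) (trans
      (cong₂ ℤ._+_ (cong (g 0 ℤ.*_) (sym (sec-at c f (suc n))))
        (trans (cong (X ^ 5 ⋆ (dilate 5 (tl g) ⋆ f)) 5*suc)
            (trans (X^⋆-+ 5 _ (5 * n + c)) (go n (tl g)))))
      (sym (⋆-suc g (sec c f) n)))
      where 5*suc : 5 * suc n + c ≡ 5 + (5 * n + c)
            5*suc = trans (cong (_+ c) (ℕ.*-suc 5 n)) (ℕ.+-assoc 5 (5 * n) c)

open PowerSeriesRing

-- Sums of summable families of series.

module Summation where
  private variable I J : Set

  Σℓ : List I → (I → PowerSeries) → PowerSeries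
  Σℓ []       f = 0s
  Σℓ (i ∷ is) f = f i ⊞ Σℓ is f

  -- Modulo q^N all terms outside a finite list vanish; the list may contain vanishing terms too. As
  -- no order is imposed on the index set, sums over ℤ and ℤ² can be reindexed along any bijection.
  record IsSum (f : I → PowerSeries) (s : PowerSeries) : Set where
    field
      list   : ℕ → List I
      unique : ∀ N → Unique (list N)
      covers : ∀ N i → i ∈ list N ⊎ f i ≋[ N ] 0s
      total  : ∀ N → Σℓ (list N) f ≋[ N ] s

  private
    Σℓ-split : ∀ as {x : I} {bs} f → Σℓ (as ++ x ∷ bs) f ≋ f x ⊞ Σℓ (as ++ bs) f
    Σℓ-split []       f = P.refl
    Σℓ-split (a ∷ as) f = P.trans (P.+-congˡ (Σℓ-split as f)) (+P.x∙yz≈y∙xz _ _ _)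

    Unique-split : ∀ as {x : I} {bs} → Unique (as ++ x ∷ bs) → Unique (x ∷ as ++ bs)
    Unique-split []       u = u
    Unique-split (a ∷ as) (px ∷ u) with Unique-split as u | All.++⁻ as px
    ... | qx ∷ v | pas , a≢x ∷ pbs = ((a≢x ∘ sym) ∷ qx) ∷ All.++⁺ pas pbs ∷ v

    ∈-split : ∀ as {x i : I} {bs} → i ∈ as ++ x ∷ bs → i ≡ x ⊎ i ∈ as ++ bs
    ∈-split as i∈ with ∈.∈-++⁻ as i∈
    ... | inj₁ p         = inj₂ (∈.∈-++⁺ˡ p)
    ... | inj₂ (here p)  = inj₁ p
    ... | inj₂ (there p) = inj₂ (∈.∈-++⁺ʳ as p)

    ∈-unsplit : ∀ as {x i : I} {bs} → i ∈ as ++ bs → i ∈ as ++ x ∷ bs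
    ∈-unsplit as i∈ with ∈.∈-++⁻ as i∈
    ... | inj₁ p = ∈.∈-++⁺ˡ p
    ... | inj₂ p = ∈.∈-++⁺ʳ as (there p)

  -- This makes the value of a sum independent of the chosen lists: each entry of `xs` either
  -- vanishes at this precision or is cut out of `ys`.
  Σℓ-unique : ∀ {f : I → PowerSeries} {N} xs ys → Unique xs → Unique ys →
    (∀ {i} → i ∈ xs → i ∈ ys ⊎ f i ≋[ N ] 0s) → (∀ {i} → i ∈ ys → i ∈ xs ⊎ f i ≋[ N ] 0s) →
    Σℓ xs f ≋[ N ] Σℓ ys f
  Σℓ-unique []       []       _ _ _ _ = ≋[]-refl
  Σℓ-unique []       (y ∷ ys) u (_ ∷ v) p q with q (here refl)
  ... | inj₂ y≋0 = ≋⨟ (P.sym (P.+-identityˡ 0s)) (⊞-cong[] (≋[]-sym y≋0)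
    (Σℓ-unique [] ys u v (λ ()) (λ i∈ → q (there i∈))))
  Σℓ-unique {f = f} (x ∷ xs) ys (x∉ ∷ u) v p q with p (here refl)
  ... | inj₂ x≋0 = ⨟≋ (⊞-cong[] x≋0 (Σℓ-unique xs ys u v (λ i∈ → p (there i∈)) q′))
      (P.+-identityˡ _)
    where
    q′ : ∀ {i} → i ∈ ys → i ∈ xs ⊎ f i ≋[ _ ] 0s
    q′ i∈ with q i∈
    ... | inj₁ (here refl) = inj₂ x≋0
    ... | inj₁ (there r)   = inj₁ r
    ... | inj₂ r           = inj₂ r
  ... | inj₁ x∈ with ∈.∈-∃++ x∈
  ...   | as , bs , refl with Unique-split as v
  ...     | x∉′ ∷ v′ = ⨟≋ (⊞-cong[] ≋[]-refl (Σℓ-unique xs (as ++ bs) u v′ p′ q′))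
      (P.sym (Σℓ-split as f))
    where
    p′ : ∀ {i} → i ∈ xs → i ∈ as ++ bs ⊎ f i ≋[ _ ] 0s
    p′ i∈ with p (there i∈)
    ... | inj₂ r = inj₂ r
    ... | inj₁ r with ∈-split as r
    ...   | inj₁ refl = contradiction refl (All.lookup x∉ i∈)
    ...   | inj₂ r′   = inj₁ r′
    q′ : ∀ {i} → i ∈ as ++ bs → i ∈ xs ⊎ f i ≋[ _ ] 0s
    q′ i∈ with q (∈-unsplit as i∈)
    ... | inj₂ r            = inj₂ r
    ... | inj₁ (there r)    = inj₁ r
    ... | inj₁ (here refl)  = contradiction refl (All.lookup x∉′ i∈)

  Σℓ-cong[] : ∀ {f g : I → PowerSeries} {N} xs → (∀ i → f i ≋[ N ] g i) → Σℓ xs f ≋[ N ] Σℓ xs g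
  Σℓ-cong[] []       p = ≋[]-refl
  Σℓ-cong[] (x ∷ xs) p = ⊞-cong[] (p x) (Σℓ-cong[] xs p)

  Σℓ-cong : ∀ {f g : I → PowerSeries} xs → (∀ i → f i ≋ g i) → Σℓ xs f ≋ Σℓ xs g
  Σℓ-cong []       p = P.refl
  Σℓ-cong (x ∷ xs) p = P.+-cong (p x) (Σℓ-cong xs p)

  Σℓ-⊞ : ∀ (f g : I → PowerSeries) xs → Σℓ xs (λ i → f i ⊞ g i) ≋ Σℓ xs f ⊞ Σℓ xs g
  Σℓ-⊞ f g []       = P.sym (P.+-identityˡ 0s)
  Σℓ-⊞ f g (x ∷ xs) = P.trans (P.+-congˡ (Σℓ-⊞ f g xs)) (+P.interchange _ _ _ _)

  Σℓ-⋆ : ∀ c (f : I → PowerSeries) xs → Σℓ xs (λ i → c ⋆ f i) ≋ c ⋆ Σℓ xs f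
  Σℓ-⋆ c f []       = P.sym (P.zeroʳ c)
  Σℓ-⋆ c f (x ∷ xs) = P.trans (P.+-congˡ (Σℓ-⋆ c f xs)) (P.sym (P.distribˡ _ _ _))

  Σℓ-++ : ∀ (f : I → PowerSeries) xs ys → Σℓ (xs ++ ys) f ≋ Σℓ xs f ⊞ Σℓ ys f
  Σℓ-++ f []       ys = P.sym (P.+-identityˡ _)
  Σℓ-++ f (x ∷ xs) ys = P.trans (P.+-congˡ (Σℓ-++ f xs ys)) (P.sym (P.+-assoc _ _ _))

  Σℓ-map : ∀ (g : J → I) (f : I → PowerSeries) xs → Σℓ (map g xs) f ≡ Σℓ xs (f ∘ g)
  Σℓ-map g f []       = refl
  Σℓ-map g f (x ∷ xs) = cong (f (g x) ⊞_) (Σℓ-map g f xs)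

  Σℓ-× : ∀ (f : I → PowerSeries) (g : J → PowerSeries) xs ys →
    Σℓ (cartesianProduct xs ys) (λ (i , j) → f i ⋆ g j) ≋ Σℓ xs f ⋆ Σℓ ys g
  Σℓ-× f g []       ys = P.sym (P.zeroˡ _)
  Σℓ-× f g (x ∷ xs) ys = P.trans (Σℓ-++ _ (map (x ,_) ys) _)
    (P.trans (P.+-cong (P.trans (≡⇒≋ (Σℓ-map (x ,_) _ ys)) (Σℓ-⋆ (f x) g ys)) (Σℓ-× f g xs ys))
             (P.sym (P.distribʳ _ _ _)))

  open IsSum

  sum-unique : ∀ {f : I → PowerSeries} {s t} → IsSum f s → IsSum f t → s ≋ t
  sum-unique {f = f} A B = ≋[]⇒≋ λ N → ≋[]-trans (≋[]-sym (A .total N)) (≋[]-trans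
    (Σℓ-unique (A .list N) (B .list N) (A .unique N) (B .unique N) (λ {i} _ → B .covers N i) (λ {i} _ → A .covers N i))
    (B .total N))

  sum-cong : ∀ {f g : I → PowerSeries} {s t} → (∀ i → f i ≋ g i) → s ≋ t → IsSum f s → IsSum g t
  sum-cong {f = f} {g} p q A = record
    { list = A .list ; unique = A .unique ; covers = λ N i → cov (A .covers N i)
    ; total = λ N → ≋⨟ (Σℓ-cong (A .list N) (λ i → P.sym (p i))) (⨟≋ (A .total N) q) }
    where
    cov : ∀ {N i} → i ∈ A .list N ⊎ f i ≋[ N ] 0s → i ∈ A .list N ⊎ g i ≋[ N ] 0s
    cov (inj₁ i∈) = inj₁ i∈
    cov {i = i} (inj₂ z)  = inj₂ (≋⨟ (P.sym (p i)) z)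

  -- Suited to `φ[-q]` and `ψ[-q]`, whose truncation depends on the coefficient: lists for different
  -- precisions differ in vanishing terms only, so each list has to be evaluated at a single
  -- coefficient.
  sum-from : ∀ {f : I → PowerSeries} {s} (l : ℕ → List I) → (∀ N → Unique (l N)) →
    (∀ N i → i ∈ l N ⊎ f i ≋[ N ] 0s) → (∀ n → Σℓ (l (suc n)) f n ≡ s n) → IsSum f s
  sum-from {f = f} {s} l u c t = record { list = l ; unique = u ; covers = c ; total = λ N →
      mk≋[] λ n n<N →
    trans (Σℓ-unique {N = suc n} (l N) (l (suc n)) (u N) (u (suc n)) (λ {i} _ → c (suc n) i)
      (λ {i} _ → weaken n<N (c N i)) .below n ℕ.≤-refl) (t n) }
    where
    weaken : ∀ {n N i} → suc n ≤ N → i ∈ l N ⊎ f i ≋[ N ] 0s → i ∈ l N ⊎ f i ≋[ suc n ] 0s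
    weaken n<N (inj₁ p) = inj₁ p
    weaken n<N (inj₂ p) = inj₂ (≋[]-weaken n<N p)

  sum-reindex : ∀ {f : I → PowerSeries} {s} (g : J → I) (h : I → J) →
    (∀ i → g (h i) ≡ i) → (∀ j → h (g j) ≡ j) → IsSum f s → IsSum (f ∘ g) s
  sum-reindex {f = f} {s} g h gh hg A = record
    { list = λ N → map h (A .list N)
    ; unique = λ N → Unique.map⁺ (λ {x} {y} e → trans (sym (gh x)) (trans (cong g e) (gh y))) (A .unique N)
    ; covers = λ N j → cov (A .covers N (g j))
    ; total = λ N → ≋⨟ (P.trans (≡⇒≋ (Σℓ-map h (f ∘ g) (A .list N)))
        (Σℓ-cong (A .list N) λ i → ≡⇒≋ (cong f (gh i)))) (A .total N) }
    where
    cov : ∀ {N j} → g j ∈ A .list N ⊎ f (g j) ≋[ N ] 0s → j ∈ map h (A .list N) ⊎ f (g j) ≋[ N ] 0s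
    cov {N} {j} (inj₁ p) = inj₁ (subst (_∈ map h (A .list N)) (hg j) (∈.∈-map⁺ h p))
    cov (inj₂ p) = inj₂ p

  sum-⊎ : ∀ {f : I → PowerSeries} {g : J → PowerSeries} {s t} → IsSum f s → IsSum g t →
      IsSum [ f , g ] (s ⊞ t)
  sum-⊎ {f = f} {g} {s} {t} A B = record
    { list = λ N → map inj₁ (A .list N) ++ map inj₂ (B .list N)
    ; unique = λ N → Unique.++⁺ (Unique.map⁺ (λ { refl → refl }) (A .unique N))
        (Unique.map⁺ (λ { refl → refl }) (B .unique N)) (disj N)
    ; covers = cov
    ; total = λ N → ≋⨟ (P.trans (Σℓ-++ [ f , g ] (map inj₁ (A .list N)) _)
        (P.+-cong (≡⇒≋ (Σℓ-map inj₁ [ f , g ] (A .list N)))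
            (≡⇒≋ (Σℓ-map inj₂ [ f , g ] (B .list N)))))
        (⊞-cong[] (A .total N) (B .total N)) }
    where
    disj : ∀ N {v} → ¬ (v ∈ map inj₁ (A .list N) × v ∈ map inj₂ (B .list N))
    disj N (p , r) with ∈.∈-map⁻ inj₁ p | ∈.∈-map⁻ inj₂ r
    ... | _ , _ , refl | _ , _ , ()
    cov : ∀ N i → i ∈ map inj₁ (A .list N) ++ map inj₂ (B .list N) ⊎ [ f , g ] i ≋[ N ] 0s
    cov N (inj₁ i) with A .covers N i
    ... | inj₁ p = inj₁ (∈.∈-++⁺ˡ (∈.∈-map⁺ inj₁ p))
    ... | inj₂ p = inj₂ p
    cov N (inj₂ j) with B .covers N j
    ... | inj₁ p = inj₁ (∈.∈-++⁺ʳ (map inj₁ (A .list N)) (∈.∈-map⁺ inj₂ p))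
    ... | inj₂ p = inj₂ p

  sum-× : ∀ {f : I → PowerSeries} {g : J → PowerSeries} {s t} → IsSum f s → IsSum g t →
    IsSum (λ (i , j) → f i ⋆ g j) (s ⋆ t)
  sum-× {f = f} {g} {s} {t} A B = record
    { list = λ N → cartesianProduct (A .list N) (B .list N)
    ; unique = λ N → Unique.cartesianProduct⁺ (A .unique N) (B .unique N)
    ; covers = cov
    ; total = λ N → ≋⨟ (Σℓ-× f g (A .list N) (B .list N)) (⋆-cong[] (A .total N) (B .total N)) }
    where
    cov : ∀ N ij → ij ∈ cartesianProduct (A .list N) (B .list N) ⊎ f (proj₁ ij) ⋆ g (proj₂ ij) ≋[ N
        ] 0s
    cov N (i , j) with A .covers N i | B .covers N j
    ... | inj₁ p | inj₁ r = inj₁ (∈.∈-cartesianProduct⁺ p r)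
    ... | inj₂ p | _      = inj₂ (⨟≋ (⋆-cong[] p (≋[]-refl {g j})) (P.zeroˡ _))
    ... | inj₁ _ | inj₂ r = inj₂ (⨟≋ (⋆-cong[] (≋[]-refl {f i}) r) (P.zeroʳ _))

  sum-⋆ : ∀ {f : I → PowerSeries} {s} c → IsSum f s → IsSum (λ i → c ⋆ f i) (c ⋆ s)
  sum-⋆ {f = f} c A = record
    { list = A .list ; unique = A .unique ; covers = λ N i → cov (A .covers N i)
    ; total = λ N → ≋⨟ (Σℓ-⋆ c f (A .list N)) (⋆-cong[] ≋[]-refl (A .total N)) }
    where
    cov : ∀ {N i} → i ∈ A .list N ⊎ f i ≋[ N ] 0s → i ∈ A .list N ⊎ c ⋆ f i ≋[ N ] 0s
    cov (inj₁ p) = inj₁ p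
    cov (inj₂ p) = inj₂ (⨟≋ (⋆-cong[] (≋[]-refl {c}) p) (P.zeroʳ c))

  -- The two families come with unrelated lists. Their union must not repeat an index, hence
  -- `deduplicate` and the decidable equality.
  sum-⊞ : DecidableEquality I → ∀ {f g : I → PowerSeries} {s t} → IsSum f s → IsSum g t →
    IsSum (λ i → f i ⊞ g i) (s ⊞ t)
  sum-⊞ {I} _≟_ {f} {g} A B = record
    { list = l ; unique = λ N → DecUnique.deduplicate-! _≟_ (A .list N ++ B .list N) ; covers = cov
    ; total = λ N → ≋⨟ (Σℓ-⊞ f g (l N)) (⊞-cong[]
        (≋[]-trans (Σℓ-unique (l N) (A .list N) (DecUnique.deduplicate-! _≟_ _) (A .unique N)
          (λ {i} _ → A .covers N i) (λ p → inj₁ (∈.∈-deduplicate⁺ _≟_ (∈.∈-++⁺ˡ p)))) (A .total N))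
        (≋[]-trans (Σℓ-unique (l N) (B .list N) (DecUnique.deduplicate-! _≟_ _) (B .unique N)
          (λ {i} _ → B .covers N i) (λ p → inj₁ (∈.∈-deduplicate⁺ _≟_ (∈.∈-++⁺ʳ (A .list N) p)))) (B .total N))) }
    where
    l : ℕ → List I
    l N = deduplicate _≟_ (A .list N ++ B .list N)
    cov : ∀ N i → i ∈ l N ⊎ f i ⊞ g i ≋[ N ] 0s
    cov N i with A .covers N i | B .covers N i
    ... | inj₁ p | _      = inj₁ (∈.∈-deduplicate⁺ _≟_ (∈.∈-++⁺ˡ p))
    ... | inj₂ _ | inj₁ p = inj₁ (∈.∈-deduplicate⁺ _≟_ (∈.∈-++⁺ʳ (A .list N) p))
    ... | inj₂ p | inj₂ r = inj₂ (⨟≋ (⊞-cong[] p r) (P.+-identityˡ 0s))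

  sum-singleton : ∀ {f : I → PowerSeries} i → (∀ j → j ≡ i ⊎ f j ≋ 0s) → IsSum f (f i)
  sum-singleton {f = f} i p = record
    { list = λ _ → i ∷ [] ; unique = λ _ → [] ∷ [] ; covers = λ N j → cov (p j)
    ; total = λ N → ≋⇒≋[] (P.+-identityʳ _) }
    where
    cov : ∀ {N j} → j ≡ i ⊎ f j ≋ 0s → j ∈ i ∷ [] ⊎ f j ≋[ N ] 0s
    cov (inj₁ r) = inj₁ (here r)
    cov (inj₂ r) = inj₂ (≋⇒≋[] r)

open Summation

-- Infinite products as limits of q-Pochhammer symbols.

module InfiniteProducts where
  prod : ℕ → (ℕ → PowerSeries) → PowerSeries
  prod zero    g = 1s
  prod (suc n) g = prod n g ⋆ g n

  prod-cong : ∀ n {g h} → (∀ i → g i ≋ h i) → prod n g ≋ prod n h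
  prod-cong zero    p = P.refl
  prod-cong (suc n) p = P.*-cong (prod-cong n p) (p n)

  prod-cong[] : ∀ n {g h N} → (∀ i → g i ≋[ N ] h i) → prod n g ≋[ N ] prod n h
  prod-cong[] zero    p = ≋[]-refl
  prod-cong[] (suc n) p = ⋆-cong[] (prod-cong[] n p) (p n)

  prod-+ : ∀ j k g → prod (j + k) g ≋ prod j g ⋆ prod k (λ i → g (j + i))
  prod-+ j zero    g = P.trans (≡⇒≋ (cong (λ n → prod n g) (ℕ.+-identityʳ j)))
      (P.sym (P.*-identityʳ _))
  prod-+ j (suc k) g = P.trans (≡⇒≋ (cong (λ n → prod n g) (ℕ.+-suc j k)))
    (P.trans (P.*-congʳ (prod-+ j k g)) (P.*-assoc _ _ _))

  prod-⋆ : ∀ n g h → prod n g ⋆ prod n h ≋ prod n (λ i → g i ⋆ h i)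
  prod-⋆ zero    g h = P.*-identityˡ 1s
  prod-⋆ (suc n) g h = P.trans (*P.interchange _ _ _ _) (P.*-congʳ (prod-⋆ n g h))

  prod-1 : ∀ n → prod n (λ _ → 1s) ≋ 1s
  prod-1 zero    = P.refl
  prod-1 (suc n) = P.trans (P.*-identityʳ _) (prod-1 n)

  prod-* : ∀ L m g → prod (L * m) g ≋ prod m (λ i → prod L (λ l → g (l * m + i)))
  prod-* zero    m g = P.sym (prod-1 m)
  prod-* (suc L) m g = P.trans (≡⇒≋ (cong (λ n → prod n g) (ℕ.+-comm m (L * m))))
    (P.trans (prod-+ (L * m) m g) (P.trans (P.*-congʳ (prod-* L m g)) (prod-⋆ m _ _)))

  homo-prod : ∀ {h s} (H : Substitution h s) n g → h (prod n g) ≋ prod n (h ∘ g)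
  homo-prod H zero    g = Substitution.const-homo H 1ℤ
  homo-prod H (suc n) g = P.trans (Substitution.*-homo H _ _) (P.*-congʳ (homo-prod H n g))

  factor : ℤ → ℕ → PowerSeries
  factor ε e = 1s ⊞ const ε ⋆ X ^ e

  factor≋[]1 : ∀ ε {e N} → N ≤ e → factor ε e ≋[ N ] 1s
  factor≋[]1 ε {e} N≤e = ⨟≋ (⊞-cong[] ≋[]-refl
      (⨟≋ (⋆-cong[] (≋[]-refl {const ε}) (≋[]-weaken N≤e (X^≋[]0 e))) (P.zeroʳ _)))
    (P.+-identityʳ 1s)

  -- The q-Pochhammer symbol (−ε q^a ; q^N)_L and its limit L → ∞.
  poch : ℤ → ℕ → ℕ → ℕ → PowerSeries
  poch ε a N L = prod L (λ k → factor ε (a + N * k))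

  opaque
    poch∞ : ℤ → ℕ → ℕ → PowerSeries
    poch∞ ε a N n = poch ε a N (suc n) n

  module _ (ε : ℤ) (a N : ℕ) .{{_ : NonZero N}} where
    private
      stable : ∀ K d → poch ε a N K ≋[ K ] poch ε a N (K + d)
      stable K zero    = ≋⇒≋[] (≡⇒≋ (cong (poch ε a N) (sym (ℕ.+-identityʳ K))))
      stable K (suc d) = ⨟≋ (≋[]-trans (stable K d)
        (≋⨟ (P.sym (P.*-identityʳ _)) (⋆-cong[] ≋[]-refl (≋[]-sym (factor≋[]1 ε
          (ℕ.≤-trans (ℕ.m≤m+n K d) (ℕ.≤-trans (ℕ.m≤n*m (K + d) N) (ℕ.m≤n+m _ a))))))))
        (≡⇒≋ (cong (poch ε a N) (sym (ℕ.+-suc K d))))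

    opaque
      unfolding poch∞

      poch∞≋[] : ∀ {K L} → K ≤ L → poch∞ ε a N ≋[ K ] poch ε a N L
      poch∞≋[] {K} {L} K≤L .below n n<K =
        trans (stable (suc n) (L ∸ suc n) .below n ℕ.≤-refl)
              (cong (λ l → poch ε a N l n) (ℕ.m+[n∸m]≡n (ℕ.≤-trans n<K K≤L)))

    poch∞-≋ : ∀ {f} → (∀ L → f ≋[ L ] poch ε a N L) → f ≋ poch∞ ε a N
    poch∞-≋ p = ≋[]⇒≋ λ L → ≋[]-trans (p L) (≋[]-sym (poch∞≋[] ℕ.≤-refl))

  -- Factors are sorted by the residue i of their index modulo m. The first L m factors sort exactly
  -- (`prod-*`), which settles every precision L.
  poch∞-split : ∀ ε a N m .{{_ : NonZero N}} .{{_ : NonZero m}} .{{_ : NonZero (m * N)}} →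
    poch∞ ε a N ≋ prod m (λ i → poch∞ ε (a + N * i) (m * N))
  poch∞-split ε a N m = ≋[]⇒≋ λ L → ≋[]-trans (poch∞≋[] ε a N (ℕ.m≤m*n L m)) (≋⨟ (prod-* L m _)
    (≋[]-sym (prod-cong[] m λ i → ⨟≋ (poch∞≋[] ε (a + N * i) (m * N) ℕ.≤-refl)
      (prod-cong L λ l → ≡⇒≋ (cong (factor ε) (eq i l))))))
    where
    eq : ∀ i l → a + N * i + m * N * l ≡ a + N * (l * m + i)
    eq i l = lem a N m i l
      where lem : ∀ a N m i l → a + N * i + m * N * l ≡ a + N * (l * m + i)
            lem = ℕTactic.solve-∀

  poch∞-head : ∀ ε a N .{{_ : NonZero N}} → poch∞ ε a N ≋ factor ε a ⋆ poch∞ ε (a + N) N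
  poch∞-head ε a N = ≋[]⇒≋ λ L → ≋[]-trans (poch∞≋[] ε a N (ℕ.n≤1+n L)) (≋⨟ (prod-+ 1 L _)
    (⋆-cong[] (≋⇒≋[] (P.trans (P.*-identityˡ _)
        (≡⇒≋ (cong (factor ε) (trans (cong (λ x → a + x) (ℕ.*-zeroʳ N)) (ℕ.+-identityʳ a))))))
      (≋⨟ (prod-cong L λ l → ≡⇒≋ (cong (factor ε) (trans (cong (λ x → a + x) (ℕ.*-suc N l))
          (sym (ℕ.+-assoc a N (N * l))))))
        (≋[]-sym (poch∞≋[] ε (a + N) N ℕ.≤-refl)))))

  poch∞-conj : ∀ a N .{{_ : NonZero N}} .{{_ : NonZero (2 * N)}} →
    poch∞ 1ℤ a N ⋆ poch∞ -1ℤ a N ≋ poch∞ -1ℤ (2 * a) (2 * N)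
  poch∞-conj a N = poch∞-≋ -1ℤ (2 * a) (2 * N) λ L →
    ≋[]-trans (⋆-cong[] (poch∞≋[] 1ℤ a N ℕ.≤-refl) (poch∞≋[] -1ℤ a N ℕ.≤-refl))
      (≋⇒≋[] (P.trans (prod-⋆ L _ _) (prod-cong L λ l → lem l)))
    where
    lem : ∀ l → factor 1ℤ (a + N * l) ⋆ factor -1ℤ (a + N * l) ≋ factor -1ℤ (2 * a + 2 * N * l)
    lem l = P.trans (solve 1 (λ x → (con 1ℤ :+ con 1ℤ :* x) :* (con 1ℤ :+ con -1ℤ :* x) := con 1ℤ
        :+ con -1ℤ :* x :^ 2) P.refl (X ^ (a + N * l)))
      (P.+-congˡ (P.*-congˡ (P.trans (^-assocʳ X (a + N * l) 2) (≡⇒≋ (cong (X ^_) (eq l))))))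
      where
      eq : ∀ l → (a + N * l) * 2 ≡ 2 * a + 2 * N * l
      eq l = lem′ a N l
        where lem′ : ∀ a N l → (a + N * l) * 2 ≡ 2 * a + 2 * N * l
              lem′ = ℕTactic.solve-∀

  homo-factor : ∀ {h s} (H : Substitution h s) ε e → h (factor ε e) ≋ 1s ⊞ const ε ⋆ s ^ e
  homo-factor H ε e = P.trans (H.+-homo _ _) (P.+-cong (H.const-homo 1ℤ)
    (P.trans (H.const-⋆-homo ε _) (P.*-congˡ (P.trans (homo-^ H X e) (^-congˡ e (homo-X H))))))
    where module H = Substitution H

  dilate-poch∞ : ∀ m ε a N .{{_ : NonZero m}} .{{_ : NonZero N}} .{{_ : NonZero (m * N)}} →
    dilate m (poch∞ ε a N) ≋ poch∞ ε (m * a) (m * N)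
  dilate-poch∞ m ε a N = poch∞-≋ ε (m * a) (m * N) λ L →
      ≋[]-trans (D.local m L (poch∞≋[] ε a N ℕ.≤-refl))
    (≋⇒≋[] (P.trans (homo-prod (dilation m) L _) (prod-cong L λ l →
        P.trans (homo-factor (dilation m) ε (a + N * l))
      (P.+-congˡ (P.*-congˡ (P.trans (^-assocʳ X m (a + N * l)) (≡⇒≋ (cong (X ^_) (eq l)))))))))
    where
    eq : ∀ l → m * (a + N * l) ≡ m * a + m * N * l
    eq l = trans (ℕ.*-distribˡ-+ m a (N * l)) (cong (λ x → m * a + x) (sym (ℕ.*-assoc m N l)))

  σ-poch∞ : ∀ c ε a N .{{_ : NonZero N}} → (∀ l → -1^ (a + N * l) ≡ c) → σ (poch∞ ε a N)
      ≋ poch∞ (c ℤ.* ε) a N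
  σ-poch∞ c ε a N par = poch∞-≋ (c ℤ.* ε) a N λ L → ≋[]-trans (σH.local L (poch∞≋[] ε a N ℕ.≤-refl))
    (≋⇒≋[] (P.trans (homo-prod σ-substitution L _) (prod-cong L λ l →
        P.trans (homo-factor σ-substitution ε (a + N * l))
      (P.+-congˡ (P.trans (P.*-congˡ (neg-^ (a + N * l)))
          (P.trans (P.sym (P.*-assoc _ _ _)) (P.*-congʳ
        (P.trans (P.sym (const-* ε (-1^ (a + N * l))))
            (const-cong (trans (cong (ε ℤ.*_) (par l)) (ℤ.*-comm ε c)))))))))))
    where
    neg-^ : ∀ e → (⊟ X) ^ e ≋ const (-1^ e) ⋆ X ^ e
    neg-^ zero    = P.sym (P.*-identityˡ 1s)
    neg-^ (suc e) = P.trans (P.*-congˡ (neg-^ e)) (P.trans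
      (solve 3 (λ x c y → (:- x) :* (c :* y) := (:- c) :* (x :* y)) P.refl X (const (-1^ e))
          (X ^ e))
      (P.*-congʳ (P.sym (const-neg (-1^ e)))))

  Unit-poch : ∀ ε a N L → a ≢ 0 → Unit (poch ε a N L)
  Unit-poch ε a N zero    a≢0 = refl
  Unit-poch ε a N (suc L) a≢0 = Unit-⋆ {poch ε a N L} (Unit-poch ε a N L a≢0)
    (factor≋[]1 ε {N = 1} (ℕ.≤-trans (ℕ.n≢0⇒n>0 a≢0) (ℕ.m≤m+n a _)) .below 0 (s≤s z≤n))

  Unit-poch∞ : ∀ ε a N .{{_ : NonZero N}} → a ≢ 0 → Unit (poch∞ ε a N)
  Unit-poch∞ ε a N a≢0 = trans (poch∞≋[] ε a N {1} {1} ℕ.≤-refl .below 0 (s≤s z≤n))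
      (Unit-poch ε a N 1 a≢0)

open InfiniteProducts

-- The Jacobi triple product.

module TripleProduct where
  -- The number m (m - 1) / 2, that is 0 + 1 + ... + (m - 1); k (k + 1) / 2 is therefore
  -- `tri (suc k)`.
  tri : ℕ → ℕ
  tri zero    = 0
  tri (suc m) = tri m + m

  tri-double : ∀ m → + 2 ℤ.* + tri m ≡ + m ℤ.* + m ℤ.- + m
  tri-double zero    = refl
  tri-double (suc m) = trans (cong (λ x → + 2 ℤ.* x) (ℤ.pos-+ (tri m) m))
      (trans (ℤ.*-distribˡ-+ (+ 2) (+ tri m) (+ m))
    (trans (cong (ℤ._+ + 2 ℤ.* + m) (tri-double m)) (lem (+ m))))
    where
    lem : ∀ m → m ℤ.* m ℤ.- m ℤ.+ + 2 ℤ.* m ≡ (+ 1 ℤ.+ m) ℤ.* (+ 1 ℤ.+ m) ℤ.- (+ 1 ℤ.+ m)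
    lem = ℤTactic.solve-∀

  tri≥ : ∀ m → m ≤ suc (tri m)
  tri≥ zero          = z≤n
  tri≥ (suc zero)    = s≤s z≤n
  tri≥ (suc (suc m)) = s≤s (ℕ.≤-trans (tri≥ (suc m)) (ℕ.≤-trans (ℕ.≤-reflexive (ℕ.+-comm 1 _))
      (ℕ.+-monoʳ-≤ (tri (suc m)) (s≤s z≤n))))

  -- Exponents are always compared after doubling: then they are polynomials over ℤ, and the case
  -- distinction on the sign of j in `expo` disappears.
  halve : ∀ {m n} → + 2 ℤ.* + m ≡ + 2 ℤ.* + n → m ≡ n
  halve {m} {n} p = ℤ.+-injective (ℤ.*-cancelˡ-≡ (+ 2) (+ m) (+ n) p)

  double-+ : ∀ m n {u v} → + 2 ℤ.* + m ≡ u → + 2 ℤ.* + n ≡ v → + 2 ℤ.* + (m + n) ≡ u ℤ.+ v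
  double-+ m n p q = trans (cong (λ x → + 2 ℤ.* x) (ℤ.pos-+ m n))
    (trans (ℤ.*-distribˡ-+ (+ 2) (+ m) (+ n)) (cong₂ ℤ._+_ p q))

  -- The exponent (a + b) j (j − 1) / 2 + a j of the theta series with parameters a and b.
  expo : ℕ → ℕ → ℤ → ℕ
  expo a b (+ m)    = (a + b) * tri m + a * m
  expo a b -[1+ k ] = (a + b) * tri (suc k) + b * suc k

  expo-double : ∀ a b j → + 2 ℤ.* + expo a b j ≡ (+ a ℤ.+ + b) ℤ.* (j ℤ.* j) ℤ.+ (+ a ℤ.- + b) ℤ.* j
  expo-double a b j = go j
    where
    cast : ∀ c m → + ((a + b) * tri m + c * m) ≡ (+ a ℤ.+ + b) ℤ.* + tri m ℤ.+ + c ℤ.* + m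
    cast c m = trans (ℤ.pos-+ ((a + b) * tri m) (c * m)) (cong₂ ℤ._+_
      (trans (ℤ.pos-* (a + b) (tri m)) (cong (ℤ._* + tri m) (ℤ.pos-+ a b))) (ℤ.pos-* c m))
    lem₀ : ∀ a b c t m → + 2 ℤ.* ((a ℤ.+ b) ℤ.* t ℤ.+ c ℤ.* m) ≡ (a ℤ.+ b) ℤ.* (+ 2 ℤ.* t)
        ℤ.+ + 2 ℤ.* c ℤ.* m
    lem₀ = ℤTactic.solve-∀
    lem₁ : ∀ a b m → (a ℤ.+ b) ℤ.* (m ℤ.* m ℤ.- m) ℤ.+ + 2 ℤ.* a ℤ.* m ≡ (a ℤ.+ b) ℤ.* (m ℤ.* m)
        ℤ.+ (a ℤ.- b) ℤ.* m
    lem₁ = ℤTactic.solve-∀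
    lem₂ : ∀ a b m → (a ℤ.+ b) ℤ.* (m ℤ.* m ℤ.- m) ℤ.+ + 2 ℤ.* b ℤ.* m
      ≡ (a ℤ.+ b) ℤ.* (ℤ.- m ℤ.* ℤ.- m) ℤ.+ (a ℤ.- b) ℤ.* ℤ.- m
    lem₂ = ℤTactic.solve-∀
    main : ∀ c m → + 2 ℤ.* + ((a + b) * tri m + c * m) ≡ (+ a ℤ.+ + b) ℤ.* (+ m ℤ.* + m ℤ.- + m)
        ℤ.+ + 2 ℤ.* + c ℤ.* + m
    main c m = trans (cong (λ x → + 2 ℤ.* x) (cast c m))
        (trans (lem₀ (+ a) (+ b) (+ c) (+ tri m) (+ m))
      (cong (λ x → (+ a ℤ.+ + b) ℤ.* x ℤ.+ + 2 ℤ.* + c ℤ.* + m) (tri-double m)))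
    go : ∀ j → + 2 ℤ.* + expo a b j ≡ (+ a ℤ.+ + b) ℤ.* (j ℤ.* j) ℤ.+ (+ a ℤ.- + b) ℤ.* j
    go (+ m)    = trans (main a m) (lem₁ (+ a) (+ b) (+ m))
    go -[1+ k ] = trans (main b (suc k)) (lem₂ (+ a) (+ b) (+ suc k))

  -- Growth of the exponents makes theta series summable. The slack of one is for parameters such as
  -- a = 1, b = 0, where j = -1 has exponent 0.
  expo≥ : ∀ a b .{{_ : NonZero (a + b)}} j → ℤ.∣ j ∣ ≤ suc (expo a b j)
  expo≥ a b (+ m)    = ℕ.≤-trans (tri≥ m) (s≤s (ℕ.≤-trans (ℕ.m≤n*m (tri m) (a + b)) (ℕ.m≤m+n _ _)))
  expo≥ a b -[1+ k ] = ℕ.≤-trans (tri≥ (suc k))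
      (s≤s (ℕ.≤-trans (ℕ.m≤n*m (tri (suc k)) (a + b)) (ℕ.m≤m+n _ _)))

  -- Only used for ε² = 1, when ε^∣j∣ is ε^j also for negative j.
  pow : ℤ → ℤ → ℤ
  pow ε j = ε ℤ.^ ℤ.∣ j ∣

  pow-pred : ∀ ε → ε ℤ.* ε ≡ 1ℤ → ∀ j → ε ℤ.* pow ε (ℤ.pred j) ≡ pow ε j
  pow-pred ε ε² (+ zero)  = trans (cong (ε ℤ.*_) (ℤ.*-identityʳ ε)) ε²
  pow-pred ε ε² (+ suc m) = refl
  pow-pred ε ε² -[1+ k ]  = trans (sym (ℤ.*-assoc ε ε (ε ℤ.^ suc k)))
      (trans (cong (λ x → x ℤ.* ε ℤ.^ suc k) ε²) (ℤ.*-identityˡ _))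

  theta : ℤ → ℕ → ℕ → ℤ → PowerSeries
  theta ε a b j = const (pow ε j) ⋆ X ^ expo a b j

  private
    neg-expo : ∀ a b j → expo a b (ℤ.- j) ≡ expo b a j
    neg-expo a b j = halve (trans (expo-double a b (ℤ.- j))
        (trans (lem (+ a) (+ b) j) (sym (expo-double b a j))))
      where
      lem : ∀ a b j → (a ℤ.+ b) ℤ.* (ℤ.- j ℤ.* ℤ.- j) ℤ.+ (a ℤ.- b) ℤ.* ℤ.- j
          ≡ (b ℤ.+ a) ℤ.* (j ℤ.* j) ℤ.+ (b ℤ.- a) ℤ.* j
      lem = ℤTactic.solve-∀

  theta-neg : ∀ ε a b j → theta ε a b (ℤ.- j) ≋ theta ε b a j
  theta-neg ε a b j = P.*-cong (≡⇒≋ (cong (λ n → const (ε ℤ.^ n)) (ℤ.∣-i∣≡∣i∣ j)))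
      (≡⇒≋ (cong (X ^_) (neg-expo a b j)))

  theta≋[]0 : ∀ ε a b .{{_ : NonZero (a + b)}} {N} j → N < ℤ.∣ j ∣ → theta ε a b j ≋[ N ] 0s
  theta≋[]0 ε a b {N} j N<j = ⨟≋ (⋆-cong[] (≋[]-refl {const (pow ε j)})
    (≋[]-weaken (s≤s⁻¹ (ℕ.≤-trans N<j (expo≥ a b j))) (X^≋[]0 (expo a b j)))) (P.zeroʳ _)

  module JacobiTripleProduct (ε : ℤ) (ε² : ε ℤ.* ε ≡ 1ℤ) (N : ℕ) .{{_ : NonZero N}} where
    euler : ℕ → PowerSeries
    euler = poch -1ℤ N N

    euler∞ : PowerSeries
    euler∞ = poch∞ -1ℤ N N

    private
      N≢0 : N ≢ 0
      N≢0 = ≢-nonZero⁻¹ N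

    -- 1 / (q^N ; q^N)_n, with the usual convention 0 for negative n. It makes the q-binomial
    -- coefficients vanish outside -M ≤ j ≤ L, so that j may run over all of ℤ.
    recip : ℤ → PowerSeries
    recip (+ n)    = inv (euler n)
    recip -[1+ _ ] = 0s

    -- The q-binomial coefficient [M + L , M + j] in base q^N.
    binom : ℕ → ℕ → ℤ → PowerSeries
    binom M L j = euler (M + L) ⋆ (recip (+ M ℤ.+ j) ⋆ recip (+ L ℤ.- j))

    private
      recip-suc : ∀ n → recip (+ n) ≋ factor -1ℤ (N + N * n) ⋆ recip (+ suc n)
      recip-suc n = ⋆-cancel {euler n} (Unit-poch -1ℤ N N n N≢0)
          (P.trans (P.trans (P.*-comm _ _) (inv-⋆ (Unit-poch -1ℤ N N n N≢0)))
        (P.trans (P.sym (inv-⋆ (Unit-poch -1ℤ N N (suc n) N≢0)))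
          (solve 3 (λ i e f → i :* (e :* f) := e :* (f :* i)) P.refl (inv (euler (suc n))) (euler n)
              (factor -1ℤ (N + N * n)))))

      -- At n = 0 both sides vanish, since the factor is 1 - q⁰. Thus the ends of the range of j
      -- need no separate treatment in the q-Pascal rule.
      recip-pred : ∀ n → recip (ℤ.pred (+ n)) ≋ factor -1ℤ (N * n) ⋆ recip (+ n)
      recip-pred zero = P.sym (P.trans (P.*-congʳ
          (P.trans (P.+-congˡ (P.*-congˡ (≡⇒≋ (cong (X ^_) (ℕ.*-zeroʳ N)))))
        (P.trans (solve 0 (con 1ℤ :+ con -1ℤ :* con 1ℤ := con 0ℤ) P.refl) (mk≋ λ { zero → refl ; (suc _) → refl })))) (P.zeroˡ _))
      recip-pred (suc n) = P.trans (recip-suc n)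
          (P.*-congʳ (≡⇒≋ (cong (factor -1ℤ) (sym (ℕ.*-suc N n)))))

      step : ∀ a b → N ≡ a + b → ∀ M L j →
        theta ε a b j ⋆ binom M L j ⊞ const ε ⋆ X ^ (a + N * L) ⋆ (theta ε a b (ℤ.pred j) ⋆ binom M
            L (ℤ.pred j))
          ≋ theta ε a b j ⋆ binom M (suc L) j
      step a b N≡ M L j = go (+ M ℤ.+ j) (+ suc L ℤ.- j) refl refl
        where
        lem₁ : ∀ M j → M ℤ.+ (-1ℤ ℤ.+ j) ≡ -1ℤ ℤ.+ (M ℤ.+ j)
        lem₁ = ℤTactic.solve-∀
        lem₂ : ∀ L j → L ℤ.- (-1ℤ ℤ.+ j) ≡ + 1 ℤ.+ L ℤ.- j
        lem₂ = ℤTactic.solve-∀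
        lem₃ : ∀ L j → L ℤ.- j ≡ -1ℤ ℤ.+ (+ 1 ℤ.+ L ℤ.- j)
        lem₃ = ℤTactic.solve-∀

        T T′ E : PowerSeries
        T = theta ε a b j
        T′ = theta ε a b (ℤ.pred j)
        E = euler (M + L)

        goal : ℤ → ℤ → Set
        goal A B = T ⋆ (E ⋆ (recip A ⋆ recip (ℤ.pred B)))
          ⊞ const ε ⋆ X ^ (a + N * L) ⋆ (T′ ⋆ (E ⋆ (recip (ℤ.pred A) ⋆ recip B)))
          ≋ T ⋆ (euler (M + suc L) ⋆ (recip A ⋆ recip B))

        zeros : ∀ {x y z} → x ≋ 0s → y ≋ 0s → z ≋ 0s →
          T ⋆ (E ⋆ x) ⊞ const ε ⋆ X ^ (a + N * L) ⋆ (T′ ⋆ (E ⋆ y)) ≋ T ⋆ (euler (M + suc L) ⋆ z)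
        zeros p q r = P.trans (P.+-cong (P.*-congˡ (P.trans (P.*-congˡ p) (P.zeroʳ E)))
            (P.*-congˡ (P.trans (P.*-congˡ (P.trans (P.*-congˡ q) (P.zeroʳ E))) (P.zeroʳ T′))))
          (P.trans (P.+-cong (P.zeroʳ T) (P.zeroʳ _)) (P.trans (P.+-identityʳ 0s)
            (P.sym (P.trans (P.*-congˡ (P.trans (P.*-congˡ r) (P.zeroʳ _))) (P.zeroʳ T)))))

        main : ∀ A B → + M ℤ.+ j ≡ A → + suc L ℤ.- j ≡ B → goal A B
        main -[1+ k ] B p q = zeros (P.zeroˡ _) (P.zeroˡ _) (P.zeroˡ _)
        main (+ α) -[1+ k ] p q = zeros (P.zeroʳ _) (P.zeroʳ _) (P.zeroʳ _)
        main (+ α) (+ β) p q = P.trans (P.+-cong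
            (P.*-congˡ (P.*-congˡ (P.*-congˡ {recip (+ α)} (recip-pred β))))
            (P.trans (P.sym (P.*-assoc _ _ _))
                (P.*-cong shift (P.*-congˡ {E} (P.*-congʳ {recip (+ β)} (recip-pred α))))))
          (P.trans (solve 6 (λ t e i k u v → t :* (e :* (i :* ((con 1ℤ :+ con -1ℤ :* v) :* k)))
              :+ t :* v :* (e :* (((con 1ℤ :+ con -1ℤ :* u) :* i) :* k))
              := t :* (e :* (con 1ℤ :+ con -1ℤ :* (u :* v)) :* (i :* k))) P.refl
              T E (recip (+ α)) (recip (+ β)) (X ^ (N * α)) (X ^ (N * β)))
          (P.*-congˡ (P.*-congʳ (P.trans (P.*-congˡ (P.+-congˡ (P.*-congˡ
              (P.trans (P.sym (^-homo-* X (N * α) (N * β))) (≡⇒≋ (cong (X ^_) expo≡))))))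
            (≡⇒≋ (cong euler (sym (ℕ.+-suc M L))))))))
          where
          α+β : α + β ≡ suc (M + L)
          α+β = ℤ.+-injective (trans (ℤ.pos-+ α β)
              (trans (sym (cong₂ ℤ._+_ p q)) (lem (+ M) (+ L) j)))
            where lem : ∀ M L j → (M ℤ.+ j) ℤ.+ (+ 1 ℤ.+ L ℤ.- j) ≡ + 1 ℤ.+ (M ℤ.+ L)
                  lem = ℤTactic.solve-∀
          expo≡ : N * α + N * β ≡ N + N * (M + L)
          expo≡ = trans (sym (ℕ.*-distribˡ-+ N α β))
              (trans (cong (λ x → N * x) α+β) (ℕ.*-suc N (M + L)))

          exps : a + N * L + expo a b (ℤ.pred j) ≡ expo a b j + N * β
          exps = halve (trans cast₁ (trans
              (lem (+ a) (+ b) (+ N) (+ L) j (trans (cong +_ N≡) (ℤ.pos-+ a b)))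
              (trans (cong (λ x → (+ a ℤ.+ + b) ℤ.* (j ℤ.* j) ℤ.+ (+ a ℤ.- + b) ℤ.* j
                  ℤ.+ + 2 ℤ.* (+ N ℤ.* x)) q) (sym cast₂))))
            where
            lem′ : ∀ a b L j → + 2 ℤ.* (a ℤ.+ (a ℤ.+ b) ℤ.* L)
                ℤ.+ ((a ℤ.+ b) ℤ.* ((-1ℤ ℤ.+ j) ℤ.* (-1ℤ ℤ.+ j)) ℤ.+ (a ℤ.- b) ℤ.* (-1ℤ ℤ.+ j))
              ≡ (a ℤ.+ b) ℤ.* (j ℤ.* j) ℤ.+ (a ℤ.- b) ℤ.* j
                  ℤ.+ + 2 ℤ.* ((a ℤ.+ b) ℤ.* (+ 1 ℤ.+ L ℤ.- j))
            lem′ = ℤTactic.solve-∀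
            lem : ∀ a b n L j → n ≡ a ℤ.+ b → + 2 ℤ.* (a ℤ.+ n ℤ.* L)
                ℤ.+ ((a ℤ.+ b) ℤ.* ((-1ℤ ℤ.+ j) ℤ.* (-1ℤ ℤ.+ j)) ℤ.+ (a ℤ.- b) ℤ.* (-1ℤ ℤ.+ j))
              ≡ (a ℤ.+ b) ℤ.* (j ℤ.* j) ℤ.+ (a ℤ.- b) ℤ.* j ℤ.+ + 2 ℤ.* (n ℤ.* (+ 1 ℤ.+ L ℤ.- j))
            lem a b _ L j refl = lem′ a b L j
            cast₁ : + 2 ℤ.* + (a + N * L + expo a b (ℤ.pred j)) ≡ + 2 ℤ.* (+ a ℤ.+ + N ℤ.* + L)
              ℤ.+ ((+ a ℤ.+ + b) ℤ.* (ℤ.pred j ℤ.* ℤ.pred j) ℤ.+ (+ a ℤ.- + b) ℤ.* ℤ.pred j)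
            cast₁ = double-+ (a + N * L) _ (cong (λ x → + 2 ℤ.* x)
              (trans (ℤ.pos-+ a (N * L)) (cong (λ x → + a ℤ.+ x) (ℤ.pos-* N L))))
                  (expo-double a b (ℤ.pred j))
            cast₂ : + 2 ℤ.* + (expo a b j + N * β) ≡ (+ a ℤ.+ + b) ℤ.* (j ℤ.* j)
                ℤ.+ (+ a ℤ.- + b) ℤ.* j ℤ.+ + 2 ℤ.* (+ N ℤ.* + β)
            cast₂ = double-+ (expo a b j) _ (expo-double a b j)
                (cong (λ x → + 2 ℤ.* x) (ℤ.pos-* N β))

          shift : const ε ⋆ X ^ (a + N * L) ⋆ T′ ≋ T ⋆ X ^ (N * β)
          shift = P.trans (solve 4 (λ c x d y → c :* x :* (d :* y) := (c :* d) :* (x :* y)) P.refl _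
              _ _ _)
            (P.trans (P.*-cong (P.trans (P.sym (const-* ε _)) (const-cong (pow-pred ε ε² j)))
              (P.trans (P.sym (^-homo-* X (a + N * L) (expo a b (ℤ.pred j))))
                  (P.trans (≡⇒≋ (cong (X ^_) exps)) (^-homo-* X (expo a b j) (N * β)))))
              (P.sym (P.*-assoc _ _ _)))

        go : ∀ A B → + M ℤ.+ j ≡ A → + suc L ℤ.- j ≡ B →
          T ⋆ binom M L j ⊞ const ε ⋆ X ^ (a + N * L) ⋆ (T′ ⋆ binom M L (ℤ.pred j))
              ≋ T ⋆ binom M (suc L) j
        go A B p q rewrite lem₁ (+ M) j | lem₂ (+ L) j | lem₃ (+ L) j | p | q = main A B p q

      grow : ∀ a b → N ≡ a + b → ∀ M L {s} → IsSum (λ j → theta ε a b j ⋆ binom M L j) s →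
        IsSum (λ j → theta ε a b j ⋆ binom M (suc L) j) (s ⋆ factor ε (a + N * L))
      grow a b N≡ M L {s} A = sum-cong (step a b N≡ M L)
        (solve 2 (λ s x → s :+ x :* s := s :* (con 1ℤ :+ x)) P.refl s (const ε ⋆ X ^ (a + N * L)))
        (sum-⊞ ℤ._≟_ A (sum-reindex ℤ.pred ℤ.suc ℤ.pred-suc ℤ.suc-pred
            (sum-⋆ (const ε ⋆ X ^ (a + N * L)) A)))

      -- The reflection j ↦ -j exchanges a with b and M with L, so growth in L also produces the
      -- factors of the other product.
      mirror : ∀ a b M L {s} → IsSum (λ j → theta ε a b j ⋆ binom M L j) s →
          IsSum (λ j → theta ε b a j ⋆ binom L M j) s
      mirror a b M L A = sum-cong
        (λ j → P.*-cong (theta-neg ε a b j) (P.*-cong (≡⇒≋ (cong euler (ℕ.+-comm M L)))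
          (P.trans (P.*-comm _ _) (P.*-congʳ
              (≡⇒≋ (cong (λ i → recip (+ L ℤ.+ i)) (ℤ.neg-involutive j)))))))
        P.refl (sum-reindex ℤ.-_ ℤ.-_ ℤ.neg-involutive ℤ.neg-involutive A)

      start : ∀ a b → IsSum (λ j → theta ε a b j ⋆ binom 0 0 j) 1s
      start a b = sum-cong (λ _ → P.refl) value (sum-singleton (+ 0) λ { (+ zero) → inj₁ refl
        ; (+ suc m) → inj₂ (P.trans (P.*-congˡ (P.trans (P.*-congˡ (P.zeroʳ _)) (P.zeroʳ _)))
            (P.zeroʳ _))
        ; -[1+ k ] → inj₂ (P.trans (P.*-congˡ (P.trans (P.*-congˡ (P.zeroˡ _)) (P.zeroʳ _)))
            (P.zeroʳ _)) })
        where
        recip-0 : recip (+ 0) ≋ 1s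
        recip-0 = P.trans (P.sym (P.*-identityʳ _)) (inv-⋆ {1s} refl)
        expo-0 : expo a b (+ 0) ≡ 0
        expo-0 = cong₂ _+_ (ℕ.*-zeroʳ (a + b)) (ℕ.*-zeroʳ a)
        value : theta ε a b (+ 0) ⋆ binom 0 0 (+ 0) ≋ 1s
        value = P.trans (P.*-cong (P.trans (P.*-congˡ (≡⇒≋ (cong (X ^_) expo-0)))
            (P.*-identityʳ 1s))
          (P.trans (P.*-congˡ (P.*-cong recip-0 recip-0))
              (P.trans (P.*-identityˡ _) (P.*-identityˡ _)))) (P.*-identityˡ 1s)

      row₀ : ∀ a b → N ≡ a + b → ∀ L → IsSum (λ j → theta ε a b j ⋆ binom 0 L j) (poch ε a N L)
      row₀ a b N≡ zero    = start a b
      row₀ a b N≡ (suc L) = grow a b N≡ 0 L (row₀ a b N≡ L)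

    -- The finite triple product, a form of the q-binomial theorem; the triple product is its limit
    -- M = L → ∞.
    finite : ∀ a b → N ≡ a + b → ∀ M L →
      IsSum (λ j → theta ε a b j ⋆ binom M L j) (poch ε b N M ⋆ poch ε a N L)
    finite a b N≡ M zero    = sum-cong (λ _ → P.refl) (P.sym (P.*-identityʳ _))
      (mirror b a 0 M (row₀ b a (trans N≡ (ℕ.+-comm a b)) M))
    finite a b N≡ M (suc L) = sum-cong (λ _ → P.refl) (P.*-assoc _ _ _)
        (grow a b N≡ M L (finite a b N≡ M L))

    triple-product : ∀ a b → N ≡ a + b → IsSum (theta ε a b) (euler∞ ⋆ (poch∞ ε b N ⋆ poch∞ ε a N))
    triple-product a b N≡ = record
      { list = l ; unique = λ Q → IsSum.unique (F Q) Q ; covers = cov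
      ; total = λ Q → ≋[]-trans (Σℓ-cong[] (l Q) (λ j → ≋[]-sym (absorb Q j)))
          (≋⨟ (Σℓ-⋆ euler∞ _ (l Q)) (⋆-cong[] ≋[]-refl (≋[]-trans (IsSum.total (F Q) Q)
            (⋆-cong[] (≋[]-sym (poch∞≋[] ε b N (Q≤ Q))) (≋[]-sym (poch∞≋[] ε a N (Q≤ Q)))))) ) }
      where
      -- With K = 2 Q + 1, both K + j and K - j are at least Q for ∣j∣ ≤ Q + 1, so the q-binomial
      -- coefficient is 1 / `euler∞` modulo q^Q. For larger ∣j∣ the theta term itself vanishes
      -- modulo q^Q.
      K : ℕ → ℕ
      K Q = suc (Q + Q)
      Q≤ : ∀ Q → Q ≤ K Q
      Q≤ Q = ℕ.m≤n⇒m≤1+n (ℕ.m≤m+n Q Q)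
      F = λ Q → finite a b N≡ (K Q) (K Q)
      l : ℕ → List ℤ
      l Q = IsSum.list (F Q) Q

      instance
        a+b≢0 : NonZero (a + b)
        a+b≢0 = subst NonZero N≡ (≢-nonZero N≢0)

      euler∞-recip : ∀ {Q} n → Q ≤ n → euler∞ ⋆ recip (+ n) ≋[ Q ] 1s
      euler∞-recip n Q≤n = ⨟≋ (⋆-cong[] (poch∞≋[] -1ℤ N N Q≤n) ≋[]-refl)
        (P.trans (P.*-comm _ _) (inv-⋆ (Unit-poch -1ℤ N N n N≢0)))

      index : ∀ Q j → ℤ.∣ j ∣ ≤ suc Q → ∃ λ n → + K Q ℤ.+ j ≡ + n × Q ≤ n
      index Q (+ m)    _ = K Q + m , refl , ℕ.≤-trans (Q≤ Q) (ℕ.m≤m+n _ m)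
      index Q -[1+ k ] (s≤s k≤Q) = Q + Q ∸ k , trans (ℤ.[1+m]⊖[1+n]≡m⊖n (Q + Q) k)
          (ℤ.⊖-≥ (ℕ.≤-trans k≤Q (ℕ.m≤m+n Q Q)))
        , ℕ.≤-trans (ℕ.≤-reflexive (sym (ℕ.m+n∸n≡m Q Q))) (ℕ.∸-monoʳ-≤ (Q + Q) k≤Q)

      binom≋[]1 : ∀ Q j → ℤ.∣ j ∣ ≤ suc Q → euler∞ ⋆ binom (K Q) (K Q) j ≋[ Q ] 1s
      binom≋[]1 Q j j≤ with index Q j j≤ | index Q (ℤ.- j) (ℕ.≤-trans (ℕ.≤-reflexive (ℤ.∣-i∣≡∣i∣ j))
          j≤)
      ... | m , p , Q≤m | n , r , Q≤n = ≋[]-trans (⋆-cong[] ≋[]-refl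
          (⋆-cong[] (≋[]-sym (poch∞≋[] -1ℤ N N (ℕ.≤-trans (Q≤ Q) (ℕ.m≤m+n (K Q) (K Q)))))
            (≋⇒≋[] (P.*-cong (≡⇒≋ (cong recip p)) (≡⇒≋ (cong recip r))))))
        (≋⨟ (solve 3 (λ e x y → e :* (e :* (x :* y)) := (e :* x) :* (e :* y)) P.refl euler∞
            (recip (+ m)) (recip (+ n)))
          (⨟≋ (⋆-cong[] (euler∞-recip m Q≤m) (euler∞-recip n Q≤n)) (P.*-identityˡ 1s)))

      absorb : ∀ Q j → euler∞ ⋆ (theta ε a b j ⋆ binom (K Q) (K Q) j) ≋[ Q ] theta ε a b j
      absorb Q j = ≋⨟ (solve 3 (λ e t c → e :* (t :* c) := t :* (e :* c)) P.refl euler∞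
          (theta ε a b j) (binom (K Q) (K Q) j)) main
        where
        main : theta ε a b j ⋆ (euler∞ ⋆ binom (K Q) (K Q) j) ≋[ Q ] theta ε a b j
        main with ℕ.<-≤-connex (suc Q) ℤ.∣ j ∣
        ... | inj₂ j≤ = ⨟≋ (⋆-cong[] ≋[]-refl (binom≋[]1 Q j j≤)) (P.*-identityʳ _)
        ... | inj₁ Q<j = ≋[]-trans (⨟≋ (⋆-cong[] z ≋[]-refl) (P.zeroˡ _)) (≋[]-sym z)
          where z : theta ε a b j ≋[ Q ] 0s
                z = theta≋[]0 ε a b j (ℕ.<-trans (ℕ.n<1+n Q) Q<j)

      cov : ∀ Q j → j ∈ l Q ⊎ theta ε a b j ≋[ Q ] 0s
      cov Q j with IsSum.covers (F Q) Q j
      ... | inj₁ p = inj₁ p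
      ... | inj₂ p = inj₂ (≋[]-trans (≋[]-sym (absorb Q j)) (⨟≋ (⋆-cong[] ≋[]-refl p) (P.zeroʳ _)))

open TripleProduct

-- The series φ(-q) and ψ(q) as theta series; division by 5 in ℤ.

module ThetaSeries where
  open CMSum ℤ.+-0-commutativeMonoid using (sum)
  open CMSum P.+-commutativeMonoid using () renaming (sum to sumP)

  private variable I J : Set

  sum-homo : ∀ {h s} (H : Substitution h s) {f : I → PowerSeries} {t} → IsSum f t →
      IsSum (h ∘ f) (h t)
  sum-homo {h = h} H {f} {t} A = record
    { list = list ; unique = unique
    ; covers = λ N i → cov (covers N i)
    ; total = λ N → ≋[]-trans (≋⇒≋[] (P.sym (Σℓ-homo (list N)))) (H.local N (total N)) }
    where
    open IsSum A
    module H = Substitution H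
    h0 : h 0s ≋ 0s
    h0 = P.trans (H.cong-h (mk≋ λ { zero → refl ; (suc n) → refl })) (P.trans (H.const-homo 0ℤ) (mk≋ λ { zero → refl ; (suc n) → refl }))
    Σℓ-homo : ∀ xs → h (Σℓ xs f) ≋ Σℓ xs (h ∘ f)
    Σℓ-homo []       = h0
    Σℓ-homo (x ∷ xs) = P.trans (H.+-homo (f x) (Σℓ xs f)) (P.+-congˡ (Σℓ-homo xs))
    cov : ∀ {N i} → i ∈ list N ⊎ f i ≋[ N ] 0s → i ∈ list N ⊎ h (f i) ≋[ N ] 0s
    cov (inj₁ p) = inj₁ p
    cov {N} (inj₂ p) = inj₂ (≋[]-trans (H.local N p) (≋⇒≋[] h0))

  sum-Fin : ∀ n {f : Fin n → I → PowerSeries} {s : Fin n → PowerSeries} →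
      (∀ r → IsSum (f r) (s r)) →
    IsSum {I = Fin n × I} (λ (r , i) → f r i) (sumP s)
  sum-Fin zero A = record { list = λ _ → [] ; unique = λ _ → [] ; covers = λ { _ (() , _) } ; total = λ _ → ≋[]-refl }
  sum-Fin {I} (suc n) {f} A = sum-cong (λ { (fzero , i) → P.refl ; (fsuc r , i) → P.refl }) P.refl
    (sum-reindex to from to∘from from∘to (sum-⊎ (A fzero) (sum-Fin n (A ∘ fsuc))))
    where
    to : Fin (suc n) × I → I ⊎ (Fin n × I)
    to (fzero  , i) = inj₁ i
    to (fsuc r , i) = inj₂ (r , i)
    from : I ⊎ (Fin n × I) → Fin (suc n) × I
    from (inj₁ i)       = fzero , i
    from (inj₂ (r , i)) = fsuc r , i
    to∘from : ∀ x → to (from x) ≡ x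
    to∘from (inj₁ i)       = refl
    to∘from (inj₂ (r , i)) = refl
    from∘to : ∀ x → from (to x) ≡ x
    from∘to (fzero  , i) = refl
    from∘to (fsuc r , i) = refl

  mod5 : ℕ → Fin 5
  mod5 n = fromℕ< (DivMod.m%n<n n 5)

  -- The bijection (r , i) ↦ 5 i + r, see `join-≡`. The integer -1 - n has residue 4 - (n mod 5),
  -- whence `opposite`.
  join : Fin 5 × ℤ → ℤ
  join (r , + k)      = + (toℕ r + k * 5)
  join (r , -[1+ k ]) = -[1+ toℕ (opposite r) + k * 5 ]

  split : ℤ → Fin 5 × ℤ
  split (+ n)    = mod5 n , + (n / 5)
  split -[1+ n ] = opposite (mod5 n) , -[1+ n / 5 ]

  mod5-+ : ∀ (r : Fin 5) k → mod5 (toℕ r + k * 5) ≡ r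
  mod5-+ r k = Fin.toℕ-injective (trans (Fin.toℕ-fromℕ< _)
    (trans (DivMod.[m+kn]%n≡m%n (toℕ r) k 5) (DivMod.m<n⇒m%n≡m (Fin.toℕ<n r))))

  div5-+ : ∀ (r : Fin 5) k → (toℕ r + k * 5) / 5 ≡ k
  div5-+ r k = trans (DivMod.+-distrib-/-∣ʳ (toℕ r) (Div.n∣m*n k))
    (cong₂ _+_ (DivMod.m<n⇒m/n≡0 (Fin.toℕ<n r)) (DivMod.m*n/n≡m k 5))

  mod+div : ∀ n → toℕ (mod5 n) + n / 5 * 5 ≡ n
  mod+div n = trans (cong (_+ n / 5 * 5) (Fin.toℕ-fromℕ< _)) (sym (DivMod.m≡m%n+[m/n]*n n 5))

  join-split : ∀ m → join (split m) ≡ m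
  join-split (+ n)    = cong +_ (mod+div n)
  join-split -[1+ n ] = cong -[1+_] (trans
      (cong (λ r → toℕ r + n / 5 * 5) (Fin.opposite-involutive (mod5 n))) (mod+div n))

  split-join : ∀ x → split (join x) ≡ x
  split-join (r , + k)      = cong₂ _,_ (mod5-+ r k) (cong +_ (div5-+ r k))
  split-join (r , -[1+ k ]) = cong₂ _,_
    (trans (cong opposite (mod5-+ (opposite r) k)) (Fin.opposite-involutive r))
        (cong -[1+_] (div5-+ (opposite r) k))

  join-≡ : ∀ r i → join (r , i) ≡ + 5 ℤ.* i ℤ.+ + toℕ r
  join-≡ r (+ k)      = trans (ℤ.pos-+ (toℕ r) (k * 5))
      (trans (cong (λ x → + toℕ r ℤ.+ x) (ℤ.pos-* k 5)) (lem (+ toℕ r) (+ k)))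
    where lem : ∀ r k → r ℤ.+ k ℤ.* + 5 ≡ + 5 ℤ.* k ℤ.+ r
          lem = ℤTactic.solve-∀
  join-≡ r -[1+ k ] = trans (cong ℤ.-_ (trans (ℤ.pos-+ (suc (toℕ (opposite r))) (k * 5))
      (cong₂ ℤ._+_ (opp r) (ℤ.pos-* k 5))))
      (lem (+ toℕ r) (+ k))
    where
    opp : ∀ (r : Fin 5) → + suc (toℕ (opposite r)) ≡ + 5 ℤ.- + toℕ r
    opp 0F = refl
    opp 1F = refl
    opp 2F = refl
    opp 3F = refl
    opp 4F = refl
    lem : ∀ r k → ℤ.- ((+ 5 ℤ.- r) ℤ.+ k ℤ.* + 5) ≡ + 5 ℤ.* ℤ.- (+ 1 ℤ.+ k) ℤ.+ r
    lem = ℤTactic.solve-∀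

  private
    Fin-sum : ∀ m n (f : I → PowerSeries) (g : ℕ → I) (a : ℕ → ℤ) → (∀ k → f (g k) n ≡ a k) →
        ∀ (e : ℕ → ℕ) →
      Σℓ (map g (applyUpTo e m)) f n ≡ sum {m} (λ k → a (e (toℕ k)))
    Fin-sum zero    n f g a p e = refl
    Fin-sum (suc m) n f g a p e = trans (⊞-at _ _ n)
        (cong₂ ℤ._+_ (p (e 0)) (Fin-sum m n f g a p (e ∘ suc)))

  φ-sum : IsSum (theta -1ℤ 1 1) φ[-q]
  φ-sum = sum-from l u c t
    where
    l : ℕ → List ℤ
    l N = map +_ (upTo N) ++ map -[1+_] (upTo (N ∸ 1))
    u : ∀ N → Unique (l N)
    u N = Unique.++⁺ (Unique.map⁺ ℤ.+-injective (Unique.upTo⁺ N))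
        (Unique.map⁺ ℤ.-[1+-injective (Unique.upTo⁺ (N ∸ 1))) disj
      where
      disj : ∀ {v} → ¬ (v ∈ map +_ (upTo N) × v ∈ map -[1+_] (upTo (N ∸ 1)))
      disj (p , r) with ∈.∈-map⁻ +_ p | ∈.∈-map⁻ -[1+_] r
      ... | _ , _ , refl | _ , _ , ()
    square : ∀ j → expo 1 1 j ≡ ℤ.∣ j ℤ.* j ∣
    square j = halve (trans (expo-double 1 1 j) (trans (lem j) (cong (λ x → + 2 ℤ.* x) (sq j))))
      where
      lem : ∀ j → (+ 1 ℤ.+ + 1) ℤ.* (j ℤ.* j) ℤ.+ (+ 1 ℤ.- + 1) ℤ.* j ≡ + 2 ℤ.* (j ℤ.* j)
      lem = ℤTactic.solve-∀
      sq : ∀ j → j ℤ.* j ≡ + ℤ.∣ j ℤ.* j ∣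
      sq (+ m)    = sym (ℤ.0≤i⇒+∣i∣≡i (subst (0ℤ ℤ.≤_) (ℤ.pos-* m m) (ℤ.+≤+ z≤n)))
      sq -[1+ k ] = refl
    big : ∀ {N} j → N ≤ ℤ.∣ j ∣ → theta -1ℤ 1 1 j ≋[ N ] 0s
    big {N} j N≤ = ≋[]-trans (⋆-cong[] (≋[]-refl {const (pow -1ℤ j)}) (≋[]-weaken
      (ℕ.≤-trans N≤ (ℕ.≤-trans (sq≥ ℤ.∣ j ∣)
          (ℕ.≤-reflexive (sym (trans (square j) (ℤ.∣i*j∣≡∣i∣*∣j∣ j j)))))) (X^≋[]0 (expo 1 1 j))))
      (≋⇒≋[] (P.zeroʳ _))
      where sq≥ : ∀ m → m ≤ m * m
            sq≥ zero    = z≤n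
            sq≥ (suc m) = ℕ.m≤m*n (suc m) (suc m)
    c : ∀ N j → j ∈ l N ⊎ theta -1ℤ 1 1 j ≋[ N ] 0s
    c N (+ k) with ℕ.<-≤-connex k N
    ... | inj₁ k<N = inj₁ (∈.∈-++⁺ˡ (∈.∈-map⁺ +_ (∈.∈-upTo⁺ k<N)))
    ... | inj₂ N≤k = inj₂ (big (+ k) N≤k)
    c N -[1+ k ] with ℕ.<-≤-connex k (N ∸ 1)
    ... | inj₁ k<N = inj₁ (∈.∈-++⁺ʳ (map +_ (upTo N)) (∈.∈-map⁺ -[1+_] (∈.∈-upTo⁺ k<N)))
    ... | inj₂ N≤k = inj₂ (big -[1+ k ] (le N N≤k))
      where le : ∀ N → N ∸ 1 ≤ k → N ≤ suc k
            le zero    _ = z≤n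
            le (suc N) p = s≤s p
    val : ∀ n j → theta -1ℤ 1 1 j n ≡ ((-1ℤ ℤ.^ ℤ.∣ j ∣) q^ ℤ.∣ j ℤ.* j ∣) n
    val n j = trans (P.*-congˡ {const (pow -1ℤ j)} (≡⇒≋ (cong (X ^_) (square j))) .at n)
        (sym (q^-≋ (-1ℤ ℤ.^ ℤ.∣ j ∣) ℤ.∣ j ℤ.* j ∣ .at n))
    t : ∀ n → Σℓ (l (suc n)) (theta -1ℤ 1 1) n ≡ φ[-q] n
    t n = trans (Σℓ-++ (theta -1ℤ 1 1) (map +_ (upTo (suc n))) (map -[1+_] (upTo n)) .at n)
        (trans (⊞-at _ _ n) (cong₂ ℤ._+_
      (Fin-sum (suc n) n (theta -1ℤ 1 1) +_ (λ k → ((-1ℤ ℤ.^ ℤ.∣ + k ∣) q^ ℤ.∣ + k ℤ.* + k ∣) n)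
          (λ k → val n (+ k)) id)
      (Fin-sum n n (theta -1ℤ 1 1) -[1+_] (λ k →
          ((-1ℤ ℤ.^ ℤ.∣ -[1+ k ] ∣) q^ ℤ.∣ -[1+ k ] ℤ.* -[1+ k ] ∣) n) (λ k → val n -[1+ k ]) id)))

  -- ψ(q) = ∑ q^(k (k + 1) / 2), free of signs and therefore a theta series with ε = 1.
  ψ : PowerSeries
  ψ = σ ψ[-q]

  private
    triangle : ∀ k → k * (k + 1) / 2 ≡ tri (suc k)
    triangle k = trans (cong (_/ 2) (trans (eq k) (ℕ.*-comm 2 (tri (suc k)))))
        (DivMod.m*n/n≡m (tri (suc k)) 2)
      where
      eq : ∀ k → k * (k + 1) ≡ 2 * tri (suc k)
      eq zero    = refl
      eq (suc k) = trans (lem k) (trans (cong (_+ 2 * suc k) (eq k))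
          (sym (ℕ.*-distribˡ-+ 2 (tri (suc k)) (suc k))))
        where lem : ∀ k → suc k * (suc k + 1) ≡ k * (k + 1) + 2 * suc k
              lem = ℕTactic.solve-∀

    ψ-sumℕ : IsSum (λ k → X ^ tri (suc k)) ψ
    ψ-sumℕ = sum-cong sign P.refl (sum-homo σ-substitution (sum-from upTo Unique.upTo⁺ c t))
      where
      term : ℕ → PowerSeries
      term k = const (-1ℤ ℤ.^ tri (suc k)) ⋆ X ^ tri (suc k)
      -1^-≡ : ∀ e → -1^ e ≡ -1ℤ ℤ.^ e
      -1^-≡ zero    = refl
      -1^-≡ (suc e) = trans (cong ℤ.-_ (-1^-≡ e)) (sym (ℤ.-1*i≡-i _))
      -1^² : ∀ e → -1^ e ℤ.* -1^ e ≡ 1ℤ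
      -1^² zero    = refl
      -1^² (suc e) = trans (lem (-1^ e)) (-1^² e)
        where lem : ∀ x → ℤ.- x ℤ.* ℤ.- x ≡ x ℤ.* x
              lem = ℤTactic.solve-∀
      sign : ∀ k → σ (term k) ≋ X ^ tri (suc k)
      sign k = P.trans (σH.const-⋆-homo _ (X ^ tri (suc k))) (mk≋ λ n →
          trans (const-⋆-at _ _ n) (trans (cong (λ x → -1ℤ ℤ.^ tri (suc k) ℤ.* x) (σ-at _ n))
          (go n)))
        where
        go : ∀ n → -1ℤ ℤ.^ tri (suc k) ℤ.* (-1^ n ℤ.* (X ^ tri (suc k)) n) ≡ (X ^ tri (suc k)) n
        go n with tri (suc k) ℕ.≟ n
        ... | yes refl = trans (cong (λ y → y ℤ.* (-1^ n ℤ.* (X ^ n) n)) (sym (-1^-≡ n)))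
          (trans (sym (ℤ.*-assoc (-1^ n) (-1^ n) ((X ^ n) n)))
              (trans (cong (ℤ._* (X ^ n) n) (-1^² n)) (ℤ.*-identityˡ ((X ^ n) n))))
        ... | no ≢n rewrite X^-≢ (tri (suc k)) ≢n =
          trans (cong (λ x → -1ℤ ℤ.^ tri (suc k) ℤ.* x) (ℤ.*-zeroʳ (-1^ n)))
              (ℤ.*-zeroʳ (-1ℤ ℤ.^ tri (suc k)))
      c : ∀ N k → k ∈ upTo N ⊎ term k ≋[ N ] 0s
      c N k with ℕ.<-≤-connex k N
      ... | inj₁ k<N = inj₁ (∈.∈-upTo⁺ k<N)
      ... | inj₂ N≤k = inj₂ (≋[]-trans (⋆-cong[] (≋[]-refl {const (-1ℤ ℤ.^ tri (suc k))})
          (≋[]-weaken (ℕ.≤-trans N≤k (ℕ.m≤n+m k (tri k))) (X^≋[]0 (tri (suc k)))))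
        (≋⇒≋[] (P.zeroʳ _)))
      t : ∀ n → Σℓ (upTo (suc n)) term n ≡ ψ[-q] n
      t n = trans (cong (λ xs → Σℓ xs term n) (sym (map-id (upTo (suc n)))))
          (Fin-sum (suc n) n term id (λ k → ((-1ℤ ℤ.^ (k * (k + 1) / 2)) q^ (k * (k + 1) / 2)) n)
        (λ k → trans (cong (λ e → (const (-1ℤ ℤ.^ e) ⋆ X ^ e) n) (sym (triangle k)))
            (sym (q^-≋ (-1ℤ ℤ.^ (k * (k + 1) / 2)) (k * (k + 1) / 2) .at n))) id)
        where open import Data.List.Properties using (map-id)

  -- The indices k and -1 - k share the exponent k (k + 1) / 2, so the sum over ℤ counts ψ twice.
  2ψ-sum : IsSum (theta 1ℤ 1 0) (ψ ⊞ ψ)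
  2ψ-sum = sum-cong (λ { (+ k) → term k (+ k) (lem₁ k) ; -[1+ k ] → term k -[1+ k ] (lem₂ k) }) P.refl
    (sum-reindex to from to∘from from∘to (sum-⊎ ψ-sumℕ ψ-sumℕ))
    where
    to : ℤ → ℕ ⊎ ℕ
    to (+ k)    = inj₁ k
    to -[1+ k ] = inj₂ k
    from : ℕ ⊎ ℕ → ℤ
    from (inj₁ k) = + k
    from (inj₂ k) = -[1+ k ]
    to∘from : ∀ x → to (from x) ≡ x
    to∘from (inj₁ k) = refl
    to∘from (inj₂ k) = refl
    from∘to : ∀ x → from (to x) ≡ x
    from∘to (+ k)    = refl
    from∘to -[1+ k ] = refl
    lem₁ : ∀ k → tri (suc k) ≡ expo 1 0 (+ k)
    lem₁ k = sym (cong₂ _+_ (ℕ.*-identityˡ (tri k)) (ℕ.*-identityˡ k))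
    lem₂ : ∀ k → tri (suc k) ≡ expo 1 0 -[1+ k ]
    lem₂ k = sym (trans (ℕ.+-identityʳ _) (ℕ.*-identityˡ _))
    term : ∀ k j → tri (suc k) ≡ expo 1 0 j → X ^ tri (suc k) ≋ theta 1ℤ 1 0 j
    term k j p = P.trans (P.trans (≡⇒≋ (cong (X ^_) p)) (P.sym (P.*-identityˡ _)))
      (P.*-congʳ (const-cong (sym (ℤ.^-zeroˡ ℤ.∣ j ∣))))

open ThetaSeries

-- Products of theta series over sublattices of index 5, and the 5-dissection of f₁.

module Lattices where
  open CMSum P.+-commutativeMonoid using () renaming (sum to sumP)

  private
    module *ℤ = CSProperties ℤ.*-commutativeSemigroup

  module _ {ε : ℤ} (ε² : ε ℤ.* ε ≡ 1ℤ) where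
    private
      pow-suc : ∀ i → pow ε (ℤ.suc i) ≡ ε ℤ.* pow ε i
      pow-suc i = trans (sym (pow-pred ε ε² (ℤ.suc i))) (cong (λ j → ε ℤ.* pow ε j) (ℤ.pred-suc i))

      ε-involutive : ∀ x → ε ℤ.* (ε ℤ.* x) ≡ x
      ε-involutive x = trans (sym (ℤ.*-assoc ε ε x)) (trans (cong (ℤ._* x) ε²) (ℤ.*-identityˡ x))

      pow-pred′ : ∀ i → pow ε (ℤ.pred i) ≡ ε ℤ.* pow ε i
      pow-pred′ i = trans (sym (ε-involutive _)) (cong (λ x → ε ℤ.* x) (pow-pred ε ε² i))

    pow-+ : ∀ i j → pow ε (i ℤ.+ j) ≡ pow ε i ℤ.* pow ε j
    pow-+ (+ m) j = go m
      where
      go : ∀ m → pow ε (+ m ℤ.+ j) ≡ pow ε (+ m) ℤ.* pow ε j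
      go zero    = trans (cong (pow ε) (ℤ.+-identityˡ j)) (sym (ℤ.*-identityˡ _))
      go (suc m) = trans (cong (pow ε) (ℤ.+-assoc (+ 1) (+ m) j)) (trans (pow-suc (+ m ℤ.+ j))
        (trans (cong (λ x → ε ℤ.* x) (go m)) (sym (ℤ.*-assoc ε (pow ε (+ m)) (pow ε j)))))
    pow-+ -[1+ k ] j = go k
      where
      go : ∀ k → pow ε (-[1+ k ] ℤ.+ j) ≡ pow ε -[1+ k ] ℤ.* pow ε j
      go zero    = trans (pow-pred′ j) (cong (ℤ._* pow ε j) (sym (ℤ.*-identityʳ ε)))
      go (suc k) = trans (cong (pow ε) (ℤ.+-assoc -1ℤ -[1+ k ] j))
          (trans (pow-pred′ (-[1+ k ] ℤ.+ j))
        (trans (cong (λ x → ε ℤ.* x) (go k)) (sym (ℤ.*-assoc ε (pow ε -[1+ k ]) (pow ε j)))))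

    pow-even : ∀ i j → pow ε (i ℤ.+ (j ℤ.+ j)) ≡ pow ε i
    pow-even i j = trans (pow-+ i (j ℤ.+ j))
        (trans (cong (λ x → pow ε i ℤ.* x) (trans (pow-+ j j) (square j))) (ℤ.*-identityʳ _))
      where
      square : ∀ j → pow ε j ℤ.* pow ε j ≡ 1ℤ
      square j = go ℤ.∣ j ∣
        where
        go : ∀ n → ε ℤ.^ n ℤ.* ε ℤ.^ n ≡ 1ℤ
        go zero    = refl
        go (suc n) = trans (*ℤ.interchange ε (ε ℤ.^ n) ε (ε ℤ.^ n)) (cong₂ ℤ._*_ ε² (go n))

  -- Q a b j = 2 expo a b j, doubled so that it is a polynomial in j over ℤ.
  Q : ℕ → ℕ → ℤ → ℤ
  Q a b j = (+ a ℤ.+ + b) ℤ.* (j ℤ.* j) ℤ.+ (+ a ℤ.- + b) ℤ.* j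

  Th : ∀ ε a b .{{_ : NonZero (a + b)}} → PowerSeries
  Th ε a b = poch∞ -1ℤ (a + b) (a + b) ⋆ (poch∞ ε b (a + b) ⋆ poch∞ ε a (a + b))

  theta-sum : ∀ {ε} → ε ℤ.* ε ≡ 1ℤ → ∀ a b .{{_ : NonZero (a + b)}} → IsSum (theta ε a b) (Th ε a b)
  theta-sum {ε} ε² a b = JacobiTripleProduct.triple-product ε ε² (a + b) a b refl

  private
    monomial-⋆ : ∀ s k t l → (const s ⋆ X ^ k) ⋆ (const t ⋆ X ^ l) ≋ const (s ℤ.* t) ⋆ X ^ (k + l)
    monomial-⋆ s k t l = P.trans (*P.interchange _ _ _ _)
        (P.*-cong (P.sym (const-* s t)) (P.sym (^-homo-* X k l)))

    theta-⋆ : ∀ ε a b c d i j → theta ε a b i ⋆ theta ε c d j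
        ≋ const (pow ε i ℤ.* pow ε j) ⋆ X ^ (expo a b i + expo c d j)
    theta-⋆ ε a b c d i j = monomial-⋆ (pow ε i) (expo a b i) (pow ε j) (expo c d j)

    monomial-≡ : ∀ {s t k l} → s ≡ t → k ≡ l → const s ⋆ X ^ k ≋ const t ⋆ X ^ l
    monomial-≡ refl refl = P.refl

    shift : ℤ → ℤ → ℤ × ℤ → ℤ × ℤ
    shift α β (a , b) = a ℤ.+ α , b ℤ.+ β

    cancel⁺ : ∀ a α → a ℤ.- α ℤ.+ α ≡ a
    cancel⁺ = ℤTactic.solve-∀

    cancel⁻ : ∀ a α → a ℤ.+ α ℤ.- α ≡ a
    cancel⁻ = ℤTactic.solve-∀

    sum-shift : ∀ {f : ℤ × ℤ → PowerSeries} {s} α β → IsSum f s → IsSum (f ∘ shift α β) s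
    sum-shift α β = sum-reindex (shift α β) (shift (ℤ.- α) (ℤ.- β))
      (λ (a , b) → cong₂ _,_ (cancel⁺ a α) (cancel⁺ b β)) (λ (a , b) →
          cong₂ _,_ (cancel⁻ a α) (cancel⁻ b β))

    -- The hypotheses compare the coefficients of a², b², a, b and 1.
    complete-square : ∀ N d r S D S′ D′ α β k → S ≡ + 5 ℤ.* N → S′ ≡ + 5 ℤ.* N →
      + 2 ℤ.* S ℤ.* α ℤ.+ D ≡ + 4 ℤ.* r ℤ.* N ℤ.+ + 3 ℤ.* d →
          + 2 ℤ.* S′ ℤ.* β ℤ.+ D′ ≡ + 2 ℤ.* r ℤ.* N ℤ.- d →
      + 2 ℤ.* k ℤ.+ (S ℤ.* (α ℤ.* α) ℤ.+ D ℤ.* α) ℤ.+ (S′ ℤ.* (β ℤ.* β) ℤ.+ D′ ℤ.* β)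
          ≡ N ℤ.* (r ℤ.* r) ℤ.+ d ℤ.* r →
      ∀ a b → + 2 ℤ.* k ℤ.+ ((S ℤ.* ((a ℤ.+ α) ℤ.* (a ℤ.+ α)) ℤ.+ D ℤ.* (a ℤ.+ α))
          ℤ.+ (S′ ℤ.* ((b ℤ.+ β) ℤ.* (b ℤ.+ β)) ℤ.+ D′ ℤ.* (b ℤ.+ β)))
        ≡ (N ℤ.* ((a ℤ.- + 2 ℤ.* b) ℤ.* (a ℤ.- + 2 ℤ.* b)) ℤ.+ d ℤ.* (a ℤ.- + 2 ℤ.* b))
          ℤ.+ (N ℤ.* ((r ℤ.+ + 2 ℤ.* a ℤ.+ b) ℤ.* (r ℤ.+ + 2 ℤ.* a ℤ.+ b))
              ℤ.+ d ℤ.* (r ℤ.+ + 2 ℤ.* a ℤ.+ b))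
    complete-square N d r S D S′ D′ α β k p p′ l l′ c a b =
      trans (lem₁ S D S′ D′ α β k a b) (trans (cong₂ ℤ._+_ (cong₂ ℤ._+_ (cong₂ ℤ._+_ (cong₂ ℤ._+_
        (cong (ℤ._* (a ℤ.* a)) p) (cong (ℤ._* (b ℤ.* b)) p′)) (cong (ℤ._* a) l)) (cong (ℤ._* b) l′))
            c)
        (lem₂ N d r a b))
      where
      lem₁ : ∀ S D S′ D′ α β k a b →
        + 2 ℤ.* k ℤ.+ ((S ℤ.* ((a ℤ.+ α) ℤ.* (a ℤ.+ α)) ℤ.+ D ℤ.* (a ℤ.+ α))
            ℤ.+ (S′ ℤ.* ((b ℤ.+ β) ℤ.* (b ℤ.+ β)) ℤ.+ D′ ℤ.* (b ℤ.+ β)))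
        ≡ S ℤ.* (a ℤ.* a) ℤ.+ S′ ℤ.* (b ℤ.* b) ℤ.+ (+ 2 ℤ.* S ℤ.* α ℤ.+ D) ℤ.* a
            ℤ.+ (+ 2 ℤ.* S′ ℤ.* β ℤ.+ D′) ℤ.* b
          ℤ.+ (+ 2 ℤ.* k ℤ.+ (S ℤ.* (α ℤ.* α) ℤ.+ D ℤ.* α) ℤ.+ (S′ ℤ.* (β ℤ.* β) ℤ.+ D′ ℤ.* β))
      lem₁ = ℤTactic.solve-∀
      lem₂ : ∀ N d r a b →
        + 5 ℤ.* N ℤ.* (a ℤ.* a) ℤ.+ + 5 ℤ.* N ℤ.* (b ℤ.* b)
            ℤ.+ (+ 4 ℤ.* r ℤ.* N ℤ.+ + 3 ℤ.* d) ℤ.* a ℤ.+ (+ 2 ℤ.* r ℤ.* N ℤ.- d) ℤ.* b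
          ℤ.+ (N ℤ.* (r ℤ.* r) ℤ.+ d ℤ.* r)
        ≡ (N ℤ.* ((a ℤ.- + 2 ℤ.* b) ℤ.* (a ℤ.- + 2 ℤ.* b)) ℤ.+ d ℤ.* (a ℤ.- + 2 ℤ.* b))
          ℤ.+ (N ℤ.* ((r ℤ.+ + 2 ℤ.* a ℤ.+ b) ℤ.* (r ℤ.+ + 2 ℤ.* a ℤ.+ b))
              ℤ.+ d ℤ.* (r ℤ.+ + 2 ℤ.* a ℤ.+ b))
      lem₂ = ℤTactic.solve-∀

    -- In x = a - 2 b, y = r + 2 a + b the form x² + y² becomes 5 a² + 5 b² plus linear terms,
    -- without a b, so the sum over a coset factors. The shifts α and β bring the linear terms to
    -- the shape of a theta series, and k is the exponent left over. The sign survives because x + y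
    -- and r + a + b have the same parity.
    class-sum : ∀ {ε} (ε² : ε ℤ.* ε ≡ 1ℤ) (a₀ b₀ : ℕ) (r : Fin 5) (A B C D : ℕ)
      .{{_ : NonZero (A + B)}} .{{_ : NonZero (C + D)}} (α β : ℤ) (k : ℕ) →
      + A ℤ.+ + B ≡ + 5 ℤ.* (+ a₀ ℤ.+ + b₀) → + C ℤ.+ + D ≡ + 5 ℤ.* (+ a₀ ℤ.+ + b₀) →
      + 2 ℤ.* (+ A ℤ.+ + B) ℤ.* α ℤ.+ (+ A ℤ.- + B) ≡ + 4 ℤ.* + toℕ r ℤ.* (+ a₀ ℤ.+ + b₀)
          ℤ.+ + 3 ℤ.* (+ a₀ ℤ.- + b₀) →
      + 2 ℤ.* (+ C ℤ.+ + D) ℤ.* β ℤ.+ (+ C ℤ.- + D) ≡ + 2 ℤ.* + toℕ r ℤ.* (+ a₀ ℤ.+ + b₀)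
          ℤ.- (+ a₀ ℤ.- + b₀) →
      + 2 ℤ.* + k ℤ.+ Q A B α ℤ.+ Q C D β ≡ Q a₀ b₀ (+ toℕ r) →
      IsSum (λ ((a , b) : ℤ × ℤ) → theta ε a₀ b₀ (a ℤ.- + 2 ℤ.* b) ⋆ theta ε a₀ b₀ (+ toℕ r
          ℤ.+ + 2 ℤ.* a ℤ.+ b))
        (const (pow ε (+ toℕ r ℤ.- α ℤ.- β)) ⋆ X ^ k ⋆ (Th ε A B ⋆ Th ε C D))
    class-sum {ε} ε² a₀ b₀ r A B C D α β k h₁ h₂ h₃ h₄ h₅ = sum-cong (λ (a , b) → eq a b) P.refl
      (sum-⋆ (const s ⋆ X ^ k) (sum-shift α β (sum-× (theta-sum ε² A B) (theta-sum ε² C D))))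
      where
      s : ℤ
      s = pow ε (+ toℕ r ℤ.- α ℤ.- β)
      eq : ∀ a b → const s ⋆ X ^ k ⋆ (theta ε A B (a ℤ.+ α) ⋆ theta ε C D (b ℤ.+ β))
        ≋ theta ε a₀ b₀ (a ℤ.- + 2 ℤ.* b) ⋆ theta ε a₀ b₀ (+ toℕ r ℤ.+ + 2 ℤ.* a ℤ.+ b)
      eq a b = P.trans (P.trans (P.*-congˡ (theta-⋆ ε A B C D (a ℤ.+ α) (b ℤ.+ β)))
          (monomial-⋆ s k _ (expo A B (a ℤ.+ α) + expo C D (b ℤ.+ β))))
        (P.trans (monomial-≡ signs exps) (P.sym (theta-⋆ ε a₀ b₀ a₀ b₀ x y)))
        where
        x = a ℤ.- + 2 ℤ.* b
        y = + toℕ r ℤ.+ + 2 ℤ.* a ℤ.+ b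
        lem : ∀ r a b α β → (r ℤ.- α ℤ.- β) ℤ.+ ((a ℤ.+ α) ℤ.+ (b ℤ.+ β))
            ℤ.+ ((a ℤ.- b) ℤ.+ (a ℤ.- b))
          ≡ (a ℤ.- + 2 ℤ.* b) ℤ.+ (r ℤ.+ + 2 ℤ.* a ℤ.+ b)
        lem = ℤTactic.solve-∀
        signs : s ℤ.* (pow ε (a ℤ.+ α) ℤ.* pow ε (b ℤ.+ β)) ≡ pow ε x ℤ.* pow ε y
        signs = trans (cong (λ z → s ℤ.* z) (sym (pow-+ ε² (a ℤ.+ α) (b ℤ.+ β))))
            (trans (sym (pow-+ ε² (+ toℕ r ℤ.- α ℤ.- β) ((a ℤ.+ α) ℤ.+ (b ℤ.+ β))))
          (trans (sym (pow-even ε² ((+ toℕ r ℤ.- α ℤ.- β) ℤ.+ ((a ℤ.+ α) ℤ.+ (b ℤ.+ β))) (a ℤ.- b)))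
              (trans (cong (pow ε) (lem (+ toℕ r) a b α β)) (pow-+ ε² x y))))
        exps : k + (expo A B (a ℤ.+ α) + expo C D (b ℤ.+ β)) ≡ expo a₀ b₀ x + expo a₀ b₀ y
        exps = halve (trans (double-+ k _ refl
            (double-+ (expo A B (a ℤ.+ α)) _ (expo-double A B (a ℤ.+ α))
            (expo-double C D (b ℤ.+ β))))
          (trans (complete-square (+ a₀ ℤ.+ + b₀) (+ a₀ ℤ.- + b₀) (+ toℕ r) (+ A ℤ.+ + B)
              (+ A ℤ.- + B) (+ C ℤ.+ + D) (+ C ℤ.- + D) α β (+ k) h₁ h₂ h₃ h₄ h₅ a b)
              (sym (double-+ (expo a₀ b₀ x) _ (expo-double a₀ b₀ x) (expo-double a₀ b₀ y)))))

    -- The index-5 sublattice (2 + i) ℤ[i] and its cosets: (x , y) lies in the coset of y − 2 x.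
    coset-sum : ∀ {f : ℤ → PowerSeries} {s t₀ t₁ t₂ t₃ t₄} → IsSum f s →
      let coset = λ (r : Fin 5) ((a , b) : ℤ × ℤ) → f (a ℤ.- + 2 ℤ.* b) ⋆ f (+ toℕ r ℤ.+ + 2 ℤ.* a ℤ.+ b) in
      IsSum (coset 0F) t₀ → IsSum (coset 1F) t₁ → IsSum (coset 2F) t₂ → IsSum (coset 3F) t₃ →
          IsSum (coset 4F) t₄ →
      s ⋆ s ≋ t₀ ⊞ (t₁ ⊞ (t₂ ⊞ (t₃ ⊞ t₄)))
    coset-sum {f} {t₀ = t₀} {t₁} {t₂} {t₃} {t₄} A B₀ B₁ B₂ B₃ B₄ = P.trans (sum-unique
      (sum-cong (λ (r , a , b) → P.*-congˡ (≡⇒≋ (cong f (y-≡ r a b)))) P.refl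
        (sum-reindex from to from∘to to∘from (sum-× A A)))
      (sum-Fin 5 {s = λ { 0F → t₀ ; 1F → t₁ ; 2F → t₂ ; 3F → t₃ ; 4F → t₄ }}
        (λ { 0F → B₀ ; 1F → B₁ ; 2F → B₂ ; 3F → B₃ ; 4F → B₄ })))
      (P.+-congˡ (P.+-congˡ (P.+-congˡ (P.+-congˡ (P.+-identityʳ t₄)))))
      where
      to : ℤ × ℤ → Fin 5 × (ℤ × ℤ)
      to (x , y) = let (r , b) = split (y ℤ.- + 2 ℤ.* x) in r , x ℤ.+ + 2 ℤ.* b , b
      from : Fin 5 × (ℤ × ℤ) → ℤ × ℤ
      from (r , a , b) = a ℤ.- + 2 ℤ.* b , join (r , b) ℤ.+ + 2 ℤ.* (a ℤ.- + 2 ℤ.* b)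
      y-≡ : ∀ r a b → join (r , b) ℤ.+ + 2 ℤ.* (a ℤ.- + 2 ℤ.* b) ≡ + toℕ r ℤ.+ + 2 ℤ.* a ℤ.+ b
      y-≡ r a b = trans (cong (ℤ._+ + 2 ℤ.* (a ℤ.- + 2 ℤ.* b)) (join-≡ r b)) (lem (+ toℕ r) a b)
        where lem : ∀ r a b → + 5 ℤ.* b ℤ.+ r ℤ.+ + 2 ℤ.* (a ℤ.- + 2 ℤ.* b) ≡ r ℤ.+ + 2 ℤ.* a ℤ.+ b
              lem = ℤTactic.solve-∀
      from∘to : ∀ v → from (to v) ≡ v
      from∘to (x , y) = cong₂ _,_ (lem₁ x b)
          (trans (cong₂ (λ t x′ → t ℤ.+ + 2 ℤ.* x′) (join-split (y ℤ.- + 2 ℤ.* x)) (lem₁ x b))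
          (cancel⁺ y (+ 2 ℤ.* x)))
        where
        b = proj₂ (split (y ℤ.- + 2 ℤ.* x))
        lem₁ : ∀ x b → x ℤ.+ + 2 ℤ.* b ℤ.- + 2 ℤ.* b ≡ x
        lem₁ = ℤTactic.solve-∀
      to∘from : ∀ v → to (from v) ≡ v
      to∘from (r , a , b) = trans (cong (λ z → proj₁ (split z) , a ℤ.- + 2 ℤ.* b
          ℤ.+ + 2 ℤ.* proj₂ (split z) , proj₂ (split z)) (cancel⁻ (join (r , b)) _))
        (trans (cong (λ z → proj₁ z , a ℤ.- + 2 ℤ.* b ℤ.+ + 2 ℤ.* proj₂ z , proj₂ z)
            (split-join (r , b)))
          (cong (λ z → r , z , b) (cancel⁺ a (+ 2 ℤ.* b))))

  Th-swap : ∀ ε a b .{{_ : NonZero (a + b)}} .{{_ : NonZero (b + a)}} → Th ε a b ≋ Th ε b a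
  Th-swap ε a b {{nz}} = go (a + b) (b + a) {{nz}} (ℕ.+-comm a b)
    where
    go : ∀ n m .{{_ : NonZero n}} .{{_ : NonZero m}} → n ≡ m →
      poch∞ -1ℤ n n ⋆ (poch∞ ε b n ⋆ poch∞ ε a n) ≋ poch∞ -1ℤ m m ⋆ (poch∞ ε a m ⋆ poch∞ ε b m)
    go n m refl = P.*-congˡ (P.*-comm _ _)

  -- The sublattice itself gives φ(-q⁵)². Multiplication by i permutes the other four cosets and
  -- preserves x² + y² and the sign, so these contribute equally: -4 = 4 · (-1).
  φ-cosets : Th -1ℤ 1 1 ⋆ Th -1ℤ 1 1 ≋ Th -1ℤ 5 5 ⋆ Th -1ℤ 5 5
      ⊞ const (ℤ.- + 4) ⋆ X ⋆ (Th -1ℤ 1 9 ⋆ Th -1ℤ 3 7)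
  φ-cosets = P.trans (coset-sum (theta-sum refl 1 1)
      (class-sum refl 1 1 0F 5 5 5 5 (+ 0) (+ 0) 0 refl refl refl refl refl)
      (class-sum refl 1 1 1F 9 1 7 3 (+ 0) (+ 0) 1 refl refl refl refl refl)
      (class-sum refl 1 1 2F 3 7 9 1 (+ 1) (+ 0) 1 refl refl refl refl refl)
      (class-sum refl 1 1 3F 7 3 1 9 (+ 1) (+ 1) 1 refl refl refl refl refl)
      (class-sum refl 1 1 4F 1 9 3 7 (+ 2) (+ 1) 1 refl refl refl refl refl))
    (P.trans (P.+-congˡ (P.+-cong (P.*-congˡ (P.*-cong (Th-swap -1ℤ 9 1) (Th-swap -1ℤ 7 3)))
        (P.+-cong (P.*-congˡ (P.*-congˡ (Th-swap -1ℤ 9 1)))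
            (P.+-congʳ (P.*-congˡ (P.*-congʳ (Th-swap -1ℤ 7 3)))))))
      (solve 4 (λ p m n x → con 1ℤ :* con 1ℤ :* (p :* p) :+ (con -1ℤ :* (x :* con 1ℤ) :* (m :* n)
          :+ (con -1ℤ :* (x :* con 1ℤ) :* (n :* m)
          :+ (con -1ℤ :* (x :* con 1ℤ) :* (n :* m) :+ con -1ℤ :* (x :* con 1ℤ) :* (m :* n))))
          := p :* p :+ con (ℤ.- + 4) :* x :* (m :* n)) P.refl (Th -1ℤ 5 5) (Th -1ℤ 1 9) (Th -1ℤ 3 7)
              X))

  -- The exponent is a form in 2 x + 1 and 2 y + 1. The pair (2 x + 1 , 2 y + 1) lies in the
  -- sublattice exactly when 2 r = 1 modulo 5, so the exceptional coset is r = 3; the others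
  -- contribute equally.
  ψ-cosets : Th 1ℤ 1 0 ⋆ Th 1ℤ 1 0 ≋ X ⋆ (Th 1ℤ 5 0 ⋆ Th 1ℤ 5 0)
      ⊞ const (+ 4) ⋆ (Th 1ℤ 1 4 ⋆ Th 1ℤ 2 3)
  ψ-cosets = P.trans (coset-sum (theta-sum refl 1 0)
      (class-sum refl 1 0 0F 4 1 2 3 (+ 0) (+ 0) 0 refl refl refl refl refl)
      (class-sum refl 1 0 1F 1 4 3 2 (+ 1) (+ 0) 0 refl refl refl refl refl)
      (class-sum refl 1 0 2F 3 2 4 1 (+ 1) (+ 0) 0 refl refl refl refl refl)
      (class-sum refl 1 0 3F 5 0 5 0 (+ 1) (+ 0) 1 refl refl refl refl refl)
      (class-sum refl 1 0 4F 2 3 1 4 (+ 2) (+ 1) 0 refl refl refl refl refl))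
    (P.trans (P.+-cong (P.*-congˡ (P.*-congʳ (Th-swap 1ℤ 4 1)))
        (P.+-cong (P.*-congˡ (P.*-congˡ (Th-swap 1ℤ 3 2)))
        (P.+-congʳ (P.*-congˡ (P.*-cong (Th-swap 1ℤ 3 2) (Th-swap 1ℤ 4 1))))))
      (solve 4 (λ p m n x → con 1ℤ :* con 1ℤ :* (m :* n)
          :+ (con 1ℤ :* con 1ℤ :* (m :* n) :+ (con 1ℤ :* con 1ℤ :* (n :* m)
          :+ (con 1ℤ :* (x :* con 1ℤ) :* (p :* p) :+ con 1ℤ :* con 1ℤ :* (n :* m))))
          := x :* (p :* p) :+ con (+ 4) :* (m :* n)) P.refl (Th 1ℤ 5 0) (Th 1ℤ 1 4) (Th 1ℤ 2 3) X))

  -- The pentagonal series ∑ (-1)^m q^(m (3 m - 1) / 2), split according to m mod 5.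
  private
    pent : ℤ → PowerSeries
    pent = theta -1ℤ 1 2

    -- For m = 5 j + r the pentagonal exponent is c + 5 `expo A B (j + δ)`; the three hypotheses
    -- compare the coefficients of j², j and 1 in this equation, after doubling.
    pent-section : ∀ (r : Fin 5) A B .{{_ : NonZero (A + B)}} δ c →
      + 5 ℤ.* (+ A ℤ.+ + B) ≡ + 75 → + 10 ℤ.* (+ A ℤ.+ + B) ℤ.* δ ℤ.+ + 5 ℤ.* (+ A ℤ.- + B)
          ≡ + 30 ℤ.* + toℕ r ℤ.- + 5 →
      + 2 ℤ.* + c ℤ.+ + 5 ℤ.* Q A B δ ≡ Q 1 2 (+ toℕ r) →
      IsSum (λ j → pent (join (r , j))) (const (pow -1ℤ (+ toℕ r ℤ.- δ)) ⋆ X ^ c ⋆ dilate 5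
          (Th -1ℤ A B))
    pent-section r A B δ c h₁ h₂ h₃ = sum-cong eq P.refl
        (sum-⋆ (const s ⋆ X ^ c) (sum-reindex (ℤ._+ δ) (ℤ._- δ)
        (λ j → cancel⁺ j δ) (λ j → cancel⁻ j δ) (sum-homo (dilation 5) (theta-sum refl A B))))
      where
      s = pow -1ℤ (+ toℕ r ℤ.- δ)
      eq : ∀ j → const s ⋆ X ^ c ⋆ dilate 5 (theta -1ℤ A B (j ℤ.+ δ)) ≋ pent (join (r , j))
      eq j = P.trans (P.*-congˡ (P.trans (D.const-⋆-homo 5 (pow -1ℤ (j ℤ.+ δ)) (X ^ e))
          (P.*-congˡ (P.trans (homo-^ (dilation 5) X e) (P.trans (^-congˡ e (homo-X (dilation 5)))
              (^-assocʳ X 5 e))))))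
        (P.trans (monomial-⋆ s c (pow -1ℤ (j ℤ.+ δ)) (5 * e)) (monomial-≡ signs exps))
        where
        e = expo A B (j ℤ.+ δ)
        i = join (r , j)
        signs : s ℤ.* pow -1ℤ (j ℤ.+ δ) ≡ pow -1ℤ i
        signs = trans (sym (pow-+ refl (+ toℕ r ℤ.- δ) (j ℤ.+ δ)))
            (trans (sym (pow-even refl ((+ toℕ r ℤ.- δ) ℤ.+ (j ℤ.+ δ)) (+ 2 ℤ.* j)))
          (cong (pow -1ℤ) (trans (lem (+ toℕ r) j δ) (sym (join-≡ r j)))))
          where lem : ∀ r j δ → (r ℤ.- δ) ℤ.+ (j ℤ.+ δ) ℤ.+ (+ 2 ℤ.* j ℤ.+ + 2 ℤ.* j) ≡ + 5 ℤ.* j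
                  ℤ.+ r
                lem = ℤTactic.solve-∀
        exps : c + 5 * e ≡ expo 1 2 i
        exps = halve (trans (double-+ c (5 * e) refl (trans (cong (λ x → + 2 ℤ.* x) (ℤ.pos-* 5 e))
            (trans (comm (+ e)) (cong (λ x → + 5 ℤ.* x) (expo-double A B (j ℤ.+ δ))))))
          (trans (poly (+ A ℤ.+ + B) (+ A ℤ.- + B) δ (+ c) (+ toℕ r) j h₁ h₂ h₃)
              (sym (trans (expo-double 1 2 i) (cong (Q 1 2) (join-≡ r j))))))
          where
          comm : ∀ x → + 2 ℤ.* (+ 5 ℤ.* x) ≡ + 5 ℤ.* (+ 2 ℤ.* x)
          comm = ℤTactic.solve-∀
          lem₁ : ∀ S D δ c j → + 2 ℤ.* c ℤ.+ + 5 ℤ.* (S ℤ.* ((j ℤ.+ δ) ℤ.* (j ℤ.+ δ))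
              ℤ.+ D ℤ.* (j ℤ.+ δ))
            ≡ + 5 ℤ.* S ℤ.* (j ℤ.* j) ℤ.+ (+ 10 ℤ.* S ℤ.* δ ℤ.+ + 5 ℤ.* D) ℤ.* j
                ℤ.+ (+ 2 ℤ.* c ℤ.+ + 5 ℤ.* (S ℤ.* (δ ℤ.* δ) ℤ.+ D ℤ.* δ))
          lem₁ = ℤTactic.solve-∀
          lem₂ : ∀ r j → + 75 ℤ.* (j ℤ.* j) ℤ.+ (+ 30 ℤ.* r ℤ.- + 5) ℤ.* j
              ℤ.+ (+ 3 ℤ.* (r ℤ.* r) ℤ.+ -1ℤ ℤ.* r)
            ≡ + 3 ℤ.* ((+ 5 ℤ.* j ℤ.+ r) ℤ.* (+ 5 ℤ.* j ℤ.+ r)) ℤ.+ -1ℤ ℤ.* (+ 5 ℤ.* j ℤ.+ r)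
          lem₂ = ℤTactic.solve-∀
          poly : ∀ S D δ c r j → + 5 ℤ.* S ≡ + 75 → + 10 ℤ.* S ℤ.* δ ℤ.+ + 5 ℤ.* D
              ≡ + 30 ℤ.* r ℤ.- + 5 →
            + 2 ℤ.* c ℤ.+ + 5 ℤ.* (S ℤ.* (δ ℤ.* δ) ℤ.+ D ℤ.* δ) ≡ + 3 ℤ.* (r ℤ.* r) ℤ.+ -1ℤ ℤ.* r →
            + 2 ℤ.* c ℤ.+ + 5 ℤ.* (S ℤ.* ((j ℤ.+ δ) ℤ.* (j ℤ.+ δ)) ℤ.+ D ℤ.* (j ℤ.+ δ))
              ≡ + 3 ℤ.* ((+ 5 ℤ.* j ℤ.+ r) ℤ.* (+ 5 ℤ.* j ℤ.+ r)) ℤ.+ -1ℤ ℤ.* (+ 5 ℤ.* j ℤ.+ r)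
          poly S D δ c r j p q t = trans (lem₁ S D δ c j)
              (trans (cong₂ ℤ._+_ (cong₂ ℤ._+_ (cong (ℤ._* (j ℤ.* j)) p) (cong (ℤ._* j) q)) t)
              (lem₂ r j))

    -- The pairs of residues (r , r′) with r′ ≡ 2 r − 1 modulo 5.
    partner : Fin 5 → Fin 5
    partner 0F = 4F
    partner 1F = 1F
    partner 2F = 3F
    partner 3F = 0F
    partner 4F = 2F

    carry : Fin 5 → ℤ
    carry 0F = -1ℤ
    carry 1F = + 0
    carry 2F = + 0
    carry 3F = + 1
    carry 4F = + 1

    partner-≡ : ∀ r → + 5 ℤ.* carry r ℤ.+ + toℕ (partner r) ≡ + 2 ℤ.* + toℕ r ℤ.- + 1
    partner-≡ 0F = refl
    partner-≡ 1F = refl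
    partner-≡ 2F = refl
    partner-≡ 3F = refl
    partner-≡ 4F = refl

    -- Writing n = 2 m − 1 + 5 t, the map m ↦ 1 − m − 4 t with t fixed preserves
    -- the exponent of pent m ⋆ pent n and reverses its sign.
    partner-sum : ∀ {s : Fin 5 → PowerSeries} → (∀ r → IsSum (λ j → pent (join (r , j))) (s r)) →
      sumP (λ r → s r ⋆ s (partner r)) ≋ 0s
    partner-sum {s} A = const-cancel (+ 2)
        (P.trans (solve 1 (λ w → con (+ 2) :* w := w :- (:- w)) P.refl W)
        (P.trans (P.+-congˡ (P.-‿cong W≋-W)) (P.trans (P.-‿inverseʳ W) (P.sym (P.zeroʳ _)))))
      where
      W = sumP (λ r → s r ⋆ s (partner r))
      g : ℤ × ℤ → PowerSeries
      g (m , t) = pent m ⋆ pent (+ 2 ℤ.* m ℤ.- + 1 ℤ.+ + 5 ℤ.* t)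
      to : ℤ × ℤ → Fin 5 × (ℤ × ℤ)
      to (m , t) = let (r , i) = split m in r , i , + 2 ℤ.* i ℤ.+ t ℤ.+ carry r
      from : Fin 5 × (ℤ × ℤ) → ℤ × ℤ
      from (r , i , j) = join (r , i) , j ℤ.- + 2 ℤ.* i ℤ.- carry r
      from∘to : ∀ v → from (to v) ≡ v
      from∘to (m , t) = cong₂ _,_ (join-split m) (lem (proj₂ (split m)) t (carry (proj₁ (split m))))
        where lem : ∀ i t c → + 2 ℤ.* i ℤ.+ t ℤ.+ c ℤ.- + 2 ℤ.* i ℤ.- c ≡ t
              lem = ℤTactic.solve-∀
      to∘from : ∀ v → to (from v) ≡ v
      to∘from (r , i , j) = trans (cong (λ z → proj₁ z , proj₂ z , + 2 ℤ.* proj₂ z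
          ℤ.+ (j ℤ.- + 2 ℤ.* i ℤ.- carry r) ℤ.+ carry (proj₁ z)) (split-join (r , i)))
        (cong (λ z → r , i , z) (lem i j (carry r)))
        where lem : ∀ i j c → + 2 ℤ.* i ℤ.+ (j ℤ.- + 2 ℤ.* i ℤ.- c) ℤ.+ c ≡ j
              lem = ℤTactic.solve-∀
      index : ∀ r i t → join (partner r , + 2 ℤ.* i ℤ.+ t ℤ.+ carry r)
          ≡ + 2 ℤ.* join (r , i) ℤ.- + 1 ℤ.+ + 5 ℤ.* t
      index r i t = trans (join-≡ (partner r) _) (trans (lem₁ i t (carry r) (+ toℕ (partner r)))
          (trans (cong (λ x → + 10 ℤ.* i ℤ.+ + 5 ℤ.* t ℤ.+ x) (partner-≡ r))
        (trans (lem₂ i t (+ toℕ r)) (cong (λ x → + 2 ℤ.* x ℤ.- + 1 ℤ.+ + 5 ℤ.* t)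
            (sym (join-≡ r i))))))
        where
        lem₁ : ∀ i t c p → + 5 ℤ.* (+ 2 ℤ.* i ℤ.+ t ℤ.+ c) ℤ.+ p ≡ + 10 ℤ.* i ℤ.+ + 5 ℤ.* t
            ℤ.+ (+ 5 ℤ.* c ℤ.+ p)
        lem₁ = ℤTactic.solve-∀
        lem₂ : ∀ i t r → + 10 ℤ.* i ℤ.+ + 5 ℤ.* t ℤ.+ (+ 2 ℤ.* r ℤ.- + 1)
            ≡ + 2 ℤ.* (+ 5 ℤ.* i ℤ.+ r) ℤ.- + 1 ℤ.+ + 5 ℤ.* t
        lem₂ = ℤTactic.solve-∀
      g-sum : IsSum g W
      g-sum = sum-cong (λ (m , t) → P.*-cong (≡⇒≋ (cong pent (join-split m)))
          (≡⇒≋ (cong pent (trans (index (proj₁ (split m)) (proj₂ (split m)) t)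
              (cong (λ x → + 2 ℤ.* x ℤ.- + 1 ℤ.+ + 5 ℤ.* t) (join-split m)))))) P.refl
        (sum-reindex to from to∘from from∘to (sum-Fin 5 (λ r → sum-× (A r) (A (partner r)))))
      flip : ℤ × ℤ → ℤ × ℤ
      flip (m , t) = + 1 ℤ.- m ℤ.- + 4 ℤ.* t , t
      flip-flip : ∀ v → flip (flip v) ≡ v
      flip-flip (m , t) = cong (_, t) (lem m t)
        where lem : ∀ m t → + 1 ℤ.- (+ 1 ℤ.- m ℤ.- + 4 ℤ.* t) ℤ.- + 4 ℤ.* t ≡ m
              lem = ℤTactic.solve-∀
      W≋-W : ⊟ W ≋ W
      W≋-W = P.trans (⊟-≋ W) (sum-unique
          (sum-cong eq P.refl (sum-⋆ (const -1ℤ) (sum-reindex flip flip flip-flip flip-flip g-sum)))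
          g-sum)
        where
        eq : ∀ v → const -1ℤ ⋆ g (flip v) ≋ g v
        eq (m , t) = P.trans (P.trans (P.*-cong (P.sym (P.*-identityʳ (const -1ℤ)))
            (theta-⋆ -1ℤ 1 2 1 2 m′ n′)) (monomial-⋆ -1ℤ 0 _ (expo 1 2 m′ + expo 1 2 n′)))
          (P.trans (monomial-≡ signs exps) (P.sym (theta-⋆ -1ℤ 1 2 1 2 m n)))
          where
          n = + 2 ℤ.* m ℤ.- + 1 ℤ.+ + 5 ℤ.* t
          m′ = + 1 ℤ.- m ℤ.- + 4 ℤ.* t
          n′ = + 2 ℤ.* m′ ℤ.- + 1 ℤ.+ + 5 ℤ.* t
          lemₛ : ∀ m t → + 1 ℤ.+ (+ 1 ℤ.- m ℤ.- + 4 ℤ.* t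
              ℤ.+ (+ 2 ℤ.* (+ 1 ℤ.- m ℤ.- + 4 ℤ.* t) ℤ.- + 1 ℤ.+ + 5 ℤ.* t))
              ℤ.+ ((+ 3 ℤ.* m ℤ.+ + 6 ℤ.* t ℤ.- + 2) ℤ.+ (+ 3 ℤ.* m ℤ.+ + 6 ℤ.* t ℤ.- + 2))
            ≡ m ℤ.+ (+ 2 ℤ.* m ℤ.- + 1 ℤ.+ + 5 ℤ.* t)
          lemₛ = ℤTactic.solve-∀
          signs : -1ℤ ℤ.* (pow -1ℤ m′ ℤ.* pow -1ℤ n′) ≡ pow -1ℤ m ℤ.* pow -1ℤ n
          signs = trans (cong (λ x → -1ℤ ℤ.* x) (sym (pow-+ {ε = -1ℤ} refl m′ n′)))
              (trans (sym (pow-+ {ε = -1ℤ} refl (+ 1) (m′ ℤ.+ n′)))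
            (trans (sym (pow-even refl (+ 1 ℤ.+ (m′ ℤ.+ n′)) (+ 3 ℤ.* m ℤ.+ + 6 ℤ.* t ℤ.- + 2)))
                (trans (cong (pow -1ℤ) (lemₛ m t)) (pow-+ refl m n))))
          lemₑ : ∀ m t → let m′ = + 1 ℤ.- m ℤ.- + 4 ℤ.* t ; n = + 2 ℤ.* m ℤ.- + 1 ℤ.+ + 5 ℤ.* t ; n′ = + 2 ℤ.* m′ ℤ.- + 1 ℤ.+ + 5 ℤ.* t in
            (+ 3 ℤ.* (m′ ℤ.* m′) ℤ.+ -1ℤ ℤ.* m′) ℤ.+ (+ 3 ℤ.* (n′ ℤ.* n′) ℤ.+ -1ℤ ℤ.* n′)
            ≡ (+ 3 ℤ.* (m ℤ.* m) ℤ.+ -1ℤ ℤ.* m) ℤ.+ (+ 3 ℤ.* (n ℤ.* n) ℤ.+ -1ℤ ℤ.* n)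
          lemₑ = ℤTactic.solve-∀
          exps : expo 1 2 m′ + expo 1 2 n′ ≡ expo 1 2 m + expo 1 2 n
          exps = halve (trans (double-+ (expo 1 2 m′) _ (expo-double 1 2 m′) (expo-double 1 2 n′))
            (trans (lemₑ m t) (sym (double-+ (expo 1 2 m) _ (expo-double 1 2 m)
                (expo-double 1 2 n)))))

  -- Pentagonal exponents with m = 0, 2 modulo 5 are divisible by 5, those with m = 1 are 1 and
  -- those with m = 3, 4 are 2 modulo 5. The factors `X` come from the offsets 5 (r = 2) and 7 = 2 +
  -- 5 (r = 3).
  u x v : PowerSeries
  u = Th -1ℤ 7 8 ⊞ X ⋆ Th -1ℤ 13 2
  x = ⊟ Th -1ℤ 10 5
  v = X ⋆ Th -1ℤ 1 14 ⊞ ⊟ Th -1ℤ 4 11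

  private
    sections : Fin 5 → PowerSeries
    sections 0F = const 1ℤ ⋆ X ^ 0 ⋆ dilate 5 (Th -1ℤ 7 8)
    sections 1F = const -1ℤ ⋆ X ^ 1 ⋆ dilate 5 (Th -1ℤ 10 5)
    sections 2F = const 1ℤ ⋆ X ^ 5 ⋆ dilate 5 (Th -1ℤ 13 2)
    sections 3F = const 1ℤ ⋆ X ^ 7 ⋆ dilate 5 (Th -1ℤ 1 14)
    sections 4F = const -1ℤ ⋆ X ^ 2 ⋆ dilate 5 (Th -1ℤ 4 11)

    sections-sum : ∀ r → IsSum (λ j → pent (join (r , j))) (sections r)
    sections-sum 0F = pent-section 0F 7 8 (+ 0) 0 refl refl refl
    sections-sum 1F = pent-section 1F 10 5 (+ 0) 1 refl refl refl
    sections-sum 2F = pent-section 2F 13 2 (+ 0) 5 refl refl refl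
    sections-sum 3F = pent-section 3F 1 14 (+ 1) 7 refl refl refl
    sections-sum 4F = pent-section 4F 4 11 (+ 1) 2 refl refl refl

    dilate-X : dilate 5 X ≋ X ^ 5
    dilate-X = homo-X (dilation 5)

    dilate-u : dilate 5 u ≋ dilate 5 (Th -1ℤ 7 8) ⊞ X ^ 5 ⋆ dilate 5 (Th -1ℤ 13 2)
    dilate-u = P.trans (D.+-homo 5 (Th -1ℤ 7 8) (X ⋆ Th -1ℤ 13 2))
        (P.+-congˡ (P.trans (D.*-homo 5 X (Th -1ℤ 13 2)) (P.*-congʳ dilate-X)))

    dilate-x : dilate 5 x ≋ ⊟ dilate 5 (Th -1ℤ 10 5)
    dilate-x = homo-neg (dilation 5) (Th -1ℤ 10 5)

    dilate-v : dilate 5 v ≋ X ^ 5 ⋆ dilate 5 (Th -1ℤ 1 14) ⊞ ⊟ dilate 5 (Th -1ℤ 4 11)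
    dilate-v = P.trans (D.+-homo 5 (X ⋆ Th -1ℤ 1 14) (⊟ Th -1ℤ 4 11))
      (P.+-cong (P.trans (D.*-homo 5 X (Th -1ℤ 1 14)) (P.*-congʳ dilate-X))
          (homo-neg (dilation 5) (Th -1ℤ 4 11)))

  pentagonal-dissection : Th -1ℤ 1 2 ≋ dilate 5 u ⊞ X ⋆ dilate 5 x ⊞ X ^ 2 ⋆ dilate 5 v
  pentagonal-dissection = P.trans (sum-unique (theta-sum refl 1 2)
      (sum-cong (λ m → ≡⇒≋ (cong pent (join-split m))) P.refl
          (sum-reindex split join split-join join-split (sum-Fin 5 {s = sections} sections-sum))))
    (P.trans (P.+-congˡ (P.+-congˡ (P.+-congˡ (P.+-congˡ (P.+-identityʳ _)))))
    (P.trans (solve 6 (λ a b c d e x → con 1ℤ :* con 1ℤ :* a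
        :+ (con -1ℤ :* x :^ 1 :* b :+ (con 1ℤ :* x :^ 5 :* c
        :+ (con 1ℤ :* x :^ 7 :* d :+ con -1ℤ :* x :^ 2 :* e)))
        := a :+ x :^ 5 :* c :+ x :* (:- b) :+ x :^ 2 :* (x :^ 5 :* d :+ (:- e))) P.refl _ _ _ _ _ X)
      (P.sym (P.+-cong (P.+-cong dilate-u (P.*-congˡ dilate-x)) (P.*-congˡ dilate-v)))))

  -- The pairs of residues in `partner-sum` are (1, 1), which gives x², and (0, 4), (0, 3), (2, 3),
  -- (2, 4) up to order, which are the four products in u v. Their sum is q² (u v + x²)(q⁵).
  uv≋-x² : u ⋆ v ≋ ⊟ (x ⋆ x)
  uv≋-x² = P.trans (solve 2 (λ a b → a := (a :+ b) :- b) P.refl (u ⋆ v) (x ⋆ x))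
      (P.trans (P.+-congʳ zero′) (P.+-identityˡ _))
    where
    injective : ∀ {f g} → dilate 5 f ≋ dilate 5 g → f ≋ g
    injective {f} {g} p .at n = trans (sym (dilate-* 5 f n))
        (trans (p .at (n * 5)) (dilate-* 5 g n))
    zero′ : u ⋆ v ⊞ x ⋆ x ≋ 0s
    zero′ = injective (X^-cancel≋ 2 (P.trans
        (P.*-congˡ {X ^ 2} (P.trans (D.+-homo 5 (u ⋆ v) (x ⋆ x))
        (P.+-cong (P.trans (D.*-homo 5 u v) (P.*-cong dilate-u dilate-v))
            (P.trans (D.*-homo 5 x x) (P.*-cong dilate-x dilate-x)))))
      (P.trans (solve 6 (λ a b c d e x → x :^ 2 :* ((a :+ x :^ 5 :* c) :* (x :^ 5 :* d :+ (:- e))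
          :+ (:- b) :* (:- b))
          := con 1ℤ :* con 1ℤ :* a :* (con -1ℤ :* x :^ 2 :* e)
              :+ (con -1ℤ :* x :^ 1 :* b :* (con -1ℤ :* x :^ 1 :* b)
            :+ (con 1ℤ :* x :^ 5 :* c :* (con 1ℤ :* x :^ 7 :* d)
                :+ (con 1ℤ :* x :^ 7 :* d :* (con 1ℤ :* con 1ℤ :* a)
            :+ con -1ℤ :* x :^ 2 :* e :* (con 1ℤ :* x :^ 5 :* c))))) P.refl _ _ _ _ _ X)
      (P.trans (P.+-congˡ (P.+-congˡ (P.+-congˡ (P.+-congˡ (P.sym (P.+-identityʳ _))))))
      (P.trans (partner-sum {sections} sections-sum)
          (P.sym (P.trans (P.*-congˡ dilate-0) (P.zeroʳ _))))))))
      where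
      dilate-0 : dilate 5 0s ≋ 0s
      dilate-0 = P.trans (D.cong-h 5 (mk≋ λ { zero → refl ; (suc n) → refl })) (P.trans (D.const-homo 5 0ℤ) (mk≋ λ { zero → refl ; (suc n) → refl }))

open Lattices

-- Eta quotients for the theta series and for their differences.

module EtaQuotients where
  -- η j is the product f_j = ∏ (1 − q^(j k)).
  η : (j : ℕ) → PowerSeries
  η j = poch∞ -1ℤ j j

  η-unit : ∀ j .{{_ : NonZero j}} → Unit (η j)
  η-unit j = Unit-poch∞ -1ℤ j j (≢-nonZero⁻¹ j)

  dilate-η : ∀ m j .{{_ : NonZero m}} .{{_ : NonZero j}} .{{_ : NonZero (m * j)}} → dilate m (η j)
      ≋ η (m * j)
  dilate-η m j = dilate-poch∞ m -1ℤ j j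

  private
    odd⁻ odd⁺ plus : PowerSeries
    odd⁻ = poch∞ -1ℤ 1 2
    odd⁺ = poch∞ 1ℤ 1 2
    plus = poch∞ 1ℤ 1 1

    η₁-split : η 1 ≋ odd⁻ ⋆ η 2
    η₁-split = poch∞-split -1ℤ 1 1 2 ⨟ P.*-congʳ (P.*-identityˡ _)

    η₂-split : η 2 ≋ poch∞ -1ℤ 2 4 ⋆ η 4
    η₂-split = poch∞-split -1ℤ 2 2 2 ⨟ P.*-congʳ (P.*-identityˡ _)

    η₅-split : η 5 ≋ poch∞ -1ℤ 5 10 ⋆ η 10
    η₅-split = poch∞-split -1ℤ 5 5 2 ⨟ P.*-congʳ (P.*-identityˡ _)

    odd-parity : ∀ l → -1^ (1 + 2 * l) ≡ -1ℤ
    odd-parity zero    = refl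
    odd-parity (suc l) = trans (cong (λ n → -1^ suc n) (ℕ.*-suc 2 l))
        (trans (ℤ.neg-involutive _) (odd-parity l))

    even-parity : ∀ l → -1^ (2 + 2 * l) ≡ 1ℤ
    even-parity l = cong ℤ.-_ (odd-parity l)

  σ-η₂ : σ (η 2) ≋ η 2
  σ-η₂ = σ-poch∞ 1ℤ -1ℤ 2 2 even-parity

  -- With q ↦ -q only the odd factors change: (-q ; q²) (q ; q²) = (q² ; q⁴), and (q² ; q⁴) f₄ = f₂.
  σ-η₁ : σ (η 1) ⋆ η 1 ⋆ η 4 ≋ η 2 ^ 3
  σ-η₁ = (σH.cong-h η₁-split ⨟ σH.*-homo _ _ ⨟ (σ-poch∞ -1ℤ -1ℤ 1 2 odd-parity ⟪⋆⟫ σ-η₂))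
      ⟪⋆⟫ η₁-split ⟪⋆⟫ P.refl
    ⨟ solve 4 (λ p m e f → p :* e :* (m :* e) :* f := (p :* m) :* f :* e :^ 2) P.refl odd⁺ odd⁻
        (η 2) (η 4)
    ⨟ P.*-congʳ (P.*-congʳ (poch∞-conj 1 2) ⨟ P.sym η₂-split)

  φ-η : φ[-q] ⋆ η 2 ≋ η 1 ^ 2
  φ-η = P.*-congʳ (sum-unique φ-sum (theta-sum refl 1 1))
    ⨟ solve 2 (λ o e → e :* (o :* o) :* e := (o :* e) :^ 2) P.refl odd⁻ (η 2)
    ⨟ ^-congˡ 2 (P.sym η₁-split)

  φ≋Th : φ[-q] ≋ Th -1ℤ 1 1
  φ≋Th = sum-unique φ-sum (theta-sum refl 1 1)

  private
    plus-η : plus ⋆ η 1 ≋ η 2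
    plus-η = poch∞-conj 1 1

    ψ-product : ψ ≋ η 1 ⋆ plus ^ 2
    ψ-product = const-cancel (+ 2) (solve 1 (λ s → con (+ 2) :* s := s :+ s) P.refl ψ
      ⨟ sum-unique 2ψ-sum (theta-sum refl 1 0)
      -- The first factor of (-1 ; q) is 1 + q⁰ = 2; it accounts for the 2 in front of ψ.
      ⨟ P.*-congˡ (P.*-congʳ (poch∞-head 1ℤ 0 1))
      ⨟ solve 2 (λ e p → e :* ((con 1ℤ :+ con 1ℤ :* con 1ℤ) :* p :* p)
          := con (+ 2) :* (e :* p :^ 2)) P.refl (η 1) plus)

  ψ-η : ψ ⋆ η 1 ≋ η 2 ^ 2
  ψ-η = P.*-congʳ ψ-product ⨟ solve 2 (λ e p → e :* p :^ 2 :* e := (p :* e) :^ 2) P.refl (η 1) plus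
      ⨟ ^-congˡ 2 plus-η

  σ-involutive : ∀ f → σ (σ f) ≋ f
  σ-involutive f .at n = trans (σ-at (σ f) n) (trans (cong (λ x → -1^ n ℤ.* x) (σ-at f n))
    (trans (sym (ℤ.*-assoc (-1^ n) (-1^ n) (f n)))
        (trans (cong (ℤ._* f n) (square n)) (ℤ.*-identityˡ (f n)))))
    where
    square : ∀ n → -1^ n ℤ.* -1^ n ≡ 1ℤ
    square zero    = refl
    square (suc n) = trans (lem (-1^ n)) (square n)
      where lem : ∀ x → ℤ.- x ℤ.* ℤ.- x ≡ x ℤ.* x
            lem = ℤTactic.solve-∀

  ψ[-q]-η : ψ[-q] ⋆ η 2 ≋ η 1 ⋆ η 4
  ψ[-q]-η = ⋆-cancel {η 2 ^ 2} (Unit-^ {η 2} 2 (η-unit 2))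
    (solve 2 (λ s e → e :^ 2 :* (s :* e) := s :* e :^ 3) P.refl ψ[-q] (η 2)
    ⨟ P.*-congˡ (P.sym σ-η₁)
    ⨟ solve 4 (λ s a b c → s :* (a :* b :* c) := (s :* a) :* (b :* c)) P.refl ψ[-q] (σ (η 1)) (η 1)
        (η 4)
    ⨟ P.*-congʳ (P.*-congʳ (P.sym (σ-involutive ψ[-q])) ⨟ P.sym (σH.*-homo ψ (η 1)) ⨟ σH.cong-h ψ-η
        ⨟ homo-^ σ-substitution (η 2) 2 ⨟ ^-congˡ 2 σ-η₂))

  dilate-⋆ : ∀ m .{{_ : NonZero m}} {f g h k} → f ⋆ g ≋ h ^ k → dilate m f ⋆ dilate m g
      ≋ dilate m h ^ k
  dilate-⋆ m {f} {g} {h} {k} p = P.sym (D.*-homo m f g) ⨟ D.cong-h m p ⨟ homo-^ (dilation m) h k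

  φ₅ ψ₅ : PowerSeries
  φ₅ = dilate 5 φ[-q]
  ψ₅ = dilate 5 ψ

  φ₅-η : φ₅ ⋆ η 10 ≋ η 5 ^ 2
  φ₅-η = P.*-congˡ (P.sym (dilate-η 5 2)) ⨟ dilate-⋆ 5 {k = 2} φ-η ⨟ ^-congˡ 2 (dilate-η 5 1)

  ψ₅-η : ψ₅ ⋆ η 5 ≋ η 10 ^ 2
  ψ₅-η = P.*-congˡ (P.sym (dilate-η 5 1)) ⨟ dilate-⋆ 5 {k = 2} ψ-η ⨟ ^-congˡ 2 (dilate-η 5 2)

  ψ[-q]₅-η : dilate 5 ψ[-q] ⋆ η 10 ≋ η 5 ⋆ η 20
  ψ[-q]₅-η = P.*-congˡ (P.sym (dilate-η 5 2)) ⨟ P.sym (D.*-homo 5 ψ[-q] (η 2)) ⨟ D.cong-h 5 ψ[-q]-η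
    ⨟ D.*-homo 5 (η 1) (η 4) ⨟ (dilate-η 5 1 ⟪⋆⟫ dilate-η 5 4)

  private
    φ₅≋Th : φ₅ ≋ Th -1ℤ 5 5
    φ₅≋Th = D.cong-h 5 φ≋Th ⨟ D.*-homo 5 (η 2) _
        ⨟ (dilate-η 5 2 ⟪⋆⟫ (D.*-homo 5 odd⁻ odd⁻
        ⨟ (dilate-poch∞ 5 -1ℤ 1 2 ⟪⋆⟫ dilate-poch∞ 5 -1ℤ 1 2)))

    ψ₅≋Th : ψ₅ ⊞ ψ₅ ≋ Th 1ℤ 5 0
    ψ₅≋Th = P.sym (D.+-homo 5 ψ ψ) ⨟ D.cong-h 5 (sum-unique 2ψ-sum (theta-sum refl 1 0))
        ⨟ D.*-homo 5 (η 1) _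
      ⨟ (dilate-η 5 1 ⟪⋆⟫ (D.*-homo 5 (poch∞ 1ℤ 0 1) plus
          ⨟ (dilate-poch∞ 5 1ℤ 0 1 ⟪⋆⟫ dilate-poch∞ 5 1ℤ 1 1)))

  M W : PowerSeries
  M = Th -1ℤ 1 9 ⋆ Th -1ℤ 3 7
  W = Th 1ℤ 1 4 ⋆ Th 1ℤ 2 3

  φ-difference : φ[-q] ^ 2 ≋ φ₅ ^ 2 ⊞ const (ℤ.- + 4) ⋆ X ⋆ M
  φ-difference = ^-congˡ 2 φ≋Th ⨟ solve 1 (λ a → a :^ 2 := a :* a) P.refl (Th -1ℤ 1 1) ⨟ φ-cosets
    ⨟ P.+-congʳ (solve 1 (λ a → a :* a := a :^ 2) P.refl (Th -1ℤ 5 5) ⨟ ^-congˡ 2 (P.sym φ₅≋Th))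

  ψ-difference : ψ ^ 2 ≋ X ⋆ ψ₅ ^ 2 ⊞ W
  ψ-difference = const-cancel (+ 4) (solve 1 (λ a → con (+ 4) :* a :^ 2 := (a :+ a) :* (a :+ a))
      P.refl ψ
    ⨟ (2ψ≋ ⟪⋆⟫ 2ψ≋) ⨟ ψ-cosets ⨟ P.+-congʳ (P.*-congˡ (P.sym (ψ₅≋Th ⟪⋆⟫ ψ₅≋Th)))
    ⨟ solve 3 (λ x a w → x :* ((a :+ a) :* (a :+ a)) :+ con (+ 4) :* w
        := con (+ 4) :* (x :* a :^ 2 :+ w)) P.refl X ψ₅ W)
    where 2ψ≋ = sum-unique 2ψ-sum (theta-sum refl 1 0)

  -- The residues 1, 3, 7, 9 modulo 10 in `M` are completed to all odd residues by the factor (q⁵ ;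
  -- q¹⁰) of f₅. In `W-η` the residues 1, 2, 3, 4 modulo 5 are completed by (-q⁵ ; q⁵) = f₁₀ / f₅.
  M-η : M ⋆ η 2 ⋆ η 5 ≋ η 1 ⋆ η 10 ^ 3
  M-η = P.*-congˡ η₅-split
    ⨟ solve 7 (λ e t a b c d f → e :* (a :* b) :* (e :* (c :* d)) :* t :* (f :* e)
        := (con 1ℤ :* b :* d :* f :* c :* a) :* t :* e :^ 3) P.refl
        (η 10) (η 2) (poch∞ -1ℤ 9 10) (poch∞ -1ℤ 1 10) (poch∞ -1ℤ 7 10) (poch∞ -1ℤ 3 10)
            (poch∞ -1ℤ 5 10)
    ⨟ P.*-congʳ (P.*-congʳ (P.sym (poch∞-split -1ℤ 1 2 5)) ⨟ P.sym η₁-split)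

  W-η : W ⋆ η 1 ⋆ η 10 ≋ η 2 ⋆ η 5 ^ 3
  W-η = P.*-congˡ (P.sym (poch∞-conj 5 5))
    ⨟ solve 7 (λ e t a b c d f → e :* (a :* b) :* (e :* (c :* d)) :* t :* (f :* e)
        := (con 1ℤ :* b :* d :* c :* a :* f) :* t :* e :^ 3) P.refl
        (η 5) (η 1) (poch∞ 1ℤ 4 5) (poch∞ 1ℤ 1 5) (poch∞ 1ℤ 3 5) (poch∞ 1ℤ 2 5) (poch∞ 1ℤ 5 5)
    ⨟ P.*-congʳ (P.*-congʳ (P.sym (poch∞-split 1ℤ 1 1 5)) ⨟ plus-η)

  -- The pentagonal number theorem.
  pentagonal : η 1 ≋ Th -1ℤ 1 2
  pentagonal = poch∞-split -1ℤ 1 1 3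
    ⨟ solve 3 (λ a b c → con 1ℤ :* a :* b :* c := c :* (b :* a)) P.refl (poch∞ -1ℤ 1 3)
        (poch∞ -1ℤ 2 3) (poch∞ -1ℤ 3 3)

  x≋-η₅ : x ≋ ⊟ η 5
  x≋-η₅ = P.-‿cong (P.sym (poch∞-split -1ℤ 5 5 3
    ⨟ solve 3 (λ a b c → con 1ℤ :* a :* b :* c := c :* (a :* b)) P.refl (poch∞ -1ℤ 5 15)
        (poch∞ -1ℤ 10 15) (poch∞ -1ℤ 15 15)))

open EtaQuotients

-- Relations between C(q), C(-q), C(q²) and C(q⁴): the Hecke relations at 2.

module TwoDissections where
  -1^-odd-* : ∀ m → -1^ m ≡ -1ℤ → ∀ k → -1^ (k * m) ≡ -1^ k
  -1^-odd-* m odd zero    = refl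
  -1^-odd-* m odd (suc k) = trans (go m) (trans (cong₂ ℤ._*_ odd (-1^-odd-* m odd k)) (ℤ.-1*i≡-i _))
    where
    go : ∀ j → -1^ (j + k * m) ≡ -1^ j ℤ.* -1^ (k * m)
    go zero    = sym (ℤ.*-identityˡ _)
    go (suc j) = trans (cong ℤ.-_ (go j)) (ℤ.neg-distribˡ-* (-1^ j) (-1^ (k * m)))

  σ-dilate : ∀ m .{{_ : NonZero m}} → -1^ m ≡ -1ℤ → ∀ f → σ (dilate m f) ≋ dilate m (σ f)
  σ-dilate m odd f .at n = go n (m ∣? n)
    where
    go : ∀ n → Dec (m ∣ n) → σ (dilate m f) n ≡ dilate m (σ f) n
    go n (no ¬m∣) = trans (σ-at (dilate m f) n) (trans (cong (λ x → -1^ n ℤ.* x) (dilate-∤ m f ¬m∣))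
      (trans (ℤ.*-zeroʳ (-1^ n)) (sym (dilate-∤ m (σ f) ¬m∣))))
    go n (yes (divides k refl)) = trans (σ-at (dilate m f) (k * m))
        (trans (cong₂ ℤ._*_ (-1^-odd-* m odd k) (dilate-* m f k))
      (trans (sym (σ-at f k)) (sym (dilate-* m (σ f) k))))

  -1^-even : ∀ k → -1^ (k * 2) ≡ 1ℤ
  -1^-even zero    = refl
  -1^-even (suc k) = trans (ℤ.neg-involutive _) (-1^-even k)

  σ-dilate₂ : ∀ f → σ (dilate 2 f) ≋ dilate 2 f
  σ-dilate₂ f .at n = go n (2 ∣? n)
    where
    go : ∀ n → Dec (2 ∣ n) → σ (dilate 2 f) n ≡ dilate 2 f n
    go n (no ¬2∣) = trans (σ-at (dilate 2 f) n) (trans (cong (λ x → -1^ n ℤ.* x) (dilate-∤ 2 f ¬2∣))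
      (trans (ℤ.*-zeroʳ (-1^ n)) (sym (dilate-∤ 2 f ¬2∣))))
    go n (yes (divides k refl)) = trans (σ-at (dilate 2 f) (k * 2))
      (trans (cong (ℤ._* dilate 2 f (k * 2)) (-1^-even k)) (ℤ.*-identityˡ _))

  -- Only the product formula of C enters; that the core numbers satisfy it is a separate matter.
  module Dissection (C : PowerSeries) (C-η : C ⋆ η 1 ≋ η 5 ^ 5) where
    C₂ C₄ A B F F₂ F₄ : PowerSeries
    C₂ = dilate 2 C
    C₄ = dilate 2 C₂
    A = dilate 5 φ[-q] ^ 5 ⊘ φ[-q]
    B = dilate 5 ψ[-q] ^ 5 ⊘ ψ[-q]
    F = η 1 ^ 5 ⊘ η 5
    F₂ = dilate 2 F
    F₄ = dilate 2 F₂

    C₂-η : C₂ ⋆ η 2 ≋ η 10 ^ 5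
    C₂-η = P.*-congˡ (P.sym (dilate-η 2 1)) ⨟ dilate-⋆ 2 {k = 5} C-η ⨟ ^-congˡ 5 (dilate-η 2 5)

    C₄-η : C₄ ⋆ η 4 ≋ η 20 ^ 5
    C₄-η = P.*-congˡ (P.sym (dilate-η 2 2)) ⨟ dilate-⋆ 2 {k = 5} C₂-η ⨟ ^-congˡ 5 (dilate-η 2 10)

    F-η : F ⋆ η 5 ≋ η 1 ^ 5
    F-η = ⊘-⋆ (η 1 ^ 5) (η-unit 5)

    F₂-η : F₂ ⋆ η 10 ≋ η 2 ^ 5
    F₂-η = P.*-congˡ (P.sym (dilate-η 2 5)) ⨟ dilate-⋆ 2 {k = 5} F-η ⨟ ^-congˡ 5 (dilate-η 2 1)

    private
      quotient-unit : ∀ {f g h} → Unit f → Unit g → h ⋆ f ≋ g → Unit h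
      quotient-unit {f} {g} {h} uf ug p =
          trans (sym (trans (⋆-zero h f) (trans (cong (λ x → h 0 ℤ.* x) uf) (ℤ.*-identityʳ _))))
          (trans (p .at 0) ug)

    C-unit : Unit C
    C-unit = quotient-unit {η 1} {η 5 ^ 5} (η-unit 1) (Unit-^ {η 5} 5 (η-unit 5)) C-η

    F-unit : Unit F
    F-unit = quotient-unit {η 5} {η 1 ^ 5} (η-unit 5) (Unit-^ {η 1} 5 (η-unit 1)) F-η

    C₂-unit : Unit C₂
    C₂-unit = homo-Unit (dilation 2) {C} C-unit

    C₄-unit : Unit C₄
    C₄-unit = homo-Unit (dilation 2) {C₂} C₂-unit

    φ-unit : Unit φ[-q]
    φ-unit = refl

    ψ[-q]-unit : Unit ψ[-q]
    ψ[-q]-unit = refl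

    U V : PowerSeries
    U = C ⊞ X ⋆ C₂
    V = C ⊞ const (ℤ.- + 4) ⋆ X ⋆ C₂

    -- Over the common denominator f₁ f₂ and with `W-η`, the numerator contains W + q ψ(q⁵)², which
    -- is ψ(q)². For `V-η` the corresponding combination is φ(-q⁵)² - 4 q M = φ(-q)².
    U-η : U ⋆ η 1 ^ 2 ≋ η 2 ^ 3 ⋆ η 5 ^ 2 ⋆ η 10
    U-η = ⋆-cancel {η 2} (η-unit 2) (
      solve 5 (λ c d x a b → b :* ((c :+ x :* d) :* a :^ 2) := (c :* a) :* (a :* b)
          :+ x :* (d :* b) :* a :^ 2) P.refl C C₂ X (η 1) (η 2)
      ⨟ ((C-η ⟪⋆⟫ P.refl) ⟪⊞⟫ (P.*-congˡ C₂-η ⟪⋆⟫ P.refl))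
      ⨟ solve 5 (λ x a b e t → e :^ 5 :* (a :* b) :+ x :* t :^ 5 :* a :^ 2
          := x :* a :^ 2 :* t :* (t :^ 2) :^ 2 :+ (b :* e :^ 3) :* a :* e :^ 2) P.refl X (η 1) (η 2)
          (η 5) (η 10)
      ⨟ (P.*-congˡ (^-congˡ 2 (P.sym ψ₅-η)) ⟪⊞⟫ P.*-congʳ (P.*-congʳ (P.sym W-η)))
      ⨟ solve 6 (λ x a e t s w → x :* a :^ 2 :* t :* (s :* e) :^ 2 :+ w :* a :* t :* a :* e :^ 2
          := (x :* s :^ 2 :+ w) :* (a :^ 2 :* e :^ 2 :* t)) P.refl X (η 1) (η 5) (η 10) ψ₅ W
      ⨟ P.*-congʳ (P.sym ψ-difference)
      ⨟ solve 4 (λ s a e t → s :^ 2 :* (a :^ 2 :* e :^ 2 :* t) := (s :* a) :^ 2 :* e :^ 2 :* t)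
          P.refl ψ (η 1) (η 5) (η 10)
      ⨟ P.*-congʳ (P.*-congʳ (^-congˡ 2 ψ-η))
      ⨟ solve 3 (λ b e t → (b :^ 2) :^ 2 :* e :^ 2 :* t := b :* (b :^ 3 :* e :^ 2 :* t)) P.refl
          (η 2) (η 5) (η 10))

    V-η : V ⋆ η 2 ^ 2 ≋ η 1 ^ 3 ⋆ η 5 ⋆ η 10 ^ 2
    V-η = ⋆-cancel {η 1} (η-unit 1) (
      solve 5 (λ c d x a b → a :* ((c :+ con (ℤ.- + 4) :* x :* d) :* b :^ 2) := (c :* a) :* b :^ 2
          :+ con (ℤ.- + 4) :* x :* (d :* b) :* (a :* b)) P.refl C C₂ X (η 1) (η 2)
      ⨟ ((C-η ⟪⋆⟫ P.refl) ⟪⊞⟫ (P.*-congˡ C₂-η ⟪⋆⟫ P.refl))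
      ⨟ solve 5 (λ x a b e t → e :^ 5 :* b :^ 2 :+ con (ℤ.- + 4) :* x :* t :^ 5 :* (a :* b)
          := (e :^ 2) :^ 2 :* b :^ 2 :* e :+ con (ℤ.- + 4) :* x :* (a :* t :^ 3) :* b :* t :^ 2)
              P.refl X (η 1) (η 2) (η 5) (η 10)
      ⨟ (P.*-congʳ (P.*-congʳ (^-congˡ 2 (P.sym φ₅-η)))
          ⟪⊞⟫ P.*-congʳ (P.*-congʳ (P.*-congˡ (P.sym M-η))))
      ⨟ solve 6 (λ x b e t s m → (s :* t) :^ 2 :* b :^ 2 :* e
          :+ con (ℤ.- + 4) :* x :* (m :* b :* e) :* b :* t :^ 2
          := (s :^ 2 :+ con (ℤ.- + 4) :* x :* m) :* (b :^ 2 :* t :^ 2 :* e)) P.refl X (η 2) (η 5)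
              (η 10) φ₅ M
      ⨟ P.*-congʳ (P.sym φ-difference)
      ⨟ solve 4 (λ s b t e → s :^ 2 :* (b :^ 2 :* t :^ 2 :* e) := (s :* b) :^ 2 :* t :^ 2 :* e)
          P.refl φ[-q] (η 2) (η 10) (η 5)
      ⨟ P.*-congʳ (P.*-congʳ (^-congˡ 2 φ-η))
      ⨟ solve 3 (λ a t e → (a :^ 2) :^ 2 :* t :^ 2 :* e := a :* (a :^ 3 :* e :* t :^ 2)) P.refl
          (η 1) (η 10) (η 5))

    F-UV : F ⋆ C ⋆ C₂ ≋ V ^ 2 ⋆ U
    F-UV = ⋆-cancel {η 1 ^ 2 ⋆ η 2 ^ 4 ⋆ η 5}
        (Unit-⋆ {η 1 ^ 2 ⋆ η 2 ^ 4} (Unit-⋆ {η 1 ^ 2} (Unit-^ {η 1} 2 (η-unit 1))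
        (Unit-^ {η 2} 4 (η-unit 2))) (η-unit 5)) (
      solve 6 (λ f c d a b e → (a :^ 2 :* b :^ 4 :* e) :* (f :* c :* d)
          := (f :* e) :* (c :* a) :* (d :* b) :* (a :* b :^ 3)) P.refl F C C₂ (η 1) (η 2) (η 5)
      ⨟ P.*-congʳ ((F-η ⟪⋆⟫ C-η) ⟪⋆⟫ C₂-η)
      ⨟ solve 4 (λ a b e t → a :^ 5 :* e :^ 5 :* t :^ 5 :* (a :* b :^ 3)
          := (a :^ 3 :* e :* t :^ 2) :^ 2 :* (b :^ 3 :* e :^ 2 :* t) :* e) P.refl (η 1) (η 2) (η 5)
          (η 10)
      ⨟ P.*-congʳ (^-congˡ 2 (P.sym V-η) ⟪⋆⟫ P.sym U-η)
      ⨟ solve 5 (λ u v a b e → (v :* b :^ 2) :^ 2 :* (u :* a :^ 2) :* e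
          := (a :^ 2 :* b :^ 4 :* e) :* (v :^ 2 :* u)) P.refl U V (η 1) (η 2) (η 5))

    F₂-UV : F₂ ⋆ C ⋆ C₂ ≋ V ⋆ U ^ 2
    F₂-UV = ⋆-cancel {η 1 ^ 4 ⋆ η 2 ^ 2 ⋆ η 10}
        (Unit-⋆ {η 1 ^ 4 ⋆ η 2 ^ 2} (Unit-⋆ {η 1 ^ 4} (Unit-^ {η 1} 4 (η-unit 1))
        (Unit-^ {η 2} 2 (η-unit 2))) (η-unit 10)) (
      solve 6 (λ f c d a b t → (a :^ 4 :* b :^ 2 :* t) :* (f :* c :* d)
          := (f :* t) :* (c :* a) :* (d :* b) :* (a :^ 3 :* b)) P.refl F₂ C C₂ (η 1) (η 2) (η 10)
      ⨟ P.*-congʳ ((F₂-η ⟪⋆⟫ C-η) ⟪⋆⟫ C₂-η)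
      ⨟ solve 4 (λ a b e t → b :^ 5 :* e :^ 5 :* t :^ 5 :* (a :^ 3 :* b)
          := (a :^ 3 :* e :* t :^ 2) :* (b :^ 3 :* e :^ 2 :* t) :^ 2 :* t) P.refl (η 1) (η 2) (η 5)
          (η 10)
      ⨟ P.*-congʳ (P.sym V-η ⟪⋆⟫ ^-congˡ 2 (P.sym U-η))
      ⨟ solve 5 (λ u v a b t → (v :* b :^ 2) :* (u :* a :^ 2) :^ 2 :* t
          := (a :^ 4 :* b :^ 2 :* t) :* (v :* u :^ 2)) P.refl U V (η 1) (η 2) (η 10))

    private
      dilate₂-X : dilate 2 X ≋ X ^ 2
      dilate₂-X = homo-X (dilation 2)

      U₂ V₂ : PowerSeries
      U₂ = C₂ ⊞ X ^ 2 ⋆ C₄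
      V₂ = C₂ ⊞ const (ℤ.- + 4) ⋆ X ^ 2 ⋆ C₄

      dilate-U : dilate 2 U ≋ U₂
      dilate-U = D.+-homo 2 C (X ⋆ C₂) ⨟ P.+-congˡ (D.*-homo 2 X C₂ ⨟ P.*-congʳ dilate₂-X)

      dilate-V : dilate 2 V ≋ V₂
      dilate-V = D.+-homo 2 C _ ⨟ P.+-congˡ (D.*-homo 2 _ C₂
          ⨟ P.*-congʳ (D.const-⋆-homo 2 (ℤ.- + 4) X ⨟ P.*-congˡ dilate₂-X))

      triple : ∀ f g h → dilate 2 (f ⋆ g ⋆ h) ≋ dilate 2 f ⋆ dilate 2 g ⋆ dilate 2 h
      triple f g h = D.*-homo 2 (f ⋆ g) h ⨟ P.*-congʳ (D.*-homo 2 f g)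

    -- `F-UV` with q² for q. It expresses F(q²) by C₂ and C₄, whereas `F₂-UV` expresses it by C and
    -- C₂; eliminating F(q²) ties C to C₂ and C₄.
    F₂-UV₂ : F₂ ⋆ C₂ ⋆ C₄ ≋ V₂ ^ 2 ⋆ U₂
    F₂-UV₂ = P.sym (triple F C C₂) ⨟ D.cong-h 2 F-UV ⨟ D.*-homo 2 (V ^ 2) U
        ⨟ ((homo-^ (dilation 2) V 2 ⨟ ^-congˡ 2 dilate-V) ⟪⋆⟫ dilate-U)

    F₄-UV₂ : F₄ ⋆ C₂ ⋆ C₄ ≋ V₂ ⋆ U₂ ^ 2
    F₄-UV₂ = P.sym (triple F₂ C C₂) ⨟ D.cong-h 2 F₂-UV ⨟ D.*-homo 2 V (U ^ 2)
        ⨟ (dilate-V ⟪⋆⟫ (homo-^ (dilation 2) U 2 ⨟ ^-congˡ 2 dilate-U))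

    σC : PowerSeries
    σC = σ C

    -- The fifth power of `σ-η₁` in q⁵, divided by `σ-η₁` itself.
    σC-product : σC ⋆ C ⋆ C₄ ≋ C₂ ^ 3
    σC-product = ⋆-cancel {η 2 ^ 3} (Unit-^ {η 2} 3 (η-unit 2)) (
      P.*-congʳ (P.sym σ-η₁)
      ⨟ solve 6 (λ s c d a b e → (a :* b :* e) :* (s :* c :* d) := (s :* a) :* (c :* b) :* (d :* e))
          P.refl σC C C₄ (σ (η 1)) (η 1) (η 4)
      ⨟ (((P.sym (σH.*-homo C (η 1)) ⨟ σH.cong-h C-η ⨟ homo-^ σ-substitution (η 5) 5) ⟪⋆⟫ C-η)
          ⟪⋆⟫ C₄-η)
      ⨟ solve 3 (λ a b c → a :^ 5 :* b :^ 5 :* c :^ 5 := (a :* b :* c) :^ 5) P.refl (σ (η 5)) (η 5)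
          (η 20)
      ⨟ ^-congˡ 5 σ-η₅
      ⨟ solve 1 (λ t → (t :^ 3) :^ 5 := (t :^ 5) :^ 3) P.refl (η 10)
      ⨟ ^-congˡ 3 (P.sym C₂-η)
      ⨟ solve 2 (λ d b → (d :* b) :^ 3 := b :^ 3 :* d :^ 3) P.refl C₂ (η 2))
      where
      σ-η₅ : σ (η 5) ⋆ η 5 ⋆ η 20 ≋ η 10 ^ 3
      σ-η₅ = ((σH.cong-h (P.sym (dilate-η 5 1)) ⨟ σ-dilate 5 refl (η 1)) ⟪⋆⟫ P.sym (dilate-η 5 1))
          ⟪⋆⟫ P.sym (dilate-η 5 4)
        ⨟ P.*-congʳ (P.sym (D.*-homo 5 (σ (η 1)) (η 1))) ⨟ dilate-⋆ 5 {k = 3} σ-η₁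
            ⨟ ^-congˡ 3 (dilate-η 5 2)

    -- The two expressions of F₂ differ by a unit times the relation below.
    C-relation : C ^ 2 ⋆ C₄ ⊞ ⊟ (const (+ 2) ⋆ X ⋆ C ⋆ C₂ ⋆ C₄ ⊞ const (+ 4) ⋆ X ^ 3 ⋆ C ⋆ C₄ ^ 2)
        ≋ C₂ ^ 3
    C-relation = ⋆-cancel {E} E-unit (
      solve 4 (λ c d e x → (c :+ con (+ 4) :* x :^ 3 :* e) :* (c :^ 2 :* e
          :+ (:- (con (+ 2) :* x :* c :* d :* e :+ con (+ 4) :* x :^ 3 :* c :* e :^ 2)))
          := (c :+ con (+ 4) :* x :^ 3 :* e) :* d :^ 3
              :+ (e :* ((c :+ con (ℤ.- + 4) :* x :* d) :* (c :+ x :* d) :^ 2)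
            :- c :* ((d :+ con (ℤ.- + 4) :* x :^ 2 :* e) :^ 2 :* (d :+ x :^ 2 :* e)))) P.refl C C₂
                C₄ X
      ⨟ P.+-congˡ (P.+-cong (P.*-congˡ (P.sym F₂-UV)) (P.-‿cong (P.*-congˡ (P.sym F₂-UV₂)))
        ⨟ solve 4 (λ f c d e → e :* (f :* c :* d) :- c :* (f :* d :* e) := con 0ℤ) P.refl F₂ C C₂
            C₄)
      ⨟ solve 2 (λ e d → e :* d :^ 3 :+ con 0ℤ := e :* d :^ 3) P.refl E C₂)
      where
      E : PowerSeries
      E = C ⊞ const (+ 4) ⋆ X ^ 3 ⋆ C₄
      E-unit : Unit E
      E-unit = trans (⊞-at C _ 0) (trans
          (cong₂ ℤ._+_ C-unit (trans (⋆-zero _ C₄)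
          (cong (ℤ._* C₄ 0) (trans (⋆-zero (const (+ 4)) (X ^ 3))
          (cong (λ x → + 4 ℤ.* x) (X^-≢ 3 {0} λ ())))))) refl)

    -- Once C₂³ is replaced by σC · C · C₄, every term of `C-relation` contains the unit C · C₄,
    -- which is cancelled.
    C-odd : C ⊞ ⊟ σC ≋ const (+ 2) ⋆ X ⋆ C₂ ⊞ const (+ 4) ⋆ X ^ 3 ⋆ C₄
    C-odd = ⋆-cancel {C ⋆ C₄} (Unit-⋆ {C} C-unit C₄-unit) (
      solve 3 (λ c e s → (c :* e) :* (c :+ (:- s)) := c :^ 2 :* e :- s :* c :* e) P.refl C C₄ σC
      ⨟ P.+-congˡ (P.-‿cong (σC-product ⨟ P.sym C-relation))
      ⨟ solve 4 (λ c d e x → c :^ 2 :* e :- (c :^ 2 :* e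
          :+ (:- (con (+ 2) :* x :* c :* d :* e :+ con (+ 4) :* x :^ 3 :* c :* e :^ 2)))
          := (c :* e) :* (con (+ 2) :* x :* d :+ con (+ 4) :* x :^ 3 :* e)) P.refl C C₂ C₄ X)

    A-product : A ⋆ C₂ ≋ C ^ 2
    A-product = ⋆-cancel {φ[-q] ⋆ η 2 ⋆ η 10 ^ 5}
        (Unit-⋆ {φ[-q] ⋆ η 2} (Unit-⋆ {φ[-q]} φ-unit (η-unit 2)) (Unit-^ {η 10} 5 (η-unit 10))) (
      solve 5 (λ s b t a d → (s :* b :* t :^ 5) :* (a :* d) := (a :* s) :* t :^ 5 :* (d :* b))
          P.refl φ[-q] (η 2) (η 10) A C₂
      ⨟ (P.*-congʳ (⊘-⋆ (φ₅ ^ 5) φ-unit) ⟪⋆⟫ C₂-η)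
      ⨟ solve 2 (λ s t → s :^ 5 :* t :^ 5 :* t :^ 5 := (s :* t) :^ 5 :* t :^ 5) P.refl φ₅ (η 10)
      ⨟ P.*-congʳ (^-congˡ 5 φ₅-η)
      ⨟ solve 2 (λ e t → (e :^ 2) :^ 5 :* t :^ 5 := (e :^ 5) :^ 2 :* t :^ 5) P.refl (η 5) (η 10)
      ⨟ P.*-congʳ (^-congˡ 2 (P.sym C-η))
      ⨟ solve 3 (λ c a t → (c :* a) :^ 2 :* t :^ 5 := a :^ 2 :* (t :^ 5 :* c :^ 2)) P.refl C (η 1)
          (η 10)
      ⨟ P.*-congʳ (P.sym φ-η)
      ⨟ solve 4 (λ s b t c → s :* b :* (t :^ 5 :* c :^ 2) := (s :* b :* t :^ 5) :* c :^ 2) P.refl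
          φ[-q] (η 2) (η 10) C)

    B-product : B ⋆ C₂ ≋ C ⋆ C₄
    B-product = ⋆-cancel {ψ[-q] ⋆ η 2 ⋆ η 10 ^ 5}
        (Unit-⋆ {ψ[-q] ⋆ η 2} (Unit-⋆ {ψ[-q]} ψ[-q]-unit (η-unit 2)) (Unit-^ {η 10} 5 (η-unit 10)))
        (
      solve 5 (λ s b t a d → (s :* b :* t :^ 5) :* (a :* d) := (a :* s) :* t :^ 5 :* (d :* b))
          P.refl ψ[-q] (η 2) (η 10) B C₂
      ⨟ (P.*-congʳ (⊘-⋆ (dilate 5 ψ[-q] ^ 5) ψ[-q]-unit) ⟪⋆⟫ C₂-η)
      ⨟ solve 2 (λ s t → s :^ 5 :* t :^ 5 :* t :^ 5 := (s :* t) :^ 5 :* t :^ 5) P.refl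
          (dilate 5 ψ[-q]) (η 10)
      ⨟ P.*-congʳ (^-congˡ 5 ψ[-q]₅-η)
      ⨟ solve 3 (λ e w t → (e :* w) :^ 5 :* t :^ 5 := e :^ 5 :* w :^ 5 :* t :^ 5) P.refl (η 5)
          (η 20) (η 10)
      ⨟ P.*-congʳ (P.sym C-η ⟪⋆⟫ P.sym C₄-η)
      ⨟ solve 5 (λ c a d e t → c :* a :* (d :* e) :* t :^ 5 := (a :* e) :* (t :^ 5 :* (c :* d)))
          P.refl C (η 1) C₄ (η 4) (η 10)
      ⨟ P.*-congʳ (P.sym ψ[-q]-η)
      ⨟ solve 5 (λ s b t c d → s :* b :* (t :^ 5 :* (c :* d)) := (s :* b :* t :^ 5) :* (c :* d))
          P.refl ψ[-q] (η 2) (η 10) C C₄)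

    σA σB σF : PowerSeries
    σA = σ A
    σB = σ B
    σF = σ F

    private
      σC₂ : σ C₂ ≋ C₂
      σC₂ = σ-dilate₂ C

      σC₄ : σ C₄ ≋ C₄
      σC₄ = σ-dilate₂ C₂

      σA-product : σA ⋆ C₂ ≋ σC ^ 2
      σA-product = P.*-congˡ (P.sym σC₂) ⨟ P.sym (σH.*-homo A C₂) ⨟ σH.cong-h A-product
          ⨟ homo-^ σ-substitution C 2

      σB-product : σB ⋆ C₂ ≋ σC ⋆ C₄
      σB-product = P.*-congˡ (P.sym σC₂) ⨟ P.sym (σH.*-homo B C₂) ⨟ σH.cong-h B-product
          ⨟ σH.*-homo C C₄ ⨟ P.*-congˡ σC₄

      -- Thus B(-q) = C(q²)² / C(q). In `B-odd` and `F-expansion` such quotients are left over, and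
      -- this identifies them.
      σB-square : σB ⋆ C ≋ C₂ ^ 2
      σB-square = ⋆-cancel {C₂} C₂-unit (solve 3 (λ b c d → d :* (b :* c) := (b :* d) :* c) P.refl
          σB C C₂
        ⨟ P.*-congʳ σB-product ⨟ solve 3 (λ s d c → s :* d :* c := s :* c :* d) P.refl σC C₄ C
            ⨟ σC-product
        ⨟ solve 1 (λ d → d :^ 3 := d :* d :^ 2) P.refl C₂)

      σB₂-square : dilate 2 σB ⋆ C₂ ≋ C₄ ^ 2
      σB₂-square = dilate-⋆ 2 {k = 2} σB-square

    B-odd : B ⊞ ⊟ σB ≋ const (+ 2) ⋆ X ⋆ C₄ ⊞ const (+ 4) ⋆ X ^ 3 ⋆ dilate 2 σB
    B-odd = ⋆-cancel {C₂} C₂-unit (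
      solve 3 (λ b s d → d :* (b :+ (:- s)) := b :* d :- s :* d) P.refl B σB C₂
      ⨟ P.+-cong B-product (P.-‿cong σB-product)
      ⨟ solve 3 (λ c s e → c :* e :- s :* e := (c :+ (:- s)) :* e) P.refl C σC C₄
      ⨟ P.*-congʳ C-odd
      ⨟ solve 3 (λ x d e → (con (+ 2) :* x :* d :+ con (+ 4) :* x :^ 3 :* e) :* e
          := con (+ 2) :* x :* d :* e :+ con (+ 4) :* x :^ 3 :* e :^ 2) P.refl X C₂ C₄
      ⨟ P.+-congˡ (P.*-congˡ (P.sym σB₂-square))
      ⨟ solve 4 (λ x d e b → con (+ 2) :* x :* d :* e :+ con (+ 4) :* x :^ 3 :* (b :* d)
          := d :* (con (+ 2) :* x :* e :+ con (+ 4) :* x :^ 3 :* b)) P.refl X C₂ C₄ (dilate 2 σB))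

    A-odd : A ⊞ ⊟ σA ≋ const (+ 2) ⋆ X ⋆ (C ⊞ σC) ⊞ const (+ 4) ⋆ X ^ 3 ⋆ (B ⊞ σB)
    A-odd = ⋆-cancel {C₂} C₂-unit (
      solve 3 (λ b s d → d :* (b :+ (:- s)) := b :* d :- s :* d) P.refl A σA C₂
      ⨟ P.+-cong A-product (P.-‿cong σA-product)
      ⨟ solve 2 (λ c s → c :^ 2 :- s :^ 2 := (c :+ (:- s)) :* (c :+ s)) P.refl C σC
      ⨟ P.*-congʳ C-odd
      ⨟ solve 5 (λ x d e c s → (con (+ 2) :* x :* d :+ con (+ 4) :* x :^ 3 :* e) :* (c :+ s)
          := d :* (con (+ 2) :* x :* (c :+ s)) :+ con (+ 4) :* x :^ 3 :* (c :* e :+ s :* e)) P.refl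
              X C₂ C₄ C σC
      ⨟ P.+-congˡ (P.*-congˡ (P.+-cong (P.sym B-product) (P.sym σB-product)))
      ⨟ solve 6 (λ x d c s b t → d :* (con (+ 2) :* x :* (c :+ s))
          :+ con (+ 4) :* x :^ 3 :* (b :* d :+ t :* d)
          := d :* (con (+ 2) :* x :* (c :+ s) :+ con (+ 4) :* x :^ 3 :* (b :+ t))) P.refl X C₂ C σC
              B σB)

    -- F = V² U / (C C₂). Expanding V² U and dividing the monomials C³, C² C₂, C C₂², C₂³ by C C₂
    -- gives A, C, C₂ and B(-q).
    F-expansion : F ≋ A ⊞ const (ℤ.- + 7) ⋆ X ⋆ C ⊞ const (+ 8) ⋆ X ^ 2 ⋆ C₂
        ⊞ const (+ 16) ⋆ X ^ 3 ⋆ σB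
    F-expansion = ⋆-cancel {C ⋆ C₂} (Unit-⋆ {C} C-unit C₂-unit) (
      solve 3 (λ f c d → (c :* d) :* f := f :* c :* d) P.refl F C C₂
      ⨟ F-UV
      ⨟ solve 3 (λ c d x → (c :+ con (ℤ.- + 4) :* x :* d) :^ 2 :* (c :+ x :* d)
          := c :^ 2 :* c :+ con (ℤ.- + 7) :* x :* c :* (c :* d)
              :+ con (+ 8) :* x :^ 2 :* d :* (c :* d) :+ con (+ 16) :* x :^ 3 :* d :* d :^ 2) P.refl
              C C₂ X
      ⨟ P.+-cong (P.+-congʳ (P.+-congʳ (P.*-congʳ (P.sym A-product)))) (P.*-congˡ (P.sym σB-square))
      ⨟ solve 5 (λ c d x a b → a :* d :* c :+ con (ℤ.- + 7) :* x :* c :* (c :* d)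
          :+ con (+ 8) :* x :^ 2 :* d :* (c :* d) :+ con (+ 16) :* x :^ 3 :* d :* (b :* c)
          := (c :* d) :* (a :+ con (ℤ.- + 7) :* x :* c :+ con (+ 8) :* x :^ 2 :* d
              :+ con (+ 16) :* x :^ 3 :* b)) P.refl C C₂ X A σB)

    σF-expansion : σF ≋ σA ⊞ const (+ 7) ⋆ X ⋆ σC ⊞ const (+ 8) ⋆ X ^ 2 ⋆ C₂
        ⊞ const (ℤ.- + 16) ⋆ X ^ 3 ⋆ B
    σF-expansion = σH.cong-h F-expansion
      ⨟ (σH.+-homo _ _ ⨟ P.+-cong (σH.+-homo _ _
          ⨟ P.+-cong (σH.+-homo _ _ ⨟ P.+-congˡ (term (ℤ.- + 7) X C ⨟ P.*-congʳ (P.*-congˡ σX)))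
          (term (+ 8) (X ^ 2) C₂ ⨟ (P.*-congˡ (homo-^ σ-substitution X 2 ⨟ ^-congˡ 2 σX) ⟪⋆⟫ σC₂)))
        (term (+ 16) (X ^ 3) σB ⨟ (P.*-congˡ (homo-^ σ-substitution X 3 ⨟ ^-congˡ 3 σX)
            ⟪⋆⟫ σ-involutive B)))
      ⨟ solve 5 (λ a x c d b → a :+ con (ℤ.- + 7) :* (:- x) :* c :+ con (+ 8) :* (:- x) :^ 2 :* d
          :+ con (+ 16) :* (:- x) :^ 3 :* b
          := a :+ con (+ 7) :* x :* c :+ con (+ 8) :* x :^ 2 :* d :+ con (ℤ.- + 16) :* x :^ 3 :* b)
              P.refl σA X σC C₂ B
      where
      σX : σ X ≋ ⊟ X
      σX = homo-X σ-substitution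
      term : ∀ c f g → σ (const c ⋆ f ⋆ g) ≋ const c ⋆ σ f ⋆ σ g
      term c f g = σH.*-homo (const c ⋆ f) g ⨟ P.*-congʳ (σH.const-⋆-homo c f)

    F-odd : F ⊞ ⊟ σF ≋ const (ℤ.- + 5) ⋆ X ⋆ (C ⊞ σC) ⊞ const (+ 20) ⋆ X ^ 3 ⋆ (B ⊞ σB)
    F-odd = P.+-cong F-expansion (P.-‿cong σF-expansion)
      ⨟ solve 8 (λ a s x c t d b r → (a :+ con (ℤ.- + 7) :* x :* c :+ con (+ 8) :* x :^ 2 :* d
          :+ con (+ 16) :* x :^ 3 :* b)
            :- (s :+ con (+ 7) :* x :* t :+ con (+ 8) :* x :^ 2 :* d
                :+ con (ℤ.- + 16) :* x :^ 3 :* r)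
          := (a :+ (:- s)) :+ (con (ℤ.- + 7) :* x :* (c :+ t) :+ con (+ 16) :* x :^ 3 :* (r :+ b)))
              P.refl A σA X C σC C₂ σB B
      ⨟ P.+-congʳ A-odd
      ⨟ solve 5 (λ x c t r b → con (+ 2) :* x :* (c :+ t) :+ con (+ 4) :* x :^ 3 :* (r :+ b)
          :+ (con (ℤ.- + 7) :* x :* (c :+ t) :+ con (+ 16) :* x :^ 3 :* (r :+ b))
          := con (ℤ.- + 5) :* x :* (c :+ t) :+ con (+ 20) :* x :^ 3 :* (r :+ b)) P.refl X C σC B σB

    -- The Hecke relation at 2 for F. Writing C² + σC² = (C - σC)² + 2 C σC leaves only C - σC and C
    -- σC C₄, which `C-odd` and `σC-product` turn into polynomials in C₂ and C₄.
    F-even : F ⊞ σF ≋ const (ℤ.- + 2) ⋆ F₂ ⊞ const (+ 4) ⋆ F₄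
    F-even = ⋆-cancel {C₂ ⋆ C₄} (Unit-⋆ {C₂} C₂-unit C₄-unit) (
      P.*-congˡ (P.+-cong F-expansion σF-expansion)
      ⨟ solve 9 (λ a s x c t d b r e → (d :* e) :* ((a :+ con (ℤ.- + 7) :* x :* c
          :+ con (+ 8) :* x :^ 2 :* d :+ con (+ 16) :* x :^ 3 :* b)
            :+ (s :+ con (+ 7) :* x :* t :+ con (+ 8) :* x :^ 2 :* d
                :+ con (ℤ.- + 16) :* x :^ 3 :* r))
          := (a :* d :+ s :* d) :* e :+ con (ℤ.- + 7) :* x :* (c :+ (:- t)) :* d :* e
              :+ con (+ 16) :* x :^ 2 :* d :^ 2 :* e
              :+ con (ℤ.- + 16) :* x :^ 3 :* (r :* d :- b :* d) :* e)
          P.refl A σA X C σC C₂ σB B C₄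
      ⨟ P.+-cong (P.+-congʳ (P.+-congʳ (P.*-congʳ (P.+-cong A-product σA-product))))
          (P.*-congʳ (P.*-congˡ (P.+-cong B-product (P.-‿cong σB-product))))
      ⨟ solve 5 (λ x c t d e → (c :^ 2 :+ t :^ 2) :* e
          :+ con (ℤ.- + 7) :* x :* (c :+ (:- t)) :* d :* e :+ con (+ 16) :* x :^ 2 :* d :^ 2 :* e
          :+ con (ℤ.- + 16) :* x :^ 3 :* (c :* e :- t :* e) :* e
          := (c :+ (:- t)) :^ 2 :* e :+ con (+ 2) :* (t :* c :* e)
              :+ con (ℤ.- + 7) :* x :* (c :+ (:- t)) :* d :* e
              :+ con (+ 16) :* x :^ 2 :* d :^ 2 :* e
              :+ con (ℤ.- + 16) :* x :^ 3 :* (c :+ (:- t)) :* e :^ 2)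
          P.refl X C σC C₂ C₄
      ⨟ P.+-cong (P.+-congʳ (P.+-cong (P.+-cong (P.*-congʳ (^-congˡ 2 C-odd))
          (P.*-congˡ σC-product)) (P.*-congʳ (P.*-congʳ (P.*-congˡ C-odd)))))
          (P.*-congʳ (P.*-congˡ C-odd))
      ⨟ solve 3 (λ x d e → (con (+ 2) :* x :* d :+ con (+ 4) :* x :^ 3 :* e) :^ 2 :* e
          :+ con (+ 2) :* d :^ 3 :+ con (ℤ.- + 7) :* x :* (con (+ 2) :* x :* d
          :+ con (+ 4) :* x :^ 3 :* e) :* d :* e :+ con (+ 16) :* x :^ 2 :* d :^ 2 :* e
          :+ con (ℤ.- + 16) :* x :^ 3 :* (con (+ 2) :* x :* d :+ con (+ 4) :* x :^ 3 :* e) :* e :^ 2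
          := con (ℤ.- + 2) :* ((d :+ con (ℤ.- + 4) :* x :^ 2 :* e) :^ 2 :* (d :+ x :^ 2 :* e))
              :+ con (+ 4) :* ((d :+ con (ℤ.- + 4) :* x :^ 2 :* e) :* (d :+ x :^ 2 :* e) :^ 2))
          P.refl X C₂ C₄
      ⨟ P.+-cong (P.*-congˡ (P.sym F₂-UV₂)) (P.*-congˡ (P.sym F₄-UV₂))
      ⨟ solve 4 (λ f g d e → con (ℤ.- + 2) :* (f :* d :* e) :+ con (+ 4) :* (g :* d :* e)
          := (d :* e) :* (con (ℤ.- + 2) :* f :+ con (+ 4) :* g)) P.refl F₂ F₄ C₂ C₄)

open TwoDissections

-- The norm of f₁ over series in q⁵, and the 5-dissection of f₁⁵.

module FiveDissection where
  interleave : (h₀ h₁ h₂ h₃ h₄ : PowerSeries) → PowerSeries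
  interleave h₀ h₁ h₂ h₃ h₄ =
    dilate 5 h₀ ⊞ dilate 5 h₁ ⋆ X ^ 1 ⊞ dilate 5 h₂ ⋆ X ^ 2 ⊞ dilate 5 h₃ ⋆ X ^ 3
        ⊞ dilate 5 h₄ ⋆ X ^ 4

  private
    sec-X^ : ∀ c j → c < 5 → j < 5 → c ≢ j → sec c (X ^ j) ≋ 0s
    sec-X^ c j c<5 j<5 c≢j .at zero    = trans (sec-at c (X ^ j) 0) (X^-≢ j (c≢j ∘ sym))
    sec-X^ c j c<5 j<5 c≢j .at (suc n) =
        trans (sec-at c (X ^ j) (suc n)) (X^-≢ j (ℕ.<⇒≢ (ℕ.<-≤-trans j<5
      (ℕ.≤-trans (ℕ.m≤m*n 5 (suc n)) (ℕ.m≤m+n (5 * suc n) c)))))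

    sec-X^-same : ∀ c → c < 5 → sec c (X ^ c) ≋ 1s
    sec-X^-same c c<5 .at zero    = trans (sec-at c (X ^ c) 0) (X^-at c)
    sec-X^-same c c<5 .at (suc n) = trans (sec-at c (X ^ c) (suc n)) (X^-≢ c (ℕ.<⇒≢ (ℕ.<-≤-trans c<5
      (ℕ.≤-trans (ℕ.m≤m*n 5 (suc n)) (ℕ.m≤m+n (5 * suc n) c)))))

    keep : ∀ c → c < 5 → ∀ h → sec c (dilate 5 h ⋆ X ^ c) ≋ h
    keep c c<5 h = sec-dilate c c<5 h (X ^ c) ⨟ P.*-congˡ (sec-X^-same c c<5) ⨟ P.*-identityʳ h

    drop : ∀ c j → c < 5 → j < 5 → c ≢ j → ∀ h → sec c (dilate 5 h ⋆ X ^ j) ≋ 0s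
    drop c j c<5 j<5 c≢j h = sec-dilate c c<5 h (X ^ j) ⨟ P.*-congˡ (sec-X^ c j c<5 j<5 c≢j)
        ⨟ P.zeroʳ h

    lt : ∀ (c : Fin 5) → toℕ c < 5
    lt = Fin.toℕ<n

    pick : (h₀ h₁ h₂ h₃ h₄ : PowerSeries) → Fin 5 → PowerSeries
    pick h₀ h₁ h₂ h₃ h₄ 0F = h₀
    pick h₀ h₁ h₂ h₃ h₄ 1F = h₁
    pick h₀ h₁ h₂ h₃ h₄ 2F = h₂
    pick h₀ h₁ h₂ h₃ h₄ 3F = h₃
    pick h₀ h₁ h₂ h₃ h₄ 4F = h₄

  sec-interleave : ∀ (c : Fin 5) {h₀ h₁ h₂ h₃ h₄} → sec (toℕ c) (interleave h₀ h₁ h₂ h₃ h₄)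
      ≋ pick h₀ h₁ h₂ h₃ h₄ c
  sec-interleave c {h₀} {h₁} {h₂} {h₃} {h₄} =
    sec-cong (toℕ c) (P.+-congʳ (P.+-congʳ
        (P.+-congʳ (P.+-congʳ (P.sym (P.*-identityʳ (dilate 5 h₀)))))))
    ⨟ sec-⊞ k _ _ ⨟ P.+-congʳ (sec-⊞ k _ _ ⨟ P.+-congʳ (sec-⊞ k _ _ ⨟ P.+-congʳ (sec-⊞ k _ _)))
    ⨟ go c
    where
    k = toℕ c
    go : ∀ c → sec (toℕ c) (dilate 5 h₀ ⋆ X ^ 0) ⊞ sec (toℕ c) (dilate 5 h₁ ⋆ X ^ 1)
        ⊞ sec (toℕ c) (dilate 5 h₂ ⋆ X ^ 2)
      ⊞ sec (toℕ c) (dilate 5 h₃ ⋆ X ^ 3) ⊞ sec (toℕ c) (dilate 5 h₄ ⋆ X ^ 4)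
          ≋ pick h₀ h₁ h₂ h₃ h₄ c
    go 0F = (keep 0 (lt 0F) h₀ ⟪⊞⟫ drop 0 1 (lt 0F) (lt 1F) (λ ()) h₁
        ⟪⊞⟫ drop 0 2 (lt 0F) (lt 2F) (λ ()) h₂ ⟪⊞⟫ drop 0 3 (lt 0F) (lt 3F) (λ ()) h₃
        ⟪⊞⟫ drop 0 4 (lt 0F) (lt 4F) (λ ()) h₄)
      ⨟ P.+-identityʳ _ ⨟ P.+-identityʳ _ ⨟ P.+-identityʳ _ ⨟ P.+-identityʳ _
    go 1F = (drop 1 0 (lt 1F) (lt 0F) (λ ()) h₀ ⟪⊞⟫ keep 1 (lt 1F) h₁
        ⟪⊞⟫ drop 1 2 (lt 1F) (lt 2F) (λ ()) h₂ ⟪⊞⟫ drop 1 3 (lt 1F) (lt 3F) (λ ()) h₃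
        ⟪⊞⟫ drop 1 4 (lt 1F) (lt 4F) (λ ()) h₄)
      ⨟ P.+-identityʳ _ ⨟ P.+-identityʳ _ ⨟ P.+-identityʳ _ ⨟ P.+-identityˡ _
    go 2F = (drop 2 0 (lt 2F) (lt 0F) (λ ()) h₀ ⟪⊞⟫ drop 2 1 (lt 2F) (lt 1F) (λ ()) h₁
        ⟪⊞⟫ keep 2 (lt 2F) h₂ ⟪⊞⟫ drop 2 3 (lt 2F) (lt 3F) (λ ()) h₃
        ⟪⊞⟫ drop 2 4 (lt 2F) (lt 4F) (λ ()) h₄)
      ⨟ P.+-identityʳ _ ⨟ P.+-identityʳ _ ⨟ P.+-congʳ (P.+-identityˡ _) ⨟ P.+-identityˡ _
    go 3F = (drop 3 0 (lt 3F) (lt 0F) (λ ()) h₀ ⟪⊞⟫ drop 3 1 (lt 3F) (lt 1F) (λ ()) h₁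
        ⟪⊞⟫ drop 3 2 (lt 3F) (lt 2F) (λ ()) h₂ ⟪⊞⟫ keep 3 (lt 3F) h₃
        ⟪⊞⟫ drop 3 4 (lt 3F) (lt 4F) (λ ()) h₄)
      ⨟ P.+-identityʳ _ ⨟ P.+-congʳ (P.+-congʳ (P.+-identityˡ _) ⨟ P.+-identityˡ _)
          ⨟ P.+-identityˡ _
    go 4F = (drop 4 0 (lt 4F) (lt 0F) (λ ()) h₀ ⟪⊞⟫ drop 4 1 (lt 4F) (lt 1F) (λ ()) h₁
        ⟪⊞⟫ drop 4 2 (lt 4F) (lt 2F) (λ ()) h₂ ⟪⊞⟫ drop 4 3 (lt 4F) (lt 3F) (λ ()) h₃
        ⟪⊞⟫ keep 4 (lt 4F) h₄)
      ⨟ P.+-congʳ (P.+-congʳ (P.+-congʳ (P.+-identityˡ _) ⨟ P.+-identityˡ _) ⨟ P.+-identityˡ _)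
          ⨟ P.+-identityˡ _

  -- N₀(q⁵) is the norm of f₁, that is ∏ f₁(ζ q) over the fifth roots of unity, reduced by u v =
  -- -x². The P's are the sections of the cofactor, the product over ζ ≠ 1.
  N₀ P₀ P₁ P₂ P₃ P₄ : PowerSeries
  N₀ = u ^ 5 ⊞ const (+ 11) ⋆ X ⋆ x ^ 5 ⊞ X ^ 2 ⋆ v ^ 5
  P₀ = u ^ 4 ⊞ const (ℤ.- + 3) ⋆ X ⋆ x ^ 3 ⋆ v
  P₁ = const -1ℤ ⋆ u ^ 3 ⋆ x ⊞ const (+ 2) ⋆ X ⋆ x ^ 2 ⋆ v ^ 2
  P₂ = const (+ 2) ⋆ u ^ 2 ⋆ x ^ 2 ⊞ const -1ℤ ⋆ X ⋆ x ⋆ v ^ 3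
  P₃ = const (ℤ.- + 3) ⋆ u ⋆ x ^ 3 ⊞ X ⋆ v ^ 4
  P₄ = const (+ 5) ⋆ x ^ 4

  private
    D₅ : PowerSeries → PowerSeries
    D₅ = dilate 5

    infixl 7 _d⋆_
    infixl 6 _d⊞_
    _d⋆_ : ∀ {f f′ g g′} → D₅ f ≋ f′ → D₅ g ≋ g′ → D₅ (f ⋆ g) ≋ f′ ⋆ g′
    _d⋆_ {f} {g = g} p q = D.*-homo 5 f g ⨟ (p ⟪⋆⟫ q)

    _d⊞_ : ∀ {f f′ g g′} → D₅ f ≋ f′ → D₅ g ≋ g′ → D₅ (f ⊞ g) ≋ f′ ⊞ g′
    _d⊞_ {f} {g = g} p q = D.+-homo 5 f g ⨟ (p ⟪⊞⟫ q)

    d^ : ∀ k {f f′} → D₅ f ≋ f′ → D₅ (f ^ k) ≋ f′ ^ k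
    d^ k {f} p = homo-^ (dilation 5) f k ⨟ ^-congˡ k p

    dc : ∀ c → D₅ (const c) ≋ const c
    dc = D.const-homo 5

    dX : D₅ X ≋ X ^ 5
    dX = homo-X (dilation 5)

    r : ∀ f → D₅ f ≋ D₅ f
    r _ = P.refl

    a b e : PowerSeries
    a = D₅ u
    b = D₅ x
    e = D₅ v

    dN₀ = d^ 5 (r u) d⊞ dc (+ 11) d⋆ dX d⋆ d^ 5 (r x) d⊞ d^ 2 dX d⋆ d^ 5 (r v)
    dP₀ = d^ 4 (r u) d⊞ dc (ℤ.- + 3) d⋆ dX d⋆ d^ 3 (r x) d⋆ r v
    dP₁ = dc -1ℤ d⋆ d^ 3 (r u) d⋆ r x d⊞ dc (+ 2) d⋆ dX d⋆ d^ 2 (r x) d⋆ d^ 2 (r v)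
    dP₂ = dc (+ 2) d⋆ d^ 2 (r u) d⋆ d^ 2 (r x) d⊞ dc -1ℤ d⋆ dX d⋆ r x d⋆ d^ 3 (r v)
    dP₃ = dc (ℤ.- + 3) d⋆ r u d⋆ d^ 3 (r x) d⊞ dX d⋆ d^ 4 (r v)
    dP₄ = dc (+ 5) d⋆ d^ 4 (r x)

    -- a e + b² = 0, so that its multiples may be added to any identity.
    relation : ∀ q → q ⋆ (a ⋆ e ⊞ b ⋆ b) ≋ 0s
    relation q = P.*-congˡ (P.+-cong (P.sym (D.*-homo 5 u v) ⨟ D.cong-h 5 uv≋-x²
        ⨟ homo-neg (dilation 5) (x ⋆ x)) (P.sym (D.*-homo 5 x x))
      ⨟ P.-‿inverseˡ _) ⨟ P.zeroʳ q

    modulo : ∀ q {f g} → f ≋ g ⊞ q ⋆ (a ⋆ e ⊞ b ⋆ b) → f ≋ g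
    modulo q p = p ⨟ P.+-congˡ (relation q) ⨟ P.+-identityʳ _

    η₁-dissection : η 1 ≋ a ⊞ X ⋆ b ⊞ X ^ 2 ⋆ e
    η₁-dissection = pentagonal ⨟ pentagonal-dissection

  -- Modulo u v = -x² the sections 1, 2, 3, 4 of f₁⁵ are the cofactor sections P₀, P₁, P₂, P₃ up to
  -- a factor ±5 x. This coincidence ties section c + 1 of F to section c of C.
  η₁^5-dissection : η 1 ^ 5 ≋ interleave N₀ (const (+ 5) ⋆ x ⋆ P₀) (const (ℤ.- + 5) ⋆ x ⋆ P₁)
      (const (ℤ.- + 5) ⋆ x ⋆ P₂) (const (+ 5) ⋆ x ⋆ P₃)
  η₁^5-dissection = ^-congˡ 5 η₁-dissection
    -- The multiplier is the quotient that remains when the difference of both sides is divided by a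
    -- e + b², as polynomials in a, b, e and q.
    ⨟ modulo (const (+ 5) ⋆ e ^ 3 ⋆ X ^ 8 ⊞ const (+ 20) ⋆ b ⋆ e ^ 2 ⋆ X ^ 7
        ⊞ const (+ 20) ⋆ b ^ 2 ⋆ e ⋆ X ^ 6 ⊞ const (ℤ.- + 10) ⋆ b ^ 3 ⋆ X ^ 5
        ⊞ const (+ 10) ⋆ a ⋆ e ^ 2 ⋆ X ^ 6 ⊞ const (+ 30) ⋆ a ⋆ b ⋆ e ⋆ X ^ 5
            ⊞ const (+ 20) ⋆ a ⋆ b ^ 2 ⋆ X ^ 4
        ⊞ const (+ 10) ⋆ a ^ 2 ⋆ e ⋆ X ^ 4 ⊞ const (+ 20) ⋆ a ^ 2 ⋆ b ⋆ X ^ 3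
            ⊞ const (+ 5) ⋆ a ^ 3 ⋆ X ^ 2)
      (solve 4 (λ a b e x → (a :+ x :* b :+ x :^ 2 :* e) :^ 5 :=
          (a :^ 5 :+ con (+ 11) :* x :^ 5 :* b :^ 5 :+ (x :^ 5) :^ 2 :* e :^ 5)
          :+ con (+ 5) :* b :* (a :^ 4 :+ con (ℤ.- + 3) :* x :^ 5 :* b :^ 3 :* e) :* x :^ 1
          :+ con (ℤ.- + 5) :* b :* (con -1ℤ :* a :^ 3 :* b
              :+ con (+ 2) :* x :^ 5 :* b :^ 2 :* e :^ 2) :* x :^ 2
          :+ con (ℤ.- + 5) :* b :* (con (+ 2) :* a :^ 2 :* b :^ 2
              :+ con -1ℤ :* x :^ 5 :* b :* e :^ 3) :* x :^ 3
          :+ con (+ 5) :* b :* (con (ℤ.- + 3) :* a :* b :^ 3 :+ x :^ 5 :* e :^ 4) :* x :^ 4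
          :+ (con (+ 5) :* e :^ 3 :* x :^ 8 :+ con (+ 20) :* b :* e :^ 2 :* x :^ 7
              :+ con (+ 20) :* b :^ 2 :* e :* x :^ 6 :+ con (ℤ.- + 10) :* b :^ 3 :* x :^ 5
            :+ con (+ 10) :* a :* e :^ 2 :* x :^ 6 :+ con (+ 30) :* a :* b :* e :* x :^ 5
                :+ con (+ 20) :* a :* b :^ 2 :* x :^ 4
            :+ con (+ 10) :* a :^ 2 :* e :* x :^ 4 :+ con (+ 20) :* a :^ 2 :* b :* x :^ 3
                :+ con (+ 5) :* a :^ 3 :* x :^ 2) :* (a :* e :+ b :* b)) P.refl a b e X)
    ⨟ P.sym (dN₀ ⟪⊞⟫ P.*-congʳ (dc (+ 5) d⋆ r x d⋆ dP₀) ⟪⊞⟫ P.*-congʳ (dc (ℤ.- + 5) d⋆ r x d⋆ dP₁)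
        ⟪⊞⟫ P.*-congʳ (dc (ℤ.- + 5) d⋆ r x d⋆ dP₂) ⟪⊞⟫ P.*-congʳ (dc (+ 5) d⋆ r x d⋆ dP₃))

  η₁-norm : η 1 ⋆ interleave P₀ P₁ P₂ P₃ P₄ ≋ dilate 5 N₀
  η₁-norm = (η₁-dissection ⟪⋆⟫ (dP₀ ⟪⊞⟫ P.*-congʳ dP₁ ⟪⊞⟫ P.*-congʳ dP₂ ⟪⊞⟫ P.*-congʳ dP₃
      ⟪⊞⟫ P.*-congʳ dP₄))
    ⨟ modulo (e ^ 3 ⋆ X ^ 8 ⊞ const -1ℤ ⋆ b ⋆ e ^ 2 ⋆ X ^ 7 ⊞ const (+ 2) ⋆ b ^ 2 ⋆ e ⋆ X ^ 6
        ⊞ const (ℤ.- + 6) ⋆ b ^ 3 ⋆ X ^ 5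
        ⊞ const (+ 2) ⋆ a ⋆ b ^ 2 ⋆ X ^ 4 ⊞ const -1ℤ ⋆ a ^ 2 ⋆ b ⋆ X ^ 3 ⊞ a ^ 3 ⋆ X ^ 2)
      (solve 4 (λ a b e x → (a :+ x :* b :+ x :^ 2 :* e) :*
          ((a :^ 4 :+ con (ℤ.- + 3) :* x :^ 5 :* b :^ 3 :* e)
          :+ (con -1ℤ :* a :^ 3 :* b :+ con (+ 2) :* x :^ 5 :* b :^ 2 :* e :^ 2) :* x :^ 1
          :+ (con (+ 2) :* a :^ 2 :* b :^ 2 :+ con -1ℤ :* x :^ 5 :* b :* e :^ 3) :* x :^ 2
          :+ (con (ℤ.- + 3) :* a :* b :^ 3 :+ x :^ 5 :* e :^ 4) :* x :^ 3
          :+ con (+ 5) :* b :^ 4 :* x :^ 4)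
        := (a :^ 5 :+ con (+ 11) :* x :^ 5 :* b :^ 5 :+ (x :^ 5) :^ 2 :* e :^ 5)
          :+ (e :^ 3 :* x :^ 8 :+ con -1ℤ :* b :* e :^ 2 :* x :^ 7
              :+ con (+ 2) :* b :^ 2 :* e :* x :^ 6 :+ con (ℤ.- + 6) :* b :^ 3 :* x :^ 5
            :+ con (+ 2) :* a :* b :^ 2 :* x :^ 4 :+ con -1ℤ :* a :^ 2 :* b :* x :^ 3
                :+ a :^ 3 :* x :^ 2) :* (a :* e :+ b :* b)) P.refl a b e X)
    ⨟ P.sym dN₀

open FiveDissection

-- Recurrences of the coefficients at 2 and at 5, and the proof of R = 1.

module Recurrences where
  private
    ⋆-leading : ∀ f h n → h ≋[ n ] 0s → (f ⋆ h) n ≡ f 0 ℤ.* h n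
    ⋆-leading f h zero    _ = ⋆-zero f h
    ⋆-leading f h (suc n) p = trans (⋆-suc f h n) (trans (cong (λ z → f 0 ℤ.* h (suc n) ℤ.+ z)
      (trans (⋆-cong[] (≋[]-refl {tl f}) p .below n ℕ.≤-refl) (P.zeroʳ (tl f) .at n)))
          (ℤ.+-identityʳ _))

    -- If R = 1 + R_n q^n + … then R f = f + f₀ R_n q^n + … .
    ⋆-near-1 : ∀ {R} n → R ≋[ n ] 1s → 0 < n → ∀ f → (R ⋆ f) n ≡ f n ℤ.+ f 0 ℤ.* R n
    ⋆-near-1 {R} n@(suc m) p _ f = trans (lem .at n) (trans (⊞-at f _ n) (cong (λ z → f n ℤ.+ z)
      (trans (⋆-leading f (R ⊞ ⊟ 1s) n zero′) (cong (λ z → f 0 ℤ.* z)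
        (trans (⊞-at R _ n) (trans (cong (λ z → R n ℤ.+ z) (⊟-at 1s n)) (ℤ.+-identityʳ (R n))))))))
      where
      lem : R ⋆ f ≋ f ⊞ f ⋆ (R ⊞ ⊟ 1s)
      lem = solve 2 (λ r f → r :* f := f :+ f :* (r :+ (:- con 1ℤ))) P.refl R f
      zero′ : R ⊞ ⊟ 1s ≋[ n ] 0s
      zero′ = ≋[]-trans (⊞-cong[] p ≋[]-refl) (≋⇒≋[] (P.-‿inverseʳ 1s))

  odd≢even : ∀ j k → suc (k * 2) ≢ j * 2
  odd≢even (suc j) (suc k) eq = odd≢even j k (ℕ.suc-injective (ℕ.suc-injective eq))

  dilate₂-odd : ∀ f k → dilate 2 f (suc (k * 2)) ≡ 0ℤ
  dilate₂-odd f k = dilate-∤ 2 f λ (divides j eq) → odd≢even j k eq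

  parity : ∀ n → (∃ λ k → n ≡ k * 2) ⊎ (∃ λ k → n ≡ suc (k * 2))
  parity zero = inj₁ (0 , refl)
  parity (suc n) with parity n
  ... | inj₁ (k , refl) = inj₂ (k , refl)
  ... | inj₂ (k , refl) = inj₁ (suc k , refl)

  module Coefficients (C : PowerSeries) (C-η : C ⋆ η 1 ≋ η 5 ^ 5) where
    open Dissection C C-η public

    -- With the shift by one, G = ∑ g(n) q^n is an eigenform of the Hecke operator at 2.
    G Ĝ B̂ : PowerSeries
    G = X ⋆ C
    Ĝ = dilate 2 G
    B̂ = X ^ 3 ⋆ B

    private
      dilate-X : dilate 2 X ≋ X ^ 2
      dilate-X = homo-X (dilation 2)

      Ĝ≋ : Ĝ ≋ X ^ 2 ⋆ C₂
      Ĝ≋ = D.*-homo 2 X C ⨟ P.*-congʳ dilate-X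

      Ĝ₂≋ : dilate 2 Ĝ ≋ X ^ 4 ⋆ C₄
      Ĝ₂≋ = D.cong-h 2 Ĝ≋ ⨟ D.*-homo 2 (X ^ 2) C₂
          ⨟ P.*-congʳ (homo-^ (dilation 2) X 2 ⨟ ^-congˡ 2 dilate-X)
        ⨟ solve 2 (λ x c → (x :^ 2) :^ 2 :* c := x :^ 4 :* c) P.refl X C₄

      σX : σ X ≋ ⊟ X
      σX = homo-X σ-substitution

      σG : σ G ≋ ⊟ (X ⋆ σC)
      σG = σH.*-homo X C ⨟ P.*-congʳ σX ⨟ solve 2 (λ x c → (:- x) :* c := :- (x :* c)) P.refl X σC

      σB̂ : σ B̂ ≋ ⊟ (X ^ 3 ⋆ σB)
      σB̂ = σH.*-homo (X ^ 3) B ⨟ P.*-congʳ (homo-^ σ-substitution X 3 ⨟ ^-congˡ 3 σX)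
        ⨟ solve 2 (λ x c → (:- x) :^ 3 :* c := :- (x :^ 3 :* c)) P.refl X σB

      G-even : G ⊞ σ G ≋ const (+ 2) ⋆ Ĝ ⊞ const (+ 4) ⋆ dilate 2 Ĝ
      G-even = P.+-congˡ σG ⨟ solve 3 (λ x c s → x :* c :+ (:- (x :* s)) := x :* (c :+ (:- s)))
          P.refl X C σC
        ⨟ P.*-congˡ C-odd
        ⨟ solve 3 (λ x c d → x :* (con (+ 2) :* x :* c :+ con (+ 4) :* x :^ 3 :* d)
            := con (+ 2) :* (x :^ 2 :* c) :+ con (+ 4) :* (x :^ 4 :* d)) P.refl X C₂ C₄
        ⨟ P.sym (P.*-congˡ Ĝ≋ ⟪⊞⟫ P.*-congˡ Ĝ₂≋)

      B̂-even : B̂ ⊞ σ B̂ ≋ const (+ 2) ⋆ dilate 2 Ĝ ⊞ const (ℤ.- + 4) ⋆ dilate 2 (σ B̂)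
      B̂-even = P.+-congˡ σB̂ ⨟ solve 3 (λ x c s → x :^ 3 :* c :+ (:- (x :^ 3 :* s))
          := x :^ 3 :* (c :+ (:- s))) P.refl X B σB
        ⨟ P.*-congˡ B-odd
        ⨟ solve 3 (λ x c d → x :^ 3 :* (con (+ 2) :* x :* c :+ con (+ 4) :* x :^ 3 :* d)
            := con (+ 2) :* (x :^ 4 :* c) :+ con (ℤ.- + 4) :* (:- ((x :^ 2) :^ 3 :* d))) P.refl X C₄
                (dilate 2 σB)
        ⨟ P.sym (P.*-congˡ Ĝ₂≋ ⟪⊞⟫ P.*-congˡ (D.cong-h 2 σB̂ ⨟ homo-neg (dilation 2) _
            ⨟ P.-‿cong (D.*-homo 2 (X ^ 3) σB
            ⨟ P.*-congʳ (homo-^ (dilation 2) X 3 ⨟ ^-congˡ 3 dilate-X))))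

      A-odd′ : A ⊞ ⊟ σA ≋ const (+ 2) ⋆ (G ⊞ ⊟ σ G) ⊞ const (+ 4) ⋆ (B̂ ⊞ ⊟ σ B̂)
      A-odd′ = A-odd ⨟ solve 5 (λ x c s b t → con (+ 2) :* x :* (c :+ s)
          :+ con (+ 4) :* x :^ 3 :* (b :+ t)
          := con (+ 2) :* (x :* c :- (:- (x :* s)))
              :+ con (+ 4) :* (x :^ 3 :* b :- (:- (x :^ 3 :* t)))) P.refl X C σC B σB
        ⨟ P.sym (P.*-congˡ (P.+-congˡ (P.-‿cong σG)) ⟪⊞⟫ P.*-congˡ (P.+-congˡ (P.-‿cong σB̂)))

      F-odd′ : F ⊞ ⊟ σF ≋ const (ℤ.- + 5) ⋆ (G ⊞ ⊟ σ G) ⊞ const (+ 20) ⋆ (B̂ ⊞ ⊟ σ B̂)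
      F-odd′ = F-odd ⨟ solve 5 (λ x c s b t → con (ℤ.- + 5) :* x :* (c :+ s)
          :+ con (+ 20) :* x :^ 3 :* (b :+ t)
          := con (ℤ.- + 5) :* (x :* c :- (:- (x :* s)))
              :+ con (+ 20) :* (x :^ 3 :* b :- (:- (x :^ 3 :* t)))) P.refl X C σC B σB
        ⨟ P.sym (P.*-congˡ (P.+-congˡ (P.-‿cong σG)) ⟪⊞⟫ P.*-congˡ (P.+-congˡ (P.-‿cong σB̂)))

      even-part : ∀ f n → -1^ n ≡ 1ℤ → (f ⊞ σ f) n ≡ + 2 ℤ.* f n
      even-part f n e = trans (⊞-at f (σ f) n)
          (trans (cong (λ z → f n ℤ.+ z) (trans (σ-at f n) (cong (ℤ._* f n) e))) (lem (f n)))
        where lem : ∀ z → z ℤ.+ 1ℤ ℤ.* z ≡ + 2 ℤ.* z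
              lem = ℤTactic.solve-∀

      odd-part : ∀ f n → -1^ n ≡ -1ℤ → (f ⊞ ⊟ σ f) n ≡ + 2 ℤ.* f n
      odd-part f n o = trans (⊞-at f (⊟ σ f) n)
          (trans (cong (λ z → f n ℤ.+ z)
          (trans (⊟-at (σ f) n) (cong ℤ.-_ (trans (σ-at f n) (cong (ℤ._* f n) o))))) (lem (f n)))
        where lem : ∀ z → z ℤ.+ ℤ.- (-1ℤ ℤ.* z) ≡ + 2 ℤ.* z
              lem = ℤTactic.solve-∀

      combination : ∀ s t f g n → (const s ⋆ f ⊞ const t ⋆ g) n ≡ s ℤ.* f n ℤ.+ t ℤ.* g n
      combination s t f g n = trans (⊞-at _ _ n) (cong₂ ℤ._+_ (const-⋆-at s f n) (const-⋆-at t g n))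

      half : ∀ {y z} → + 2 ℤ.* y ≡ + 2 ℤ.* z → y ≡ z
      half {y} {z} = ℤ.*-cancelˡ-≡ (+ 2) y z

    G-suc : ∀ n → G (suc n) ≡ C n
    G-suc n = X⋆-suc C n

    B̂-+3 : ∀ n → B̂ (3 + n) ≡ B n
    B̂-+3 n = X^⋆-+ 3 B n

    G-double : ∀ m → G (m * 2) ≡ G m ℤ.+ + 2 ℤ.* Ĝ m
    G-double m = half (trans (sym (even-part G (m * 2) (-1^-even m))) (trans (G-even .at (m * 2))
      (trans (combination (+ 2) (+ 4) Ĝ (dilate 2 Ĝ) (m * 2))
          (trans (cong₂ (λ y z → + 2 ℤ.* y ℤ.+ + 4 ℤ.* z) (dilate-* 2 G m) (dilate-* 2 Ĝ m))
          (lem (G m) (Ĝ m))))))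
      where lem : ∀ y z → + 2 ℤ.* y ℤ.+ + 4 ℤ.* z ≡ + 2 ℤ.* (y ℤ.+ + 2 ℤ.* z)
            lem = ℤTactic.solve-∀

    B̂-double : ∀ m → B̂ (m * 2) ≡ Ĝ m ℤ.- + 2 ℤ.* (-1^ m ℤ.* B̂ m)
    B̂-double m = half (trans (sym (even-part B̂ (m * 2) (-1^-even m))) (trans (B̂-even .at (m * 2))
      (trans (combination (+ 2) (ℤ.- + 4) (dilate 2 Ĝ) (dilate 2 (σ B̂)) (m * 2))
        (trans (cong₂ (λ y z → + 2 ℤ.* y ℤ.+ (ℤ.- + 4) ℤ.* z) (dilate-* 2 Ĝ m)
            (trans (dilate-* 2 (σ B̂) m) (σ-at B̂ m))) (lem (Ĝ m) (-1^ m ℤ.* B̂ m))))))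
      where lem : ∀ y z → + 2 ℤ.* y ℤ.+ (ℤ.- + 4) ℤ.* z ≡ + 2 ℤ.* (y ℤ.- + 2 ℤ.* z)
            lem = ℤTactic.solve-∀

    F-double : ∀ m → F (m * 2) ≡ ℤ.- F m ℤ.+ + 2 ℤ.* F₂ m
    F-double m = half (trans (sym (even-part F (m * 2) (-1^-even m))) (trans (F-even .at (m * 2))
      (trans (combination (ℤ.- + 2) (+ 4) F₂ F₄ (m * 2))
          (trans (cong₂ (λ y z → (ℤ.- + 2) ℤ.* y ℤ.+ + 4 ℤ.* z) (dilate-* 2 F m) (dilate-* 2 F₂ m))
          (lem (F m) (F₂ m))))))
      where lem : ∀ y z → (ℤ.- + 2) ℤ.* y ℤ.+ + 4 ℤ.* z ≡ + 2 ℤ.* (ℤ.- y ℤ.+ + 2 ℤ.* z)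
            lem = ℤTactic.solve-∀

    A-at-odd : ∀ n → -1^ n ≡ -1ℤ → A n ≡ + 2 ℤ.* G n ℤ.+ + 4 ℤ.* B̂ n
    A-at-odd n o = half (trans (sym (odd-part A n o))
        (trans (A-odd′ .at n) (trans (combination (+ 2) (+ 4) (G ⊞ ⊟ σ G) (B̂ ⊞ ⊟ σ B̂) n)
      (trans (cong₂ (λ y z → + 2 ℤ.* y ℤ.+ + 4 ℤ.* z) (odd-part G n o) (odd-part B̂ n o))
          (lem (G n) (B̂ n))))))
      where lem : ∀ y z → + 2 ℤ.* (+ 2 ℤ.* y) ℤ.+ + 4 ℤ.* (+ 2 ℤ.* z)
              ≡ + 2 ℤ.* (+ 2 ℤ.* y ℤ.+ + 4 ℤ.* z)
            lem = ℤTactic.solve-∀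

    F-at-odd : ∀ n → -1^ n ≡ -1ℤ → F n ≡ (ℤ.- + 5) ℤ.* G n ℤ.+ + 20 ℤ.* B̂ n
    F-at-odd n o = half (trans (sym (odd-part F n o))
        (trans (F-odd′ .at n) (trans (combination (ℤ.- + 5) (+ 20) (G ⊞ ⊟ σ G) (B̂ ⊞ ⊟ σ B̂) n)
      (trans (cong₂ (λ y z → (ℤ.- + 5) ℤ.* y ℤ.+ + 20 ℤ.* z) (odd-part G n o) (odd-part B̂ n o))
          (lem (G n) (B̂ n))))))
      where lem : ∀ y z → (ℤ.- + 5) ℤ.* (+ 2 ℤ.* y) ℤ.+ + 20 ℤ.* (+ 2 ℤ.* z)
              ≡ + 2 ℤ.* ((ℤ.- + 5) ℤ.* y ℤ.+ + 20 ℤ.* z)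
            lem = ℤTactic.solve-∀

    private
      F-sections : ∀ c → η 1 ⋆ sec (toℕ c) F ≋ sec (toℕ c) (η 1 ^ 5)
      F-sections c = P.sym (sec-dilate (toℕ c) (Fin.toℕ<n c) (η 1) F)
        ⨟ sec-cong (toℕ c) (P.*-congʳ (dilate-η 5 1) ⨟ P.*-comm _ _ ⨟ F-η)

      -- The cofactor rationalises the denominator: 1 / f₁ = (P₀ + ...) / N₀(q⁵), where the
      -- numerator is the interleaved cofactor. In C = f₅⁵ / f₁ everything but this numerator is
      -- then a series in q⁵.
      C-sections : ∀ c → N₀ ⋆ sec (toℕ c) C ≋ η 1 ^ 5 ⋆ sec (toℕ c) (interleave P₀ P₁ P₂ P₃ P₄)
      C-sections c = P.sym (sec-dilate (toℕ c) (Fin.toℕ<n c) N₀ C)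
        ⨟ sec-cong (toℕ c) (P.*-congʳ (P.sym η₁-norm)
          ⨟ solve 3 (λ a b c → a :* b :* c := (c :* a) :* b) P.refl (η 1) _ C
          ⨟ P.*-congʳ (C-η ⨟ ^-congˡ 5 (P.sym (dilate-η 5 1))
              ⨟ P.sym (homo-^ (dilation 5) (η 1) 5)))
        ⨟ sec-dilate (toℕ c) (Fin.toℕ<n c) (η 1 ^ 5) _

      F₅ C₅ R : PowerSeries
      F₅ = sec 0 F
      C₅ = sec 4 C
      R = (N₀ ⋆ η 5) ⊘ η 1 ^ 6

      η₁^6-unit : Unit (η 1 ^ 6)
      η₁^6-unit = Unit-^ {η 1} 6 (η-unit 1)

      R-η : R ⋆ η 1 ^ 6 ≋ N₀ ⋆ η 5
      R-η = ⊘-⋆ (N₀ ⋆ η 5) η₁^6-unit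

      F₅-R : F₅ ≋ R ⋆ F
      F₅-R = ⋆-cancel {η 1 ⋆ η 5} (Unit-⋆ {η 1} (η-unit 1) (η-unit 5)) (
        solve 3 (λ a e f → (a :* e) :* f := (a :* f) :* e) P.refl (η 1) (η 5) F₅
        ⨟ P.*-congʳ (F-sections 0F ⨟ sec-cong 0 η₁^5-dissection ⨟ sec-interleave 0F)
        ⨟ P.sym R-η
        ⨟ solve 2 (λ r a → r :* a :^ 6 := r :* a :* a :^ 5) P.refl R (η 1)
        ⨟ P.*-congˡ (P.sym F-η)
        ⨟ solve 4 (λ r a e f → r :* a :* (f :* e) := (a :* e) :* (r :* f)) P.refl R (η 1) (η 5) F)

      C₅-R : R ⋆ C₅ ≋ const (+ 5) ⋆ C
      C₅-R = ⋆-cancel {η 1 ^ 6} η₁^6-unit (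
        solve 3 (λ r a c → a :^ 6 :* (r :* c) := (r :* a :^ 6) :* c) P.refl R (η 1) C₅
        ⨟ P.*-congʳ R-η
        ⨟ solve 3 (λ n e c → n :* e :* c := (n :* c) :* e) P.refl N₀ (η 5) C₅
        ⨟ P.*-congʳ (C-sections 4F ⨟ P.*-congˡ (sec-interleave 4F ⨟ P.*-congˡ (^-congˡ 4 x≋-η₅)))
        ⨟ solve 2 (λ a e → a :^ 5 :* (con (+ 5) :* (:- e) :^ 4) :* e
            := con (+ 5) :* a :^ 5 :* e :^ 5) P.refl (η 1) (η 5)
        ⨟ P.*-congˡ (P.sym C-η)
        ⨟ solve 2 (λ a c → con (+ 5) :* a :^ 5 :* (c :* a) := a :^ 6 :* (con (+ 5) :* c)) P.refl
            (η 1) C)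

      R₀ : R 0 ≡ 1ℤ
      R₀ = trans (sym (ℤ.*-identityʳ (R 0))) (trans (cong (λ z → R 0 ℤ.* z) (sym F-unit))
          (trans (sym (⋆-zero R F))
        (trans (sym (F₅-R .at 0)) (trans (sec-at 0 F 0) F-unit))))

      C₅₀ : C₅ 0 ≡ + 5
      C₅₀ = trans (sym (ℤ.*-identityˡ (C₅ 0)))
          (trans (cong (ℤ._* C₅ 0) (sym R₀)) (trans (sym (⋆-zero R C₅)) (trans (C₅-R .at 0)
        (trans (const-⋆-at (+ 5) C 0) (cong (λ z → + 5 ℤ.* z) C-unit)))))

      5*even : ∀ k → 5 * (k * 2) ≡ 5 * k * 2
      5*even = ℕTactic.solve-∀

      5*odd : ∀ k → 5 * suc (k * 2) ≡ suc ((5 * k + 2) * 2)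
      5*odd = ℕTactic.solve-∀

      -- As 5 is odd, 5 m is even exactly when m is, so a scaling of f at multiples of 5 is
      -- inherited by f(q²).
      scale-dilate : ∀ f c m → (∀ k → k ≤ m → f (5 * k) ≡ c ℤ.* f k) → dilate 2 f (5 * m)
          ≡ c ℤ.* dilate 2 f m
      scale-dilate f c m p with parity m
      ... | inj₁ (k , refl) = trans (cong (dilate 2 f) (5*even k))
          (trans (dilate-* 2 f (5 * k)) (trans (p k (ℕ.m≤m*n k 2))
          (cong (λ z → c ℤ.* z) (sym (dilate-* 2 f k)))))
      ... | inj₂ (k , refl) = trans (cong (dilate 2 f) (5*odd k))
          (trans (dilate₂-odd f (5 * k + 2))
          (sym (trans (cong (λ z → c ℤ.* z) (dilate₂-odd f k)) (ℤ.*-zeroʳ c))))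

      -- The operators at 2 and 5 commute: doubling expresses the values at 5 (2 m) and at 2 m by
      -- the same combination of values at indices up to m, where the relation at 5 is known.
      F-scaled : ∀ m → (∀ k → k ≤ m → F (5 * k) ≡ 1ℤ ℤ.* F k) → F (5 * (m * 2)) ≡ F (m * 2)
      F-scaled m p = trans (cong F (5*even m)) (trans (F-double (5 * m)) (trans
        (cong₂ (λ y z → ℤ.- y ℤ.+ + 2 ℤ.* z) (trans (p m ℕ.≤-refl) (ℤ.*-identityˡ _))
            (trans (scale-dilate F 1ℤ m p) (ℤ.*-identityˡ _))) (sym (F-double m))))

      G-scaled : ∀ m → (∀ k → k ≤ m → G (5 * k) ≡ + 5 ℤ.* G k) → G (5 * (m * 2)) ≡ + 5 ℤ.* G (m * 2)
      G-scaled m p = trans (cong G (5*even m)) (trans (G-double (5 * m)) (trans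
        (cong₂ (λ y z → y ℤ.+ + 2 ℤ.* z) (p m ℕ.≤-refl) (scale-dilate G (+ 5) m p))
            (trans (lem (G m) (Ĝ m)) (cong (λ z → + 5 ℤ.* z) (sym (G-double m))))))
        where lem : ∀ y z → + 5 ℤ.* y ℤ.+ + 2 ℤ.* (+ 5 ℤ.* z) ≡ + 5 ℤ.* (y ℤ.+ + 2 ℤ.* z)
              lem = ℤTactic.solve-∀

      F₅-at : ∀ n → F₅ n ≡ F (5 * n)
      F₅-at n = trans (sec-at 0 F n) (cong F (ℕ.+-identityʳ (5 * n)))

      C₅-at : ∀ n → C₅ n ≡ G (5 * suc n)
      C₅-at n = trans (sec-at 4 C n) (trans (sym (G-suc (5 * n + 4))) (cong G (lem n)))
        where lem : ∀ n → suc (5 * n + 4) ≡ 5 * suc n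
              lem = ℕTactic.solve-∀

      module _ {n : ℕ} (p : R ≋[ n ] 1s) where
        F-below : ∀ k → k < n → F (5 * k) ≡ 1ℤ ℤ.* F k
        F-below k k<n = trans (sym (F₅-at k))
            (trans (F₅-R .at k) (trans (⋆-cong[] p (≋[]-refl {F}) .below k k<n)
          (trans (P.*-identityˡ F .at k) (sym (ℤ.*-identityˡ (F k))))))

        -- Valid up to k = n, one index further than `F-below`, because G(k) is coefficient k - 1 of
        -- C.
        G-below : ∀ k → k ≤ n → G (5 * k) ≡ + 5 ℤ.* G k
        G-below zero    _   = refl′
          where refl′ : G 0 ≡ + 5 ℤ.* G 0
                refl′ = trans (X⋆-zero C) (sym (cong (λ z → + 5 ℤ.* z) (X⋆-zero C)))
        G-below (suc k) k<n = trans (sym (C₅-at k))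
            (trans (sym (trans (⋆-cong[] p (≋[]-refl {C₅}) .below k k<n) (P.*-identityˡ C₅ .at k)))
          (trans (C₅-R .at k) (trans (const-⋆-at (+ 5) C k)
              (cong (λ z → + 5 ℤ.* z) (sym (G-suc k))))))

      cancel-self : ∀ {y z} → y ≡ y ℤ.+ z → z ≡ 0ℤ
      cancel-self {y} {z} p = trans (lem y z) (trans (cong (ℤ._- y) (sym p)) (ℤ.+-inverseʳ y))
        where lem : ∀ y z → z ≡ (y ℤ.+ z) ℤ.- y
              lem = ℤTactic.solve-∀

      -- The first nontrivial coefficient R_n is read off from F when n is even and
      -- from C when n is odd, as the eigenvalue relations at 2 and 5 commute.
      R-next : ∀ n → R ≋[ suc n ] 1s → R (suc n) ≡ 0ℤ
      R-next n p with parity (suc n)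
      ... | inj₁ (suc m , refl) = trans (sym (ℤ.*-identityˡ (R (suc m * 2))))
          (trans (cong (ℤ._* R (suc m * 2)) (sym F-unit)) (cancel-self (trans
          (sym (F-scaled (suc m) (λ k k≤ → F-below p k (ℕ.≤-<-trans k≤ (s≤s (s≤s (ℕ.m≤m*n m 2)))))))
          (trans (sym (F₅-at (suc m * 2)))
              (trans (F₅-R .at (suc m * 2)) (⋆-near-1 (suc m * 2) p (s≤s z≤n) F))))))
      ... | inj₂ (m , refl) = ℤ.*-cancelˡ-≡ (+ 5) (R (suc (m * 2))) 0ℤ
          (trans (cong (ℤ._* R (suc (m * 2))) (sym C₅₀)) (cancel-self (trans
          (trans (C₅-at (suc (m * 2))) (trans
              (G-scaled (suc m) (λ k k≤ → G-below p k (ℕ.≤-trans k≤ (s≤s (ℕ.m≤m*n m 2)))))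
            (trans (cong (λ z → + 5 ℤ.* z) (G-suc (suc (m * 2))))
                (trans (sym (const-⋆-at (+ 5) C (suc (m * 2)))) (sym (C₅-R .at (suc (m * 2))))))))
          (⋆-near-1 (suc (m * 2)) p (s≤s z≤n) C₅))))

      R≋1 : R ≋ 1s
      R≋1 = ≋[]⇒≋ λ { zero → mk≋[] (λ _ ()) ; (suc n) → go n }
        where
        extend≋ : ∀ n → R ≋[ n ] 1s → R n ≡ 1s n → R ≋[ suc n ] 1s
        extend≋ n p q .below m (s≤s m≤n) with ℕ.m≤n⇒m<n∨m≡n m≤n
        ... | inj₁ m<n  = p .below m m<n
        ... | inj₂ refl = q
        go : ∀ n → R ≋[ suc n ] 1s
        go zero    = extend≋ 0 (mk≋[] (λ _ ())) R₀
        go (suc n) = extend≋ (suc n) (go n) (R-next n (go n))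

    F-5 : ∀ n → F (5 * n) ≡ F n
    F-5 n = trans (F-below (≋⇒≋[] {N = suc n} R≋1) n ℕ.≤-refl) (ℤ.*-identityˡ (F n))

    G-5 : ∀ n → G (5 * n) ≡ + 5 ℤ.* G n
    G-5 n = G-below (≋⇒≋[] {N = n} R≋1) n ℕ.≤-refl

    private
      -- As x = -f₅, this is u⁵ - 11 q f₅⁵ + q² v⁵ = f₁⁶ / f₅, Ramanujan's identity for the fifth
      -- power of the Rogers-Ramanujan continued fraction.
      N₀-η : N₀ ⋆ η 5 ≋ η 1 ^ 6
      N₀-η = P.sym R-η ⨟ P.*-congʳ R≋1 ⨟ P.*-identityˡ _

      C-section : ∀ c {p} → sec (toℕ c) (interleave P₀ P₁ P₂ P₃ P₄) ≋ p → η 1 ⋆ sec (toℕ c) C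
          ≋ η 5 ⋆ p
      C-section c {p} eq = ⋆-cancel {η 1 ^ 5} (Unit-^ {η 1} 5 (η-unit 1)) (
        solve 2 (λ a c → a :^ 5 :* (a :* c) := a :^ 6 :* c) P.refl (η 1) (sec (toℕ c) C)
        ⨟ P.*-congʳ (P.sym N₀-η)
        ⨟ solve 3 (λ n e c → n :* e :* c := (n :* c) :* e) P.refl N₀ (η 5) (sec (toℕ c) C)
        ⨟ P.*-congʳ (C-sections c ⨟ P.*-congˡ eq)
        ⨟ solve 3 (λ a e p → a :^ 5 :* p :* e := a :^ 5 :* (e :* p)) P.refl (η 1) (η 5) p)

      -- Section d of f₁⁵ is s x p, and f₁ times section c of C is f₅ p with the same p. As x = -f₅,
      -- the sections of F and C are proportional.
      F-section : ∀ c d s {p} → sec (toℕ c) (interleave P₀ P₁ P₂ P₃ P₄) ≋ p → sec (toℕ d) (η 1 ^ 5)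
          ≋ const s ⋆ x ⋆ p →
        sec (toℕ d) F ≋ const (ℤ.- s) ⋆ sec (toℕ c) C
      F-section c d s {p} eq eq′ = ⋆-cancel {η 1} (η-unit 1) (F-sections d ⨟ eq′
        ⨟ P.*-congʳ (P.*-congˡ x≋-η₅)
        ⨟ solve 3 (λ s e p → s :* (:- e) :* p := (:- s) :* (e :* p)) P.refl (const s) (η 5) p
        ⨟ (P.sym (const-neg s) ⟪⋆⟫ P.sym (C-section c eq))
        ⨟ solve 3 (λ s a c → s :* (a :* c) := a :* (s :* c)) P.refl (const (ℤ.- s)) (η 1)
            (sec (toℕ c) C))

      at-section : ∀ c d s → d ≡ suc c → sec d F ≋ const (ℤ.- s) ⋆ sec c C → ∀ n → F (5 * n + d)
          ≡ ℤ.- s ℤ.* G (5 * n + d)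
      at-section c d s refl eq n = trans (sym (sec-at d F n))
          (trans (eq .at n) (trans (const-⋆-at (ℤ.- s) (sec c C) n) (cong (λ z → ℤ.- s ℤ.* z)
        (trans (sec-at c C n) (trans (sym (G-suc (5 * n + c)))
            (cong G (sym (ℕ.+-suc (5 * n) c))))))))

    -- The signs -, +, +, - for the residues 1, 2, 3, 4 are those of -χ(m), χ the Legendre symbol
    -- modulo 5.
    F-1 : ∀ n → F (5 * n + 1) ≡ ℤ.- + 5 ℤ.* G (5 * n + 1)
    F-1 = at-section 0 1 (+ 5) refl (F-section 0F 1F (+ 5) (sec-interleave 0F)
        (sec-cong 1 η₁^5-dissection ⨟ sec-interleave 1F))

    F-2 : ∀ n → F (5 * n + 2) ≡ + 5 ℤ.* G (5 * n + 2)
    F-2 = at-section 1 2 (ℤ.- + 5) refl (F-section 1F 2F (ℤ.- + 5) (sec-interleave 1F)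
        (sec-cong 2 η₁^5-dissection ⨟ sec-interleave 2F))

    F-3 : ∀ n → F (5 * n + 3) ≡ + 5 ℤ.* G (5 * n + 3)
    F-3 = at-section 2 3 (ℤ.- + 5) refl (F-section 2F 3F (ℤ.- + 5) (sec-interleave 2F)
        (sec-cong 3 η₁^5-dissection ⨟ sec-interleave 3F))

    F-4 : ∀ n → F (5 * n + 4) ≡ ℤ.- + 5 ℤ.* G (5 * n + 4)
    F-4 = at-section 3 4 (+ 5) refl (F-section 3F 4F (+ 5) (sec-interleave 3F)
        (sec-cong 4 η₁^5-dissection ⨟ sec-interleave 4F))

open Recurrences

-- β-sets, hook numbers and the 5-abacus.

module BetaSets where
  open import Data.Nat.ListAction using (sum)

  above below≤ : ℕ → List ℕ → ℕ
  above j μ = conjugatePart μ (suc j)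
  below≤ j μ = length (filter (_≤? j) μ)

  private
    variable
      p b j : ℕ
      μ Y : List ℕ

    below≤-yes : p ≤ j → below≤ j (p ∷ μ) ≡ suc (below≤ j μ)
    below≤-yes {p} {j} p≤j = cong length (List.filter-accept (_≤? j) p≤j)

    below≤-no : j < p → below≤ j (p ∷ μ) ≡ below≤ j μ
    below≤-no {j} j<p = cong length (List.filter-reject (_≤? j) (ℕ.<⇒≱ j<p))

    above-yes : j < p → above j (p ∷ μ) ≡ suc (above j μ)
    above-yes {j} j<p = cong length (List.filter-accept (suc j ≤?_) j<p)

    above-no : p ≤ j → above j (p ∷ μ) ≡ above j μ
    above-no {p} {j} p≤j = cong length (List.filter-reject (suc j ≤?_) (ℕ.≤⇒≯ p≤j))

    below≤-all : All (p ≥_) μ → p ≤ j → below≤ j μ ≡ length μ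
    below≤-all {j = j} a p≤j = cong length
        (List.filter-all (_≤? j) (All.map (λ x≤p → ℕ.≤-trans x≤p p≤j) a))

  below+above : ∀ j μ → below≤ j μ + above j μ ≡ length μ
  below+above j []      = refl
  below+above j (p ∷ μ) with ℕ.≤-<-connex p j
  ... | inj₁ p≤j = trans (cong₂ _+_ (below≤-yes {μ = μ} p≤j) (above-no {μ = μ} p≤j))
      (cong suc (below+above j μ))
  ... | inj₂ j<p = trans (cong₂ _+_ (below≤-no {μ = μ} j<p) (above-yes {μ = μ} j<p))
      (trans (ℕ.+-suc _ _) (cong suc (below+above j μ)))

  Decreasing : List ℕ → Set
  Decreasing = AllPairs _≥_

  -- The β-set (first-column hook lengths) of a weakly decreasing list, zeros allowed.
  beads : List ℕ → List ℕ
  beads []      = []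
  beads (p ∷ μ) = p + length μ ∷ beads μ

  length-beads : ∀ μ → length (beads μ) ≡ length μ
  length-beads []      = refl
  length-beads (p ∷ μ) = cong suc (length-beads μ)

  sum-beads : ∀ μ → sum (beads μ) ≡ tri (length μ) + sum μ
  sum-beads []      = refl
  sum-beads (p ∷ μ) = trans (cong (λ s → p + length μ + s) (sum-beads μ))
      (lem p (length μ) (tri (length μ)) (sum μ))
    where lem : ∀ p l t s → p + l + (t + s) ≡ t + l + (p + s)
          lem = ℕTactic.solve-∀

  beads-< : ∀ {μ} → All (p ≥_) μ → Decreasing μ → All (_< p + length μ) (beads μ)
  beads-< {p} {[]}    a d = []
  beads-< {p} {r ∷ μ} (r≤p ∷ a) (d ∷ ds) = bound ∷ All.map (λ x< → ℕ.<-trans x< bound)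
      (beads-< d ds)
    where bound : r + length μ < p + suc (length μ)
          bound = ℕ.≤-trans (ℕ.≤-reflexive (sym (ℕ.+-suc r (length μ))))
              (ℕ.+-monoˡ-≤ (suc (length μ)) r≤p)

  beads-strict : ∀ {μ} → Decreasing μ → AllPairs (λ x y → y < x) (beads μ)
  beads-strict {[]}    []       = []
  beads-strict {p ∷ μ} (d ∷ ds) = beads-< d ds ∷ beads-strict ds

  -- The gaps of the β-set are the numbers j + #{parts ≤ j}.
  bead-or-gap : ∀ {μ} → Decreasing μ → ∀ c → c ∈ beads μ ⊎ ∃ λ j → c ≡ j + below≤ j μ
  bead-or-gap {[]}    []       c = inj₂ (c , sym (ℕ.+-identityʳ c))
  bead-or-gap {p ∷ μ} (d ∷ ds) c with ℕ.<-cmp c (p + length μ)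

  ... | tri≈ _ c≡ _ = inj₁ (here c≡)
  ... | tri> _ _ c> = inj₂ (c ∸ suc (length μ) , sym (trans (cong (λ x → c ∸ suc (length μ) + x)
        (trans (below≤-yes {μ = μ} p≤) (cong suc (below≤-all d p≤))))
            (ℕ.m∸n+n≡m (ℕ.≤-trans (s≤s (ℕ.m≤n+m (length μ) p)) c>))))
    where p≤ : p ≤ c ∸ suc (length μ)
          p≤ = ℕ.m+n≤o⇒m≤o∸n p (ℕ.≤-trans (ℕ.≤-reflexive (ℕ.+-suc p (length μ))) c>)
  ... | tri< c< _ _ with bead-or-gap ds c
  ...   | inj₁ c∈ = inj₁ (there c∈)
  ...   | inj₂ (j , c≡) = inj₂ (j , trans c≡ (cong (λ x → j + x) (sym (below≤-no {μ = μ} j<p))))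
    where j<p : j < p
          j<p with ℕ.<-≤-connex j p
          ... | inj₁ j<p = j<p
          ... | inj₂ p≤j = contradiction c< (ℕ.≤⇒≯ (ℕ.≤-trans (ℕ.+-monoˡ-≤ (length μ) p≤j)
            (ℕ.≤-reflexive (sym (trans c≡ (cong (λ x → j + x) (below≤-all d p≤j)))))))

  bead≢gap : ∀ {μ} → Decreasing μ → ∀ j → j + below≤ j μ ∉ beads μ
  bead≢gap {p ∷ μ} (d ∷ ds) j c∈ with ℕ.≤-<-connex p j
  ... | inj₁ p≤j = ℕ.<-irrefl refl (ℕ.<-≤-trans (lt c∈)
      (ℕ.≤-trans (ℕ.+-monoˡ-≤ (suc (length μ)) p≤j)
        (ℕ.≤-reflexive (cong (λ x → j + x)
            (sym (trans (below≤-yes {μ = μ} p≤j) (cong suc (below≤-all d p≤j))))))))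
    where
    lt : ∀ {c} → c ∈ beads (p ∷ μ) → c < p + suc (length μ)
    lt (here refl) = ℕ.+-monoʳ-< p (ℕ.n<1+n (length μ))
    lt (there c∈)  = ℕ.<-trans (All.lookup (beads-< d ds) c∈) (ℕ.+-monoʳ-< p (ℕ.n<1+n (length μ)))
  ... | inj₂ j<p with subst (_∈ beads (p ∷ μ)) (cong (λ x → j + x) (below≤-no {μ = μ} j<p)) c∈
  ...   | there c∈′ = bead≢gap ds j c∈′
  ...   | here c≡ = ℕ.<⇒≢ (ℕ.+-mono-<-≤ j<p (ℕ.≤-trans (ℕ.m≤m+n (below≤ j μ) (above j μ))
      (ℕ.≤-reflexive (below+above j μ)))) c≡

  -- The hook condition row by row: the hooks of the first row of p ∷ μ are p + #{parts of μ > j} − j.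
  Core : List ℕ → Set
  Core []      = ⊤
  Core (p ∷ μ) = (∀ j → j < p → ¬ (5 ∣ p + above j μ ∸ j)) × Core μ

  private
    hook-first : ∀ p μ (i : Fin p) → hook (p ∷ μ) fzero i ≡ p + above (toℕ i) μ ∸ toℕ i
    hook-first p μ i = trans (cong (λ x → p + x + 1 ∸ suc (suc (toℕ i)))
        (above-yes {μ = μ} (Fin.toℕ<n i)))
      (cong (_∸ suc (suc (toℕ i))) (lem p (above (toℕ i) μ)))
      where lem : ∀ p x → p + suc x + 1 ≡ 2 + (p + x)
            lem = ℕTactic.solve-∀

    hook-rest : ∀ p μ (i : Fin (length μ)) (l : Fin (lookup μ i)) → lookup μ i ≤ p →
        hook (p ∷ μ) (fsuc i) l ≡ hook μ i l
    hook-rest p μ i l ≤p = trans (cong (λ x → lookup μ i + x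
        + 1 ∸ (suc (suc (toℕ i)) + suc (toℕ l))) (above-yes {μ = μ} (ℕ.<-≤-trans (Fin.toℕ<n l) ≤p)))
      (cong (_∸ (suc (suc (toℕ i)) + suc (toℕ l))) (lem (lookup μ i) (above (toℕ l) μ)))
      where lem : ∀ m x → m + suc x + 1 ≡ suc (m + x + 1)
            lem = ℕTactic.solve-∀

    lookup≤ : ∀ {μ} → All (p ≥_) μ → (i : Fin (length μ)) → lookup μ i ≤ p
    lookup≤ (x≤p ∷ a) fzero    = x≤p
    lookup≤ (x≤p ∷ a) (fsuc i) = lookup≤ a i

  IsCore⇒Core : ∀ {μ} → Decreasing μ → IsCore 5 μ → Core μ
  IsCore⇒Core {[]}    _        _ = tt
  IsCore⇒Core {p ∷ μ} (d ∷ ds) κ =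
    (λ j j<p 5∣ → κ fzero (fromℕ< j<p) (subst (5 ∣_)
        (sym (trans (hook-first p μ _) (cong (λ j → p + above j μ ∸ j) (Fin.toℕ-fromℕ< j<p)))) 5∣))
    , IsCore⇒Core ds (λ i l 5∣ → κ (fsuc i) l (subst (5 ∣_) (sym (hook-rest p μ i l (lookup≤ d i)))
        5∣))

  Core⇒IsCore : ∀ {μ} → Decreasing μ → Core μ → IsCore 5 μ
  Core⇒IsCore {p ∷ μ} (d ∷ ds) (κ , κs) fzero    l 5∣ =
      κ (toℕ l) (Fin.toℕ<n l) (subst (5 ∣_) (hook-first p μ l) 5∣)
  Core⇒IsCore {p ∷ μ} (d ∷ ds) (κ , κs) (fsuc i) l 5∣ =
      Core⇒IsCore ds κs i l (subst (5 ∣_) (hook-rest p μ i l (lookup≤ d i)) 5∣)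

  -- No bead has a gap five places below it: on the abacus with five runners no bead can be slid
  -- down.
  Closed : List ℕ → Set
  Closed Y = ∀ c → 5 + c ∈ Y → c ∈ Y

  private
    -- A hook number of the first row is the distance from the first bead down to the gap j +
    -- `below≤ j μ`. Hook numbers divisible by 5 therefore are beads with a gap below them on the
    -- same runner.
    first-hook : ∀ p μ j → j < p → (p + above j μ ∸ j) + (j + below≤ j μ) ≡ p + length μ
    first-hook p μ j j<p = trans (sym (ℕ.+-assoc (p + above j μ ∸ j) j _))
        (trans (cong (_+ below≤ j μ) (ℕ.m∸n+n≡m (ℕ.≤-trans (ℕ.<⇒≤ j<p) (ℕ.m≤m+n p _))))
      (trans (lem p (above j μ) (below≤ j μ)) (cong (λ x → p + x) (below+above j μ))))
      where lem : ∀ p a b → p + a + b ≡ p + (b + a)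
            lem = ℕTactic.solve-∀

    Closed-tail : All (_< b) Y → Closed (b ∷ Y) → Closed Y
    Closed-tail a κ c 5+c∈ with κ c (there 5+c∈)
    ... | there c∈ = c∈
    ... | here refl = contradiction (All.lookup a 5+c∈) (ℕ.≤⇒≯ (ℕ.m≤n+m c 5))

    Closed-* : Closed Y → ∀ t c → t * 5 + c ∈ Y → c ∈ Y
    Closed-* κ zero    c c∈ = c∈
    Closed-* {Y} κ (suc t) c c∈ = Closed-* κ t c (κ (t * 5 + c) c∈)

  Core⇒Closed : ∀ {μ} → Decreasing μ → Core μ → Closed (beads μ)
  Core⇒Closed {p ∷ μ} (d ∷ ds) (κ , κs) c (there 5+c∈) = there (Core⇒Closed ds κs c 5+c∈)
  Core⇒Closed {p ∷ μ} (d ∷ ds) (κ , κs) c (here eq) with bead-or-gap ds c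
  ... | inj₁ c∈ = there c∈
  ... | inj₂ (j , c≡) = contradiction (divides 1
      (ℕ.+-cancelʳ-≡ c _ _ (trans (cong (λ x → p + above j μ ∸ j + x) c≡)
      (trans (first-hook p μ j j<p) (sym eq))))) (κ j j<p)
    where
    j<p : j < p
    j<p with ℕ.<-≤-connex j p
    ... | inj₁ j<p = j<p
    ... | inj₂ p≤j = contradiction (ℕ.≤-trans (s≤s (ℕ.m≤n+m c 4)) (ℕ.≤-reflexive eq))
        (ℕ.≤⇒≯ (ℕ.≤-trans (ℕ.+-monoˡ-≤ (length μ) p≤j)
        (ℕ.≤-reflexive (sym (trans c≡ (cong (λ x → j + x) (below≤-all d p≤j)))))))

  -- A hook number 5 t would put a bead 5 t places above a gap; closedness, applied t times, makes
  -- the gap a bead. Conversely, in `Core⇒Closed`, excluding the hook number 5 is enough.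
  Closed⇒Core : ∀ {μ} → Decreasing μ → Closed (beads μ) → Core μ
  Closed⇒Core {[]}    _        _ = tt
  Closed⇒Core {p ∷ μ} (d ∷ ds) κ = row , Closed⇒Core ds (Closed-tail (beads-< d ds) κ)
    where
    row : ∀ j → j < p → ¬ (5 ∣ p + above j μ ∸ j)
    row j j<p (divides t eq) with Closed-* κ t (j + below≤ j μ)
        (here (trans (cong (_+ (j + below≤ j μ)) (sym eq)) (first-hook p μ j j<p)))
    ... | there c∈ = bead≢gap ds j c∈
    ... | here c≡ = ℕ.<⇒≢ (ℕ.+-mono-<-≤ j<p (ℕ.≤-trans (ℕ.m≤m+n (below≤ j μ) (above j μ))
        (ℕ.≤-reflexive (below+above j μ)))) c≡

  bump : Fin 5 → (Fin 5 → ℕ) → Fin 5 → ℕ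
  bump s t r with r Fin.≟ s
  ... | yes _ = suc (t r)
  ... | no _  = t r

  runners : List ℕ → Fin 5 → ℕ
  runners []      r = 0
  runners (b ∷ Y) r = bump (mod5 b) (runners Y) r

  private
    Strict : List ℕ → Set
    Strict = AllPairs (λ x y → y < x)

    bump-same : ∀ s t → bump s t s ≡ suc (t s)
    bump-same s t with s Fin.≟ s
    ... | yes _  = refl
    ... | no s≢s = contradiction refl s≢s

    bump-≤ : ∀ s t r → t r ≤ bump s t r
    bump-≤ s t r with r Fin.≟ s
    ... | yes _ = ℕ.n≤1+n (t r)
    ... | no _  = ℕ.≤-refl

    Runner : List ℕ → Set
    Runner Y = ∀ r q → (toℕ r + q * 5 ∈ Y → q < runners Y r) × (q < runners Y r → toℕ r + q * 5 ∈ Y)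

    5+ : ∀ (r : Fin 5) q → toℕ r + suc q * 5 ≡ 5 + (toℕ r + q * 5)
    5+ r q = lem (toℕ r) q
      where lem : ∀ r q → r + suc q * 5 ≡ 5 + (r + q * 5)
            lem = ℕTactic.solve-∀

    -- The largest bead b lies directly on top of the others of its runner: they are all smaller
    -- than b, and closedness puts b - 5 among them.
    top : ∀ {b Y} → All (_< b) Y → Closed (b ∷ Y) → Runner Y → runners Y (mod5 b) ≡ b / 5
    top {b} {Y} a κ run = ℕ.≤-antisym (ℕ.≮⇒≥ λ q< →
        ℕ.<-irrefl refl (All.lookup a (subst (_∈ Y) (mod+div b) (proj₂ (run (mod5 b) (b / 5)) q<))))
        (≥ (b / 5) refl)
      where
      ≥ : ∀ q → q ≡ b / 5 → q ≤ runners Y (mod5 b)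
      ≥ zero    _  = z≤n
      ≥ (suc q) eq with κ (toℕ (mod5 b) + q * 5)
          (here (trans (sym (5+ (mod5 b) q)) (trans (cong (λ q → toℕ (mod5 b) + q * 5) eq)
          (mod+div b))))
      ... | there c∈ = proj₁ (run (mod5 b) q) c∈
      ... | here c≡  = contradiction (trans (sym (5+ (mod5 b) q))
          (trans (cong (λ q → toℕ (mod5 b) + q * 5) eq) (trans (mod+div b) (sym c≡))))
          (ℕ.<⇒≢ (s≤s (ℕ.m≤n+m _ 4)) ∘ sym)

  -- In a set closed under b ↦ b − 5 every runner is filled from the bottom.
  runner : ∀ {Y} → Strict Y → Closed Y → Runner Y
  runner {[]} _ _ r q = (λ ()) , (λ ())
  runner {b ∷ Y} (a ∷ s) κ r q = to , from
    where
    run : Runner Y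
    run = runner s (Closed-tail a κ)
    to : toℕ r + q * 5 ∈ b ∷ Y → q < runners (b ∷ Y) r
    to (there c∈) = ℕ.<-≤-trans (proj₁ (run r q) c∈) (bump-≤ (mod5 b) (runners Y) r)
    to (here refl) = ℕ.≤-reflexive (trans (cong suc (sym (trans (top a κ run) (div5-+ r q))))
      (sym (trans (cong (bump (mod5 b) (runners Y)) (sym (mod5-+ r q)))
          (bump-same (mod5 b) (runners Y)))))
    from : q < runners (b ∷ Y) r → toℕ r + q * 5 ∈ b ∷ Y
    from q< with r Fin.≟ mod5 b
    ... | no _ = there (proj₂ (run r q) q<)
    ... | yes refl with ℕ.m≤n⇒m<n∨m≡n (s≤s⁻¹ q<)
    ...   | inj₁ q<′  = there (proj₂ (run r q) q<′)
    ...   | inj₂ q≡ = here (trans (cong (λ q → toℕ r + q * 5) (trans q≡ (top a κ run))) (mod+div b))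

  -- The sum of all bead positions when runner r carries t r beads in its lowest places: these are r
  -- + 5 q for q < t r, with sum r · t r + 5 `tri (t r)`.
  weight total : (Fin 5 → ℕ) → ℕ
  weight t = 5 * tri (t 0F) + (t 1F + 5 * tri (t 1F)) + (2 * t 2F + 5 * tri (t 2F))
      + (3 * t 3F + 5 * tri (t 3F)) + (4 * t 4F + 5 * tri (t 4F))
  total t = t 0F + t 1F + t 2F + t 3F + t 4F

  private
    weight-bump : ∀ s t → weight (bump s t) ≡ toℕ s + t s * 5 + weight t
    weight-bump 0F t = lem (t 0F) (tri (t 0F)) _ _ _ _
      where lem : ∀ m x b c d e → 5 * (x + m) + b + c + d + e ≡ 0 + m * 5 + (5 * x + b + c + d + e)
            lem = ℕTactic.solve-∀
    weight-bump 1F t = lem (t 1F) (tri (t 1F)) (5 * tri (t 0F)) _ _ _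
      where lem : ∀ m x a c d e → a + (suc m + 5 * (x + m)) + c + d + e ≡ 1 + m * 5
              + (a + (m + 5 * x) + c + d + e)
            lem = ℕTactic.solve-∀
    weight-bump 2F t = lem (t 2F) (tri (t 2F)) (5 * tri (t 0F)) (t 1F + 5 * tri (t 1F)) _ _
      where lem : ∀ m x a b d e → a + b + (2 * suc m + 5 * (x + m)) + d + e ≡ 2 + m * 5
              + (a + b + (2 * m + 5 * x) + d + e)
            lem = ℕTactic.solve-∀
    weight-bump 3F t = lem (t 3F) (tri (t 3F)) (5 * tri (t 0F)) (t 1F + 5 * tri (t 1F)) (2 * t 2F
        + 5 * tri (t 2F)) _
      where lem : ∀ m x a b c e → a + b + c + (3 * suc m + 5 * (x + m)) + e ≡ 3 + m * 5
              + (a + b + c + (3 * m + 5 * x) + e)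
            lem = ℕTactic.solve-∀
    weight-bump 4F t = lem (t 4F) (tri (t 4F)) (5 * tri (t 0F)) (t 1F + 5 * tri (t 1F)) (2 * t 2F
        + 5 * tri (t 2F)) (3 * t 3F + 5 * tri (t 3F))
      where lem : ∀ m x a b c d → a + b + c + d + (4 * suc m + 5 * (x + m)) ≡ 4 + m * 5
              + (a + b + c + d + (4 * m + 5 * x))
            lem = ℕTactic.solve-∀

    total-bump : ∀ s t → total (bump s t) ≡ suc (total t)
    total-bump 0F t = refl
    total-bump 1F t = lem (t 0F) (t 1F) (t 2F) (t 3F) (t 4F)
      where lem : ∀ a b c d e → a + suc b + c + d + e ≡ suc (a + b + c + d + e)
            lem = ℕTactic.solve-∀
    total-bump 2F t = lem (t 0F) (t 1F) (t 2F) (t 3F) (t 4F)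
      where lem : ∀ a b c d e → a + b + suc c + d + e ≡ suc (a + b + c + d + e)
            lem = ℕTactic.solve-∀
    total-bump 3F t = lem (t 0F) (t 1F) (t 2F) (t 3F) (t 4F)
      where lem : ∀ a b c d e → a + b + c + suc d + e ≡ suc (a + b + c + d + e)
            lem = ℕTactic.solve-∀
    total-bump 4F t = ℕ.+-suc (t 0F + t 1F + t 2F + t 3F) (t 4F)

  weight-runners : ∀ {Y} → Strict Y → Closed Y → weight (runners Y) ≡ sum Y
  weight-runners {[]} _ _ = refl
  weight-runners {b ∷ Y} (a ∷ s) κ = trans (weight-bump (mod5 b) (runners Y))
    (cong₂ _+_ (trans (cong (λ q → toℕ (mod5 b) + q * 5) (top a κ (runner s (Closed-tail a κ))))
        (mod+div b)) (weight-runners s (Closed-tail a κ)))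

  total-runners : ∀ Y → total (runners Y) ≡ length Y
  total-runners []      = refl
  total-runners (b ∷ Y) = trans (total-bump (mod5 b) (runners Y)) (cong suc (total-runners Y))

  -- The inverse of `runners`, with beads in decreasing order. The number k bounds the heights, so
  -- positions below 5 (k + 1) suffice.
  abacus : ℕ → (Fin 5 → ℕ) → List ℕ
  abacus k t = filter (λ c → c / 5 <? t (mod5 c)) (downFrom (5 * suc k))

  module _ (k : ℕ) (t : Fin 5 → ℕ) (t≤k : ∀ r → t r ≤ k) where
    private
      P? = λ c → c / 5 <? t (mod5 c)

      in-abacus : ∀ r q → q < t r → toℕ r + q * 5 ∈ abacus k t
      in-abacus r q q< = ∈.∈-filter⁺ P? (∈.∈-downFrom⁺ bound)
          (ℕ.≤-trans (ℕ.≤-reflexive (cong suc (div5-+ r q)))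
          (ℕ.≤-trans q< (ℕ.≤-reflexive (cong t (sym (mod5-+ r q))))))
        where bound : toℕ r + q * 5 < 5 * suc k
              bound = ℕ.<-≤-trans (ℕ.+-monoˡ-< (q * 5) (Fin.toℕ<n r))
                  (ℕ.≤-trans (ℕ.≤-reflexive (ℕ.*-comm (suc q) 5))
                (ℕ.*-monoʳ-≤ 5 (ℕ.m≤n⇒m≤1+n (ℕ.≤-trans q< (t≤k r)))))

      out-abacus : ∀ r q → toℕ r + q * 5 ∈ abacus k t → q < t r
      out-abacus r q c∈ = ℕ.≤-trans (ℕ.≤-reflexive (cong suc (sym (div5-+ r q))))
          (ℕ.≤-trans (proj₂ (∈.∈-filter⁻ P? {xs = downFrom (5 * suc k)} c∈))
          (ℕ.≤-reflexive (cong t (mod5-+ r q))))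

    abacus-strict : Strict (abacus k t)
    abacus-strict = AllPairs.filter⁺ P? (AllPairs.applyDownFrom⁺₁ id (5 * suc k) (λ j<i _ → j<i))

    abacus-closed : Closed (abacus k t)
    abacus-closed c 5+c∈ = subst (_∈ abacus k t) (mod+div c) (in-abacus (mod5 c) (c / 5)
      (ℕ.<-trans (ℕ.n<1+n _) (out-abacus (mod5 c) (suc (c / 5))
          (subst (_∈ abacus k t) (sym (trans (5+ (mod5 c) (c / 5))
          (cong (λ x → 5 + x) (mod+div c)))) 5+c∈))))

    runners-abacus : ∀ r → runners (abacus k t) r ≡ t r
    runners-abacus r = ℕ.≤-antisym
      (initial (λ q q< → out-abacus r q (proj₂ (runner abacus-strict abacus-closed r q) q<)))
      (initial (λ q q< → proj₁ (runner abacus-strict abacus-closed r q) (in-abacus r q q<)))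
      where
      initial : ∀ {m n} → (∀ q → q < m → q < n) → m ≤ n
      initial {zero}  f = z≤n
      initial {suc m} f = f m ℕ.≤-refl

  private
    strict-length : ∀ {b Y} → All (_< b) Y → Strict Y → length Y ≤ b
    strict-length {Y = []}    _ _ = z≤n
    strict-length {Y = c ∷ Y} (c<b ∷ _) (a ∷ s) = ℕ.≤-trans (s≤s (strict-length a s)) c<b

    Decreasing-∷ : ∀ {p r μ} → r ≤ p → Decreasing (r ∷ μ) → Decreasing (p ∷ r ∷ μ)
    Decreasing-∷ r≤p (d ∷ ds) = (r≤p ∷ All.map (λ x≤ → ℕ.≤-trans x≤ r≤p) d) ∷ d ∷ ds

  beads-surjective : ∀ {Y} → Strict Y → ∃ λ μ → Decreasing μ × beads μ ≡ Y
  beads-surjective {[]} _ = [] , [] , refl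
  beads-surjective {b ∷ Y} (a ∷ s) with beads-surjective s
  ... | [] , d , refl = b ∷ [] , [] ∷ [] , cong (_∷ []) (ℕ.+-identityʳ b)
  ... | r ∷ μ , d , refl = b ∸ l ∷ r ∷ μ , Decreasing-∷ r≤ d , cong (_∷ beads (r ∷ μ))
      (ℕ.m∸n+n≡m l≤b)
    where
    l = suc (length μ)
    l≤b : l ≤ b
    l≤b = ℕ.≤-trans (ℕ.≤-reflexive (cong suc (sym (length-beads μ)))) (strict-length a s)
    r≤ : r ≤ b ∸ l
    r≤ = ℕ.m+n≤o⇒m≤o∸n r (ℕ.≤-trans (ℕ.≤-reflexive (ℕ.+-suc r (length μ)))
        (All.lookup a (here refl)))

  beads-injective : ∀ {μ ν} → beads μ ≡ beads ν → μ ≡ ν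
  beads-injective {[]}    {[]}    _  = refl
  beads-injective {p ∷ μ} {r ∷ ν} eq with beads-injective {μ} {ν} (List.∷-injectiveʳ eq)
  ... | refl = cong (_∷ μ) (ℕ.+-cancelʳ-≡ (length μ) p r (List.∷-injectiveˡ eq))

  strict-≡ : ∀ {Y Z} → Strict Y → Strict Z → (∀ {c} → c ∈ Y → c ∈ Z) → (∀ {c} → c ∈ Z → c ∈ Y) →
      Y ≡ Z
  strict-≡ {[]}    {[]}    _ _ f g = refl
  strict-≡ {[]}    {z ∷ Z} _ _ f g with g (here refl)
  ... | ()
  strict-≡ {y ∷ Y} {[]}    _ _ f g with f (here refl)
  ... | ()
  strict-≡ {y ∷ Y} {z ∷ Z} (a ∷ s) (a′ ∷ s′) f g = cong₂ _∷_ y≡z (strict-≡ s s′ f′ g′)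
    where
    ≤-head : ∀ {y z Z} → y ∈ z ∷ Z → All (_< z) Z → y ≤ z
    ≤-head (here refl) _ = ℕ.≤-refl
    ≤-head (there y∈)  a = ℕ.<⇒≤ (All.lookup a y∈)
    y≡z : y ≡ z
    y≡z = ℕ.≤-antisym (≤-head (f (here refl)) a′) (≤-head (g (here refl)) a)
    f′ : ∀ {c} → c ∈ Y → c ∈ Z
    f′ c∈ with f (there c∈)
    ... | there c∈′ = c∈′
    ... | here refl = contradiction (All.lookup a c∈) (ℕ.≤⇒≯ (ℕ.≤-reflexive y≡z))
    g′ : ∀ {c} → c ∈ Z → c ∈ Y
    g′ c∈ with g (there c∈)
    ... | there c∈′ = c∈′
    ... | here refl = contradiction (All.lookup a′ c∈) (ℕ.≤⇒≯ (ℕ.≤-reflexive (sym y≡z)))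

  runners-injective : ∀ {Y Z} → Strict Y → Closed Y → Strict Z → Closed Z →
      (∀ r → runners Y r ≡ runners Z r) → Y ≡ Z
  runners-injective {Y} {Z} s κ s′ κ′ eq = strict-≡ s s′ (transfer s κ s′ κ′ eq)
      (transfer s′ κ′ s κ (sym ∘ eq))
    where
    transfer : ∀ {Y Z} → Strict Y → Closed Y → Strict Z → Closed Z →
        (∀ r → runners Y r ≡ runners Z r) → ∀ {c} → c ∈ Y → c ∈ Z
    transfer {Y} {Z} s κ s′ κ′ eq {c} c∈ =
        subst (_∈ Z) (mod+div c) (proj₂ (runner s′ κ′ (mod5 c) (c / 5))
      (ℕ.<-≤-trans (proj₁ (runner s κ (mod5 c) (c / 5)) (subst (_∈ Y) (sym (mod+div c)) c∈))
          (ℕ.≤-reflexive (eq (mod5 c)))))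

open BetaSets

-- The bijection between 5-cores and tuples of runner heights.

module Abacus where
  open import Data.Nat.ListAction using (sum)

  opaque
    tuples : ∀ m → ℕ → List (Vec ℕ m)
    tuples zero    zero    = [] ∷ []
    tuples zero    (suc k) = []
    tuples (suc m) k       = concat (map (λ i → map (i ∷_) (tuples m (k ∸ i))) (upTo (suc k)))

    ∈-tuples⁻ : ∀ m k {w} → w ∈ tuples m k → Vec.sum w ≡ k
    ∈-tuples⁻ zero    zero    (here refl) = refl
    ∈-tuples⁻ (suc m) k w∈ with ∈.∈-concat⁻′ (map (λ i → map (i ∷_) (tuples m (k ∸ i)))
        (upTo (suc k))) w∈
    ... | _ , w∈l , l∈ with ∈.∈-map⁻ (λ i → map (i ∷_) (tuples m (k ∸ i))) {xs = upTo (suc k)} l∈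
    ...   | i , i∈ , refl with ∈.∈-map⁻ (i ∷_) w∈l
    ...     | w′ , w′∈ , refl = trans (cong (λ s → i + s) (∈-tuples⁻ m (k ∸ i) w′∈))
        (ℕ.m+[n∸m]≡n (s≤s⁻¹ (∈.∈-upTo⁻ i∈)))

    ∈-tuples⁺ : ∀ m k {w} → Vec.sum w ≡ k → w ∈ tuples m k
    ∈-tuples⁺ zero    zero    {[]}    _ = here refl
    ∈-tuples⁺ (suc m) k {i ∷ w} refl = ∈.∈-concat⁺′
      (∈.∈-map⁺ (i ∷_) (∈-tuples⁺ m (k ∸ i) (sym (ℕ.m+n∸m≡n i (Vec.sum w)))))
      (∈.∈-map⁺ _ (∈.∈-upTo⁺ (s≤s (ℕ.m≤m+n i (Vec.sum w)))))

    tuples-unique : ∀ m k → Unique (tuples m k)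
    tuples-unique zero    zero    = [] ∷ []
    tuples-unique zero    (suc k) = []
    tuples-unique (suc m) k = Unique.concat⁺
      (All.map⁺ (All.applyUpTo⁺₂ id (suc k) (λ i →
          Unique.map⁺ Vec.∷-injectiveʳ (tuples-unique m (k ∸ i)))))
      (AllPairs.map⁺ (AllPairs.map disjoint (Unique.upTo⁺ (suc k))))
      where
      disjoint : ∀ {i j} → i ≢ j → ∀ {w} →
          ¬ (w ∈ map (i ∷_) (tuples m (k ∸ i)) × w ∈ map (j ∷_) (tuples m (k ∸ j)))
      disjoint {i} {j} i≢j (p , r) with ∈.∈-map⁻ (i ∷_) p | ∈.∈-map⁻ (j ∷_) r
      ... | _ , _ , refl | _ , _ , eq = i≢j (Vec.∷-injectiveˡ eq)

  private
    length-Σℓ : ∀ {I : Set} (xs : List I) → Σℓ xs (λ _ → 1s) 0 ≡ + length xs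
    length-Σℓ []       = refl
    length-Σℓ (x ∷ xs) = trans (⊞-at 1s _ 0) (cong (λ z → 1ℤ ℤ.+ z) (length-Σℓ xs))

    Unique-map-∈ : ∀ {A B : Set} (f : A → B) {xs} → (∀ {x y} → x ∈ xs → y ∈ xs → f x ≡ f y →
        x ≡ y) → Unique xs → Unique (map f xs)
    Unique-map-∈ f inj []       = []
    Unique-map-∈ f inj (x∉ ∷ u) = All.map⁺
        (All.tabulate (λ y∈ fx≡fy → All.lookup x∉ y∈ (inj (here refl) (there y∈) fx≡fy)))
      ∷ Unique-map-∈ f (λ x∈ y∈ → inj (there x∈) (there y∈)) u

    -- A list is counted by summing the series 1 over it, so that `Σℓ-unique` does the comparison of
    -- the two lists.
    equinumerous : ∀ {A B : Set} (f : A → B) {xs ys} → Unique xs → Unique ys →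
      (∀ {x y} → x ∈ xs → y ∈ xs → f x ≡ f y → x ≡ y) → (∀ {x} → x ∈ xs → f x ∈ ys) →
          (∀ {y} → y ∈ ys → ∃ λ x → x ∈ xs × f x ≡ y) →
      length xs ≡ length ys
    equinumerous f {xs} {ys} u v inj into onto =
        trans (sym (List.length-map f xs)) (ℤ.+-injective (trans (sym (length-Σℓ (map f xs)))
      (trans (Σℓ-unique {N = 1} (map f xs) ys (Unique-map-∈ f inj u) v ⊆ ⊇ .below 0 (s≤s z≤n))
          (length-Σℓ ys))))
      where
      ⊆ : ∀ {y} → y ∈ map f xs → y ∈ ys ⊎ 1s ≋[ 1 ] 0s
      ⊆ y∈ with ∈.∈-map⁻ f y∈
      ... | x , x∈ , refl = inj₁ (into x∈)
      ⊇ : ∀ {y} → y ∈ ys → y ∈ map f xs ⊎ 1s ≋[ 1 ] 0s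
      ⊇ y∈ with onto y∈
      ... | x , x∈ , refl = inj₁ (∈.∈-map⁺ f x∈)

    total-lookup : ∀ (w : Vec ℕ 5) → total (Vec.lookup w) ≡ Vec.sum w
    total-lookup (a ∷ b ∷ c ∷ d ∷ e ∷ []) = lem a b c d e
      where lem : ∀ a b c d e → a + b + c + d + e ≡ a + (b + (c + (d + (e + 0))))
            lem = ℕTactic.solve-∀

    total-cong : ∀ {s t : Fin 5 → ℕ} → (∀ r → s r ≡ t r) → total s ≡ total t
    total-cong p = cong₂ _+_ (cong₂ _+_ (cong₂ _+_ (cong₂ _+_ (p 0F) (p 1F)) (p 2F)) (p 3F)) (p 4F)

    weight-cong : ∀ {s t : Fin 5 → ℕ} → (∀ r → s r ≡ t r) → weight s ≡ weight t
    weight-cong p = cong₂ _+_ (cong₂ _+_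
        (cong₂ _+_ (cong₂ _+_ (cong (λ m → 5 * tri m) (p 0F)) (cong (λ m → m + 5 * tri m) (p 1F)))
      (cong (λ m → 2 * m + 5 * tri m) (p 2F))) (cong (λ m → 3 * m + 5 * tri m) (p 3F)))
          (cong (λ m → 4 * m + 5 * tri m) (p 4F))

    lookup≤sum : ∀ {m} (w : Vec ℕ m) r → Vec.lookup w r ≤ Vec.sum w
    lookup≤sum (a ∷ w) fzero    = ℕ.m≤m+n a _
    lookup≤sum (a ∷ w) (fsuc r) = ℕ.≤-trans (lookup≤sum w r) (ℕ.m≤n+m _ a)

  -- The list has exactly k entries, zeros included. The term `tri k` is the bead sum of the empty
  -- partition with k zero parts; the excess of the weight over it is the size of the partition.
  realise : ∀ k w → w ∈ tuples 5 k → ∃ λ μ →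
    Decreasing μ × length μ ≡ k × Closed (beads μ) × (∀ r → runners (beads μ) r ≡ Vec.lookup w r)
        × weight (Vec.lookup w) ≡ tri k + sum μ
  realise k w w∈ with beads-surjective (abacus-strict k (Vec.lookup w) t≤k)
    where t≤k = λ r → ℕ.≤-trans (lookup≤sum w r) (ℕ.≤-reflexive (∈-tuples⁻ 5 k w∈))
  ... | μ , d , eq = μ , d , len , closed , run , trans (weight-cong (sym ∘ run))
      (trans (weight-runners (beads-strict d) closed)
          (trans (sum-beads μ) (cong (λ l → tri l + sum μ) len)))
    where
    t≤k = λ r → ℕ.≤-trans (lookup≤sum w r) (ℕ.≤-reflexive (∈-tuples⁻ 5 k w∈))
    closed : Closed (beads μ)
    closed = subst Closed (sym eq) (abacus-closed k (Vec.lookup w) t≤k)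
    run : ∀ r → runners (beads μ) r ≡ Vec.lookup w r
    run r = trans (cong (λ Y → runners Y r) eq) (runners-abacus k (Vec.lookup w) t≤k r)
    len : length μ ≡ k
    len = trans (sym (length-beads μ)) (trans (sym (total-runners (beads μ)))
        (trans (total-cong run) (trans (total-lookup w) (∈-tuples⁻ 5 k w∈))))

  private
    -- Zero parts add no hooks. Padding to exactly k parts fixes the number of beads, so the runner
    -- heights become tuples of natural numbers with sum k.
    pad : ℕ → List ℕ → List ℕ
    pad m λs = λs ++ replicate m 0

    sum-pad : ∀ m λs → sum (pad m λs) ≡ sum λs
    sum-pad m λs = trans (sum-++ λs (replicate m 0)) (trans (cong (λ s → sum λs + s) (zeros m))
        (ℕ.+-identityʳ _))
      where zeros : ∀ m → sum (replicate m 0) ≡ 0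
            zeros zero    = refl
            zeros (suc m) = zeros m

    length-pad : ∀ m λs → length (pad m λs) ≡ length λs + m
    length-pad m λs = trans (List.length-++ λs)
        (cong (λ s → length λs + s) (List.length-replicate m))

    above-pad : ∀ m j λs → above j (pad m λs) ≡ above j λs
    above-pad m j λs = cong length (trans (List.filter-++ (suc j ≤?_) λs (replicate m 0))
      (trans (cong (filter (suc j ≤?_) λs ++_)
          (List.filter-none (suc j ≤?_) (All.replicate⁺ m λ ()))) (List.++-identityʳ _)))

    Decreasing-pad : ∀ m {λs} → Decreasing λs → Decreasing (pad m λs)
    Decreasing-pad m []       = zeros m
      where zeros : ∀ m → Decreasing (replicate m 0)
            zeros zero    = []
            zeros (suc m) = All.replicate⁺ m z≤n ∷ zeros m
    Decreasing-pad m (d ∷ ds) = All.++⁺ d (All.replicate⁺ m z≤n) ∷ Decreasing-pad m ds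

    Core-pad : ∀ m λs → Core λs → Core (pad m λs)
    Core-pad m []       _ = zeros m
      where zeros : ∀ m → Core (replicate m 0)
            zeros zero    = tt
            zeros (suc m) = (λ _ ()) , zeros m
    Core-pad m (p ∷ λs) (κ , κs) = (λ j j<p →
        subst (λ x → ¬ (5 ∣ p + x ∸ j)) (sym (above-pad m j λs)) (κ j j<p)) , Core-pad m λs κs

    Core-unpad : ∀ m λs → Core (pad m λs) → Core λs
    Core-unpad m []       _        = tt
    Core-unpad m (p ∷ λs) (κ , κs) = (λ j j<p → subst (λ x → ¬ (5 ∣ p + x ∸ j)) (above-pad m j λs)
        (κ j j<p)) , Core-unpad m λs κs

    pad-injective : ∀ l m {λs νs} → All (0 <_) λs → All (0 <_) νs → pad l λs ≡ pad m νs → λs ≡ νs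
    pad-injective l m {λs} {νs} a b eq =
        trans (sym (positive l a)) (trans (cong (filter (0 <?_)) eq) (positive m b))
      where
      positive : ∀ m {λs} → All (0 <_) λs → filter (0 <?_) (pad m λs) ≡ λs
      positive m {λs} a = trans (List.filter-++ (0 <?_) λs (replicate m 0))
        (trans (cong₂ _++_ (List.filter-all (0 <?_) a)
            (List.filter-none (0 <?_) (All.replicate⁺ m λ ()))) (List.++-identityʳ λs))

    unpad : ∀ {μ} → Decreasing μ → ∃ λ λs → ∃ λ m → μ ≡ pad m λs × All (0 <_) λs × Decreasing λs
    unpad {[]}        _ = [] , 0 , refl , [] , []
    unpad {zero ∷ μ}  (d ∷ ds) = [] , suc (length μ) , cong (0 ∷_) (zeros d) , [] , []
      where zeros : ∀ {μ} → All (0 ≥_) μ → μ ≡ replicate (length μ) 0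
            zeros []        = refl
            zeros (z≤n ∷ a) = cong (0 ∷_) (zeros a)
    unpad {suc p ∷ μ} (d ∷ ds) with unpad ds
    ... | λs , m , refl , a , d′ = suc p ∷ λs , m , refl , s≤s z≤n ∷ a , All.++⁻ˡ λs d ∷ d′

    length≤sum : ∀ {λs} → All (0 <_) λs → length λs ≤ sum λs
    length≤sum []      = z≤n
    length≤sum (p ∷ a) = ℕ.+-mono-≤ p (length≤sum a)

    encode : ℕ → List ℕ → Vec ℕ 5
    encode k λs = tabulate (runners (beads (pad (k ∸ length λs) λs)))

  private opaque
    cores : ℕ → List (List ℕ)
    cores n = filter (isCore? 5) (partitions n)

    length-cores : ∀ n → length (cores n) ≡ coreCount 5 n
    length-cores n = refl

    cores-unique : ∀ n → Unique (cores n)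
    cores-unique n = Unique.filter⁺ (isCore? 5) (partitions-unique n)

    ∈-cores⁻ : ∀ n {λs} → λs ∈ cores n → IsPartition n λs × IsCore 5 λs
    ∈-cores⁻ n {λs} λs∈ = let (λs∈p , κ) = ∈.∈-filter⁻ (isCore? 5) {v = λs} {xs = partitions n} λs∈ in
      Equivalence.to (∈-partitions n) λs∈p , κ

    ∈-cores⁺ : ∀ n {λs} → IsPartition n λs → IsCore 5 λs → λs ∈ cores n
    ∈-cores⁺ n {λs} p κ = ∈.∈-filter⁺ (isCore? 5) {x = λs} (Equivalence.from (∈-partitions n) p) κ

  private
    decode : ∀ k n w → w ∈ tuples 5 k → weight (Vec.lookup w) ≡ tri k + n → ∃ λ λs → λs ∈ cores n
        × encode k λs ≡ w
    decode k n w w∈ weight≡ = from (realise k w w∈)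
      where
      from : (∃ λ μ → Decreasing μ × length μ ≡ k × Closed (beads μ)
          × (∀ r → runners (beads μ) r ≡ Vec.lookup w r) × weight (Vec.lookup w) ≡ tri k + sum μ) →
        ∃ λ λs → λs ∈ cores n × encode k λs ≡ w
      from (μ , d , len , closed , run , weight≡′) = strip (unpad d)
        where
        strip : (∃ λ λs → ∃ λ m → μ ≡ pad m λs × All (0 <_) λs × Decreasing λs) → ∃ λ λs →
            λs ∈ cores n × encode k λs ≡ w
        strip (λs , m , μ≡ , pos , ds) = λs
          , ∈-cores⁺ n (Linked.AllPairs⇒Linked ds , pos , trans (sym (sum-pad m λs))
              (trans (cong sum (sym μ≡)) Σ≡n))
              (Core⇒IsCore ds (Core-unpad m λs (subst Core μ≡ (Closed⇒Core d closed))))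
          , trans (Vec.tabulate-cong (λ r → trans (cong (λ ν → runners (beads ν) r) pad≡) (run r)))
              (Vec.tabulate∘lookup w)
          where
          Σ≡n : sum μ ≡ n
          Σ≡n = ℕ.+-cancelˡ-≡ (tri k) _ _ (trans (sym weight≡′) weight≡)
          pad≡ : pad (k ∸ length λs) λs ≡ μ
          pad≡ = trans (cong (λ m → pad m λs)
              (trans (cong (_∸ length λs)
              (trans (sym len) (trans (cong length μ≡) (length-pad m λs))))
              (ℕ.m+n∸m≡n (length λs) m))) (sym μ≡)

  -- A partition of n has at most n ≤ k parts and can be padded to k. Its bead sum, read off from
  -- the heights, is then `tri k + n`.
  coreCount-tuples : ∀ k n → n ≤ k → coreCount 5 n
      ≡ length (filter (λ w → weight (Vec.lookup w) ℕ.≟ tri k + n) (tuples 5 k))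
  coreCount-tuples k n n≤k = trans (sym (length-cores n)) (equinumerous (encode k) (cores-unique n)
      (Unique.filter⁺ (λ w → weight (Vec.lookup w) ℕ.≟ tri k + n) (tuples-unique 5 k)) inj into
          onto)
    where
    record Facts (λs : List ℕ) : Set where
      μ : List ℕ
      μ = pad (k ∸ length λs) λs
      field
        positive : All (0 <_) λs
        decreasing : Decreasing μ
        closed : Closed (beads μ)
        length-μ : length μ ≡ k
        sum-μ : sum μ ≡ n

    facts : ∀ {λs} → λs ∈ cores n → Facts λs
    facts {λs} λs∈ with ∈-cores⁻ n λs∈
    ... | (linked , pos , Σ≡n) , κ = record
      { positive = pos ; decreasing = d ; closed = Core⇒Closed d (Core-pad m λs (IsCore⇒Core ds κ))
      ; length-μ = trans (length-pad m λs)
          (ℕ.m+[n∸m]≡n (ℕ.≤-trans (length≤sum pos) (ℕ.≤-trans (ℕ.≤-reflexive Σ≡n) n≤k)))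
      ; sum-μ = trans (sum-pad m λs) Σ≡n }
      where
      m = k ∸ length λs
      ds : Decreasing λs
      ds = Linked.Linked⇒AllPairs (λ x≥y y≥z → ℕ.≤-trans y≥z x≥y) linked
      d = Decreasing-pad m ds

    inj : ∀ {λs νs} → λs ∈ cores n → νs ∈ cores n → encode k λs ≡ encode k νs → λs ≡ νs
    inj {λs} {νs} λs∈ νs∈ eq = pad-injective (k ∸ length λs) (k ∸ length νs) (A.positive)
        (B.positive)
      (beads-injective (runners-injective (beads-strict A.decreasing) A.closed
          (beads-strict B.decreasing) B.closed
        λ r → trans (sym (Vec.lookup∘tabulate (runners (beads A.μ)) r))
            (trans (cong (λ w → Vec.lookup w r) eq) (Vec.lookup∘tabulate (runners (beads B.μ)) r))))
      where
      module A = Facts (facts λs∈)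
      module B = Facts (facts νs∈)

    into : ∀ {λs} → λs ∈ cores n → encode k λs ∈ filter (λ w → weight (Vec.lookup w) ℕ.≟ tri k + n)
        (tuples 5 k)
    into {λs} λs∈ = ∈.∈-filter⁺ _ (∈-tuples⁺ 5 k (trans (sym (total-lookup (encode k λs)))
        (trans (total-cong (Vec.lookup∘tabulate t))
            (trans (total-runners (beads μ)) (trans (length-beads μ) length-μ)))))
      (trans (weight-cong (Vec.lookup∘tabulate t))
          (trans (weight-runners (beads-strict decreasing) closed)
        (trans (sum-beads μ) (cong₂ (λ l s → tri l + s) length-μ sum-μ))))
      where
      open Facts (facts λs∈)
      t = runners (beads μ)

    onto : ∀ {w} → w ∈ filter (λ w → weight (Vec.lookup w) ℕ.≟ tri k + n) (tuples 5 k) → ∃ λ λs →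
        λs ∈ cores n × encode k λs ≡ w
    onto {w} w∈ = decode k n w (proj₁ split-w) (proj₂ split-w)
      where split-w = ∈.∈-filter⁻ (λ w → weight (Vec.lookup w) ℕ.≟ tri k + n) {v = w} {xs =
              tuples 5 k} w∈

  private
    above≤sum : ∀ j μ → above j μ ≤ sum μ
    above≤sum j []      = z≤n
    above≤sum j (p ∷ μ) = step (suc j ≤? p)
      where
      step : Dec (suc j ≤ p) → above j (p ∷ μ) ≤ p + sum μ
      step (yes j<p) = ℕ.≤-trans (ℕ.≤-reflexive
          (cong length (List.filter-accept (suc j ≤?_) {p} {μ} j<p)))
          (ℕ.+-mono-≤ (ℕ.≤-trans (s≤s z≤n) j<p) (above≤sum j μ))
      step (no j≮p)  = ℕ.≤-trans (ℕ.≤-reflexive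
          (cong length (List.filter-reject (suc j ≤?_) {p} {μ} j≮p)))
          (ℕ.≤-trans (above≤sum j μ) (ℕ.m≤n+m _ p))

  -- The lowest free place c = r + 5 t on runner r is a gap, c = j + `below≤ j μ`. The k beads
  -- number `below≤ j μ` + `above j μ`, at most c plus the size, and the size is below Q. With t < Q
  -- this is less than 5 Q + Q = k.
  runners-large : ∀ Q k → k ≡ Q * 5 + Q → ∀ w → w ∈ tuples 5 k → weight (Vec.lookup w) < tri k + Q →
      ∀ r → Q ≤ Vec.lookup w r
  runners-large Q k k≡ w w∈ small r = from (realise k w w∈)
    where
    t = Vec.lookup w r
    from : (∃ λ μ → Decreasing μ × length μ ≡ k × Closed (beads μ)
        × (∀ r → runners (beads μ) r ≡ Vec.lookup w r) × weight (Vec.lookup w) ≡ tri k + sum μ) →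
        Q ≤ t
    from (μ , d , len , closed , run , weight≡) = case (bead-or-gap d (toℕ r + t * 5))
      where
      sum<Q : sum μ < Q
      sum<Q = ℕ.+-cancelˡ-< (tri k) _ _ (ℕ.≤-<-trans (ℕ.≤-reflexive (sym weight≡)) small)
      case : (toℕ r + t * 5 ∈ beads μ ⊎ ∃ λ j → toℕ r + t * 5 ≡ j + below≤ j μ) → Q ≤ t
      case (inj₁ c∈) = contradiction (proj₁ (runner (beads-strict d) closed r t) c∈)
          (ℕ.<-irrefl (sym (run r)))
      case (inj₂ (j , c≡)) = ℕ.≮⇒≥ λ t<Q →
          ℕ.<-irrefl refl (ℕ.<-≤-trans (bound t<Q) (ℕ.≤-reflexive (sym k≡)))
        where
        bound : t < Q → k < Q * 5 + Q
        bound t<Q = ℕ.≤-<-trans (ℕ.≤-trans (ℕ.≤-reflexive (trans (sym len) (sym (below+above j μ))))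
            (ℕ.+-mono-≤ (ℕ.≤-trans (ℕ.m≤n+m _ j) (ℕ.≤-reflexive (sym c≡))) (above≤sum j μ)))
          (ℕ.+-mono-≤-< (ℕ.≤-trans (ℕ.+-monoˡ-≤ (t * 5) (ℕ.<⇒≤ (Fin.toℕ<n r))) (ℕ.*-monoˡ-≤ 5 t<Q))
              sum<Q)

open Abacus

-- The generating function f₅⁵ / f₁ of the 5-cores.

module CoreGeneratingFunction where
  open import Data.Nat.ListAction using (sum)

  -- Power series in z over ℤ[[q]].
  module Z = Series ℤ[[q]]

  private
    module ZR = CommutativeRing Z.ring
    module *Z = CSProperties (CommutativeMonoid.commutativeSemigroup ZR.*-commutativeMonoid)

    Σℓ-cong-∈ : ∀ {I : Set} {f g : I → PowerSeries} {N} xs → (∀ {i} → i ∈ xs → f i ≋[ N ] g i) →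
        Σℓ xs f ≋[ N ] Σℓ xs g
    Σℓ-cong-∈ []       p = ≋[]-refl
    Σℓ-cong-∈ (x ∷ xs) p = ⊞-cong[] (p (here refl)) (Σℓ-cong-∈ xs (λ i∈ → p (there i∈)))

    Σℓ-zero : ∀ {I : Set} {f : I → PowerSeries} {N} xs → (∀ {i} → i ∈ xs → f i ≋[ N ] 0s) →
        Σℓ xs f ≋[ N ] 0s
    Σℓ-zero []       p = ≋[]-refl
    Σℓ-zero (x ∷ xs) p = ≋[]-trans (⊞-cong[] (p (here refl)) (Σℓ-zero xs (λ i∈ → p (there i∈))))
        (≋⇒≋[] (P.+-identityˡ 0s))

    Σℓ-concat : ∀ {I J : Set} (f : J → PowerSeries) (l : I → List J) xs → Σℓ (concat (map l xs)) f
        ≋ Σℓ xs (λ i → Σℓ (l i) f)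
    Σℓ-concat f l []       = P.refl
    Σℓ-concat f l (x ∷ xs) = Σℓ-++ f (l x) (concat (map l xs)) ⨟ P.+-congˡ (Σℓ-concat f l xs)

    Σℓ-X^ : ∀ {I : Set} (g : I → ℕ) m xs → Σℓ xs (λ i → X ^ g i) m
        ≡ + length (filter (λ i → g i ℕ.≟ m) xs)
    Σℓ-X^ g m []       = refl
    Σℓ-X^ g m (x ∷ xs) = trans (⊞-at (X ^ g x) _ m) (step (g x ℕ.≟ m))
      where
      step : Dec (g x ≡ m) → (X ^ g x) m ℤ.+ Σℓ xs (λ i → X ^ g i) m
          ≡ + length (filter (λ i → g i ℕ.≟ m) (x ∷ xs))
      step (yes p) = trans (cong₂ ℤ._+_ (trans (cong (X ^ g x) (sym p)) (X^-at (g x)))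
          (Σℓ-X^ g m xs))
        (cong (λ l → + length l) (sym (List.filter-accept (λ i → g i ℕ.≟ m) {x} {xs} p)))
      step (no ¬p) = trans (cong₂ ℤ._+_ (X^-≢ (g x) ¬p) (Σℓ-X^ g m xs)) (trans (ℤ.+-identityˡ _)
        (cong (λ l → + length l) (sym (List.filter-reject (λ i → g i ℕ.≟ m) {x} {xs} ¬p))))

    Z⋆-Σℓ : ∀ F G n → (F Z.⋆ G) n ≋ Σℓ (upTo (suc n)) (λ i → F i ⋆ G (n ∸ i))
    Z⋆-Σℓ F G zero    = Z.⋆-zero F G ⨟ P.sym (P.+-identityʳ _)
    Z⋆-Σℓ F G (suc n) = ≡⇒≋ (Z.⋆-suc F G n) ⨟ P.+-congˡ (Z⋆-Σℓ (Z.tl F) G n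
        ⨟ Σℓ-cong (upTo (suc n)) (λ i → P.*-congʳ (≡⇒≋ (Z.tl-at F i)))
            ⨟ ≡⇒≋ (sym (shift id (suc n))))
      where
      shift : ∀ (e : ℕ → ℕ) m → Σℓ (applyUpTo (suc ∘ e) m) (λ i → F i ⋆ G (suc n ∸ i))
          ≡ Σℓ (applyUpTo e m) (λ i → F (suc i) ⋆ G (n ∸ i))
      shift e zero    = refl
      shift e (suc m) = cong (F (suc (e 0)) ⋆ G (n ∸ e 0) ⊞_) (shift (e ∘ suc) m)

    product : ∀ {m} → Vec Z.S m → Z.S
    product []       = Z.1s
    product (F ∷ Fs) = F Z.⋆ product Fs

    term : ∀ {m} → Vec Z.S m → Vec ℕ m → PowerSeries
    term []       []      = 1s
    term (F ∷ Fs) (i ∷ w) = F i ⋆ term Fs w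

  opaque
    unfolding tuples

    product-Σℓ : ∀ {m} (Fs : Vec Z.S m) k → product Fs k ≋ Σℓ (tuples m k) (term Fs)
    product-Σℓ []       zero    = P.sym (P.+-identityʳ 1s)
    product-Σℓ []       (suc k) = P.refl
    product-Σℓ {suc m} (F ∷ Fs) k = Z⋆-Σℓ F (product Fs) k
      ⨟ Σℓ-cong (upTo (suc k)) (λ i → P.*-congˡ (product-Σℓ Fs (k ∸ i))
          ⨟ P.sym (Σℓ-⋆ (F i) (term Fs) (tuples m (k ∸ i)))
          ⨟ ≡⇒≋ (sym (Σℓ-map (i ∷_) (term (F ∷ Fs)) (tuples m (k ∸ i)))))
      ⨟ P.sym (Σℓ-concat (term (F ∷ Fs)) (λ i → map (i ∷_) (tuples m (k ∸ i))) (upTo (suc k)))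

  private
    poch₅ : ℕ → PowerSeries
    poch₅ = poch -1ℤ 5 5

    -- Euler's series for ∏_m (1 + z q^(i + 5 m)).
    euler : ℕ → Z.S
    euler i n = X ^ (i * n) ⋆ (X ^ (5 * tri n) ⋆ inv (poch₅ n))

    opaque
      -- The substitution z ↦ q z; its multiplicativity comes from `Z.Substitution`.
      τ : Z.S → Z.S
      τ F n = X ^ n ⋆ F n

      τ-at : ∀ F n → τ F n ≡ X ^ n ⋆ F n
      τ-at F n = refl

    -- The series c z.
    shifted : PowerSeries → Z.S
    shifted c zero    = 0s
    shifted c (suc n) = Z.const c n

    shifted-⋆-suc : ∀ c F n → (shifted c Z.⋆ F) (suc n) ≋ c ⋆ F n
    shifted-⋆-suc c F n = ≡⇒≋ (Z.⋆-suc (shifted c) F n)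
      ⨟ P.+-cong (P.zeroˡ _) (Z.⋆-cong (Z.mk≋ λ n → ≡⇒≋ (Z.tl-at (shifted c) n)) (ZR.refl {F}) .Z.at
          n ⨟ Z.const-⋆-at c F n) ⨟ P.+-identityˡ _

    shifted-⋆-zero : ∀ c F → (shifted c Z.⋆ F) 0 ≋ 0s
    shifted-⋆-zero c F = Z.⋆-zero (shifted c) F ⨟ P.zeroˡ _

    τ-substitution : Z.Substitution τ (shifted X)
    τ-substitution = record { s₀ = P.refl ; step = λ F → Z.mk≋ (go F) }
      where
      go : ∀ F n → τ F n ≋ (Z.const (F 0) Z.⊞ shifted X Z.⋆ τ (Z.tl F)) n
      go F zero    = ≡⇒≋ (τ-at F 0) ⨟ P.*-identityˡ (F 0) ⨟ P.sym (P.+-identityʳ (F 0))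
          ⨟ P.+-congˡ (P.sym (shifted-⋆-zero X (τ (Z.tl F))))
        ⨟ ≡⇒≋ (sym (Z.⊞-at _ _ 0))
      go F (suc n) = ≡⇒≋ (τ-at F (suc n)) ⨟ P.*-assoc X (X ^ n) (F (suc n))
          ⨟ P.*-congˡ (P.*-congˡ (≡⇒≋ (sym (Z.tl-at F n))) ⨟ ≡⇒≋ (sym (τ-at (Z.tl F) n)))
        ⨟ P.sym (shifted-⋆-suc X (τ (Z.tl F)) n) ⨟ P.sym (P.+-identityˡ _)
            ⨟ ≡⇒≋ (sym (Z.⊞-at _ _ (suc n)))

    module τ = Z.Substitution τ-substitution

    1+z : Z.S
    1+z = Z.1s Z.⊞ shifted 1s

    1+z-zero : ∀ F → (1+z Z.⋆ F) 0 ≋ F 0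
    1+z-zero F = ZR.distribʳ F Z.1s (shifted 1s) .Z.at 0 ⨟ ≡⇒≋ (Z.⊞-at _ _ 0)
        ⨟ P.+-cong (ZR.*-identityˡ F .Z.at 0) (shifted-⋆-zero 1s F) ⨟ P.+-identityʳ _

    1+z-suc : ∀ F n → (1+z Z.⋆ F) (suc n) ≋ F (suc n) ⊞ F n
    1+z-suc F n = ZR.distribʳ F Z.1s (shifted 1s) .Z.at (suc n) ⨟ ≡⇒≋ (Z.⊞-at _ _ (suc n))
      ⨟ P.+-cong (ZR.*-identityˡ F .Z.at (suc n)) (shifted-⋆-suc 1s F n ⨟ P.*-identityˡ (F n))

    poch₅-unit : ∀ n → Unit (poch₅ n)
    poch₅-unit n = Unit-poch -1ℤ 5 5 n λ ()

    inv-suc : ∀ n → inv (poch₅ n) ≋ factor -1ℤ (5 + 5 * n) ⋆ inv (poch₅ (suc n))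
    inv-suc n = ⋆-cancel {poch₅ n} (poch₅-unit n) (P.*-comm _ _ ⨟ inv-⋆ (poch₅-unit n)
        ⨟ P.sym (inv-⋆ (poch₅-unit (suc n)))
      ⨟ solve 3 (λ i e f → i :* (e :* f) := e :* (f :* i)) P.refl (inv (poch₅ (suc n))) (poch₅ n)
          (factor -1ℤ (5 + 5 * n)))

    -- `euler 5` is `euler 0` with q⁵ z in place of z, that is ∏ (1 + z q^(5 m)) without its factor
    -- 1 + z.
    euler-functional : 1+z Z.⋆ euler 5 Z.≋ euler 0
    euler-functional .Z.at zero    = 1+z-zero (euler 5)
    euler-functional .Z.at (suc n) = 1+z-suc (euler 5) n
      ⨟ P.+-cong (P.*-congʳ (≡⇒≋ (cong (X ^_) (ℕ.*-suc 5 n)))) (P.*-congˡ (P.*-congˡ (inv-suc n))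
        ⨟ solve 4 (λ a b f i → a :* (b :* (f :* i)) := (a :* b) :* (f :* i)) P.refl (X ^ (5 * n))
            (X ^ (5 * tri n)) (factor -1ℤ (5 + 5 * n)) (inv (poch₅ (suc n)))
        ⨟ P.*-congʳ (P.sym (^-homo-* X (5 * n) (5 * tri n)) ⨟ ≡⇒≋ (cong (X ^_) (lem n (tri n)))))
      ⨟ solve 3 (λ u t i → u :* (t :* i) :+ t :* ((con 1ℤ :+ con -1ℤ :* u) :* i)
          := con 1ℤ :* (t :* i)) P.refl (X ^ (5 + 5 * n)) (X ^ (5 * tri (suc n)))
          (inv (poch₅ (suc n)))
      where lem : ∀ n t → 5 * n + 5 * t ≡ 5 * (t + n)
            lem = ℕTactic.solve-∀

    τ-euler : ∀ i → τ (euler i) Z.≋ euler (suc i)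
    τ-euler i .Z.at n = ≡⇒≋ (τ-at (euler i) n) ⨟ P.sym (P.*-assoc _ _ _)
        ⨟ P.*-congʳ (P.sym (^-homo-* X n (i * n)))

    eulers : Vec Z.S 5
    eulers = euler 0 ∷ euler 1 ∷ euler 2 ∷ euler 3 ∷ euler 4 ∷ []

    -- ∏ (1 + z q^m) over all m ≥ 0, sorted by m modulo 5. Its coefficient of z^k is evaluated
    -- twice: as a sum over runner heights (`product-Σℓ`) and in closed form (`c-closed-form`).
    c : Z.S
    c = product eulers

    -- `τ` moves each factor to the next one; the last becomes `euler 5`, which absorbs 1 + z and
    -- returns as `euler 0`.
    c-functional : 1+z Z.⋆ τ c Z.≋ c
    c-functional = ZR.trans (ZR.*-congˡ {1+z}
        (step 0 (step 1 (step 2 (step 3 (step 4 (τ.const-homo 1s)))))))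
      (lift 1 (lift 2 (lift 3 (lift 4 (ZR.trans (ZR.sym (ZR.*-assoc 1+z (euler 5) Z.1s))
          (ZR.*-congʳ euler-functional))))))
      where
      step : ∀ i {F G} → τ F Z.≋ G → τ (euler i Z.⋆ F) Z.≋ euler (suc i) Z.⋆ G
      step i {F} p = ZR.trans (τ.*-homo (euler i) F) (ZR.*-cong (τ-euler i) p)
      lift : ∀ i {F G} → 1+z Z.⋆ F Z.≋ euler 0 Z.⋆ G → 1+z Z.⋆ (euler i Z.⋆ F) Z.≋ euler 0 Z.⋆
          (euler i Z.⋆ G)
      lift i {F} {G} p = ZR.trans (*Z.x∙yz≈y∙xz 1+z (euler i) F)
          (ZR.trans (ZR.*-congˡ {euler i} p) (*Z.x∙yz≈y∙xz (euler i) (euler 0) G))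

    c-zero : c 0 ≋ 1s
    c-zero = first 0 (first 1 (first 2 (first 3 (first 4 P.refl))))
      where
      first : ∀ i {F} → F 0 ≋ 1s → (euler i Z.⋆ F) 0 ≋ 1s
      first i {F} p = Z.⋆-zero (euler i) F
          ⨟ (P.*-cong (≡⇒≋ (cong (X ^_) (ℕ.*-zeroʳ i))) (P.*-identityˡ (inv (poch₅ 0))
          ⨟ P.sym (P.*-identityʳ _) ⨟ inv-⋆ {1s} refl) ⟪⋆⟫ p)
        ⨟ P.*-identityʳ _ ⨟ P.*-identityʳ 1s

    c-suc : ∀ k → factor -1ℤ (1 + 1 * k) ⋆ c (suc k) ≋ X ^ k ⋆ c k
    c-suc k = P.*-congʳ (P.+-congˡ (P.*-congˡ (≡⇒≋ (cong (λ n → X ^ suc n) (ℕ.*-identityˡ k)))))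
      ⨟ solve 2 (λ u y → (con 1ℤ :+ con -1ℤ :* u) :* y := y :- u :* y) P.refl (X ^ suc k)
          (c (suc k))
      ⨟ P.+-congʳ (P.sym (c-functional .Z.at (suc k)) ⨟ 1+z-suc (τ c) k
          ⨟ P.+-cong (≡⇒≋ (τ-at c (suc k))) (≡⇒≋ (τ-at c k)))
      ⨟ solve 3 (λ u y w → u :* y :+ w :- u :* y := w) P.refl (X ^ suc k) (c (suc k)) (X ^ k ⋆ c k)

    -- Euler's evaluation: the coefficient of z^(k + 1) in the functional equation reads (1 - q^(k +
    -- 1)) c_(k + 1) = q^k c_k.
    c-closed-form : ∀ k → poch -1ℤ 1 1 k ⋆ c k ≋ X ^ tri k
    c-closed-form zero    = P.*-identityˡ _ ⨟ c-zero
    c-closed-form (suc k) = P.*-assoc _ _ _ ⨟ P.*-congˡ (c-suc k)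
      ⨟ solve 3 (λ p u y → p :* (u :* y) := (p :* y) :* u) P.refl (poch -1ℤ 1 1 k) (X ^ k) (c k)
      ⨟ P.*-congʳ (c-closed-form k) ⨟ P.sym (^-homo-* X (tri k) k)

    X^-weight : ∀ t → X ^ weight t ≋ X ^ (5 * tri (t 0F)) ⋆ (X ^ (1 * t 1F) ⋆ X ^ (5 * tri (t 1F)))
        ⋆ (X ^ (2 * t 2F) ⋆ X ^ (5 * tri (t 2F)))
      ⋆ (X ^ (3 * t 3F) ⋆ X ^ (5 * tri (t 3F))) ⋆ (X ^ (4 * t 4F) ⋆ X ^ (5 * tri (t 4F)))
    X^-weight t = ^-homo-* X (w₀ + w₁ + w₂ + w₃) w₄ ⨟ (
        (^-homo-* X (w₀ + w₁ + w₂) w₃ ⨟ ((^-homo-* X (w₀ + w₁) w₂ ⨟ ((^-homo-* X w₀ w₁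
          ⨟ P.*-congˡ (^-homo-* X (t 1F) _
              ⨟ P.*-congʳ (≡⇒≋ (cong (X ^_) (sym (ℕ.*-identityˡ (t 1F))))))) ⟪⋆⟫ ^-homo-* X
              (2 * t 2F) _)) ⟪⋆⟫ ^-homo-* X (3 * t 3F) _))
        ⟪⋆⟫ ^-homo-* X (4 * t 4F) _)
      where
      w₀ = 5 * tri (t 0F)
      w₁ = t 1F + 5 * tri (t 1F)
      w₂ = 2 * t 2F + 5 * tri (t 2F)
      w₃ = 3 * t 3F + 5 * tri (t 3F)
      w₄ = 4 * t 4F + 5 * tri (t 4F)

    X^-precision : ∀ e {f g Q} → f ≋[ Q ] g → X ^ e ⋆ f ≋[ e + Q ] X ^ e ⋆ g
    X^-precision zero    p = ⋆-cong[] ≋[]-refl p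
    X^-precision (suc e) {f} {g} p = ≋[]-trans (≋⇒≋[] (P.*-assoc X (X ^ e) f))
        (≋[]-trans (⋆-raise refl (X^-precision e p)) (≋⇒≋[] (P.sym (P.*-assoc X (X ^ e) g))))

    euler-limit : ∀ Q n → Q ≤ n → η 5 ⋆ inv (poch₅ n) ≋[ Q ] 1s
    euler-limit Q n Q≤n = ≋[]-trans (⋆-cong[] (poch∞≋[] -1ℤ 5 5 Q≤n) ≋[]-refl)
        (≋⇒≋[] (P.*-comm _ _ ⨟ inv-⋆ (poch₅-unit n)))

    -- If the weight is at least `tri k + Q`, both sides vanish at this precision. Otherwise all
    -- heights are at least Q, and each of the five factors 1 / (q⁵ ; q⁵)_i agrees with 1 / f₅
    -- modulo q^Q.
    term-limit : ∀ Q k → k ≡ Q * 5 + Q → ∀ w → w ∈ tuples 5 k → η 5 ^ 5 ⋆ term eulers w ≋[ tri k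
        + Q ] X ^ weight (Vec.lookup w)
    term-limit Q k k≡ w@(i₀ ∷ i₁ ∷ i₂ ∷ i₃ ∷ i₄ ∷ []) w∈ =
        ≋[]-trans (≋⇒≋[] rearrange) (cases (ℕ.<-≤-connex e (tri k + Q)))
      where
      e = weight (Vec.lookup w)
      r : ℕ → PowerSeries
      r i = η 5 ⋆ inv (poch₅ i)
      rest : PowerSeries
      rest = r i₀ ⋆ r i₁ ⋆ r i₂ ⋆ r i₃ ⋆ r i₄
      rearrange : η 5 ^ 5 ⋆ term eulers w ≋ X ^ e ⋆ rest
      rearrange = solve 15 (λ h a₀ p₀ a₁ b₁ p₁ a₂ b₂ p₂ a₃ b₃ p₃ a₄ b₄ p₄ →
          h :^ 5 :* (con 1ℤ :* (a₀ :* p₀)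
              :* (a₁ :* (b₁ :* p₁) :* (a₂ :* (b₂ :* p₂)
              :* (a₃ :* (b₃ :* p₃) :* (a₄ :* (b₄ :* p₄) :* con 1ℤ)))))
          := a₀ :* (a₁ :* b₁) :* (a₂ :* b₂) :* (a₃ :* b₃) :* (a₄ :* b₄)
              :* ((h :* p₀) :* (h :* p₁) :* (h :* p₂) :* (h :* p₃) :* (h :* p₄))) P.refl
          (η 5) (X ^ (5 * tri i₀)) (inv (poch₅ i₀)) (X ^ (1 * i₁)) (X ^ (5 * tri i₁))
              (inv (poch₅ i₁)) (X ^ (2 * i₂)) (X ^ (5 * tri i₂)) (inv (poch₅ i₂))
          (X ^ (3 * i₃)) (X ^ (5 * tri i₃)) (inv (poch₅ i₃)) (X ^ (4 * i₄)) (X ^ (5 * tri i₄))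
              (inv (poch₅ i₄))
        ⨟ P.*-congʳ (P.sym (X^-weight (Vec.lookup w)))
      cases : e < tri k + Q ⊎ tri k + Q ≤ e → X ^ e ⋆ rest ≋[ tri k + Q ] X ^ e
      cases (inj₂ large) = ≋[]-weaken large (≋[]-trans (X^⋆≋[]0 e rest) (≋[]-sym (X^≋[]0 e)))
      cases (inj₁ small) = ≋[]-weaken (ℕ.+-monoˡ-≤ Q weight≥)
          (≋[]-trans (X^-precision e rest≋1) (≋⇒≋[] (P.*-identityʳ _)))
        where
        large : ∀ j → Q ≤ Vec.lookup w j
        large = runners-large Q k k≡ w w∈ small
        weight≥ : tri k ≤ e
        weight≥ = let (μ , _ , _ , _ , _ , eq) = realise k w w∈ in ℕ.≤-trans (ℕ.m≤m+n (tri k) (sum μ)) (ℕ.≤-reflexive (sym eq))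
        rest≋1 : rest ≋[ Q ] 1s
        rest≋1 = ≋[]-trans (⋆-cong[] (⋆-cong[]
            (⋆-cong[] (⋆-cong[] (euler-limit Q i₀ (large 0F)) (euler-limit Q i₁ (large 1F)))
            (euler-limit Q i₂ (large 2F)))
            (euler-limit Q i₃ (large 3F))) (euler-limit Q i₄ (large 4F)))
          (≋⇒≋[] (P.*-identityʳ _ ⨟ P.*-identityʳ _ ⨟ P.*-identityʳ _ ⨟ P.*-identityʳ 1s))

  coreSeries : PowerSeries
  coreSeries n = + coreCount 5 n

  private
    -- No weight lies below `tri k`, the bead sum of the empty partition; at `tri k + n` with n < Q
    -- ≤ k the tuples are counted by the 5-cores of n.
    core-Σℓ : ∀ Q k → Q ≤ k → Σℓ (tuples 5 k) (λ w → X ^ weight (Vec.lookup w)) ≋[ tri k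
        + Q ] X ^ tri k ⋆ coreSeries
    core-Σℓ Q k Q≤k .below m m< = cases (ℕ.<-≤-connex m (tri k))
      where
      cases : m < tri k ⊎ tri k ≤ m → Σℓ (tuples 5 k) (λ w → X ^ weight (Vec.lookup w)) m
          ≡ (X ^ tri k ⋆ coreSeries) m
      cases (inj₁ m<tri) = trans (Σℓ-zero (tuples 5 k) (λ {w} w∈ → ≋[]-weaken (W≥ w w∈) (X^≋[]0 (weight (Vec.lookup w)))) .below m m<tri) (sym (X^⋆-< (tri k) coreSeries m<tri))
        where
        W≥ : ∀ w → w ∈ tuples 5 k → tri k ≤ weight (Vec.lookup w)
        W≥ w w∈ = let (μ , _ , _ , _ , _ , eq) = realise k w w∈ in ℕ.≤-trans (ℕ.m≤m+n (tri k) (sum μ)) (ℕ.≤-reflexive (sym eq))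
      cases (inj₂ tri≤m) = subst (λ m → Σℓ (tuples 5 k) (λ w → X ^ weight (Vec.lookup w)) m
          ≡ (X ^ tri k ⋆ coreSeries) m) (ℕ.m+[n∸m]≡n tri≤m)
        (trans (Σℓ-X^ (λ w → weight (Vec.lookup w)) (tri k + n) (tuples 5 k))
            (trans (cong +_ (sym (coreCount-tuples k n n≤k))) (sym (X^⋆-+ (tri k) coreSeries n))))
        where
        n = m ∸ tri k
        n≤k : n ≤ k
        n≤k = ℕ.≤-trans (ℕ.<⇒≤ (ℕ.+-cancelˡ-< (tri k) n Q
            (ℕ.≤-<-trans (ℕ.≤-reflexive (ℕ.m+[n∸m]≡n tri≤m)) m<))) Q≤k

  -- Both evaluations of c_k contain q^(tri k). Divided by it they tend to C / f₅⁵ and to 1 / f₁; at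
  -- k = 6 Q, the size required by `runners-large`, they agree with these limits modulo q^Q.
  core-generating-function : coreSeries ⋆ η 1 ≋ η 5 ^ 5
  core-generating-function = ≋[]⇒≋ λ Q → X^-cancel (tri (K Q)) (go Q)
    where
    K : ℕ → ℕ
    K Q = Q * 5 + Q
    Q≤K : ∀ Q → Q ≤ K Q
    Q≤K Q = ℕ.m≤n+m Q (Q * 5)
    go : ∀ Q → X ^ tri (K Q) ⋆ (coreSeries ⋆ η 1) ≋[ tri (K Q) + Q ] X ^ tri (K Q) ⋆ η 5 ^ 5
    go Q = ≋[]-trans (≋⇒≋[] (P.sym (P.*-assoc (X ^ tri k) coreSeries (η 1))))
      (≋[]-trans (⋆-cong[] (≋[]-trans (≋[]-sym (core-Σℓ Q k (Q≤K Q))) (≋[]-trans (Σℓ-cong-∈ (tuples 5 k) (λ {w} w∈ → ≋[]-sym (term-limit Q k refl w w∈)))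
          (≋⇒≋[] (Σℓ-⋆ (η 5 ^ 5) (term eulers) (tuples 5 k)
              ⨟ P.*-congˡ (P.sym (product-Σℓ eulers k)))))) ≋[]-refl)
      (≋[]-trans (≋⇒≋[] (P.*-congʳ (P.*-congˡ c≋) ⨟ solve 4 (λ e x i h → e :* (x :* i) :* h
          := x :* ((h :* i) :* e)) P.refl (η 5 ^ 5) (X ^ tri k) (inv p) (η 1)))
      (X^-precision (tri k) (≋[]-trans (⋆-cong[]
          (≋[]-trans (⋆-cong[] (poch∞≋[] -1ℤ 1 1 (Q≤K Q)) ≋[]-refl)
          (≋⇒≋[] (P.*-comm p (inv p) ⨟ inv-⋆ p-unit))) ≋[]-refl)
        (≋⇒≋[] (P.*-identityˡ _))))))
      where
      k = K Q
      p = poch -1ℤ 1 1 k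
      p-unit : Unit p
      p-unit = Unit-poch -1ℤ 1 1 k λ ()
      c≋ : c k ≋ X ^ tri k ⋆ inv p
      c≋ = ⋆-cancel {p} p-unit (c-closed-form k
          ⨟ P.sym (solve 3 (λ p x i → p :* (x :* i) := x :* (i :* p)) P.refl p (X ^ tri k) (inv p)
          ⨟ P.*-congˡ (inv-⋆ p-unit) ⨟ P.*-identityʳ _))

open CoreGeneratingFunction

open Coefficients coreSeries core-generating-function

-- The coefficients of B̂ on residue classes, and the theorem.

private
  fromℤ-≃ : ∀ z → ℚ.toℚᵘ (fromℤ z) ℚᵘ.≃ mkℚᵘ z 0
  fromℤ-≃ z = ℚ.toℚᵘ-fromℚᵘ (mkℚᵘ z 0)

  ½-≃ : ∀ z → ℚ.toℚᵘ (½ ℚ.* fromℤ z) ℚᵘ.≃ ℚᵘ.½ ℚᵘ.* mkℚᵘ z 0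
  ½-≃ z = ℚᵘ.≃-trans (ℚ.toℚᵘ-homo-* ½ (fromℤ z)) (ℚᵘ.*-cong {ℚ.toℚᵘ ½} ℚᵘ.≃-refl (fromℤ-≃ z))

  halve-ℚ : ∀ b c → + 2 ℤ.* b ≡ c → fromℤ b ≡ ½ ℚ.* fromℤ c
  halve-ℚ b c eq = ℚ.toℚᵘ-injective (ℚᵘ.≃-trans (fromℤ-≃ b)
      (ℚᵘ.≃-trans (*≡* (trans (lem b) (cong (λ z → 1ℤ ℤ.* z ℤ.* 1ℤ) eq))) (ℚᵘ.≃-sym (½-≃ c))))
    where lem : ∀ b → b ℤ.* + 2 ≡ 1ℤ ℤ.* (+ 2 ℤ.* b) ℤ.* 1ℤ
          lem = ℤTactic.solve-∀

  quarter-ℚ : ∀ b a c → + 4 ℤ.* b ≡ a ℤ.+ + 2 ℤ.* c → fromℤ b ≡ (+ 1 ℚ./ 4) ℚ.* fromℤ a ℚ.+ ½ ℚ.*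
      fromℤ c
  quarter-ℚ b a c eq = ℚ.toℚᵘ-injective (ℚᵘ.≃-trans (fromℤ-≃ b)
      (ℚᵘ.≃-trans (*≡* (trans (lem b) (trans (cong (λ z → + 2 ℤ.* z) eq) (lem′ a c))))
      (ℚᵘ.≃-sym (ℚᵘ.≃-trans (ℚ.toℚᵘ-homo-+ ((+ 1 ℚ./ 4) ℚ.* fromℤ a) (½ ℚ.* fromℤ c)) (ℚᵘ.+-cong
        (ℚᵘ.≃-trans (ℚ.toℚᵘ-homo-* (+ 1 ℚ./ 4) (fromℤ a)) (ℚᵘ.*-cong {ℚ.toℚᵘ (+ 1 ℚ./ 4)} ℚᵘ.≃-refl
            (fromℤ-≃ a))) (½-≃ c))))))
    where lem : ∀ b → b ℤ.* + 8 ≡ + 2 ℤ.* (+ 4 ℤ.* b)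
          lem = ℤTactic.solve-∀
          lem′ : ∀ a c → + 2 ℤ.* (a ℤ.+ + 2 ℤ.* c) ≡ (1ℤ ℤ.* a ℤ.* + 2 ℤ.+ 1ℤ ℤ.* c ℤ.* + 4) ℤ.* 1ℤ
          lem′ = ℤTactic.solve-∀

  half-sum-ℚ : ∀ b a c → + 2 ℤ.* b ≡ a ℤ.+ + 2 ℤ.* c → fromℤ b ≡ ½ ℚ.* fromℤ a ℚ.+ fromℤ c
  half-sum-ℚ b a c eq = ℚ.toℚᵘ-injective
      (ℚᵘ.≃-trans (fromℤ-≃ b) (ℚᵘ.≃-trans (*≡* (trans (lem b) (trans eq (lem′ a c))))
      (ℚᵘ.≃-sym (ℚᵘ.≃-trans (ℚ.toℚᵘ-homo-+ (½ ℚ.* fromℤ a) (fromℤ c))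
          (ℚᵘ.+-cong (½-≃ a) (fromℤ-≃ c))))))
    where lem : ∀ b → b ℤ.* + 2 ≡ + 2 ℤ.* b
          lem = ℤTactic.solve-∀
          lem′ : ∀ a c → a ℤ.+ + 2 ℤ.* c ≡ (1ℤ ℤ.* a ℤ.* 1ℤ ℤ.+ c ℤ.* + 2) ℤ.* 1ℤ
          lem′ = ℤTactic.solve-∀

  ⊘-cong : ∀ {f f′} g → f ≋ f′ → f ⊘ g ≋ f′ ⊘ g
  ⊘-cong g p .at n = go n p
    where
    go : ∀ n {f f′} → f ≋ f′ → (f ⊘ g) n ≡ (f′ ⊘ g) n
    go zero    p = p .at 0
    go (suc n) p = go n (mk≋ λ k → cong₂ (λ y z → y ℤ.- z ℤ.* g (suc k)) (p .at (suc k)) (p .at 0))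

  ā₅-A : ∀ n → ā₅ (+ n) ≡ A n
  ā₅-A n = ⊘-cong φ[-q] (↑-≋ (dilate 5 φ[-q]) 5) .at n

  b̄₅-B̂ : ∀ n m → 3 + n ≡ m → b̄₅ (+ n) ≡ B̂ m
  b̄₅-B̂ n _ refl = trans (⊘-cong ψ[-q] (↑-≋ (dilate 5 ψ[-q]) 5) .at n) (sym (B̂-+3 n))

  c₅-G : ∀ n m → suc n ≡ m → c₅ (+ n) ≡ G m
  c₅-G n _ refl = sym (G-suc n)

  Odd : ℕ → Set
  Odd n = ∃ λ k → n ≡ suc (k * 2)

  -1^-odd : ∀ {n} → Odd n → -1^ n ≡ -1ℤ
  -1^-odd (k , refl) = cong ℤ.-_ (-1^-even k)

  B̂-2 : ∀ {m} → Odd m → B̂ (m * 2) ≡ + 2 ℤ.* B̂ m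
  B̂-2 {m} odd@(k , refl) = trans (B̂-double m)
      (trans (cong₂ (λ y z → y ℤ.- + 2 ℤ.* (z ℤ.* B̂ m)) (dilate₂-odd G k) (-1^-odd odd))
      (lem (B̂ m)))
    where lem : ∀ y → 0ℤ ℤ.- + 2 ℤ.* (-1ℤ ℤ.* y) ≡ + 2 ℤ.* y
          lem = ℤTactic.solve-∀

  B̂-4 : ∀ m → B̂ (m * 2 * 2) ≡ G m ℤ.- + 2 ℤ.* B̂ (m * 2)
  B̂-4 m = trans (B̂-double (m * 2)) (trans (cong₂ (λ y z → y ℤ.- + 2 ℤ.* (z ℤ.* B̂ (m * 2)))
      (dilate-* 2 G m) (-1^-even m))
    (cong (λ z → G m ℤ.- + 2 ℤ.* z) (ℤ.*-identityˡ (B̂ (m * 2)))))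

  -- The classes ±1 and ±2 modulo 5, i.e. the nonzero squares and the non-squares.
  Square NonSquare : ℕ → Set
  Square m    = ∃ λ n → m ≡ 5 * n + 1 ⊎ m ≡ 5 * n + 4
  NonSquare m = ∃ λ n → m ≡ 5 * n + 2 ⊎ m ≡ 5 * n + 3

  F-square : ∀ {m} → Square m → F m ≡ ℤ.- + 5 ℤ.* G m
  F-square (n , inj₁ refl) = F-1 n
  F-square (n , inj₂ refl) = F-4 n

  F-nonSquare : ∀ {m} → NonSquare m → F m ≡ + 5 ℤ.* G m
  F-nonSquare (n , inj₁ refl) = F-2 n
  F-nonSquare (n , inj₂ refl) = F-3 n

  -- For odd m, F(m) = -5 G(m) + 20 B̂(m); for squares modulo 5 also F(m) = -5 G(m). With +5 G(m)
  -- instead, the same comparison gives `B̂-nonSquare`.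
  B̂-square : ∀ {m} → Odd m → Square m → B̂ m ≡ 0ℤ
  B̂-square {m} odd sq = ℤ.*-cancelˡ-≡ (+ 20) (B̂ m) 0ℤ
      (trans (lem (ℤ.- + 5 ℤ.* G m) (+ 20 ℤ.* B̂ m))
    (trans (cong (ℤ._- (ℤ.- + 5 ℤ.* G m)) (trans (sym (F-at-odd m (-1^-odd odd))) (F-square sq)))
        (ℤ.+-inverseʳ (ℤ.- + 5 ℤ.* G m))))
    where lem : ∀ y z → z ≡ (y ℤ.+ z) ℤ.- y
          lem = ℤTactic.solve-∀

  B̂-nonSquare : ∀ {m} → Odd m → NonSquare m → + 2 ℤ.* B̂ m ≡ G m
  B̂-nonSquare {m} odd ns = ℤ.*-cancelˡ-≡ (+ 10) (+ 2 ℤ.* B̂ m) (G m) (trans (lem (G m) (B̂ m))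
    (trans (cong (ℤ._- (ℤ.- + 5 ℤ.* G m)) (trans (sym (F-at-odd m (-1^-odd odd))) (F-nonSquare ns)))
        (lem′ (G m))))
    where lem : ∀ y z → + 10 ℤ.* (+ 2 ℤ.* z) ≡ (ℤ.- + 5 ℤ.* y ℤ.+ + 20 ℤ.* z) ℤ.- (ℤ.- + 5 ℤ.* y)
          lem = ℤTactic.solve-∀
          lem′ : ∀ y → + 5 ℤ.* y ℤ.- (ℤ.- + 5 ℤ.* y) ≡ + 10 ℤ.* y
          lem′ = ℤTactic.solve-∀

  -- The formula for F at odd indices is taken at 5 m and at m. With F(5 m) = F(m) and G(5 m) = 5
  -- G(m) it leaves B̂(5 m) = G(m) + B̂(m), and A(m) = 2 G(m) + 4 B̂(m).
  B̂-5 : ∀ {m} → Odd m → Odd (5 * m) → + 4 ℤ.* B̂ (5 * m) ≡ A m ℤ.+ + 2 ℤ.* G m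
  B̂-5 {m} odd odd₅ = ℤ.*-cancelˡ-≡ (+ 5) _ _
      (trans (lem (G (5 * m)) (B̂ (5 * m))) (trans (cong₂ (λ y z → y ℤ.- (ℤ.- + 5 ℤ.* z))
      (trans (sym (F-at-odd (5 * m) (-1^-odd odd₅))) (trans (F-5 m) (F-at-odd m (-1^-odd odd))))
          (G-5 m))
      (trans (lem′ (G m) (B̂ m)) (cong (λ z → + 5 ℤ.* (z ℤ.+ + 2 ℤ.* G m))
          (sym (A-at-odd m (-1^-odd odd)))))))
    where lem : ∀ y z → + 5 ℤ.* (+ 4 ℤ.* z) ≡ (ℤ.- + 5 ℤ.* y ℤ.+ + 20 ℤ.* z) ℤ.- (ℤ.- + 5 ℤ.* y)
          lem = ℤTactic.solve-∀
          lem′ : ∀ y z → (ℤ.- + 5 ℤ.* y ℤ.+ + 20 ℤ.* z) ℤ.- (ℤ.- + 5 ℤ.* (+ 5 ℤ.* y))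
              ≡ + 5 ℤ.* (+ 2 ℤ.* y ℤ.+ + 4 ℤ.* z ℤ.+ + 2 ℤ.* y)
          lem′ = ℤTactic.solve-∀

  *2-injective : ∀ {j k} → j * 2 ≡ k * 2 → j ≡ k
  *2-injective {j} {k} = ℕ.*-cancelʳ-≡ j k 2

  -- 2 is not a square modulo 5, so halving exchanges squares and non-squares; the cases are the
  -- parities of n.
  half-nonSquare : ∀ k → NonSquare (k * 2) → Square k
  half-nonSquare k (n , eq) = go (parity n) eq
    where
    go : (∃ λ j → n ≡ j * 2) ⊎ (∃ λ j → n ≡ suc (j * 2)) → k * 2 ≡ 5 * n + 2 ⊎ k * 2 ≡ 5 * n + 3 →
        Square k
    go (inj₁ (j , refl)) (inj₁ p) = j , inj₁ (*2-injective (trans p (lem j)))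
      where lem : ∀ j → 5 * (j * 2) + 2 ≡ (5 * j + 1) * 2
            lem = ℕTactic.solve-∀
    go (inj₁ (j , refl)) (inj₂ p) = contradiction (trans (lem j) (sym p)) (odd≢even k (5 * j + 1))
      where lem : ∀ j → suc ((5 * j + 1) * 2) ≡ 5 * (j * 2) + 3
            lem = ℕTactic.solve-∀
    go (inj₂ (j , refl)) (inj₁ p) = contradiction (trans (lem j) (sym p)) (odd≢even k (5 * j + 3))
      where lem : ∀ j → suc ((5 * j + 3) * 2) ≡ 5 * suc (j * 2) + 2
            lem = ℕTactic.solve-∀
    go (inj₂ (j , refl)) (inj₂ p) = j , inj₂ (*2-injective (trans p (lem j)))
      where lem : ∀ j → 5 * suc (j * 2) + 3 ≡ (5 * j + 4) * 2
            lem = ℕTactic.solve-∀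

  half-square : ∀ k → Square (k * 2) → NonSquare k
  half-square k (n , eq) = go (parity n) eq
    where
    go : (∃ λ j → n ≡ j * 2) ⊎ (∃ λ j → n ≡ suc (j * 2)) → k * 2 ≡ 5 * n + 1 ⊎ k * 2 ≡ 5 * n + 4 →
        NonSquare k
    go (inj₁ (j , refl)) (inj₂ p) = j , inj₁ (*2-injective (trans p (lem j)))
      where lem : ∀ j → 5 * (j * 2) + 4 ≡ (5 * j + 2) * 2
            lem = ℕTactic.solve-∀
    go (inj₁ (j , refl)) (inj₁ p) = contradiction (trans (lem j) (sym p)) (odd≢even k (5 * j))
      where lem : ∀ j → suc (5 * j * 2) ≡ 5 * (j * 2) + 1
            lem = ℕTactic.solve-∀
    go (inj₂ (j , refl)) (inj₂ p) = contradiction (trans (lem j) (sym p)) (odd≢even k (5 * j + 4))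
      where lem : ∀ j → suc ((5 * j + 4) * 2) ≡ 5 * suc (j * 2) + 4
            lem = ℕTactic.solve-∀
    go (inj₂ (j , refl)) (inj₁ p) = j , inj₂ (*2-injective (trans p (lem j)))
      where lem : ∀ j → 5 * suc (j * 2) + 1 ≡ (5 * j + 3) * 2
            lem = ℕTactic.solve-∀

  -- Strong induction. For m = 2 k, k is a square class and B̂(4 k) = G(k) - 2 B̂(2 k). If k is odd,
  -- B̂(2 k) = 2 B̂(k) = 0. If k = 2 j, then j is a non-square class again, and B̂(4 j) = G(j) - 2
  -- B̂(2 j) = -G(j) by induction. Both values match the doubling rule for G.
  B̂-2-nonSquare : ∀ m → NonSquare m → B̂ (m * 2) ≡ G m
  B̂-2-nonSquare = <-rec (λ m → NonSquare m → B̂ (m * 2) ≡ G m) λ m rec → go m rec (parity m)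
    where
    go : ∀ m → (∀ {j} → j < m → NonSquare j → B̂ (j * 2) ≡ G j) → (∃ λ k → m ≡ k * 2) ⊎ Odd m →
        NonSquare m → B̂ (m * 2) ≡ G m
    go m rec (inj₂ odd) ns = trans (B̂-2 odd) (B̂-nonSquare odd ns)
    go m rec (inj₁ (k , refl)) ns = trans (B̂-4 k) (even (parity k))
      where
      sq : Square k
      sq = half-nonSquare k ns
      even : (∃ λ j → k ≡ j * 2) ⊎ Odd k → G k ℤ.- + 2 ℤ.* B̂ (k * 2) ≡ G (k * 2)
      even (inj₂ odd@(j , refl)) = trans
          (cong (λ z → G k ℤ.- + 2 ℤ.* z)
          (trans (B̂-2 odd) (cong (λ z → + 2 ℤ.* z) (B̂-square odd sq))))
        (sym (trans (G-double k) (cong (λ z → G k ℤ.+ + 2 ℤ.* z) (dilate₂-odd G j))))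
      even (inj₁ (j , refl)) = trans (cong (λ z → G k ℤ.- + 2 ℤ.* z)
          (trans (B̂-4 j) (cong (λ z → G j ℤ.- + 2 ℤ.* z) (rec (j< j ns) nsj))))
        (trans (lem (G k) (G j)) (sym (trans (G-double k)
            (cong (λ z → G k ℤ.+ + 2 ℤ.* z) (dilate-* 2 G j)))))
        where
        nsj : NonSquare j
        nsj = half-square j sq
        j< : ∀ j → NonSquare (j * 2 * 2) → j < j * 2 * 2
        j< zero    (n , inj₁ eq) = contradiction (trans eq (ℕ.+-comm (5 * n) 2)) λ ()
        j< zero    (n , inj₂ eq) = contradiction (trans eq (ℕ.+-comm (5 * n) 3)) λ ()
        j< (suc j) _ = s≤s (s≤s (ℕ.≤-trans (ℕ.m≤m*n j 2)
            (ℕ.≤-trans (ℕ.m≤m*n (j * 2) 2) (ℕ.m≤n+m _ 2))))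
        lem : ∀ y z → y ℤ.- + 2 ℤ.* (z ℤ.- + 2 ℤ.* z) ≡ y ℤ.+ + 2 ℤ.* z
        lem = ℤTactic.solve-∀

  B̂-4-nonSquare : ∀ m → NonSquare m → B̂ (m * 2 * 2) ≡ ℤ.- G m
  B̂-4-nonSquare m ns = trans (B̂-4 m) (trans (cong (λ z → G m ℤ.- + 2 ℤ.* z) (B̂-2-nonSquare m ns))
      (lem (G m)))
    where lem : ∀ y → y ℤ.- + 2 ℤ.* y ≡ ℤ.- y
          lem = ℤTactic.solve-∀

-- With b̅₅(n) = B̂(n + 3) and c₅(n) = G(n + 1) the claims evaluate B̂, in this order, at 4 (n + 1);
-- 10 n + 3; 2 (5 n + 2); 5 (2 n + 1); 2 (5 n + 3); 10 n + 7; 10 n + 9; 10 n + 11; 4 (5 n + 2); 10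
-- (2 n + 1); 4 (5 n + 3); 2 (10 n + 9); 2 (10 n + 11).
theorem5 : ∀ (n : ℕ) →
    b̄₅ (+ (4 * n + 1)) ≡ c₅ (+ n) ℤ.- + 2 ℤ.* b̄₅ (+ (2 * n) ℤ.- 1ℤ)
    × fromℤ (b̄₅ (+ (10 * n))) ≡ ½ ℚ.* fromℤ (c₅ (+ (10 * n + 2)))
    × b̄₅ (+ (10 * n + 1)) ≡ c₅ (+ (5 * n + 1))
    × fromℤ (b̄₅ (+ (10 * n + 2))) ≡ (+ 1 ℚ./ 4) ℚ.* fromℤ (ā₅ (+ (2 * n + 1))) ℚ.+ ½ ℚ.* fromℤ (c₅ (+ (2 * n)))
    × b̄₅ (+ (10 * n + 3)) ≡ c₅ (+ (5 * n + 2))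
    × fromℤ (b̄₅ (+ (10 * n + 4))) ≡ ½ ℚ.* fromℤ (c₅ (+ (10 * n + 6)))
    × b̄₅ (+ (10 * n + 6)) ≡ 0ℤ
    × b̄₅ (+ (10 * n + 8)) ≡ 0ℤ
    × b̄₅ (+ (20 * n + 5)) ≡ ℤ.- c₅ (+ (5 * n + 1))
    × fromℤ (b̄₅ (+ (20 * n + 7))) ≡ ½ ℚ.* fromℤ (ā₅ (+ (2 * n + 1))) ℚ.+ fromℤ (c₅ (+ (2 * n)))
    × b̄₅ (+ (20 * n + 9)) ≡ ℤ.- c₅ (+ (5 * n + 2))
    × b̄₅ (+ (20 * n + 15)) ≡ 0ℤ
    × b̄₅ (+ (20 * n + 19)) ≡ 0ℤ
theorem5 n = claim₁ n
  , halve-ℚ (b̄₅ (+ (10 * n))) (c₅ (+ (10 * n + 2)))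
      (trans (cong (λ z → + 2 ℤ.* z) (b̄₅-B̂ (10 * n) (10 * n + 3) (e₁ n)))
      (trans (B̂-nonSquare (5 * n + 1 , o₃ n) (2 * n , inj₂ (s₃ n)))
      (sym (c₅-G (10 * n + 2) (10 * n + 3) (e₂ n)))))
  , trans (b̄₅-B̂ (10 * n + 1) _ (e₃ n)) (trans (B̂-2-nonSquare (5 * n + 2) (n , inj₁ refl))
      (sym (c₅-G (5 * n + 1) _ (e₄ n))))
  , quarter-ℚ (b̄₅ (+ (10 * n + 2))) (ā₅ (+ (2 * n + 1))) (c₅ (+ (2 * n))) quarter
  , trans (b̄₅-B̂ (10 * n + 3) _ (e₅ n)) (trans (B̂-2-nonSquare (5 * n + 3) (n , inj₂ refl))
      (sym (c₅-G (5 * n + 2) _ (e₆ n))))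
  , halve-ℚ (b̄₅ (+ (10 * n + 4))) (c₅ (+ (10 * n + 6)))
      (trans (cong (λ z → + 2 ℤ.* z) (b̄₅-B̂ (10 * n + 4) (10 * n + 7) (e₇ n)))
      (trans (B̂-nonSquare (5 * n + 3 , o₇ n) (2 * n + 1 , inj₁ (s₇ n)))
      (sym (c₅-G (10 * n + 6) (10 * n + 7) (e₈ n)))))
  , trans (b̄₅-B̂ (10 * n + 6) (10 * n + 9) (e₉ n)) (B̂-square (o₉ n) (2 * n + 1 , inj₂ (s₉ n)))
  , trans (b̄₅-B̂ (10 * n + 8) (10 * n + 11) (e₁₀ n)) (B̂-square (o₁₁ n) (2 * n + 2 , inj₁ (s₁₁ n)))
  , trans (b̄₅-B̂ (20 * n + 5) _ (e₁₁ n)) (trans (B̂-4-nonSquare (5 * n + 2) (n , inj₁ refl))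
      (cong ℤ.-_ (sym (c₅-G (5 * n + 1) _ (e₄ n)))))
  , half-sum-ℚ (b̄₅ (+ (20 * n + 7))) (ā₅ (+ (2 * n + 1))) (c₅ (+ (2 * n)))
      (trans (trans (cong (λ z → + 2 ℤ.* z) (trans (b̄₅-B̂ (20 * n + 7) _ (e₁₂ n)) (B̂-2 odd₅)))
      (l n)) (trans (cong (λ z → + 4 ℤ.* z) (sym (b̄₅-B̂ (10 * n + 2) _ (e₁₃ n)))) quarter))
  , trans (b̄₅-B̂ (20 * n + 9) _ (e₁₄ n)) (trans (B̂-4-nonSquare (5 * n + 3) (n , inj₂ refl))
      (cong ℤ.-_ (sym (c₅-G (5 * n + 2) _ (e₆ n)))))
  , trans (b̄₅-B̂ (20 * n + 15) _ (e₁₅ n))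
      (trans (B̂-2 (o₉ n)) (cong (λ z → + 2 ℤ.* z) (B̂-square (o₉ n) (2 * n + 1 , inj₂ (s₉ n)))))
  , trans (b̄₅-B̂ (20 * n + 19) _ (e₁₆ n))
      (trans (B̂-2 (o₁₁ n)) (cong (λ z → + 2 ℤ.* z) (B̂-square (o₁₁ n) (2 * n + 2 , inj₁ (s₁₁ n)))))
  where
  claim₁ : ∀ n → b̄₅ (+ (4 * n + 1)) ≡ c₅ (+ n) ℤ.- + 2 ℤ.* b̄₅ (+ (2 * n) ℤ.- 1ℤ)
  claim₁ n = trans (b̄₅-B̂ (4 * n + 1) _ (lem n))
      (trans (B̂-4 (suc n)) (cong₂ (λ y z → y ℤ.- + 2 ℤ.* z) (sym (c₅-G n _ refl)) (previous n)))
    where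
    lem : ∀ n → 3 + (4 * n + 1) ≡ suc n * 2 * 2
    lem = ℕTactic.solve-∀
    previous : ∀ n → B̂ (suc n * 2) ≡ b̄₅ (+ (2 * n) ℤ.- 1ℤ)
    -- Here b̅₅(-1) = 0 holds by convention and B̂(2) = 0 because B̂ starts at q³.
    previous zero    = X^⋆-< 3 B (s≤s (s≤s (s≤s z≤n)))
    previous (suc m) = sym (b̄₅-B̂ (m + suc (m + 0)) _ (lem′ m))
      where lem′ : ∀ m → 3 + (m + suc (m + 0)) ≡ suc (suc m) * 2
            lem′ = ℕTactic.solve-∀
  e₁ : ∀ n → 3 + 10 * n ≡ 10 * n + 3
  e₁ = ℕTactic.solve-∀
  e₂ : ∀ n → suc (10 * n + 2) ≡ 10 * n + 3
  e₂ = ℕTactic.solve-∀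
  o₃ : ∀ n → 10 * n + 3 ≡ suc ((5 * n + 1) * 2)
  o₃ = ℕTactic.solve-∀
  s₃ : ∀ n → 10 * n + 3 ≡ 5 * (2 * n) + 3
  s₃ = ℕTactic.solve-∀
  e₃ : ∀ n → 3 + (10 * n + 1) ≡ (5 * n + 2) * 2
  e₃ = ℕTactic.solve-∀
  e₄ : ∀ n → suc (5 * n + 1) ≡ 5 * n + 2
  e₄ = ℕTactic.solve-∀
  e₅ : ∀ n → 3 + (10 * n + 3) ≡ (5 * n + 3) * 2
  e₅ = ℕTactic.solve-∀
  e₆ : ∀ n → suc (5 * n + 2) ≡ 5 * n + 3
  e₆ = ℕTactic.solve-∀
  e₇ : ∀ n → 3 + (10 * n + 4) ≡ 10 * n + 7
  e₇ = ℕTactic.solve-∀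
  o₇ : ∀ n → 10 * n + 7 ≡ suc ((5 * n + 3) * 2)
  o₇ = ℕTactic.solve-∀
  s₇ : ∀ n → 10 * n + 7 ≡ 5 * (2 * n + 1) + 2
  s₇ = ℕTactic.solve-∀
  e₈ : ∀ n → suc (10 * n + 6) ≡ 10 * n + 7
  e₈ = ℕTactic.solve-∀
  e₉ : ∀ n → 3 + (10 * n + 6) ≡ 10 * n + 9
  e₉ = ℕTactic.solve-∀
  o₉ : ∀ n → Odd (10 * n + 9)
  o₉ n = 5 * n + 4 , lem n
    where lem : ∀ n → 10 * n + 9 ≡ suc ((5 * n + 4) * 2)
          lem = ℕTactic.solve-∀
  s₉ : ∀ n → 10 * n + 9 ≡ 5 * (2 * n + 1) + 4
  s₉ = ℕTactic.solve-∀
  e₁₀ : ∀ n → 3 + (10 * n + 8) ≡ 10 * n + 11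
  e₁₀ = ℕTactic.solve-∀
  o₁₁ : ∀ n → Odd (10 * n + 11)
  o₁₁ n = 5 * n + 5 , lem n
    where lem : ∀ n → 10 * n + 11 ≡ suc ((5 * n + 5) * 2)
          lem = ℕTactic.solve-∀
  s₁₁ : ∀ n → 10 * n + 11 ≡ 5 * (2 * n + 2) + 1
  s₁₁ = ℕTactic.solve-∀
  e₁₁ : ∀ n → 3 + (20 * n + 5) ≡ (5 * n + 2) * 2 * 2
  e₁₁ = ℕTactic.solve-∀
  e₁₂ : ∀ n → 3 + (20 * n + 7) ≡ 5 * (2 * n + 1) * 2
  e₁₂ = ℕTactic.solve-∀
  e₁₃ : ∀ n → 3 + (10 * n + 2) ≡ 5 * (2 * n + 1)
  e₁₃ = ℕTactic.solve-∀
  e₁₄ : ∀ n → 3 + (20 * n + 9) ≡ (5 * n + 3) * 2 * 2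
  e₁₄ = ℕTactic.solve-∀
  e₁₅ : ∀ n → 3 + (20 * n + 15) ≡ (10 * n + 9) * 2
  e₁₅ = ℕTactic.solve-∀
  e₁₆ : ∀ n → 3 + (20 * n + 19) ≡ (10 * n + 11) * 2
  e₁₆ = ℕTactic.solve-∀
  odd₁ : Odd (2 * n + 1)
  odd₁ = n , lem n
    where lem : ∀ n → 2 * n + 1 ≡ suc (n * 2)
          lem = ℕTactic.solve-∀
  odd₅ : Odd (5 * (2 * n + 1))
  odd₅ = 5 * n + 2 , lem n
    where lem : ∀ n → 5 * (2 * n + 1) ≡ suc ((5 * n + 2) * 2)
          lem = ℕTactic.solve-∀
  l : ∀ n → + 2 ℤ.* (+ 2 ℤ.* B̂ (5 * (2 * n + 1))) ≡ + 4 ℤ.* B̂ (5 * (2 * n + 1))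
  l n = lem (B̂ (5 * (2 * n + 1)))
    where lem : ∀ z → + 2 ℤ.* (+ 2 ℤ.* z) ≡ + 4 ℤ.* z
          lem = ℤTactic.solve-∀
  quarter : + 4 ℤ.* b̄₅ (+ (10 * n + 2)) ≡ ā₅ (+ (2 * n + 1)) ℤ.+ + 2 ℤ.* c₅ (+ (2 * n))
  quarter = trans (cong (λ z → + 4 ℤ.* z) (b̄₅-B̂ (10 * n + 2) _ (e₁₃ n))) (trans (B̂-5 odd₁ odd₅)
    (cong₂ (λ y z → y ℤ.+ + 2 ℤ.* z) (sym (ā₅-A (2 * n + 1)))
        (sym (c₅-G (2 * n) (2 * n + 1) (ℕ.+-comm 1 (2 * n))))))
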